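{- Let $T$ be an $m$-uniform hypertree with $k$ edges and diameter $d$ such that $(k-d-6)(m-1)\ge 42$. If $T\ne T_d(c_{p+1}=k-d)$, where $p=\lfloor d/2\rfloor$, then $\lambda_1(T)\le \lambda_1(T_d(c_p=k-d))$, and equality holds only when $T=T_d(c_p=k-d)$.
   Context: A hypergraph has a finite vertex set and an edge set of non-empty subsets of the vertex set; it is $m$-uniform if all edges have cardinality $m$ (with $m\ge 2$), and linear if two distinct edges share at most one vertex. The adjacency matrix of a linear $m$-uniform hypergraph $\mathcal{H}$ has $(i,j)$ entry $\frac{1}{m-1}$ if $i\ne j$ lie in a common edge, and $0$ otherwise; $\lambda_1(\mathcal{H})$ denotes its spectral radius. The degree of a vertex is the corresponding row sum of the adjacency matrix, that is, the number of edges containing it; a vertex is pendant if its degree is one and non-pendant if its degree is larger. A loose path of length $d$, $P_L(d)=v_1e_1v_2e_2\dots v_de_dv_{d+1}$, is the $m$-uniform hypergraph with edges $e_1,\dots,e_d$ such that $e_{i-1}\cap e_i=\{v_i\}$ for $2\le i\le d$ (the $v_i$ distinct), non-consecutive edges are disjoint, and $v_1\in e_1$, $v_{d+1}\in e_d$ are pendant. A loose cycle of length $l\ge3$, $v_1e_1v_2e_2\dots v_le_lv_1$, is the $m$-uniform hypergraph with edges $e_1,\dots,e_l$ in which $e_{i-1}\cap e_i=\{v_i\}$ (indices mod $l$, the $v_i$ distinct) and edges that are not cyclically consecutive are disjoint. A hypertree is a connected linear hypergraph containing no loose cycle in which every edge contains at most two non-pendant vertices. The diameter is the maximum distance between two vertices,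 distance being the minimum length (number of edges) of a path joining them. Attaching a pendant edge at a vertex $v$ means adding a new edge consisting of $v$ and $m-1$ new vertices. $T_d(c_2,\dots,c_d)$ is the hypertree obtained from $P_L(d)=v_1e_1v_2\dots v_de_dv_{d+1}$ by attaching $c_i$ pendant edges at $v_i$ for $i=2,\dots,d$; when only some of the $c_i$ are listed, the others are $0$. Equality of hypergraphs means isomorphism. -}

module Defs where

open import Algebra.Bundles.Raw using (RawMonoid)
import Algebra.Definitions.RawMonoid as RawMonoidDefs
open import Data.Bool.Base using (Bool; if_then_else_; _∧_)
open import Data.Bool.Properties using (T-≡; T-∧)
open import Data.Empty using (⊥-elim)
open import Data.Fin.Base using (Fin; zero; suc; toℕ; fromℕ; fromℕ<; inject₁; _↑ˡ_)
import Data.Fin.Properties as Fin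
open import Data.Fin.Subset using (Subset; _∈_; _∩_; ∣_∣; ⁅_⁆; ⊤; ⊥; Nonempty; Empty)
open import Data.Fin.Subset.Properties using (_∈?_; x∈⁅x⁆)
open import Data.Integer.Base using (+_)
open import Data.List.Base using (List; []; _∷_; concatMap; replicate; allFin)
open import Data.Nat.Base as ℕ using (ℕ; zero; suc; _∸_; _≡ᵇ_; _≤ᵇ_; NonZero; NonTrivial; s≤s; 2+)
import Data.Nat.Properties as ℕ
open import Data.Product.Base using (∃; Σ-syntax; _×_; _,_; proj₁; proj₂)
open import Data.Rational.Base as ℚ using (ℚ; 0ℚ; 1ℚ; ½; _/_)
import Data.Rational.Properties as ℚ
open import Data.Rational.Solver using (module +-*-Solver)
open import Data.Sum.Base using (_⊎_)
open import Data.Vec.Base using (tabulate; lookup; _++_)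
open import Data.Vec.Properties
  using (lookup-++ˡ; lookup∘tabulate; []=⇒lookup; lookup⇒[]=; ++-injectiveˡ; ++-injectiveʳ)
open import Function.Base using (_∘_; id)
open import Function.Bundles using (_↔_; _⇔_; Inverse; Equivalence)
open import Function.Definitions using (Injective)
open import Level using (0ℓ)
open import Relation.Binary.PropositionalEquality
  using (_≡_; _≢_; refl; sym; trans; cong; cong₂; subst; module ≡-Reasoning)
open import Relation.Nullary using (¬_; does; ¬?; _×-dec_)

------------------------------------------------------------------------
-- Real numbers: Cauchy sequences of rationals, up to _≈ᴿ_

IsCauchy : (ℕ → ℚ) → Set
IsCauchy s = ∀ ε → 0ℚ ℚ.< ε →
  ∃ λ N → ∀ i j → N ℕ.≤ i → N ℕ.≤ j → ℚ.∣ s i ℚ.- s j ∣ ℚ.≤ ε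

record ℝ : Set where
  constructor mkℝ
  field
    seq    : ℕ → ℚ
    cauchy : IsCauchy seq

open ℝ public

infix 4 _≈ᴿ_ _≤ᴿ_ _<ᴿ_

_≈ᴿ_ : ℝ → ℝ → Set
x ≈ᴿ y = ∀ ε → 0ℚ ℚ.< ε →
  ∃ λ N → ∀ i → N ℕ.≤ i → ℚ.∣ seq x i ℚ.- seq y i ∣ ℚ.≤ ε

_≤ᴿ_ : ℝ → ℝ → Set
x ≤ᴿ y = ∀ ε → 0ℚ ℚ.< ε →
  ∃ λ N → ∀ i → N ℕ.≤ i → seq x i ℚ.≤ seq y i ℚ.+ ε

_<ᴿ_ : ℝ → ℝ → Set
x <ᴿ y = ∃ λ ε → 0ℚ ℚ.< ε ×
  ∃ λ N → ∀ i → N ℕ.≤ i → seq x i ℚ.+ ε ℚ.≤ seq y i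

-- The Cauchy proofs are abstract to keep normal forms of real terms small.
private
  abstract
    constant-cauchy : ∀ q → IsCauchy (λ _ → q)
    constant-cauchy q ε 0<ε = 0 , λ _ _ _ _ →
      subst (λ r → ℚ.∣ r ∣ ℚ.≤ ε) (sym (ℚ.+-inverseʳ q)) (ℚ.<⇒≤ 0<ε)

fromℚ : ℚ → ℝ
fromℚ q = mkℝ (λ _ → q) (constant-cauchy q)

0ᴿ : ℝ
0ᴿ = fromℚ 0ℚ

private
  half-pos : ∀ {ε} → 0ℚ ℚ.< ε → 0ℚ ℚ.< ε ℚ.* ½
  half-pos {ε} 0<ε = subst (ℚ._< ε ℚ.* ½) (ℚ.*-zeroˡ ½) (ℚ.*-monoˡ-<-pos ½ 0<ε)

  halves : ∀ ε → ε ℚ.* ½ ℚ.+ ε ℚ.* ½ ≡ ε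
  halves ε = trans (sym (ℚ.*-distribˡ-+ ε ½ ½)) (ℚ.*-identityʳ ε)

  shrink : ∀ B ε → 0ℚ ℚ.< B → 0ℚ ℚ.< ε → ∃ λ δ → 0ℚ ℚ.< δ × B ℚ.* δ ≡ ε
  shrink B ε 0<B 0<ε = 1/B ℚ.* ε , pos , eq
    where
    instance
      B-pos : ℚ.Positive B
      B-pos = ℚ.positive 0<B
      B-nz : ℚ.NonZero B
      B-nz = ℚ.pos⇒nonZero B
    1/B : ℚ
    1/B = ℚ.1/ B
    instance
      1/B-pos : ℚ.Positive 1/B
      1/B-pos = ℚ.1/pos⇒pos B
    pos : 0ℚ ℚ.< 1/B ℚ.* ε
    pos = subst (ℚ._< 1/B ℚ.* ε) (ℚ.*-zeroʳ 1/B) (ℚ.*-monoʳ-<-pos 1/B 0<ε)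
    eq : B ℚ.* (1/B ℚ.* ε) ≡ ε
    eq = trans (sym (ℚ.*-assoc B 1/B ε))
           (trans (cong (ℚ._* ε) (ℚ.*-inverseʳ B)) (ℚ.*-identityˡ ε))

  bounded : ∀ x → ∃ λ B → 0ℚ ℚ.< B × ∃ λ N → ∀ i → N ℕ.≤ i → ℚ.∣ seq x i ∣ ℚ.≤ B
  bounded x with cauchy x 1ℚ (ℚ.positive⁻¹ 1ℚ)
  ... | N , close = 1ℚ ℚ.+ ℚ.∣ seq x N ∣
                  , ℚ.+-mono-<-≤ (ℚ.positive⁻¹ 1ℚ) (ℚ.0≤∣p∣ (seq x N))
                  , N , bound
    where
    open ℚ.≤-Reasoning
    bound : ∀ i → N ℕ.≤ i → ℚ.∣ seq x i ∣ ℚ.≤ 1ℚ ℚ.+ ℚ.∣ seq x N ∣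
    bound i N≤i = begin
      ℚ.∣ seq x i ∣
        ≡⟨ cong ℚ.∣_∣ (solve 2 (λ a b → a := (a :- b) :+ b) refl (seq x i) (seq x N)) ⟩
      ℚ.∣ (seq x i ℚ.- seq x N) ℚ.+ seq x N ∣
        ≤⟨ ℚ.∣p+q∣≤∣p∣+∣q∣ (seq x i ℚ.- seq x N) (seq x N) ⟩
      ℚ.∣ seq x i ℚ.- seq x N ∣ ℚ.+ ℚ.∣ seq x N ∣
        ≤⟨ ℚ.+-monoˡ-≤ ℚ.∣ seq x N ∣ (close i N N≤i ℕ.≤-refl) ⟩
      1ℚ ℚ.+ ℚ.∣ seq x N ∣ ∎
      where open +-*-Solver

private
  sum-regroup : ∀ a b c d → (a ℚ.+ b) ℚ.- (c ℚ.+ d) ≡ (a ℚ.- c) ℚ.+ (b ℚ.- d)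
  sum-regroup = solve 4 (λ a b c d → (a :+ b) :- (c :+ d) := (a :- c) :+ (b :- d)) refl
    where open +-*-Solver

  neg-regroup : ∀ a b → (ℚ.- a) ℚ.- (ℚ.- b) ≡ ℚ.- (a ℚ.- b)
  neg-regroup = solve 2 (λ a b → (:- a) :- (:- b) := :- (a :- b)) refl
    where open +-*-Solver

  product-regroup : ∀ a b c d → a ℚ.* b ℚ.- c ℚ.* d ≡ a ℚ.* (b ℚ.- d) ℚ.+ d ℚ.* (a ℚ.- c)
  product-regroup = solve 4 (λ a b c d → a :* b :- c :* d := a :* (b :- d) :+ d :* (a :- c)) refl
    where open +-*-Solver

  sum-close : ∀ a b c d {δ δ′ ε} → ℚ.∣ a ℚ.- c ∣ ℚ.≤ δ → ℚ.∣ b ℚ.- d ∣ ℚ.≤ δ′ → δ ℚ.+ δ′ ≡ ε →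
              ℚ.∣ (a ℚ.+ b) ℚ.- (c ℚ.+ d) ∣ ℚ.≤ ε
  sum-close a b c d {δ} {δ′} {ε} p q eq = begin
    ℚ.∣ (a ℚ.+ b) ℚ.- (c ℚ.+ d) ∣       ≡⟨ cong ℚ.∣_∣ (sum-regroup a b c d) ⟩
    ℚ.∣ (a ℚ.- c) ℚ.+ (b ℚ.- d) ∣       ≤⟨ ℚ.∣p+q∣≤∣p∣+∣q∣ (a ℚ.- c) (b ℚ.- d) ⟩
    ℚ.∣ a ℚ.- c ∣ ℚ.+ ℚ.∣ b ℚ.- d ∣     ≤⟨ ℚ.+-mono-≤ p q ⟩
    δ ℚ.+ δ′                            ≡⟨ eq ⟩
    ε                                   ∎
    where open ℚ.≤-Reasoning

  neg-close : ∀ a b {ε} → ℚ.∣ a ℚ.- b ∣ ℚ.≤ ε → ℚ.∣ (ℚ.- a) ℚ.- (ℚ.- b) ∣ ℚ.≤ ε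
  neg-close a b {ε} p = begin
    ℚ.∣ (ℚ.- a) ℚ.- (ℚ.- b) ∣     ≡⟨ cong ℚ.∣_∣ (neg-regroup a b) ⟩
    ℚ.∣ ℚ.- (a ℚ.- b) ∣           ≡⟨ ℚ.∣-p∣≡∣p∣ (a ℚ.- b) ⟩
    ℚ.∣ a ℚ.- b ∣                 ≤⟨ p ⟩
    ε                             ∎
    where open ℚ.≤-Reasoning

  product-≤ : ∀ u v {B δ} → 0ℚ ℚ.< B → ℚ.∣ u ∣ ℚ.≤ B → ℚ.∣ v ∣ ℚ.≤ δ → ℚ.∣ u ℚ.* v ∣ ℚ.≤ B ℚ.* δ
  product-≤ u v {B} {δ} 0<B ∣u∣≤B ∣v∣≤δ = begin
    ℚ.∣ u ℚ.* v ∣           ≡⟨ ℚ.∣p*q∣≡∣p∣*∣q∣ u v ⟩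
    ℚ.∣ u ∣ ℚ.* ℚ.∣ v ∣     ≤⟨ ℚ.*-monoʳ-≤-nonNeg ℚ.∣ v ∣ {{ℚ.∣-∣-nonNeg v}} ∣u∣≤B ⟩
    B ℚ.* ℚ.∣ v ∣           ≤⟨ ℚ.*-monoˡ-≤-nonNeg B {{ℚ.nonNegative (ℚ.<⇒≤ 0<B)}} ∣v∣≤δ ⟩
    B ℚ.* δ                 ∎
    where open ℚ.≤-Reasoning

  product-close : ∀ a b c d {B δ B′ δ′ ε} → 0ℚ ℚ.< B → 0ℚ ℚ.< B′ →
                  ℚ.∣ a ∣ ℚ.≤ B → ℚ.∣ b ℚ.- d ∣ ℚ.≤ δ →
                  ℚ.∣ d ∣ ℚ.≤ B′ → ℚ.∣ a ℚ.- c ∣ ℚ.≤ δ′ →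
                  B ℚ.* δ ≡ ε ℚ.* ½ → B′ ℚ.* δ′ ≡ ε ℚ.* ½ →
                  ℚ.∣ a ℚ.* b ℚ.- c ℚ.* d ∣ ℚ.≤ ε
  product-close a b c d {B} {δ} {B′} {δ′} {ε} 0<B 0<B′ p q p′ q′ eq eq′ = begin
    ℚ.∣ a ℚ.* b ℚ.- c ℚ.* d ∣
      ≡⟨ cong ℚ.∣_∣ (product-regroup a b c d) ⟩
    ℚ.∣ a ℚ.* (b ℚ.- d) ℚ.+ d ℚ.* (a ℚ.- c) ∣
      ≤⟨ ℚ.∣p+q∣≤∣p∣+∣q∣ (a ℚ.* (b ℚ.- d)) (d ℚ.* (a ℚ.- c)) ⟩
    ℚ.∣ a ℚ.* (b ℚ.- d) ∣ ℚ.+ ℚ.∣ d ℚ.* (a ℚ.- c) ∣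
      ≤⟨ ℚ.+-mono-≤ (product-≤ a (b ℚ.- d) 0<B p q) (product-≤ d (a ℚ.- c) 0<B′ p′ q′) ⟩
    B ℚ.* δ ℚ.+ B′ ℚ.* δ′
      ≡⟨ trans (cong₂ ℚ._+_ eq eq′) (halves ε) ⟩
    ε ∎
    where open ℚ.≤-Reasoning

private
  abstract
    +-cauchy : ∀ x y → IsCauchy (λ i → seq x i ℚ.+ seq y i)
    +-cauchy x y ε 0<ε =
      let M , closeˣ = cauchy x (ε ℚ.* ½) (half-pos 0<ε)
          N , closeʸ = cauchy y (ε ℚ.* ½) (half-pos 0<ε)
      in M ℕ.⊔ N , λ i j p q →
        sum-close (seq x i) (seq y i) (seq x j) (seq y j)
          (closeˣ i j (ℕ.m⊔n≤o⇒m≤o M N p) (ℕ.m⊔n≤o⇒m≤o M N q))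
          (closeʸ i j (ℕ.m⊔n≤o⇒n≤o M N p) (ℕ.m⊔n≤o⇒n≤o M N q))
          (halves ε)

    neg-cauchy : ∀ x → IsCauchy (λ i → ℚ.- seq x i)
    neg-cauchy x ε 0<ε =
      let N , close = cauchy x ε 0<ε
      in N , λ i j p q → neg-close (seq x i) (seq x j) (close i j p q)

    *-cauchy : ∀ x y → IsCauchy (λ i → seq x i ℚ.* seq y i)
    *-cauchy x y ε 0<ε =
      let Bˣ , 0<Bˣ , Kˣ , boundˣ = bounded x
          Bʸ , 0<Bʸ , Kʸ , boundʸ = bounded y
          δˣ , 0<δˣ , eqˣ = shrink Bʸ (ε ℚ.* ½) 0<Bʸ (half-pos 0<ε)
          δʸ , 0<δʸ , eqʸ = shrink Bˣ (ε ℚ.* ½) 0<Bˣ (half-pos 0<ε)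
          M , closeˣ = cauchy x δˣ 0<δˣ
          N , closeʸ = cauchy y δʸ 0<δʸ
          K = Kˣ ℕ.⊔ Kʸ
          L = M ℕ.⊔ N
      in K ℕ.⊔ L , λ i j p q →
        let L≤i = ℕ.m⊔n≤o⇒n≤o K L p
            L≤j = ℕ.m⊔n≤o⇒n≤o K L q
        in product-close (seq x i) (seq y i) (seq x j) (seq y j) 0<Bˣ 0<Bʸ
             (boundˣ i (ℕ.m⊔n≤o⇒m≤o Kˣ Kʸ (ℕ.m⊔n≤o⇒m≤o K L p)))
             (closeʸ i j (ℕ.m⊔n≤o⇒n≤o M N L≤i) (ℕ.m⊔n≤o⇒n≤o M N L≤j))
             (boundʸ j (ℕ.m⊔n≤o⇒n≤o Kˣ Kʸ (ℕ.m⊔n≤o⇒m≤o K L q)))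
             (closeˣ i j (ℕ.m⊔n≤o⇒m≤o M N L≤i) (ℕ.m⊔n≤o⇒m≤o M N L≤j))
             eqʸ eqˣ

infixl 6 _+ᴿ_
infixl 7 _*ᴿ_
infix  8 -ᴿ_

_+ᴿ_ : ℝ → ℝ → ℝ
x +ᴿ y = mkℝ (λ i → seq x i ℚ.+ seq y i) (+-cauchy x y)

-ᴿ_ : ℝ → ℝ
-ᴿ x = mkℝ (λ i → ℚ.- seq x i) (neg-cauchy x)

_*ᴿ_ : ℝ → ℝ → ℝ
x *ᴿ y = mkℝ (λ i → seq x i ℚ.* seq y i) (*-cauchy x y)

------------------------------------------------------------------------
-- Complex numbers

record ℂ : Set where
  constructor _+i_
  field
    re im : ℝ

open ℂ public

infix  4 _≈ᶜ_
infixl 6 _+ᶜ_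
infixl 7 _*ᶜ_

_≈ᶜ_ : ℂ → ℂ → Set
z ≈ᶜ w = re z ≈ᴿ re w × im z ≈ᴿ im w

_+ᶜ_ : ℂ → ℂ → ℂ
z +ᶜ w = (re z +ᴿ re w) +i (im z +ᴿ im w)

_*ᶜ_ : ℂ → ℂ → ℂ
z *ᶜ w = (re z *ᴿ re w +ᴿ -ᴿ (im z *ᴿ im w)) +i (re z *ᴿ im w +ᴿ im z *ᴿ re w)

ℚ⇒ℂ : ℚ → ℂ
ℚ⇒ℂ q = fromℚ q +i 0ᴿ

∣_∣² : ℂ → ℝ
∣ z ∣² = re z *ᴿ re z +ᴿ im z *ᴿ im z

ℂ-+-rawMonoid : RawMonoid 0ℓ 0ℓ
ℂ-+-rawMonoid = record { Carrier = ℂ ; _≈_ = _≈ᶜ_ ; _∙_ = _+ᶜ_ ; ε = ℚ⇒ℂ 0ℚ }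

open RawMonoidDefs ℂ-+-rawMonoid public using (sum)

------------------------------------------------------------------------
-- Eigenvalues and the spectral radius

Matrix : ℕ → Set
Matrix n = Fin n → Fin n → ℂ

IsEigenvalue : ∀ {n} → Matrix n → ℂ → Set
IsEigenvalue {n} A z = ∃ λ (x : Fin n → ℂ) →
  (∃ λ i → 0ᴿ <ᴿ ∣ x i ∣²) ×
  (∀ i → sum (λ j → A i j *ᶜ x j) ≈ᶜ z *ᶜ x i)

-- ρ is the largest modulus of an eigenvalue.  Since ρ is non-negative, a
-- modulus is compared with ρ through the squares.
record IsSpectralRadius {n} (A : Matrix n) (ρ : ℝ) : Set where
  field
    nonNegative : 0ᴿ ≤ᴿ ρ
    attained    : ∃ λ z → IsEigenvalue A z × ∣ z ∣² ≈ᴿ ρ *ᴿ ρ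
    largest     : ∀ z → IsEigenvalue A z → ∣ z ∣² ≤ᴿ ρ *ᴿ ρ

------------------------------------------------------------------------
-- Hypergraphs

-- The edge set is an injectively indexed family of subsets, so that size is
-- the number of edges.  The indexing is immaterial up to _≅_ below.
record Hypergraph : Set where
  field
    order          : ℕ
    size           : ℕ
    edge           : Fin size → Subset order
    edge-nonempty  : ∀ e → Nonempty (edge e)
    edge-injective : Injective _≡_ _≡_ edge

  Vertex : Set
  Vertex = Fin order

  Edge : Set
  Edge = Fin size

open Hypergraph public

infix 4 _≅_

record _≅_ (G H : Hypergraph) : Set where
  field
    vertices  : Vertex G ↔ Vertex H
    edges     : Edge G ↔ Edge H
    incidence : ∀ v e → v ∈ edge G e ⇔ Inverse.to vertices v ∈ edge H (Inverse.to edges e)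

Uniform : ℕ → Hypergraph → Set
Uniform m H = ∀ e → ∣ edge H e ∣ ≡ m

Linear : Hypergraph → Set
Linear H = ∀ e f → e ≢ f → ∣ edge H e ∩ edge H f ∣ ℕ.≤ 1

degree : (H : Hypergraph) → Vertex H → ℕ
degree H v = ∣ tabulate (λ e → lookup (edge H e) v) ∣

nonPendant : (H : Hypergraph) → Subset (order H)
nonPendant H = tabulate (λ v → does (1 ℕ.<? degree H v))

record Path (H : Hypergraph) (x y : Vertex H) (l : ℕ) : Set where
  field
    vertex            : Fin (suc l) → Vertex H
    link              : Fin l → Edge H
    start             : vertex zero ≡ x
    end               : vertex (fromℕ l) ≡ y
    incident          : ∀ i → vertex (inject₁ i) ∈ edge H (link i) × vertex (suc i) ∈ edge H (link i)
    vertices-distinct : Injective _≡_ _≡_ vertex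
    edges-distinct    : Injective _≡_ _≡_ link

Connected : Hypergraph → Set
Connected H = ∀ x y → ∃ (Path H x y)

Distance : (H : Hypergraph) → Vertex H → Vertex H → ℕ → Set
Distance H x y l = Path H x y l × (∀ l′ → Path H x y l′ → l ℕ.≤ l′)

Diameter : Hypergraph → ℕ → Set
Diameter H d = (∃ λ x → ∃ λ y → Distance H x y d) ×
               (∀ x y l → Distance H x y l → l ℕ.≤ d)

-- j is the successor of i modulo l.
CyclicSuc : ∀ {l} → Fin l → Fin l → Set
CyclicSuc {l} i j = toℕ j ≡ suc (toℕ i) ⊎ (suc (toℕ i) ≡ l × toℕ j ≡ 0)

record LooseCycle (H : Hypergraph) (l : ℕ) : Set where
  field
    vertex            : Fin l → Vertex H
    link              : Fin l → Edge H
    3≤length          : 3 ℕ.≤ l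
    vertices-distinct : Injective _≡_ _≡_ vertex
    edges-distinct    : Injective _≡_ _≡_ link
    consecutive       : ∀ i j → CyclicSuc i j → edge H (link i) ∩ edge H (link j) ≡ ⁅ vertex j ⁆
    non-consecutive   : ∀ i j → i ≢ j → ¬ CyclicSuc i j → ¬ CyclicSuc j i →
                        Empty (edge H (link i) ∩ edge H (link j))

record Hypertree (H : Hypergraph) : Set where
  field
    connected       : Connected H
    linear          : Linear H
    acyclic         : ∀ l → ¬ LooseCycle H l
    two-non-pendant : ∀ e → ∣ edge H e ∩ nonPendant H ∣ ℕ.≤ 2

private
  pred-nonZero : ∀ m → .{{NonTrivial m}} → NonZero (m ∸ 1)
  pred-nonZero (2+ m) = _

adjacency : ∀ m → .{{NonTrivial m}} → (H : Hypergraph) → Vertex H → Vertex H → ℚ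
adjacency m H v w =
  if does (¬? (v Fin.≟ w) ×-dec Fin.any? (λ e → (v ∈? edge H e) ×-dec (w ∈? edge H e)))
  then _/_ (+ 1) (m ∸ 1) {{pred-nonZero m}}
  else 0ℚ

-- λ₁(H) = ρ
λ₁ : ∀ m → .{{NonTrivial m}} → Hypergraph → ℝ → Set
λ₁ m H ρ = IsSpectralRadius (λ v w → ℚ⇒ℂ (adjacency m H v w)) ρ

------------------------------------------------------------------------
-- Loose paths and the hypertrees T_d(c₂, …, c_d)

module _ (m : ℕ) .{{_ : NonTrivial m}} where

  private
    r : ℕ
    r = m ∸ 1

    instance
      r-nonZero : NonZero r
      r-nonZero = pred-nonZero m

  -- joint d i is v_{i+1}
  joint : ∀ d → Fin (suc d) → Fin (suc (d ℕ.* r))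
  joint d i = fromℕ< {toℕ i ℕ.* r} (s≤s (ℕ.*-monoˡ-≤ r (ℕ.s≤s⁻¹ (Fin.toℕ<n i))))

  -- The vertices of P_L(d) are 0, …, d (m − 1) in order along the path; the
  -- i-th edge (counted from 0) is the interval from i (m − 1) to
  -- (i + 1) (m − 1).
  within : ∀ d → Fin d → Fin (suc (d ℕ.* r)) → Bool
  within d i x = (toℕ i ℕ.* r ≤ᵇ toℕ x) ∧ (toℕ x ≤ᵇ suc (toℕ i) ℕ.* r)

  interval : ∀ d → Fin d → Subset (suc (d ℕ.* r))
  interval d i = tabulate (within d i)

  private
    toℕ-joint : ∀ d i → toℕ (joint d i) ≡ toℕ i ℕ.* r
    toℕ-joint d i = Fin.toℕ-fromℕ< _

    joint∈interval : ∀ d i → joint d (inject₁ i) ∈ interval d i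
    joint∈interval d i = lookup⇒[]= _ _ (trans (lookup∘tabulate (within d i) (joint d (inject₁ i)))
      (Equivalence.to T-≡ (Equivalence.from T-∧
        ( ℕ.≤⇒≤ᵇ (ℕ.≤-reflexive (sym eq))
        , ℕ.≤⇒≤ᵇ (ℕ.≤-trans (ℕ.≤-reflexive eq) (ℕ.m≤n+m (toℕ i ℕ.* r) r))))))
      where
      eq : toℕ (joint d (inject₁ i)) ≡ toℕ i ℕ.* r
      eq = trans (toℕ-joint d (inject₁ i)) (cong (ℕ._* r) (Fin.toℕ-inject₁ i))

    interval-≥ : ∀ d i x → x ∈ interval d i → toℕ i ℕ.* r ℕ.≤ toℕ x
    interval-≥ d i x x∈ = ℕ.≤ᵇ⇒≤ _ _ (proj₁ (Equivalence.to (T-∧ {toℕ i ℕ.* r ≤ᵇ toℕ x})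
      (Equivalence.from T-≡ (trans (sym (lookup∘tabulate (within d i) x)) ([]=⇒lookup x∈)))))

    interval-≤ : ∀ d i j → interval d i ≡ interval d j → toℕ j ℕ.≤ toℕ i
    interval-≤ d i j eq = ℕ.*-cancelʳ-≤ (toℕ j) (toℕ i) r
      (subst (toℕ j ℕ.* r ℕ.≤_)
        (trans (toℕ-joint d (inject₁ i)) (cong (ℕ._* r) (Fin.toℕ-inject₁ i)))
        (interval-≥ d j _ (subst (joint d (inject₁ i) ∈_) eq (joint∈interval d i))))

  loosePath : ℕ → Hypergraph
  loosePath d = record
    { order          = suc (d ℕ.* r)
    ; size           = d
    ; edge           = interval d
    ; edge-nonempty  = λ i → joint d (inject₁ i) , joint∈interval d i
    ; edge-injective = λ {i} {j} eq →
        Fin.toℕ-injective (ℕ.≤-antisym (interval-≤ d j i (sym eq)) (interval-≤ d i j eq))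
    }

  attach : (H : Hypergraph) → Vertex H → Hypergraph
  attach H v = record
    { order          = order H ℕ.+ r
    ; size           = suc (size H)
    ; edge           = newEdge
    ; edge-nonempty  = nonempty
    ; edge-injective = injective
    }
    where
    newEdge : Fin (suc (size H)) → Subset (order H ℕ.+ r)
    newEdge zero    = ⁅ v ⁆ ++ ⊤
    newEdge (suc e) = edge H e ++ ⊥

    ∈-++ : ∀ {n k} {x : Fin n} (p : Subset n) (q : Subset k) → x ∈ p → x ↑ˡ k ∈ p ++ q
    ∈-++ {x = x} p q x∈p = lookup⇒[]= _ _ (trans (lookup-++ˡ p q x) ([]=⇒lookup x∈p))

    nonempty : ∀ e → Nonempty (newEdge e)
    nonempty zero    = _ , ∈-++ ⁅ v ⁆ ⊤ (x∈⁅x⁆ v)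
    nonempty (suc e) = let x , x∈e = edge-nonempty H e in _ , ∈-++ (edge H e) ⊥ x∈e

    ⊤≢⊥ : ∀ k → .{{NonZero k}} → ⊤ {n = k} ≢ ⊥
    ⊤≢⊥ (suc k) ()

    injective : Injective _≡_ _≡_ newEdge
    injective {zero}  {zero}  _  = refl
    injective {zero}  {suc f} eq = ⊥-elim (⊤≢⊥ r (++-injectiveʳ ⁅ v ⁆ (edge H f) eq))
    injective {suc e} {zero}  eq = ⊥-elim (⊤≢⊥ r (sym (++-injectiveʳ (edge H e) ⁅ v ⁆ eq)))
    injective {suc e} {suc f} eq = cong suc (edge-injective H (++-injectiveˡ (edge H e) (edge H f) eq))

  -- Attaches a pendant edge at every vertex of the list (with multiplicity);
  -- the second component embeds the vertices of H.
  attachAll : (H : Hypergraph) → List (Vertex H) → Σ[ G ∈ Hypergraph ] (Vertex H → Vertex G)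
  attachAll H []       = H , id
  attachAll H (v ∷ vs) = let G , ι = attachAll H vs in attach G (ι v) , (_↑ˡ r) ∘ ι

  -- inner d j is v_{j+2}, so it runs over v₂, …, v_d
  inner : ∀ d → Fin (d ∸ 1) → Vertex (loosePath d)
  inner (suc d) j = joint (suc d) (suc (inject₁ j))

  -- T_d(c₂, …, c_d), with c_{j+2} given by c j
  T : ∀ d → (Fin (d ∸ 1) → ℕ) → Hypergraph
  T d c = proj₁ (attachAll (loosePath d)
    (concatMap (λ j → replicate (c j) (inner d j)) (allFin (d ∸ 1))))

-- The argument of T written (c_i = q): all other entries are 0.  It is
-- meaningful for 2 ≤ i ≤ d only.
c[_]=_ : ∀ {n} → ℕ → ℕ → Fin n → ℕ
c[ i ]= q = λ j → if 2 ℕ.+ toℕ j ≡ᵇ i then q else 0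

-- Write r = m − 1, D = k − d + 2 and a = r λ₁, so that a star with D edges has
-- a (a − r + 1) = D r.  A positive vector y with A y ≤ Λ y bounds the modulus of
-- every eigenvalue by Λ; all such vectors below are rational.
--
-- A geodesic of length d has at most two edges at a vertex v, so deg v ≤ D.  If
-- deg v = D, then all edges off the geodesic contain v and only touch it there,
-- that is, H = T_d(c_i = k − d).  An eigenvector of T_d(c_i = k − d) can be written
-- down with the solution X of a linear recurrence along the two arms; it leaves
-- one equation F = 0 at the centre, whose root is found by bisection.  By the
-- identity X_{j+1}² − X_j X_{j+2} = const, F increases when the centre is
-- moved one joint towards the nearer end, so the spectral radius drops.
--
-- If all degrees are at most D − 1, then λ₁ is smaller than for the star with D
-- edges.  The witness comes from the edge weights
-- S_e = a / r + 1 + Σ_{v ∈ e} (deg v − 1): since there are no cycles of length 3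
-- or 4 and at most five edges of the geodesic are within two steps of e, the
-- degrees around e add up to at most D + 4, and what remains is a polynomial
-- inequality in the degrees of the two non-pendant vertices of e.

module Submission where

open import Data.Bool.Base using (Bool; true; false; _∧_; if_then_else_)
open import Data.Empty using (⊥; ⊥-elim)
open import Data.Fin.Base
  using (Fin; zero; suc; toℕ; fromℕ; fromℕ<; inject₁; opposite; punchIn; punchOut; splitAt; _↑ˡ_)
import Data.Fin.Properties as Fin
open import Data.Integer.Base using (+_)
open import Data.Maybe.Base as Maybe using (Maybe; just; nothing)
open import Data.Nat.Base as ℕ using (ℕ; zero; suc; 2+; _∸_; ⌊_/2⌋)
import Data.Nat.Properties as ℕ
open import Data.Product.Base using (∃; Σ; _×_; _,_; proj₁; proj₂)
open import Data.Rational.Solver using (module +-*-Solver)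
open import Data.Sum.Base as Sum using (_⊎_; inj₁; inj₂; [_,_]′)
open import Function.Base using (_∘_; id; const)
open import Function.Bundles using (_⇔_; mk⇔; Equivalence)
open import Relation.Binary.Definitions using (DecidableEquality; tri<; tri≈; tri>)
open import Relation.Binary.PropositionalEquality
open import Relation.Nullary using (Dec; does; yes; no; contradiction; ¬_; ¬?; _×-dec_; _⊎-dec_)

-- Cauchy reals cannot be compared by cases, so no estimate is made at λ₁ itself. All inequalities
-- are between rationals, at rational values of t = a - r + 1, and pass to the reals only at the
-- end. Bisection of `F` brackets the radius of T_d(c_p = k - d): at upper ends, where F ≥ 0, the
-- explicit vector is a super-solution; at lower ends it satisfies the eigenvalue equations up to an
-- error tending to 0, which is all that equality of reals requires. A bound for H at a rational t
-- with t + δ below every upper end yields strict inequality. The case of small degrees therefore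
-- needs a rational below the root of the star, so a (a - r + 1) may fall short of D r by up to r /
-- 4. The edge inequality has to absorb this loss, and it is mainly there that the bound 42 is
-- spent. T_d(c_i = k - d) and the extremal H are never compared as concrete sets of vertices. Both
-- carry the labels of a `Broom`, from which incidence, the eigenvector and, by counting labels, the
-- isomorphism are obtained. After reversal the centre is at most v_{p+1}; with that place excluded,
-- v_p is the next best.

module Rationals where

  -- Ordered-field arithmetic of the rationals

  open import Data.Integer.Base as ℤ using (+_)
  import Data.Integer.Properties as ℤ
  open import Data.Rational.Base
  open import Data.Rational.Properties
  import Data.Rational.Unnormalised.Base as ℚᵘ
  import Data.Rational.Unnormalised.Properties as ℚᵘ
  open +-*-Solver using (solve; con; _:=_; _:+_; _:*_; _:-_; :-_)

  private
    variable
      p q s u : ℚ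

  sub-add = solve 2 (λ a b → a := (a :- b) :+ b) refl

  0≤-+ : 0ℚ ≤ p → 0ℚ ≤ q → 0ℚ ≤ p + q
  0≤-+ = +-mono-≤

  0≤-* : 0ℚ ≤ p → 0ℚ ≤ q → 0ℚ ≤ p * q
  0≤-* {p} {q} 0≤p 0≤q = nonNegative⁻¹ _ {{nonNeg*nonNeg⇒nonNeg p {{nonNegative 0≤p}} q
      {{nonNegative 0≤q}}}}

  0<-+ : 0ℚ < p → 0ℚ ≤ q → 0ℚ < p + q
  0<-+ = +-mono-<-≤

  0<-* : 0ℚ < p → 0ℚ < q → 0ℚ < p * q
  0<-* {p} {q} 0<p 0<q = positive⁻¹ _ {{pos*pos⇒pos p {{positive 0<p}} q {{positive 0<q}}}}

  ≡0⇒*≡0 : p ≡ 0ℚ → ∀ q → p * q ≡ 0ℚ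
  ≡0⇒*≡0 refl = *-zeroˡ

  ≡1⇒*≡ : p ≡ 1ℚ → ∀ q → p * q ≡ q
  ≡1⇒*≡ refl = *-identityˡ

  ≤⇒0≤- : p ≤ q → 0ℚ ≤ q - p
  ≤⇒0≤- {p} {q} p≤q = subst (_≤ q - p) (+-inverseʳ p) (+-monoˡ-≤ (- p) p≤q)

  0≤-⇒≤ : 0ℚ ≤ q - p → p ≤ q
  0≤-⇒≤ {q} {p} h = subst₂ _≤_ (+-identityˡ p) (sym (sub-add q p)) (+-monoˡ-≤ p h)

  <⇒0<- : p < q → 0ℚ < q - p
  <⇒0<- {p} {q} p<q = subst (_< q - p) (+-inverseʳ p) (+-monoˡ-< (- p) p<q)

  0<-⇒< : 0ℚ < q - p → p < q
  0<-⇒< {q} {p} h = subst₂ _<_ (+-identityˡ p) (sym (sub-add q p)) (+-monoˡ-< p h)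

  ≤-by : ∀ {e} → q - p ≡ e → 0ℚ ≤ e → p ≤ q
  ≤-by eq h = 0≤-⇒≤ (subst (0ℚ ≤_) (sym eq) h)

  <-by : ∀ {e} → q - p ≡ e → 0ℚ < e → p < q
  <-by eq h = 0<-⇒< (subst (0ℚ <_) (sym eq) h)

  *-monoˡ : ∀ c → 0ℚ ≤ c → p ≤ q → c * p ≤ c * q
  *-monoˡ c 0≤c = *-monoˡ-≤-nonNeg c {{nonNegative 0≤c}}

  *-monoʳ : ∀ c → 0ℚ ≤ c → p ≤ q → p * c ≤ q * c
  *-monoʳ c 0≤c = *-monoʳ-≤-nonNeg c {{nonNegative 0≤c}}

  *-mono : 0ℚ ≤ p → 0ℚ ≤ u → p ≤ q → s ≤ u → p * s ≤ q * u
  *-mono {p} {u} 0≤p 0≤u p≤q s≤u = ≤-trans (*-monoˡ p 0≤p s≤u) (*-monoʳ u 0≤u p≤q)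

  *-cancelˡ : ∀ c → 0ℚ < c → c * p ≤ c * q → p ≤ q
  *-cancelˡ c 0<c = *-cancelˡ-≤-pos c {{positive 0<c}}

  *-cancelˡ-< : ∀ c → 0ℚ ≤ c → c * p < c * q → p < q
  *-cancelˡ-< c 0≤c = *-cancelˡ-<-nonNeg c {{nonNegative 0≤c}}

  0≤-cancelˡ : ∀ c → 0ℚ < c → 0ℚ ≤ c * p → 0ℚ ≤ p
  0≤-cancelˡ {p} c 0<c h = *-cancelˡ c 0<c (subst (_≤ c * p) (sym (*-zeroʳ c)) h)

  0<-cancelˡ : ∀ c → 0ℚ ≤ c → 0ℚ < c * p → 0ℚ < p
  0<-cancelˡ {p} c 0≤c h = *-cancelˡ-< c 0≤c (subst (_< c * p) (sym (*-zeroʳ c)) h)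

  private
    neg-sq = solve 1 (λ a → (:- a) :* (:- a) := a :* a) refl

  0≤² : ∀ p → 0ℚ ≤ p * p
  0≤² p with ≤-total 0ℚ p
  ... | inj₁ 0≤p = 0≤-* 0≤p 0≤p
  ... | inj₂ p≤0 = subst (0ℚ ≤_) (neg-sq p) (0≤-* 0≤-p 0≤-p)
    where 0≤-p = neg-antimono-≤ p≤0

  p≤∣p∣ : ∀ p → p ≤ ∣ p ∣
  p≤∣p∣ p with ≤-total 0ℚ p
  ... | inj₁ 0≤p = ≤-reflexive (sym (0≤p⇒∣p∣≡p 0≤p))
  ... | inj₂ p≤0 = ≤-trans p≤0 (0≤∣p∣ p)

  ∣-∣-≤ : p ≤ q → - p ≤ q → ∣ p ∣ ≤ q
  ∣-∣-≤ {p} {q} h₁ h₂ with ∣p∣≡p∨∣p∣≡-p p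
  ... | inj₁ eq = subst (_≤ q) (sym eq) h₁
  ... | inj₂ eq = subst (_≤ q) (sym eq) h₂

  ∣p-q∣≡∣q-p∣ : ∀ p q → ∣ p - q ∣ ≡ ∣ q - p ∣
  ∣p-q∣≡∣q-p∣ p q = trans (cong ∣_∣ (flip p q)) (∣-p∣≡∣p∣ (q - p))
    where
    flip = solve 2 (λ a b → a :- b := :- (b :- a)) refl

  abstract
    -- Total, with value 0 at 0, so that formulas containing `inv (t + c)` can be written before
    -- positivity is known. It is abstract so that such formulas never unfold; everything about it
    -- comes from `*-inv`.
    inv : ℚ → ℚ
    inv p with p ≟ 0ℚ
    ... | yes _  = 0ℚ
    ... | no p≢0 = 1/_ p {{≢-nonZero p≢0}}

    *-inv : 0ℚ < p → p * inv p ≡ 1ℚ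
    *-inv {p} 0<p with p ≟ 0ℚ
    ... | yes p≡0 = contradiction (sym p≡0) (<⇒≢ 0<p)
    ... | no p≢0  = *-inverseʳ p {{≢-nonZero p≢0}}

  0<inv : 0ℚ < p → 0ℚ < inv p
  0<inv {p} 0<p = 0<-cancelˡ p (<⇒≤ 0<p) (subst (0ℚ <_) (sym (*-inv 0<p)) (positive⁻¹ 1ℚ))

  0<1 : 0ℚ < 1ℚ
  0<1 = positive⁻¹ 1ℚ

  0≤1 : 0ℚ ≤ 1ℚ
  0≤1 = <⇒≤ 0<1

  -- Recursion makes `ι (suc n)` unfold to `1ℚ + ι n`, while closed instances such as `ι 2` still
  -- reduce to the literal `+ 2 / 1`; both facts are used silently below.
  ι : ℕ → ℚ
  ι zero    = 0ℚ
  ι (suc n) = 1ℚ + ι n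

  0≤ι : ∀ n → 0ℚ ≤ ι n
  0≤ι zero    = ≤-refl
  0≤ι (suc n) = 0≤-+ 0≤1 (0≤ι n)

  ι-homo-+ : ∀ m n → ι (m ℕ.+ n) ≡ ι m + ι n
  ι-homo-+ zero    n = sym (+-identityˡ (ι n))
  ι-homo-+ (suc m) n = trans (cong (λ h → 1ℚ + h) (ι-homo-+ m n)) (sym (+-assoc 1ℚ (ι m) (ι n)))

  ι-homo-* : ∀ m n → ι (m ℕ.* n) ≡ ι m * ι n
  ι-homo-* zero    n = sym (*-zeroˡ (ι n))
  ι-homo-* (suc m) n = trans (ι-homo-+ n (m ℕ.* n))
      (trans (cong (λ h → ι n + h) (ι-homo-* m n)) (expand (ι m) (ι n)))
    where
    expand = solve 2 (λ a b → b :+ a :* b := (con 1ℚ :+ a) :* b) refl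

  ι-mono : ∀ {m n} → m ℕ.≤ n → ι m ≤ ι n
  ι-mono {n = n} ℕ.z≤n = 0≤ι n
  ι-mono (ℕ.s≤s m≤n) = +-monoʳ-≤ 1ℚ (ι-mono m≤n)

  ι-mono-< : ∀ {m n} → m ℕ.< n → ι m < ι n
  ι-mono-< {m} {n} m<n = <-≤-trans (subst (_< 1ℚ + ι m) (+-identityˡ (ι m)) (+-monoˡ-< (ι m) 0<1))
      (ι-mono m<n)

  ι-cancel-≤ : ∀ {m n} → ι m ≤ ι n → m ℕ.≤ n
  ι-cancel-≤ {m} {n} h with m ℕ.≤? n
  ... | yes m≤n = m≤n
  ... | no m≰n  = contradiction (<-≤-trans (ι-mono-< (ℕ.≰⇒> m≰n)) h) (<-irrefl refl)

  ι-injective : ∀ {m n} → ι m ≡ ι n → m ≡ n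
  ι-injective h = ℕ.≤-antisym (ι-cancel-≤ (≤-reflexive h)) (ι-cancel-≤ (≤-reflexive (sym h)))

  ι≡/1 : ∀ n → ι n ≡ + n / 1
  ι≡/1 zero    = refl
  ι≡/1 (suc n) = trans (cong (λ h → 1ℚ + h) (ι≡/1 n)) (toℚᵘ-injective (begin
    toℚᵘ (1ℚ + + n / 1)                   ≈⟨ toℚᵘ-homo-+ 1ℚ (+ n / 1) ⟩
    toℚᵘ 1ℚ ℚᵘ.+ toℚᵘ (+ n / 1)           ≈⟨ ℚᵘ.+-congʳ (toℚᵘ 1ℚ) (toℚᵘ-fromℚᵘ (ℚᵘ.mkℚᵘ (+ n) 0)) ⟩
    toℚᵘ 1ℚ ℚᵘ.+ ℚᵘ.mkℚᵘ (+ n) 0          ≈⟨ ℚᵘ.*≡*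
        (cong (λ h → (+ 1 ℤ.+ h) ℤ.* + 1) (ℤ.*-identityʳ (+ n))) ⟩
    ℚᵘ.mkℚᵘ (+ suc n) 0                   ≈⟨ toℚᵘ-fromℚᵘ (ℚᵘ.mkℚᵘ (+ suc n) 0) ⟨
    toℚᵘ (+ suc n / 1)                    ∎))
    where open ℚᵘ.≃-Reasoning

  -- The entry 1 / (m - 1) of the adjacency matrix has a variable denominator; this identity
  -- connects it with `ι`.
  unit-fraction : ∀ n → (+ 1 / suc n) * ι (suc n) ≡ 1ℚ
  unit-fraction n = trans (cong (λ h → (+ 1 / suc n) * h) (ι≡/1 (suc n))) (toℚᵘ-injective (begin
    toℚᵘ ((+ 1 / suc n) * (+ suc n / 1))            ≈⟨ toℚᵘ-homo-* (+ 1 / suc n) (+ suc n / 1) ⟩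
    toℚᵘ (+ 1 / suc n) ℚᵘ.* toℚᵘ (+ suc n / 1)
        ≈⟨ ℚᵘ.*-cong (toℚᵘ-fromℚᵘ (ℚᵘ.mkℚᵘ (+ 1) n)) (toℚᵘ-fromℚᵘ (ℚᵘ.mkℚᵘ (+ suc n) 0)) ⟩
    ℚᵘ.mkℚᵘ (+ 1) n ℚᵘ.* ℚᵘ.mkℚᵘ (+ suc n) 0
        ≈⟨ ℚᵘ.*≡* (trans (ℤ.*-identityʳ (+ 1 ℤ.* + suc n)) (trans (ℤ.*-identityˡ (+ suc n))
        (sym (trans (ℤ.*-identityˡ (+ (suc n ℕ.* 1))) (cong +_ (ℕ.*-identityʳ (suc n))))))) ⟩
    toℚᵘ 1ℚ                                         ∎))
    where open ℚᵘ.≃-Reasoning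

  archimedean : ∀ p → ∃ λ n → p ≤ ι n
  archimedean p@(mkℚ n d c) = ℤ.∣ n ∣ , subst (p ≤_) (sym (ι≡/1 ℤ.∣ n ∣)) (toℚᵘ-cancel-≤ (begin
    toℚᵘ p                        ≤⟨ ℚᵘ.*≤* (ℤ.≤-trans (ℤ.≤-reflexive (ℤ.*-identityʳ n)) bound) ⟩
    ℚᵘ.mkℚᵘ (+ ℤ.∣ n ∣) 0         ≃⟨ toℚᵘ-fromℚᵘ (ℚᵘ.mkℚᵘ (+ ℤ.∣ n ∣) 0) ⟨
    toℚᵘ (+ ℤ.∣ n ∣ / 1)          ∎))
    where
    open ℚᵘ.≤-Reasoning
    i≤∣i∣ : ∀ i → i ℤ.≤ + ℤ.∣ i ∣
    i≤∣i∣ (+ _)      = ℤ.≤-refl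
    i≤∣i∣ ℤ.-[1+ _ ] = ℤ.-≤+
    bound : n ℤ.≤ + ℤ.∣ n ∣ ℤ.* + suc d
    bound = ℤ.≤-trans (i≤∣i∣ n) (subst (+ ℤ.∣ n ∣ ℤ.≤_) (ℤ.pos-* ℤ.∣ n ∣ (suc d))
              (ℤ.+≤+ (ℕ.m≤m*n ℤ.∣ n ∣ (suc d))))

-- Finite sums of rationals and indicators

module FiniteSums where

  open import Algebra.Bundles using (CommutativeRing)
  import Algebra.Properties.Semiring.Sum as SemiringSum
  open import Data.Fin.Subset using (Subset; ∣_∣)
  open import Data.Rational.Base hiding (∣_∣)
  open import Data.Rational.Properties
  open import Data.Vec.Base using (_∷_; []; lookup)
  open import Function.Definitions using (Injective)
  open +-*-Solver using (solve; con; _:=_; _:+_; _:*_; _:-_; :-_)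

  open Rationals

  open SemiringSum (CommutativeRing.semiring +-*-commutativeRing) public
    using (sum; sum-cong-≗; ∑-distrib-+; ∑-comm; *-distribˡ-sum; *-distribʳ-sum; sum-remove)

  sum-mono : ∀ {n} {f g : Fin n → ℚ} → (∀ i → f i ≤ g i) → sum f ≤ sum g
  sum-mono {zero}  h = ≤-refl
  sum-mono {suc n} h = +-mono-≤ (h zero) (sum-mono (h ∘ suc))

  sum-zero : ∀ {n} {f : Fin n → ℚ} → (∀ i → f i ≡ 0ℚ) → sum f ≡ 0ℚ
  sum-zero {zero}  h = refl
  sum-zero {suc n} h = trans (cong₂ _+_ (h zero) (sum-zero (h ∘ suc))) (+-identityˡ 0ℚ)

  0≤sum : ∀ {n} {f : Fin n → ℚ} → (∀ i → 0ℚ ≤ f i) → 0ℚ ≤ sum f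
  0≤sum {zero}  h = ≤-refl
  0≤sum {suc n} h = 0≤-+ (h zero) (0≤sum (h ∘ suc))

  sum-const : ∀ n p → sum {n} (λ _ → p) ≡ ι n * p
  sum-const zero    p = sym (*-zeroˡ p)
  sum-const (suc n) p = trans (cong (λ h → p + h) (sum-const n p)) (expand (ι n) p)
    where
    expand = solve 2 (λ a b → b :+ a :* b := (con 1ℚ :+ a) :* b) refl

  sum-neg : ∀ {n} (f : Fin n → ℚ) → sum (λ i → - f i) ≡ - sum f
  sum-neg {zero}  f = refl
  sum-neg {suc n} f = trans (cong (λ h → - f zero + h) (sum-neg (f ∘ suc)))
      (sym (neg-distrib-+ (f zero) (sum (f ∘ suc))))

  ∑-distrib-- : ∀ {n} (f g : Fin n → ℚ) → sum (λ i → f i - g i) ≡ sum f - sum g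
  ∑-distrib-- f g = trans (∑-distrib-+ f (λ i → - g i)) (cong (λ h → sum f + h) (sum-neg g))

  sum-split : ∀ {n} (i : Fin n) (f : Fin n → ℚ) → ∃ λ rest → sum f ≡ f i + rest ×
      ((∀ j → 0ℚ ≤ f j) → 0ℚ ≤ rest)
  sum-split {suc n} i f = _ , sum-remove {i = i} f , λ 0≤f → 0≤sum (0≤f ∘ punchIn i)

  single≤sum : ∀ {n} {f : Fin n → ℚ} → (∀ i → 0ℚ ≤ f i) → ∀ i → f i ≤ sum f
  single≤sum {f = f} 0≤f i with sum-split i f
  ... | rest , eq , 0≤rest = ≤-by (trans (cong (_- f i) eq) (cancel (f i) rest)) (0≤rest 0≤f)
    where
    cancel = solve 2 (λ a b → (a :+ b) :- a := b) refl

  sum-single : ∀ {n} {f : Fin n → ℚ} i → (∀ j → j ≢ i → f j ≡ 0ℚ) → sum f ≡ f i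
  sum-single {suc n} {f} i h = trans (sum-remove {i = i} f)
    (trans (cong (λ h → f i + h) (sum-zero (λ j → h (punchIn i j) (Fin.punchInᵢ≢i i j))))
        (+-identityʳ (f i)))

  -- Induction on `m`: the term at `h zero` is split off on both sides, and `punchOut` turns the
  -- rest of `h` into an injection into the remaining indices.
  sum-injective : ∀ {m n} {f : Fin n → ℚ} (h : Fin m → Fin n) → Injective _≡_ _≡_ h →
                  (∀ i → 0ℚ ≤ f i) → sum (f ∘ h) ≤ sum f
  sum-injective {zero}              h inj 0≤f = 0≤sum 0≤f
  sum-injective {suc m} {zero}      h inj 0≤f with h zero
  ... | ()
  sum-injective {suc m} {suc n} {f} h inj 0≤f = begin
    f (h zero) + sum (f ∘ h ∘ suc)
      ≡⟨ cong (λ s → f (h zero) + s) (sum-cong-≗ (λ i → cong f (sym (Fin.punchIn-punchOut (apart i)))))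
          ⟩
    f (h zero) + sum (f ∘ punchIn (h zero) ∘ h′)
      ≤⟨ +-monoʳ-≤ (f (h zero)) (sum-injective h′ inj′ (0≤f ∘ punchIn (h zero))) ⟩
    f (h zero) + sum (f ∘ punchIn (h zero))
      ≡⟨ sum-remove {i = h zero} f ⟨
    sum f ∎
    where
    open ≤-Reasoning
    apart : ∀ i → h zero ≢ h (suc i)
    apart i eq with inj eq
    ... | ()
    h′ : Fin m → Fin n
    h′ i = punchOut (apart i)
    inj′ : Injective _≡_ _≡_ h′
    inj′ {i} {j} eq = Fin.suc-injective (inj (Fin.punchOut-injective (apart i) (apart j) eq))

  -- The shape of an indicator with at most one witness. The sum of such a family is again between 0
  -- and 1, which turns unique existence into a number that can be summed further.
  record Exclusive {n} (f : Fin n → ℚ) : Set where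
    constructor exclusive
    field
      0≤f    : ∀ i → 0ℚ ≤ f i
      f≤1    : ∀ i → f i ≤ 1ℚ
      unique : ∀ i j → 0ℚ < f i → 0ℚ < f j → i ≡ j

  -- The order of the rationals is decidable, so the entries can be searched; positive counts are
  -- turned back into vertices and edges in this way.
  0<sum⇒∃ : ∀ {n} {f : Fin n → ℚ} → 0ℚ < sum f → ∃ λ i → 0ℚ < f i
  0<sum⇒∃ {zero}      h = contradiction h (<-irrefl refl)
  0<sum⇒∃ {suc n} {f} h with 0ℚ <? f zero
  ... | yes 0<f₀ = zero , 0<f₀
  ... | no 0≮f₀  with 0<sum⇒∃ {f = f ∘ suc} (<-≤-trans h (subst (sum f ≤_) (+-identityˡ _) (+-monoˡ-≤ (sum (f ∘ suc)) (≮⇒≥ 0≮f₀))))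
  ... | i , 0<fᵢ = suc i , 0<fᵢ

  sum≤1 : ∀ {n} {f : Fin n → ℚ} → Exclusive f → sum f ≤ 1ℚ
  sum≤1 {n} {f} (exclusive 0≤f f≤1 unique) with 0ℚ <? sum f
  ... | no ≮  = ≤-trans (≮⇒≥ ≮) 0≤1
  ... | yes 0<s with 0<sum⇒∃ 0<s
  ... | i , 0<fᵢ = subst (_≤ 1ℚ) (sym (sum-single i
      (λ j j≢i → ≤-antisym (≮⇒≥ (λ 0<fⱼ → j≢i (unique j i 0<fⱼ 0<fᵢ))) (0≤f j)))) (f≤1 i)

  I : Bool → ℚ
  I true  = 1ℚ
  I false = 0ℚ

  0≤I : ∀ b → 0ℚ ≤ I b
  0≤I true  = 0≤1
  0≤I false = ≤-refl

  I≤1 : ∀ b → I b ≤ 1ℚ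
  I≤1 true  = ≤-refl
  I≤1 false = 0≤1

  0<I⇒true : ∀ {b} → 0ℚ < I b → b ≡ true
  0<I⇒true {true}  _ = refl
  0<I⇒true {false} h = contradiction h (<-irrefl refl)

  I-idem : ∀ b → I b * I b ≡ I b
  I-idem true  = refl
  I-idem false = refl

  ⟦_⟧ : ∀ {a} {A : Set a} → Dec A → ℚ
  ⟦ A? ⟧ = I (does A?)

  ⟦⟧-yes : ∀ {a} {A : Set a} (A? : Dec A) → A → ⟦ A? ⟧ ≡ 1ℚ
  ⟦⟧-yes (yes _) _ = refl
  ⟦⟧-yes (no ¬a) a = contradiction a ¬a

  ⟦⟧-no : ∀ {a} {A : Set a} (A? : Dec A) → ¬ A → ⟦ A? ⟧ ≡ 0ℚ
  ⟦⟧-no (yes a) ¬a = contradiction a ¬a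
  ⟦⟧-no (no _)  _  = refl

  0<⟦⟧ : ∀ {a} {A : Set a} (A? : Dec A) → 0ℚ < ⟦ A? ⟧ → A
  0<⟦⟧ (yes a) _ = a
  0<⟦⟧ (no _)  h = contradiction h (<-irrefl refl)

  ι∣∣≡sum : ∀ {n} (S : Subset n) → ι ∣ S ∣ ≡ sum (λ v → I (lookup S v))
  ι∣∣≡sum []          = refl
  ι∣∣≡sum (true ∷ S)  = cong (λ h → 1ℚ + h) (ι∣∣≡sum S)
  ι∣∣≡sum (false ∷ S) = trans (ι∣∣≡sum S) (sym (+-identityˡ _))

-- Bounds on the spectral radius from above and below

module SpectralBounds where

  open import Data.Rational.Base
  open import Data.Rational.Properties
  open +-*-Solver using (solve; con; _:=_; _:+_; _:*_; _:-_; :-_)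

  open import Defs hiding (sum)
  open Rationals
  open FiniteSums

  Eventually : (ℕ → Set) → Set
  Eventually P = ∃ λ N → ∀ n → N ℕ.≤ n → P n

  eventually₂ : ∀ {P Q R : ℕ → Set} → (∀ n → P n → Q n → R n) → Eventually P → Eventually Q → Eventually
      R
  eventually₂ f (M , p) (N , q) = M ℕ.⊔ N , λ n h → f n (p n (ℕ.m⊔n≤o⇒m≤o M N h))
      (q n (ℕ.m⊔n≤o⇒n≤o M N h))

  eventually : ∀ {P Q : ℕ → Set} → (∀ n → P n → Q n) → Eventually P → Eventually Q
  eventually f (N , p) = N , λ n h → f n (p n h)

  -- `x ≈ᴿ y` is by definition `Null` of the difference of the two sequences, so eigenvalue
  -- equations enter and leave this calculus without conversion.
  Null : (ℕ → ℚ) → Set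
  Null f = ∀ ε → 0ℚ < ε → Eventually (λ n → ∣ f n ∣ ≤ ε)

  Bounded : (ℕ → ℚ) → Set
  Bounded f = ∃ λ B → 0ℚ < B × Eventually (λ n → ∣ f n ∣ ≤ B)

  half-positive : ∀ {ε} → 0ℚ < ε → 0ℚ < ε * ½
  half-positive 0<ε = 0<-* 0<ε (positive⁻¹ ½)

  halves = solve 1 (λ a → a :* (con ½) :+ a :* (con ½) := a) refl

  null-cong : ∀ {f g} → (∀ n → f n ≡ g n) → Null f → Null g
  null-cong eq h ε 0<ε = eventually (λ n → subst (λ s → ∣ s ∣ ≤ ε) (eq n)) (h ε 0<ε)

  null-+ : ∀ {f g} → Null f → Null g → Null (λ n → f n + g n)
  null-+ {f} {g} hf hg ε 0<ε = eventually₂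
    (λ n p q → ≤-trans (∣p+q∣≤∣p∣+∣q∣ (f n) (g n))
        (subst (∣ f n ∣ + ∣ g n ∣ ≤_) (halves ε) (+-mono-≤ p q)))
    (hf (ε * ½) (half-positive 0<ε)) (hg (ε * ½) (half-positive 0<ε))

  null-* : ∀ {f g} → Null f → Bounded g → Null (λ n → f n * g n)
  null-* {f} {g} hf (B , 0<B , hg) ε 0<ε = eventually₂
    (λ n p q → subst₂ _≤_ (sym (∣p*q∣≡∣p∣*∣q∣ (f n) (g n)))
      (trans (*-assoc ε (inv B) B) (trans (cong (ε *_) (trans (*-comm (inv B) B) (*-inv 0<B)))
          (*-identityʳ ε)))
      (*-mono (0≤∣p∣ (f n)) (<⇒≤ 0<B) p q))
    (hf (ε * inv B) (0<-* 0<ε (0<inv 0<B))) hg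

  null-sum : ∀ {k} {f : Fin k → ℕ → ℚ} → (∀ i → Null (f i)) → Null (λ n → sum (λ i → f i n))
  null-sum {zero}      h ε 0<ε = 0 , λ _ _ → <⇒≤ 0<ε
  null-sum {suc k} {f} h = null-+ {f zero} (h zero) (null-sum (h ∘ suc))

  bounded-+ : ∀ {f g} → Bounded f → Bounded g → Bounded (λ n → f n + g n)
  bounded-+ {f} {g} (B , 0<B , hf) (C , 0<C , hg) = B + C , 0<-+ 0<B (<⇒≤ 0<C) ,
    eventually₂ (λ n p q → ≤-trans (∣p+q∣≤∣p∣+∣q∣ (f n) (g n)) (+-mono-≤ p q)) hf hg

  bounded-* : ∀ {f g} → Bounded f → Bounded g → Bounded (λ n → f n * g n)
  bounded-* {f} {g} (B , 0<B , hf) (C , 0<C , hg) = B * C , 0<-* 0<B 0<C ,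
    eventually₂ (λ n p q → ≤-trans (≤-reflexive (∣p*q∣≡∣p∣*∣q∣ (f n) (g n)))
        (*-mono (0≤∣p∣ (f n)) (<⇒≤ 0<C) p q)) hf hg

  bounded-sum : ∀ {k} {f : Fin k → ℕ → ℚ} → (∀ i → Bounded (f i)) → Bounded (λ n → sum (λ i → f i n))
  bounded-sum {zero}      h = 1ℚ , 0<1 , 0 , λ _ _ → 0≤1
  bounded-sum {suc k} {f} h = bounded-+ {f zero} (h zero) (bounded-sum (h ∘ suc))

  bounded-const : ∀ c → Bounded (λ _ → c)
  bounded-const c = 1ℚ + ∣ c ∣ , 0<-+ 0<1 (0≤∣p∣ c) , 0 , λ _ _ → ≤-by (cancel ∣ c ∣) 0≤1
    where
    cancel = solve 1 (λ a → (con 1ℚ :+ a) :- a := con 1ℚ) refl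

  bounded-seq : ∀ x → Bounded (seq x)
  bounded-seq x with cauchy x 1ℚ 0<1
  ... | N , close = 1ℚ + ∣ seq x N ∣ , 0<-+ 0<1 (0≤∣p∣ (seq x N)) , N , λ n N≤n → begin
    ∣ seq x n ∣                        ≡⟨ cong ∣_∣ (sub-add (seq x n) (seq x N)) ⟩
    ∣ (seq x n - seq x N) + seq x N ∣  ≤⟨ ∣p+q∣≤∣p∣+∣q∣ (seq x n - seq x N) (seq x N) ⟩
    ∣ seq x n - seq x N ∣ + ∣ seq x N ∣ ≤⟨ +-monoˡ-≤ ∣ seq x N ∣ (close n N N≤n ℕ.≤-refl) ⟩
    1ℚ + ∣ seq x N ∣                   ∎
    where open ≤-Reasoning

  ≤ᴿ-trans : ∀ {x y z} → x ≤ᴿ y → y ≤ᴿ z → x ≤ᴿ z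
  ≤ᴿ-trans {x} {y} {z} h₁ h₂ ε 0<ε = eventually₂
    (λ n p q → ≤-trans p (≤-trans (+-monoˡ-≤ (ε * ½) q)
      (≤-reflexive (trans (+-assoc (seq z n) (ε * ½) (ε * ½)) (cong (λ h → seq z n + h) (halves ε))))))
    (h₁ (ε * ½) (half-positive 0<ε)) (h₂ (ε * ½) (half-positive 0<ε))

  private
    quad-step = solve 6 (λ w b q s W a → (w :* (b :* b) :+ q) :- ((w :* b :+ s) :+ (w :* b :+ s)) :* a
        :+ (w
        :+ W) :* (a :* a) := (q :- (s :+ s) :* a :+ W :* (a :* a)) :+ w :* ((b :- a) :* (b :- a)))
        refl

    cs-step = solve 5 (λ w b q s W → (w :+ W) :* (w :* (b :* b) :+ q) :- (w :* b :+ s) :* (w :* b :+ s)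
        :=
        (W :* q :- s :* s) :+ w :* (q :- (s :+ s) :* b :+ W :* (b :* b))) refl

  -- Division-free induction: adding an entry (w, b) increases the defect by w Σ wᵢ (bᵢ - b)², and
  -- `quad` is the expanded form of such a sum of squares.
  cauchy-schwarz : ∀ {n} (w b : Fin n → ℚ) → (∀ i → 0ℚ ≤ w i) →
                   sum (λ i → w i * b i) * sum (λ i → w i * b i) ≤ sum w * sum (λ i → w i * (b i * b i))
  cauchy-schwarz w b 0≤w = 0≤-⇒≤ (go w b 0≤w)
    where
    quad : ∀ {n} (w b : Fin n → ℚ) → (∀ i → 0ℚ ≤ w i) → ∀ a → let s = sum (λ i → w i * b i) in
           0ℚ ≤ sum (λ i → w i * (b i * b i)) - (s + s) * a + sum w * (a * a)
    quad {zero}  w b 0≤w a = ≤-reflexive (zeros a)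
      where
      zeros = solve 1 (λ a → (con 0ℚ) := con 0ℚ :- (con 0ℚ :+ con 0ℚ) :* a :+ con 0ℚ :* (a :*
          a)) refl
    quad {suc n} w b 0≤w a = subst (0ℚ ≤_) (sym (quad-step (w zero) (b zero) _ _ _ a))
      (0≤-+ (quad (w ∘ suc) (b ∘ suc) (0≤w ∘ suc) a) (0≤-* (0≤w zero) (0≤² (b zero - a))))
    go : ∀ {n} (w b : Fin n → ℚ) → (∀ i → 0ℚ ≤ w i) → let s = sum (λ i → w i * b i) in
         0ℚ ≤ sum w * sum (λ i → w i * (b i * b i)) - s * s
    go {zero}  w b 0≤w = ≤-refl
    go {suc n} w b 0≤w = subst (0ℚ ≤_) (sym (cs-step (w zero) (b zero) _ _ _))
      (0≤-+ (go (w ∘ suc) (b ∘ suc) (0≤w ∘ suc)) (0≤-* (0≤w zero)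
          (quad (w ∘ suc) (b ∘ suc) (0≤w ∘ suc) (b zero))))

  module SuperSolution {n} (A : Fin n → Fin n → ℚ) (0≤A : ∀ i j → 0ℚ ≤ A i j)
      (A-sym : ∀ i j → A i j ≡ A j i)
    (y : Fin n → ℚ) (0<y : ∀ i → 0ℚ < y i) (Λ : ℚ) (0≤Λ : 0ℚ ≤ Λ)
    (super : ∀ i → sum (λ j → A i j * y j) ≤ Λ * y i) where

    private
      y⁻¹ : Fin n → ℚ
      y⁻¹ i = inv (y i)

      y*y⁻¹ : ∀ i → y i * y⁻¹ i ≡ 1ℚ
      y*y⁻¹ i = *-inv (0<y i)

    -- Cauchy–Schwarz in each row with the weights A i j * y j; the symmetry of A
    -- then allows super to be used a second time after exchanging the sums.
    norm-bound : ∀ (p : Fin n → ℚ) →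
      sum (λ i → sum (λ j → A i j * p j) * sum (λ j → A i j * p j)) ≤ (Λ * Λ) * sum (λ i → p i * p i)
    norm-bound p = begin
      sum (λ i → sum (λ j → A i j * p j) * sum (λ j → A i j * p j))
        ≤⟨ sum-mono row ⟩
      sum (λ i → (Λ * y i) * sum (λ j → A i j * e j))
        ≡⟨ sum-cong-≗ (λ i → *-distribˡ-sum (Λ * y i) (λ j → A i j * e j)) ⟩
      sum (λ i → sum (λ j → (Λ * y i) * (A i j * e j)))
        ≡⟨ ∑-comm (λ i j → (Λ * y i) * (A i j * e j)) ⟩
      sum (λ j → sum (λ i → (Λ * y i) * (A i j * e j)))
        ≡⟨ sum-cong-≗ (λ j → trans (sum-cong-≗ (λ i → trans
            (cong (λ h → (Λ * y i) * (h * e j)) (A-sym i j)) (shuffle Λ (y i) (A j i) (e j))))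
             (sym (*-distribˡ-sum (Λ * e j) (λ i → A j i * y i)))) ⟩
      sum (λ j → (Λ * e j) * sum (λ i → A j i * y i))
        ≤⟨ sum-mono (λ j → *-monoˡ (Λ * e j) (0≤-* 0≤Λ (0≤e j)) (super j)) ⟩
      sum (λ j → (Λ * e j) * (Λ * y j))
        ≡⟨ sum-cong-≗ (λ j → trans (regroup Λ (p j) (y j) (y⁻¹ j))
            (trans (cong (λ h → (Λ * Λ) * (p j * p j * h)) (y*y⁻¹ j))
            (cong ((Λ * Λ) *_) (*-identityʳ _)))) ⟩
      sum (λ j → (Λ * Λ) * (p j * p j))
        ≡⟨ *-distribˡ-sum (Λ * Λ) (λ j → p j * p j) ⟨
      (Λ * Λ) * sum (λ j → p j * p j) ∎
      where
      open ≤-Reasoning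
      shuffle = solve 4 (λ l y a e → (l :* y) :* (a :* e) := (l :* e) :* (a :* y)) refl
      regroup = solve 4 (λ l p y v → (l :* (p :* (p :* v))) :* (l :* y) := (l :* l) :* (p :* p :* (y :*
          v))) refl
      weight = solve 4 (λ a y p v → (a :* y) :* (p :* v) := (a :* p) :* (y :* v)) refl
      weight² = solve 4 (λ a y p v → (a :* y) :* ((p :* v) :* (p :* v)) := (a :* (p :* (p :* v))) :*
          (y :*
          v)) refl
      e : Fin n → ℚ
      e j = p j * (p j * y⁻¹ j)
      0≤e : ∀ j → 0ℚ ≤ e j
      0≤e j = subst (0ℚ ≤_) (*-assoc (p j) (p j) (y⁻¹ j)) (0≤-* (0≤² (p j)) (<⇒≤ (0<inv (0<y j))))
      unweigh : ∀ i c d → c * (y i * y⁻¹ i) ≡ d → d ≡ c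
      unweigh i c d eq = trans (sym eq) (trans (cong (c *_) (y*y⁻¹ i)) (*-identityʳ c))
      row : ∀ i → sum (λ j → A i j * p j) * sum (λ j → A i j * p j) ≤ (Λ * y i) * sum
          (λ j → A i j * e j)
      row i = begin
        sum (λ j → A i j * p j) * sum (λ j → A i j * p j)
          ≡⟨ cong (λ h → h * h) (sum-cong-≗ (λ j → sym
              (unweigh j (A i j * p j) _ (sym (weight (A i j) (y j) (p j) (y⁻¹ j)))))) ⟩
        sum (λ j → w j * b j) * sum (λ j → w j * b j)
          ≤⟨ cauchy-schwarz w b (λ j → 0≤-* (0≤A i j) (<⇒≤ (0<y j))) ⟩
        sum w * sum (λ j → w j * (b j * b j))
          ≡⟨ cong (sum w *_) (sum-cong-≗ (λ j → unweigh j (A i j * e j) _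
              (sym (weight² (A i j) (y j) (p j) (y⁻¹ j))))) ⟩
        sum w * sum (λ j → A i j * e j)
          ≤⟨ *-monoʳ (sum (λ j → A i j * e j)) (0≤sum (λ j → 0≤-* (0≤A i j) (0≤e j))) (super i) ⟩
        (Λ * y i) * sum (λ j → A i j * e j) ∎
        where
        w b : Fin n → ℚ
        w j = A i j * y j
        b j = p j * y⁻¹ j

  -- The matrix is real, so the real and imaginary parts of an eigenvector decouple, exactly and at
  -- every index of the representing sequences.
  re-sum : ∀ {n} (a : Fin n → ℚ) (x : Fin n → ℂ) k →
           seq (re (Defs.sum (λ j → ℚ⇒ℂ (a j) *ᶜ x j))) k ≡ sum (λ j → a j * seq (re (x j)) k)
  re-sum {zero}  a x k = refl
  re-sum {suc n} a x k = cong₂ _+_ (drop (a zero) (seq (re (x zero)) k) (seq (im (x zero)) k))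
      (re-sum (a ∘ suc) (x ∘ suc) k)
    where
    drop = solve 3 (λ a p q → a :* p :+ (:- (con 0ℚ :* q)) := a :* p) refl

  im-sum : ∀ {n} (a : Fin n → ℚ) (x : Fin n → ℂ) k →
           seq (im (Defs.sum (λ j → ℚ⇒ℂ (a j) *ᶜ x j))) k ≡ sum (λ j → a j * seq (im (x j)) k)
  im-sum {zero}  a x k = refl
  im-sum {suc n} a x k = cong₂ _+_ (drop (a zero) (seq (re (x zero)) k) (seq (im (x zero)) k))
      (im-sum (a ∘ suc) (x ∘ suc) k)
    where
    drop = solve 3 (λ a p q → a :* q :+ con 0ℚ :* p := a :* q) refl

  module _ {n} (A : Fin n → Fin n → ℚ) (0≤A : ∀ i j → 0ℚ ≤ A i j) (A-sym : ∀ i j → A i j ≡ A j i)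
    (y : Fin n → ℚ) (0<y : ∀ i → 0ℚ < y i) (Λ : ℚ) (0≤Λ : 0ℚ ≤ Λ)
    (super : ∀ i → sum (λ j → A i j * y j) ≤ Λ * y i) where

    open SuperSolution A 0≤A A-sym y 0<y Λ 0≤Λ super

    -- At each index k the real and imaginary parts of x are rational vectors, so `norm-bound`
    -- applies to both and gives ‖Ax‖² ≤ Λ² ‖x‖². Replacing Ax by z x costs the null sequence `err`,
    -- and ‖x‖² eventually stays above `ε₀`, so that it can be divided out.
    eigenvalue-bound : ∀ z → IsEigenvalue (λ i j → ℚ⇒ℂ (A i j)) z → ∣ z ∣² ≤ᴿ fromℚ (Λ * Λ)
    eigenvalue-bound z (x , (i₀ , ε₀ , 0<ε₀ , N₀ , nonzero) , eigen) ε 0<ε =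
      -- The tolerance ε ε₀ for `err` becomes ε after division by ‖x‖² ≥ ε₀.
      eventually₂ conclude (N₀ , nonzero) (null-err (ε * ε₀) (0<-* 0<ε 0<ε₀))
      where
      p q a b X Y : Fin n → ℕ → ℚ
      p i k = seq (re (x i)) k
      q i k = seq (im (x i)) k
      a i k = sum (λ j → A i j * p j k)
      b i k = sum (λ j → A i j * q j k)
      X i k = seq (re (z *ᶜ x i)) k
      Y i k = seq (im (z *ᶜ x i)) k
      null-a : ∀ i → Null (λ k → a i k - X i k)
      null-a i = null-cong (λ k → cong (_- X i k) (re-sum (A i) x k)) (proj₁ (eigen i))
      null-b : ∀ i → Null (λ k → b i k - Y i k)
      null-b i = null-cong (λ k → cong (_- Y i k) (im-sum (A i) x k)) (proj₂ (eigen i))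
      bounded-a : ∀ i → Bounded (a i)
      bounded-a i = bounded-sum (λ j → bounded-* (bounded-const (A i j)) (bounded-seq (re (x j))))
      bounded-b : ∀ i → Bounded (b i)
      bounded-b i = bounded-sum (λ j → bounded-* (bounded-const (A i j)) (bounded-seq (im (x j))))
      err : ℕ → ℚ
      err k = sum (λ i → (a i k - X i k) * (a i k + X i k) + (b i k - Y i k) * (b i k + Y i k))
      null-err : Null err
      null-err = null-sum (λ i → null-+
        (null-* (null-a i) (bounded-+ (bounded-a i) (bounded-seq (re (z *ᶜ x i)))))
        (null-* (null-b i) (bounded-+ (bounded-b i) (bounded-seq (im (z *ᶜ x i))))))
      Q : ℕ → ℚ
      Q k = sum (λ i → p i k * p i k + q i k * q i k)
      Z : ℕ → ℚ
      Z k = seq ∣ z ∣² k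
      product = solve 4 (λ zr zi p q → (zr :* zr :+ zi :* zi) :* (p :* p :+ q :* q) :=
          (zr :* p :+ (:- (zi
          :* q))) :* (zr :* p :+ (:- (zi :* q))) :+ (zr :* q :+ zi :* p) :* (zr :* q :+ zi :* p))
          refl
      difference = solve 4 (λ a b x y → (a :- x) :* (a :+ x) :+ (b :- y) :* (b :+ y) :=
          (a :* a :+ b :* b) :-
          (x :* x :+ y :* y)) refl
      identity : ∀ k → Z k * Q k + err k ≡ sum (λ i → a i k * a i k) + sum (λ i → b i k * b i k)
      identity k = begin
        Z k * Q k + err k
          ≡⟨ cong₂ _+_ (trans (*-distribˡ-sum (Z k) (λ i → p i k * p i k + q i k * q i k))
              (sum-cong-≗ (λ i → product (seq (re z) k) (seq (im z) k) (p i k) (q i k))))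
               (trans (sum-cong-≗ (λ i → difference (a i k) (b i k) (X i k) (Y i k)))
                   (∑-distrib-- (λ i → a i k * a i k + b i k * b i k)
                   (λ i → X i k * X i k + Y i k * Y i k))) ⟩
        sum (λ i → X i k * X i k + Y i k * Y i k) + (sum (λ i → a i k * a i k + b i k * b i k) - sum
            (λ i → X i k * X i k + Y i k * Y i k))
          ≡⟨ collapse (sum (λ i → X i k * X i k + Y i k * Y i k))
              (sum (λ i → a i k * a i k + b i k * b i k)) ⟩
        sum (λ i → a i k * a i k + b i k * b i k)
          ≡⟨ ∑-distrib-+ (λ i → a i k * a i k) (λ i → b i k * b i k) ⟩
        sum (λ i → a i k * a i k) + sum (λ i → b i k * b i k) ∎
        where
        open ≡-Reasoning
        collapse = solve 2 (λ u v → u :+ (v :- u) := v) refl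
      ZQ≤ : ∀ k → Z k * Q k + err k ≤ (Λ * Λ) * Q k
      ZQ≤ k = begin
        Z k * Q k + err k
          ≡⟨ identity k ⟩
        sum (λ i → a i k * a i k) + sum (λ i → b i k * b i k)
          ≤⟨ +-mono-≤ (norm-bound (λ i → p i k)) (norm-bound (λ i → q i k)) ⟩
        (Λ * Λ) * sum (λ i → p i k * p i k) + (Λ * Λ) * sum (λ i → q i k * q i k)
          ≡⟨ *-distribˡ-+ (Λ * Λ) (sum (λ i → p i k * p i k)) (sum (λ i → q i k * q i k)) ⟨
        (Λ * Λ) * (sum (λ i → p i k * p i k) + sum (λ i → q i k * q i k))
          ≡⟨ cong ((Λ * Λ) *_) (∑-distrib-+ (λ i → p i k * p i k) (λ i → q i k * q i k)) ⟨
        (Λ * Λ) * Q k ∎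
        where open ≤-Reasoning
      conclude : ∀ k → 0ℚ + ε₀ ≤ p i₀ k * p i₀ k + q i₀ k * q i₀ k → ∣ err k ∣ ≤ ε * ε₀ → Z k ≤ Λ * Λ +
          ε
      conclude k h₁ h₂ = *-cancelˡ (Q k) (<-≤-trans 0<ε₀ ε₀≤Q)
        (≤-by (regroup (Q k) (Λ * Λ) ε (Z k) (err k) ε₀)
            (0≤-+ (0≤-+ (≤⇒0≤- (ZQ≤ k)) (0≤-* (<⇒≤ 0<ε) (≤⇒0≤- ε₀≤Q)))
          (subst (0ℚ ≤_) (swap (ε * ε₀) (err k)) (≤⇒0≤- -err≤))))
        where
        regroup = solve 6 (λ Q L e Z err e₀ → Q :* (L :+ e) :- Q :* Z := (L :* Q :- (Z :* Q :+ err)) :+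
            e
            :* (Q :- e₀) :+ (err :+ e :* e₀)) refl
        swap = solve 2 (λ u v → u :- (:- v) := v :+ u) refl
        -err≤ : - err k ≤ ε * ε₀
        -err≤ = ≤-trans (p≤∣p∣ (- err k)) (subst (_≤ ε * ε₀) (sym (∣-p∣≡∣p∣ (err k))) h₂)
        ε₀≤Q : ε₀ ≤ Q k
        ε₀≤Q = ≤-trans (subst (_≤ p i₀ k * p i₀ k + q i₀ k * q i₀ k) (+-identityˡ ε₀) h₁)
            (single≤sum (λ i → 0≤-+ (0≤² (p i k)) (0≤² (q i k))) i₀)

    spectralRadius-bound : ∀ ρ → IsSpectralRadius (λ i j → ℚ⇒ℂ (A i j)) ρ → ρ ≤ᴿ fromℚ Λ
    spectralRadius-bound ρ sr ε 0<ε with IsSpectralRadius.attained sr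
    ... | z , isEigen , z≈ρ = eventually₂ conclude
      -- Two errors of ε² / 2 add up to ε², and ρ² ≤ Λ² + ε² forces ρ ≤ Λ + ε.
      (z≈ρ (ε * ε * ½) (half-positive (0<-* 0<ε 0<ε)))
          (eigenvalue-bound z isEigen (ε * ε * ½) (half-positive (0<-* 0<ε 0<ε)))
      where
      conclude : ∀ k → ∣ seq ∣ z ∣² k - seq ρ k * seq ρ k ∣ ≤ ε * ε * ½ → seq ∣ z ∣² k ≤ Λ * Λ + ε * ε *
          ½ → seq ρ k ≤ Λ + ε
      conclude k h₁ h₂ = ≮⇒≥ λ Λ+ε<ρ → <-irrefl refl (begin-strict
        0ℚ  <⟨ 0<-+ (0<-* (<⇒0<- Λ+ε<ρ) (<-trans 0<Λ+ε
            (<-≤-trans Λ+ε<ρ (≤-by (cancel r (Λ + ε)) (<⇒≤ 0<Λ+ε)))))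
                (0≤-+ (0≤-* (0≤-+ 0≤1 0≤1) (0≤-* 0≤Λ (<⇒≤ 0<ε))) (0≤-+ (≤⇒0≤- h₂) (≤⇒0≤- diff))) ⟩
        (r - (Λ + ε)) * (r + (Λ + ε)) + ((1ℚ + 1ℚ) * (Λ * ε) +
            ((Λ * Λ + ε * ε * ½ - w) + (ε * ε * ½ - (r * r - w))))
            ≡⟨ zero-sum r Λ ε w ⟩
        0ℚ  ∎)
        where
        open ≤-Reasoning
        r w : ℚ
        r = seq ρ k
        w = seq ∣ z ∣² k
        0<Λ+ε : 0ℚ < Λ + ε
        0<Λ+ε = subst (0ℚ <_) (+-comm ε Λ) (0<-+ 0<ε 0≤Λ)
        cancel = solve 2 (λ r u → (r :+ u) :- r := u) refl
        zero-sum = solve 4 (λ r L e w → (r :- (L :+ e)) :* (r :+ (L :+ e)) :+ ((con 1ℚ :+ con 1ℚ) :* (L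
            :* e) :+ ((L :* L :+ e :* e :* (con ½) :- w) :+ (e :* e :* (con ½) :- (r :* r :- w))))
            := con 0ℚ) refl
        diff : r * r - w ≤ ε * ε * ½
        diff = ≤-trans (p≤∣p∣ (r * r - w)) (subst (_≤ ε * ε * ½) (∣p-q∣≡∣q-p∣ w (r * r)) h₁)

  -- A real eigenvalue with a real eigenvector is an instance of `largest`. The entry that is at
  -- least 1 separates the vector from 0, and the equations are required only up to null sequences
  -- because equality of reals is no more than that.
  eigenvalue≤spectralRadius : ∀ {n} (A : Fin n → Fin n → ℚ) (τ : ℝ) (y : Fin n → ℝ) →
    (∀ k → 0ℚ ≤ seq τ k) → (∃ λ i → ∀ k → 1ℚ ≤ seq (y i) k) →
    (∀ i → Null (λ k → sum (λ j → A i j * seq (y j) k) - seq τ k * seq (y i) k)) →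
    ∀ σ → IsSpectralRadius (λ i j → ℚ⇒ℂ (A i j)) σ → τ ≤ᴿ σ
  eigenvalue≤spectralRadius {n} A τ y 0≤τ (i₀ , 1≤y) eigen σ sr ε 0<ε = eventually₂ conclude
    -- The terms of σ may be slightly negative; σ ≥ - ε / 4 is enough for (σ + ε)² ≥ σ² + ε² / 2.
    (IsSpectralRadius.nonNegative sr (ε * ½ * ½) (half-positive (half-positive 0<ε)))
    (IsSpectralRadius.largest sr z isEigen (ε * ε * ½) (half-positive (0<-* 0<ε 0<ε)))
    where
    z : ℂ
    z = τ +i 0ᴿ
    x : Fin n → ℂ
    x i = y i +i 0ᴿ
    isEigen : IsEigenvalue (λ i j → ℚ⇒ℂ (A i j)) z
    isEigen = x , (i₀ , 1ℚ , 0<1 , 0 , λ k _ → nonzero (seq (y i₀) k) (1≤y k)) , λ i →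
      null-cong (λ k → sym (cong₂ _-_ (re-sum (A i) x k) (drop (seq τ k) (seq (y i) k)))) (eigen i) ,
      null-cong (λ k → sym (trans (cong (_- (seq τ k * 0ℚ + 0ℚ * seq (y i) k))
          (trans (im-sum (A i) x k) (sum-zero (λ j → *-zeroʳ (A i j)))))
        (drop′ (seq τ k) (seq (y i) k)))) (λ ε 0<ε → 0 , λ _ _ → <⇒≤ 0<ε)
      where
      drop = solve 2 (λ t y → t :* y :+ (:- (con 0ℚ :* con 0ℚ)) := t :* y) refl
      drop′ = solve 2 (λ t y → (con 0ℚ) :- (t :* con 0ℚ :+ con 0ℚ :* y) := con 0ℚ) refl
      excess = solve 1 (λ y → y :* y :+ con 0ℚ :* con 0ℚ :- (con 0ℚ :+ con 1ℚ) := (y :- con 1ℚ)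
          :* (y :- con 1ℚ) :+ (con 1ℚ :+ con 1ℚ) :* (y :- con 1ℚ)) refl
      nonzero : ∀ y → 1ℚ ≤ y → 0ℚ + 1ℚ ≤ y * y + 0ℚ * 0ℚ
      nonzero y 1≤y = ≤-by (excess y) (0≤-+ (0≤² (y - 1ℚ)) (0≤-* (0≤-+ 0≤1 0≤1) (≤⇒0≤- 1≤y)))
    conclude : ∀ k → 0ℚ ≤ seq σ k + ε * ½ * ½ → seq τ k * seq τ k + 0ℚ * 0ℚ ≤ seq σ k * seq σ k + ε * ε
        * ½ → seq τ k ≤ seq σ k + ε
    conclude k h₁ h₂ = ≮⇒≥ λ σ+ε<τ → <-irrefl refl (begin-strict
      0ℚ <⟨ 0<-+ (0<-* (<⇒0<- σ+ε<τ) (<-trans 0<σ+ε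
          (<-≤-trans σ+ε<τ (≤-by (cancel t (s + ε)) (<⇒≤ 0<σ+ε)))))
             (0≤-+ (0≤-* (<⇒≤ 0<ε) (0≤-* (0≤-+ 0≤1 0≤1) h₁)) (≤⇒0≤- h₂)) ⟩
      (t - (s + ε)) * (t + (s + ε)) + (ε * ((1ℚ + 1ℚ) * (s + ε * ½ * ½)) +
          (s * s + ε * ε * ½ - (t * t + 0ℚ * 0ℚ)))
         ≡⟨ zero-sum t s ε ⟩
      0ℚ ∎)
      where
      open ≤-Reasoning
      t s : ℚ
      t = seq τ k
      s = seq σ k
      cancel = solve 2 (λ r u → (r :+ u) :- r := u) refl
      split = solve 2 (λ s e → s :+ e := (s :+ e :* (con ½) :* (con ½)) :+ e :* (con ½) :+ e :* (con ½)
          :* (con ½)) refl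
      zero-sum = solve 3 (λ t s e → (t :- (s :+ e)) :* (t :+ (s :+ e)) :+ (e :* ((con 1ℚ :+ con 1ℚ) :*
          (s :+ e :* (con ½) :* (con ½))) :+ (s :* s :+ e :* e :* (con ½) :- (t :* t :+ con 0ℚ :*
          (con 0ℚ)))) := con 0ℚ) refl
      0<σ+ε : 0ℚ < s + ε
      0<σ+ε = subst (0ℚ <_) (sym (split s ε)) (+-mono-≤-< (0≤-+ h₁ (<⇒≤ (half-positive 0<ε)))
          (half-positive (half-positive 0<ε)))

-- Incidence and the adjacency matrix of a linear hypergraph

module Adjacencies where

  open import Data.Fin.Subset as Subset using (_∈_; _∩_; ∣_∣)
  open import Data.Fin.Subset.Properties using (_∈?_; x∈p∩q⁺; x∈p∧x≢y⇒x∈p-y; x∈p⇒∣p-x∣<∣p∣)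
  open import Data.Rational.Base using (ℚ; 0ℚ; 1ℚ; _+_; _*_; _-_; -_; _≤_; _<_; _/_)
  open import Data.Rational.Properties hiding (_≟_)
  open import Data.Vec.Base using (lookup; tabulate)
  open import Data.Vec.Properties using ([]=⇒lookup; lookup⇒[]=; lookup∘tabulate)
  open +-*-Solver using (solve; con; _:=_; _:+_; _:*_; _:-_; :-_)

  open import Defs hiding (sum)
  open Rationals
  open FiniteSums
  open SpectralBounds

  module Incidence (H : Hypergraph) where

    _∈ᵉ_ : Vertex H → Edge H → Set
    v ∈ᵉ e = v ∈ edge H e

    χ : Edge H → Vertex H → ℚ
    χ e v = I (lookup (edge H e) v)

    ∈⇒χ≡1 : ∀ {v e} → v ∈ᵉ e → χ e v ≡ 1ℚ
    ∈⇒χ≡1 v∈e = cong I ([]=⇒lookup v∈e)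

    0<χ⇒∈ : ∀ {e v} → 0ℚ < χ e v → v ∈ᵉ e
    0<χ⇒∈ h = lookup⇒[]= _ _ (0<I⇒true h)

    ∉⇒χ≡0 : ∀ {v e} → ¬ v ∈ᵉ e → χ e v ≡ 0ℚ
    ∉⇒χ≡0 {v} {e} v∉e = ≤-antisym (≮⇒≥ (v∉e ∘ 0<χ⇒∈)) (0≤I (lookup (edge H e) v))

    0≤χ : ∀ e v → 0ℚ ≤ χ e v
    0≤χ e v = 0≤I (lookup (edge H e) v)

    χ≤1 : ∀ e v → χ e v ≤ 1ℚ
    χ≤1 e v = I≤1 (lookup (edge H e) v)

    χ-idem : ∀ e v → χ e v * χ e v ≡ χ e v
    χ-idem e v = I-idem (lookup (edge H e) v)

    χ-cong : ∀ {e v p q} → (v ∈ᵉ e → p ≡ q) → χ e v * p ≡ χ e v * q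
    χ-cong {e} {v} {p} {q} h with v ∈? edge H e
    ... | yes v∈e = cong (λ s → χ e v * s) (h v∈e)
    ... | no v∉e  = trans (cong (_* p) (∉⇒χ≡0 v∉e))
        (trans (trans (*-zeroˡ p) (sym (*-zeroˡ q))) (cong (_* q) (sym (∉⇒χ≡0 v∉e))))

    χ-mono : ∀ {e v p q} → (v ∈ᵉ e → p ≤ q) → χ e v * p ≤ χ e v * q
    χ-mono {e} {v} {p} {q} h with v ∈? edge H e
    ... | yes v∈e = *-monoˡ (χ e v) (0≤χ e v) (h v∈e)
    ... | no v∉e  = ≤-reflexive (trans (cong (_* p) (∉⇒χ≡0 v∉e))
        (trans (trans (*-zeroˡ p) (sym (*-zeroˡ q))) (cong (_* q) (sym (∉⇒χ≡0 v∉e)))))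

    deg : Vertex H → ℚ
    deg v = ι (degree H v)

    deg≡sum : ∀ v → deg v ≡ sum (λ e → χ e v)
    deg≡sum v = trans (ι∣∣≡sum (tabulate (λ e → lookup (edge H e) v)))
        (sum-cong-≗ (λ e → cong I (lookup∘tabulate (λ e → lookup (edge H e) v) e)))

    size≡sum : ∀ e → ι ∣ edge H e ∣ ≡ sum (χ e)
    size≡sum e = ι∣∣≡sum (edge H e)

    edgeSum : (Vertex H → ℚ) → Edge H → ℚ
    edgeSum y e = sum (λ w → χ e w * y w)

    δ : Vertex H → Vertex H → ℚ
    δ v w = ⟦ v Fin.≟ w ⟧

    linear-unique : Linear H → ∀ {e f v w} → v ≢ w → v ∈ᵉ e → w ∈ᵉ e → v ∈ᵉ f → w ∈ᵉ f → e ≡ f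
    linear-unique lin {e} {f} {v} {w} v≢w ve we vf wf with e Fin.≟ f
    ... | yes e≡f = e≡f
    ... | no e≢f  = contradiction (ℕ.≤-trans 2≤ (lin e f e≢f)) λ { (ℕ.s≤s ()) }
      where
      w∈ : w ∈ (edge H e ∩ edge H f) Subset.- v
      w∈ = x∈p∧x≢y⇒x∈p-y (x∈p∩q⁺ (we , wf)) (v≢w ∘ sym)
      2≤ : 2 ℕ.≤ ∣ edge H e ∩ edge H f ∣
      2≤ = ℕ.≤-trans (ℕ.s≤s (ℕ.≤-trans (ℕ.s≤s ℕ.z≤n) (x∈p⇒∣p-x∣<∣p∣ w∈)))
          (x∈p⇒∣p-x∣<∣p∣ {p = edge H e ∩ edge H f} (x∈p∩q⁺ (ve , vf)))

  module Adjacency (n : ℕ) (H : Hypergraph) (linear : Linear H) where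

    open Incidence H

    private
      m : ℕ
      m = 2+ n

    ϱ : ℚ
    ϱ = + 1 / suc n

    ϱ*r≡1 : ϱ * ι (suc n) ≡ 1ℚ
    ϱ*r≡1 = unit-fraction n

    0<ϱ : 0ℚ < ϱ
    0<ϱ = 0<-cancelˡ (ι (suc n)) (0≤ι (suc n)) (subst (0ℚ <_) (sym (trans (*-comm (ι (suc n)) ϱ) ϱ*r≡1))
        0<1)

    A : Vertex H → Vertex H → ℚ
    A = adjacency m H

    -- By linearity two distinct vertices lie in at most one common edge, so the truth value of
    -- having a common edge equals the number of common edges.
    A≡ : ∀ v w → A v w ≡ ϱ * sum (λ e → χ e v * (χ e w * (1ℚ - δ v w)))
    A≡ v w = by-cases (v Fin.≟ w) (Fin.any? (λ e → (v ∈? edge H e) ×-dec (w ∈? edge H e)))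
      where
      t = λ e → χ e v * (χ e w * (1ℚ - δ v w))
      kill = solve 2 (λ a b → a :* (b :* (con 1ℚ :- con 1ℚ)) := con 0ℚ) refl
      zeros : (∀ e → t e ≡ 0ℚ) → 0ℚ ≡ ϱ * sum t
      zeros h = sym (trans (cong (ϱ *_) (sum-zero h)) (*-zeroʳ ϱ))
      by-cases : (v≟w : Dec (v ≡ w)) (common? : Dec (∃ λ e → v ∈ᵉ e × w ∈ᵉ e)) →
                 (if does (¬? v≟w ×-dec common?) then ϱ else 0ℚ) ≡ ϱ * sum t
      by-cases (yes v≡w) _ = zeros (λ e → trans (cong (λ h → χ e v * (χ e w * (1ℚ - h)))
          (⟦⟧-yes (v Fin.≟ w) v≡w)) (kill (χ e v) (χ e w)))
      by-cases (no v≢w) (no none) = zeros zero-at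
        where
        zero-at : ∀ e → t e ≡ 0ℚ
        zero-at e with v ∈? edge H e
        ... | no v∉e  = ≡0⇒*≡0 (∉⇒χ≡0 v∉e) (χ e w * (1ℚ - δ v w))
        ... | yes v∈e = trans (cong (λ h → χ e v * (h * (1ℚ - δ v w)))
            (∉⇒χ≡0 (λ w∈e → none (e , v∈e , w∈e))))
                          (trans (cong (χ e v *_) (*-zeroˡ (1ℚ - δ v w))) (*-zeroʳ (χ e v)))
      by-cases (no v≢w) (yes (e₀ , v∈e₀ , w∈e₀)) = sym
          (trans (cong (ϱ *_) (trans (sum-single e₀ other) value)) (*-identityʳ ϱ))
        where
        value : t e₀ ≡ 1ℚ
        value = cong₂ _*_ (∈⇒χ≡1 v∈e₀) (cong₂ _*_ (∈⇒χ≡1 w∈e₀)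
            (cong (λ h → 1ℚ - h) (⟦⟧-no (v Fin.≟ w) v≢w)))
        other : ∀ e → e ≢ e₀ → t e ≡ 0ℚ
        other e e≢e₀ with v ∈? edge H e | w ∈? edge H e
        ... | no v∉e  | _ = ≡0⇒*≡0 (∉⇒χ≡0 v∉e) (χ e w * (1ℚ - δ v w))
        ... | yes v∈e | yes w∈e = contradiction (linear-unique linear v≢w v∈e w∈e v∈e₀ w∈e₀) e≢e₀
        ... | yes v∈e | no w∉e = trans (cong (λ h → χ e v * (h * (1ℚ - δ v w))) (∉⇒χ≡0 w∉e))
                          (trans (cong (χ e v *_) (*-zeroˡ (1ℚ - δ v w))) (*-zeroʳ (χ e v)))

    δ-sym : ∀ v w → δ v w ≡ δ w v
    δ-sym v w with v Fin.≟ w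
    ... | yes v≡w = sym (⟦⟧-yes (w Fin.≟ v) (sym v≡w))
    ... | no v≢w  = sym (⟦⟧-no (w Fin.≟ v) (v≢w ∘ sym))

    A-sym : ∀ v w → A v w ≡ A w v
    A-sym v w = trans (A≡ v w) (trans (cong (ϱ *_)
        (sum-cong-≗ (λ e → trans (cong (λ h → χ e v * (χ e w * (1ℚ - h))) (δ-sym v w))
      (swap (χ e v) (χ e w) (1ℚ - δ w v))))) (sym (A≡ w v)))
      where
      swap = solve 3 (λ a b c → a :* (b :* c) := b :* (a :* c)) refl

    0≤A : ∀ v w → 0ℚ ≤ A v w
    0≤A v w with does (¬? (v Fin.≟ w) ×-dec Fin.any? (λ e → (v ∈? edge H e) ×-dec (w ∈? edge H e)))
    ... | true  = <⇒≤ 0<ϱ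
    ... | false = ≤-refl

    -- This is m - 1 times a row of the matrix applied to y, summed edge by edge; bounds on it speak
    -- of a = (m - 1) λ instead of λ.
    neighbourSum : (Vertex H → ℚ) → Vertex H → ℚ
    neighbourSum y v = sum (λ e → χ e v * (edgeSum y e - y v))

    row-sum : ∀ (y : Vertex H → ℚ) v → sum (λ w → A v w * y w) ≡ ϱ * neighbourSum y v
    row-sum y v = begin
      sum (λ w → A v w * y w)
        ≡⟨ sum-cong-≗ (λ w → trans (cong (_* y w) (A≡ v w))
            (trans (*-assoc ϱ _ (y w)) (cong (ϱ *_) (*-distribʳ-sum (y w)
            (λ e → χ e v * (χ e w * (1ℚ - δ v w))))))) ⟩
      sum (λ w → ϱ * sum (λ e → (χ e v * (χ e w * (1ℚ - δ v w))) * y w))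
        ≡⟨ *-distribˡ-sum ϱ (λ w → sum (λ e → (χ e v * (χ e w * (1ℚ - δ v w))) * y w)) ⟨
      ϱ * sum (λ w → sum (λ e → (χ e v * (χ e w * (1ℚ - δ v w))) * y w))
        ≡⟨ cong (ϱ *_) (∑-comm (λ w e → (χ e v * (χ e w * (1ℚ - δ v w))) * y w)) ⟩
      ϱ * sum (λ e → sum (λ w → (χ e v * (χ e w * (1ℚ - δ v w))) * y w))
        ≡⟨ cong (ϱ *_) (sum-cong-≗ inner-sum) ⟩
      ϱ * neighbourSum y v ∎
      where
      open ≡-Reasoning
      expand = solve 4 (λ a b c y → (a :* (b :* (con 1ℚ :- c))) :* y := a :* (b :* y) :- c :* (a :* (b
          :* y))) refl
      factor = solve 3 (λ a s y → a :* s :- a :* (a :* y) := a :* s :- (a :* a) :* y) refl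
      factor′ = solve 3 (λ a s y → a :* s :- a :* y := a :* (s :- y)) refl
      inner-sum : ∀ e → sum (λ w → (χ e v * (χ e w * (1ℚ - δ v w))) * y w) ≡ χ e v * (edgeSum y e - y v)
      inner-sum e = begin
        sum (λ w → (χ e v * (χ e w * (1ℚ - δ v w))) * y w)
          ≡⟨ sum-cong-≗ (λ w → expand (χ e v) (χ e w) (δ v w) (y w)) ⟩
        sum (λ w → χ e v * (χ e w * y w) - δ v w * (χ e v * (χ e w * y w)))
          ≡⟨ ∑-distrib-- (λ w → χ e v * (χ e w * y w)) (λ w → δ v w * (χ e v * (χ e w * y w))) ⟩
        sum (λ w → χ e v * (χ e w * y w)) - sum (λ w → δ v w * (χ e v * (χ e w * y w)))
          ≡⟨ cong₂ _-_ (sym (*-distribˡ-sum (χ e v) (λ w → χ e w * y w)))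
               (trans (sum-single v (λ w w≢v → ≡0⇒*≡0 (⟦⟧-no (v Fin.≟ w) (w≢v ∘ sym))
                   (χ e v * (χ e w * y w))))
                 (≡1⇒*≡ (⟦⟧-yes (v Fin.≟ v) refl) (χ e v * (χ e v * y v)))) ⟩
        χ e v * edgeSum y e - χ e v * (χ e v * y v)
          ≡⟨ factor (χ e v) (edgeSum y e) (y v) ⟩
        χ e v * edgeSum y e - (χ e v * χ e v) * y v
          ≡⟨ cong (λ h → χ e v * edgeSum y e - h * y v) (χ-idem e v) ⟩
        χ e v * edgeSum y e - χ e v * y v
          ≡⟨ factor′ (χ e v) (edgeSum y e) (y v) ⟩
        χ e v * (edgeSum y e - y v) ∎

    neighbour-bound : ∀ a (y : Vertex H → ℚ) → 0ℚ ≤ a → (∀ v → 0ℚ < y v) →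
        (∀ v → neighbourSum y v ≤ a * y v) →
                      ∀ ρ → λ₁ m H ρ → ρ ≤ᴿ fromℚ (ϱ * a)
    neighbour-bound a y 0≤a 0<y super ρ = spectralRadius-bound A 0≤A A-sym y 0<y (ϱ * a)
        (0≤-* (<⇒≤ 0<ϱ) 0≤a)
      (λ v → subst₂ _≤_ (sym (row-sum y v)) (sym (*-assoc ϱ a (y v))) (*-monoˡ ϱ (<⇒≤ 0<ϱ) (super v))) ρ

    -- The values inv (a + deg v) * Σ_{f ∋ v} S f at the vertices are a
    -- super-solution as soon as their sum over each edge e is at most S e.
    edge-bound : ∀ a (S : Edge H → ℚ) → 0ℚ < a → (∀ e → 0ℚ < S e) → (∀ v → ∃ λ e → v ∈ᵉ e) →
                 (∀ e → edgeSum (λ v → inv (a + deg v) * sum (λ f → χ f v * S f)) e ≤ S e) →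
                 ∀ ρ → λ₁ m H ρ → ρ ≤ᴿ fromℚ (ϱ * a)
    edge-bound a S 0<a 0<S covered super = neighbour-bound a y (<⇒≤ 0<a) 0<y bound
      where
      0<a+d : ∀ v → 0ℚ < a + deg v
      0<a+d v = 0<-+ 0<a (0≤ι (degree H v))
      s y : Vertex H → ℚ
      s v = sum (λ f → χ f v * S f)
      y v = inv (a + deg v) * s v
      0<s : ∀ v → 0ℚ < s v
      0<s v with covered v
      ... | e , v∈e = <-≤-trans (subst (0ℚ <_) (sym
          (trans (cong (_* S e) (∈⇒χ≡1 v∈e)) (*-identityˡ (S e)))) (0<S e))
                        (single≤sum (λ f → 0≤-* (0≤χ f v) (<⇒≤ (0<S f))) e)
      0<y : ∀ v → 0ℚ < y v
      0<y v = 0<-* (0<inv (0<a+d v)) (0<s v)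
      s≡ : ∀ v → (a + deg v) * y v ≡ s v
      s≡ v = trans (sym (*-assoc (a + deg v) (inv (a + deg v)) (s v)))
          (trans (cong (_* s v) (*-inv (0<a+d v))) (*-identityˡ (s v)))
      split = solve 3 (λ c s y → c :* (s :- y) := c :* s :- c :* y) refl
      leave = solve 3 (λ a d y → (a :+ d) :* y :- d :* y := a :* y) refl
      -- The choice (a + deg v) y v = Σ S f is made so that exactly a y v remains once the edge sums
      -- are replaced by their bounds `S e`.
      bound : ∀ v → neighbourSum y v ≤ a * y v
      bound v = begin
        neighbourSum y v
          ≤⟨ sum-mono (λ e → *-monoˡ (χ e v) (0≤χ e v) (+-monoˡ-≤ (- y v) (super e))) ⟩
        sum (λ e → χ e v * (S e - y v))
          ≡⟨ trans (sum-cong-≗ (λ e → split (χ e v) (S e) (y v)))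
              (∑-distrib-- (λ e → χ e v * S e) (λ e → χ e v * y v)) ⟩
        s v - sum (λ e → χ e v * y v)
          ≡⟨ cong₂ _-_ (sym (s≡ v)) (trans (sym (*-distribʳ-sum (y v) (λ e → χ e v)))
              (cong (_* y v) (sym (deg≡sum v)))) ⟩
        (a + deg v) * y v - deg v * y v
          ≡⟨ leave a (deg v) (y v) ⟩
        a * y v ∎
        where open ≤-Reasoning

-- Walks, paths and chains of edges

module Walks where

  open import Data.Fin.Subset using (_∈_)
  open import Data.Nat.Base using (ℕ; zero; suc; _+_; _∸_; _≤_; _<_; z≤n; s≤s)

  open import Defs

  module _ {H : Hypergraph} where

    -- Unlike a `Path` it may repeat vertices and edges, so walks can be concatenated freely;
    -- `shorten` leads back to paths.
    data Walk : ℕ → Vertex H → Vertex H → Set where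
      nil  : ∀ {x} → Walk 0 x x
      step : ∀ {n x y z e} → x ∈ edge H e → y ∈ edge H e → Walk n y z → Walk (suc n) x z

    _++ʷ_ : ∀ {m n x y z} → Walk m x y → Walk n y z → Walk (m + n) x z
    nil        ++ʷ W′ = W′
    step p q W ++ʷ W′ = step p q (W ++ʷ W′)

    open Path

    tail : ∀ {x y l} (P : Path H x y (suc l)) → Path H (vertex P (suc zero)) y l
    tail P = record
      { vertex = vertex P ∘ suc
      ; link = link P ∘ suc
      ; start = refl
      ; end = end P
      ; incident = incident P ∘ suc
      ; vertices-distinct = λ eq → Fin.suc-injective (vertices-distinct P eq)
      ; edges-distinct = λ eq → Fin.suc-injective (edges-distinct P eq)
      }

    prefix : ∀ {x y l} (P : Path H x y l) i → Walk (toℕ i) x (vertex P i)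
    prefix P zero = subst (λ v → Walk 0 v (vertex P zero)) (start P) nil
    prefix {l = suc l} P (suc i) = step (subst (_∈ edge H (link P zero)) (start P)
        (proj₁ (incident P zero)))
      (proj₂ (incident P zero)) (prefix (tail P) i)

    suffix : ∀ {x y l} (P : Path H x y l) i → Walk (l ∸ toℕ i) (vertex P i) y
    suffix {l = zero}  P zero    = subst (Walk 0 _) (end P) nil
    suffix {l = suc l} P zero    = step (proj₁ (incident P zero)) (proj₂ (incident P zero))
        (suffix (tail P) zero)
    suffix {l = suc l} P (suc i) = suffix (tail P) i

    private
      trivial : ∀ x → Path H x x 0
      trivial x = record
        { vertex = const x
        ; link = λ ()
        ; start = refl
        ; end = refl
        ; incident = λ ()
        ; vertices-distinct = λ { {zero} {zero} _ → refl }
        ; edges-distinct = λ { {()} }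
        }

      cons : ∀ {x y z e l} → x ∈ edge H e → y ∈ edge H e → (P : Path H y z l) →
             (∀ i → vertex P i ≢ x) → (∀ i → link P i ≢ e) → Path H x z (suc l)
      cons {x} {y} {z} {e} {l} x∈e y∈e P x∉ e∉ = record
        { vertex = vs
        ; link = es
        ; start = refl
        ; end = end P
        ; incident = λ { zero → x∈e , subst (_∈ edge H e) (sym (start P)) y∈e ; (suc i) → incident P i }
        ; vertices-distinct = vs-distinct
        ; edges-distinct = es-distinct
        }
        where
        vs : Fin (suc (suc l)) → Vertex H
        vs zero    = x
        vs (suc i) = vertex P i
        es : Fin (suc l) → Edge H
        es zero    = e
        es (suc i) = link P i
        vs-distinct : ∀ {i j} → vs i ≡ vs j → i ≡ j
        vs-distinct {zero}  {zero}  _  = refl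
        vs-distinct {zero}  {suc j} eq = contradiction (sym eq) (x∉ j)
        vs-distinct {suc i} {zero}  eq = contradiction eq (x∉ i)
        vs-distinct {suc i} {suc j} eq = cong suc (vertices-distinct P eq)
        es-distinct : ∀ {i j} → es i ≡ es j → i ≡ j
        es-distinct {zero}  {zero}  _  = refl
        es-distinct {zero}  {suc j} eq = contradiction (sym eq) (e∉ j)
        es-distinct {suc i} {zero}  eq = contradiction eq (e∉ i)
        es-distinct {suc i} {suc j} eq = cong suc (edges-distinct P eq)

      restart : ∀ {x y z l} (P : Path H y z l) → vertex P zero ≡ x → Path H x z l
      restart P eq = record
        { vertex = vertex P
        ; link = link P
        ; start = eq
        ; end = end P
        ; incident = incident P
        ; vertices-distinct = vertices-distinct P
        ; edges-distinct = edges-distinct P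
        }

      from-vertex : ∀ {y z l} x (P : Path H y z l) → (∃ λ l′ → l′ ≤ l × Path H x z l′) ⊎
          (∀ i → vertex P i ≢ x)
      from-vertex x P with vertex P zero Fin.≟ x
      from-vertex {l = l} x P | yes eq = inj₁ (l , ℕ.≤-refl , restart P eq)
      from-vertex {l = zero} x P | no neq = inj₂ λ { zero → neq }
      from-vertex {l = suc l} x P | no neq with from-vertex x (tail P)
      ... | inj₁ (l′ , l′≤l , Q) = inj₁ (l′ , ℕ.m≤n⇒m≤1+n l′≤l , Q)
      ... | inj₂ x∉ = inj₂ λ { zero → neq ; (suc i) → x∉ i }

      -- A path to `z` that starts on `e` but contains neither the vertex `x` nor the link `e`,
      -- hence can be preceded by both.
      Past : Vertex H → Edge H → Vertex H → ℕ → Set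
      Past x e z l = ∃ λ l′ → l′ ≤ l × ∃ λ y → y ∈ edge H e × ∃ λ (Q : Path H y z l′) →
        (∀ i → vertex Q i ≢ x) × (∀ i → link Q i ≢ e)

      after-edge : ∀ {y z l} x e (P : Path H y z l) i → link P i ≡ e → (∀ i → vertex P i ≢ x) → Past x e
          z l
      after-edge {l = suc l} x e P zero eq x∉ = l , ℕ.n≤1+n l , vertex P (suc zero) ,
        subst (λ e → vertex P (suc zero) ∈ edge H e) eq (proj₂ (incident P zero)) , tail P , x∉ ∘ suc ,
        λ i eq′ → Fin.0≢1+n (edges-distinct P (trans eq (sym eq′)))
      after-edge {l = suc l} x e P (suc i) eq x∉ with after-edge x e (tail P) i eq (x∉ ∘ suc)
      ... | l′ , l′≤l , rest = l′ , ℕ.m≤n⇒m≤1+n l′≤l , rest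

      past-edge : ∀ {y z l} x e → y ∈ edge H e → (P : Path H y z l) → (∀ i → vertex P i ≢ x) → Past x e
          z l
      past-edge {y} {l = l} x e y∈e P x∉ with Fin.any? (λ i → link P i Fin.≟ e)
      ... | no e∉        = l , ℕ.≤-refl , y , y∈e , P , x∉ , λ i eq → e∉ (i , eq)
      ... | yes (i , eq) = after-edge x e P i eq x∉

    -- Recursion on the walk: if the first vertex already lies on the shortened rest, the part
    -- before it is dropped; if only the first edge occurs there, the rest is entered where it
    -- leaves that edge.
    shorten : ∀ {n x y} → Walk n x y → ∃ λ l → l ≤ n × Path H x y l
    shorten nil = 0 , z≤n , trivial _
    shorten (step {x = x} {e = e} x∈e y∈e W) with shorten W
    ... | l , l≤n , P with from-vertex x P
    ... | inj₁ (l′ , l′≤l , Q) = l′ , ℕ.m≤n⇒m≤1+n (ℕ.≤-trans l′≤l l≤n) , Q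
    ... | inj₂ x∉ with past-edge x e y∈e P x∉
    ... | l′ , l′≤l , y′ , y′∈e , Q , x∉′ , e∉ = suc l′ , s≤s (ℕ.≤-trans l′≤l l≤n) , cons x∈e y′∈e Q x∉′
        e∉

    -- The index counts edges. `_++ᶜ_` identifies the last edge of one chain with the first of the
    -- next, so the edge in the middle is counted once.
    data Chain : ℕ → Edge H → Edge H → Set where
      [_]   : ∀ e → Chain 1 e e
      _,_∷_ : ∀ {n e f g v} → v ∈ edge H e → v ∈ edge H f → Chain n f g → Chain (suc n) e g

    chain⇒walk : ∀ {n e f x y} → x ∈ edge H e → y ∈ edge H f → Chain n e f → Walk n x y
    chain⇒walk x∈e y∈e [ e ]          = step x∈e y∈e nil
    chain⇒walk x∈e y∈g (p , q ∷ C) = step x∈e p (chain⇒walk q y∈g C)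

    _++ᶜ_ : ∀ {m n e f g} → Chain (suc m) e f → Chain n f g → Chain (m + n) e g
    _++ᶜ_ {zero}  [ e ]         C′ = C′
    _++ᶜ_ {suc m} (p , q ∷ C) C′ = p , q ∷ (C ++ᶜ C′)

    module Geodesic {x y d} (P : Path H x y d) (minimal : ∀ l → Path H x y l → d ≤ l) where

      walk-length : ∀ {n} → Walk n x y → d ≤ n
      walk-length W with shorten W
      ... | l , l≤n , Q = ℕ.≤-trans (minimal l Q) l≤n

      -- Replacing the part of P from link a to link b by the chain yields a walk
      -- from x to y, which is not shorter than P.
      chain-length : ∀ {n} a b → Chain n (link P a) (link P b) → toℕ b < toℕ a + n
      chain-length {n} a b C = ℕ.+-cancelʳ-≤ (d ∸ suc (toℕ b)) (suc (toℕ b)) (toℕ a + n) (begin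
        suc (toℕ b) + (d ∸ suc (toℕ b))           ≡⟨ ℕ.m+[n∸m]≡n (Fin.toℕ<n b) ⟩
        d                                         ≤⟨ walk-length
            (prefix P (inject₁ a) ++ʷ (chain⇒walk (proj₁ (incident P a)) (proj₂ (incident P b)) C ++ʷ
            suffix P (suc b))) ⟩
        toℕ (inject₁ a) + (n + (d ∸ suc (toℕ b))) ≡⟨ cong (_+ (n + (d ∸ suc (toℕ b))))
            (Fin.toℕ-inject₁ a) ⟩
        toℕ a + (n + (d ∸ suc (toℕ b)))           ≡⟨ ℕ.+-assoc (toℕ a) n _ ⟨
        toℕ a + n + (d ∸ suc (toℕ b))             ∎)
        where open ℕ.≤-Reasoning

-- Absence of short cycles

module LinearAcyclic where

  open import Data.Fin.Subset using (_∈_; _∩_; ⁅_⁆; Empty)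
  open import Data.Fin.Subset.Properties using (x∈p∩q⁺; x∈p∩q⁻; x∈⁅x⁆; x∈⁅y⁆⇒x≡y; ⊆-antisym)
  open import Data.Nat.Base using (s≤s; z≤n)
  open import Data.Vec.Base using (Vec; []; _∷_; lookup)
  open import Data.Vec.Relation.Unary.All using ([]; _∷_)
  open import Data.Vec.Relation.Unary.AllPairs using ([]; _∷_)
  open import Data.Vec.Relation.Unary.Unique.Propositional using (Unique)
  open import Data.Vec.Relation.Unary.Unique.Propositional.Properties using (lookup-injective)

  open import Defs
  open Adjacencies

  -- Lets `consecutive` be checked for one successor of each index instead of for all pairs.
  cyclicSuc-unique : ∀ {l} {i j k : Fin l} → CyclicSuc i j → CyclicSuc i k → j ≡ k
  cyclicSuc-unique (inj₁ p)       (inj₁ q)       = Fin.toℕ-injective (trans p (sym q))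
  cyclicSuc-unique (inj₂ (_ , p)) (inj₂ (_ , q)) = Fin.toℕ-injective (trans p (sym q))
  cyclicSuc-unique {j = j} (inj₁ p) (inj₂ (q , _)) = contradiction (trans p q) (ℕ.<⇒≢ (Fin.toℕ<n j))
  cyclicSuc-unique {k = k} (inj₂ (p , _)) (inj₁ q) = contradiction (trans q p) (ℕ.<⇒≢ (Fin.toℕ<n k))

  module ShortCycles (H : Hypergraph) (linear : Linear H) (acyclic : ∀ l → ¬ LooseCycle H l) where

    open Incidence H

    same-edge : ∀ {e f v w} → v ≢ w → v ∈ᵉ e → w ∈ᵉ e → v ∈ᵉ f → w ∈ᵉ f → e ≡ f
    same-edge = linear-unique linear

    same-vertex : ∀ {e f v w} → e ≢ f → v ∈ᵉ e → w ∈ᵉ e → v ∈ᵉ f → w ∈ᵉ f → v ≡ w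
    same-vertex {v = v} {w} e≢f ve we vf wf with v Fin.≟ w
    ... | yes v≡w = v≡w
    ... | no v≢w  = contradiction (same-edge v≢w ve we vf wf) e≢f

    private
      meet : ∀ {e f v} → e ≢ f → v ∈ᵉ e → v ∈ᵉ f → edge H e ∩ edge H f ≡ ⁅ v ⁆
      meet {e} {f} {v} e≢f ve vf = ⊆-antisym
        (λ w∈ → let we , wf = x∈p∩q⁻ (edge H e) (edge H f) w∈ in
          subst (_∈ ⁅ v ⁆) (same-vertex e≢f ve we vf wf) (x∈⁅x⁆ v))
        (λ w∈ → subst (_∈ edge H e ∩ edge H f) (sym (x∈⁅y⁆⇒x≡y v w∈)) (x∈p∩q⁺ (ve , vf)))

    -- One pair of distinct meeting vertices is enough: by linearity, a coincidence of `w` with `u`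
    -- or `v` would identify two of the edges, so the three edges form a loose cycle.
    no-triangle : ∀ {e f g u v w} → e ≢ f → f ≢ g → g ≢ e → u ∈ᵉ e → u ∈ᵉ f → v ∈ᵉ f → v ∈ᵉ g → w ∈ᵉ g →
        w ∈ᵉ e →
                  u ≢ v → ⊥
    no-triangle {e} {f} {g} {u} {v} {w} e≢f f≢g g≢e ue uf vf vg wg we u≢v = acyclic 3 record
      { vertex = lookup vs
      ; link = lookup es
      ; 3≤length = s≤s (s≤s (s≤s z≤n))
      ; vertices-distinct = λ {i} {j} → lookup-injective vs-unique i j
      ; edges-distinct = λ {i} {j} → lookup-injective es-unique i j
      ; consecutive = λ i j → es-consecutive i j
      ; non-consecutive = λ i j i≢j p q → contradiction (adjacent i j i≢j) λ
          { (inj₁ h) → p h ; (inj₂ h) → q h }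
      }
      where
      v≢w : v ≢ w
      v≢w refl = e≢f (same-edge u≢v ue we uf vf)
      w≢u : w ≢ u
      w≢u refl = f≢g (same-edge (u≢v ∘ sym) vf uf vg wg)
      vs : Vec (Vertex H) 3
      vs = w ∷ u ∷ v ∷ []
      es : Vec (Edge H) 3
      es = e ∷ f ∷ g ∷ []
      vs-unique : Unique vs
      vs-unique = (w≢u ∷ (v≢w ∘ sym) ∷ []) ∷ (u≢v ∷ []) ∷ [] ∷ []
      es-unique : Unique es
      es-unique = (e≢f ∷ (g≢e ∘ sym) ∷ []) ∷ (f≢g ∷ []) ∷ [] ∷ []
      es-consecutive : ∀ i j → CyclicSuc i j → edge H (lookup es i) ∩ edge H (lookup es j) ≡ ⁅ lookup vs
          j ⁆
      es-consecutive zero             j h with refl ← cyclicSuc-unique {k = suc zero} h (inj₁ refl)       = meet e≢f ue uf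
      es-consecutive (suc zero)       j h with refl ← cyclicSuc-unique {k = suc (suc zero)} h (inj₁ refl) = meet f≢g vf vg
      es-consecutive (suc (suc zero)) j h with refl ← cyclicSuc-unique {k = zero} h (inj₂ (refl , refl))  = meet g≢e wg we
      adjacent : ∀ i j → i ≢ j → CyclicSuc i j ⊎ CyclicSuc j i
      adjacent zero             zero             i≢j = contradiction refl i≢j
      adjacent zero             (suc zero)       _   = inj₁ (inj₁ refl)
      adjacent zero             (suc (suc zero)) _   = inj₂ (inj₂ (refl , refl))
      adjacent (suc zero)       zero             _   = inj₂ (inj₁ refl)
      adjacent (suc zero)       (suc zero)       i≢j = contradiction refl i≢j
      adjacent (suc zero)       (suc (suc zero)) _   = inj₁ (inj₁ refl)
      adjacent (suc (suc zero)) zero             _   = inj₁ (inj₂ (refl , refl))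
      adjacent (suc (suc zero)) (suc zero)       _   = inj₂ (inj₁ refl)
      adjacent (suc (suc zero)) (suc (suc zero)) i≢j = contradiction refl i≢j

    private
      opposite-disjoint : ∀ {e f g u v} → e ≢ f → f ≢ g → g ≢ e → u ∈ᵉ e → u ∈ᵉ f → v ∈ᵉ f → v ∈ᵉ g → u
          ≢ v →
                          Empty (edge H e ∩ edge H g)
      opposite-disjoint {e} {f} {g} e≢f f≢g g≢e ue uf vf vg u≢v (p , p∈) =
        let pe , pg = x∈p∩q⁻ (edge H e) (edge H g) p∈ in no-triangle e≢f f≢g g≢e ue uf vf vg pg pe u≢v

      swap-empty : ∀ {e f} → Empty (edge H e ∩ edge H f) → Empty (edge H f ∩ edge H e)
      swap-empty {e} {f} h (p , p∈) = let pf , pe = x∈p∩q⁻ (edge H f) (edge H e) p∈ in h (p , x∈p∩q⁺ (pe , pf))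

    -- Opposite edges are disjoint, since a common vertex would close a triangle; disjointness also
    -- separates the meeting vertices that are not assumed distinct.
    no-square : ∀ {e f g h u v w t} → e ≢ f → f ≢ g → g ≢ h → h ≢ e → e ≢ g → f ≢ h →
                u ∈ᵉ e → u ∈ᵉ f → v ∈ᵉ f → v ∈ᵉ g → w ∈ᵉ g → w ∈ᵉ h → t ∈ᵉ h → t ∈ᵉ e →
                u ≢ v → v ≢ w → ⊥
    no-square {e} {f} {g} {h} {u} {v} {w} {t} e≢f f≢g g≢h h≢e e≢g f≢h ue uf vf vg wg wh th te u≢v v≢w =
        acyclic 4 record
      { vertex = lookup vs
      ; link = lookup es
      ; 3≤length = s≤s (s≤s (s≤s z≤n))
      ; vertices-distinct = λ {i} {j} → lookup-injective vs-unique i j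
      ; edges-distinct = λ {i} {j} → lookup-injective es-unique i j
      ; consecutive = λ i j → es-consecutive i j
      ; non-consecutive = λ i j → es-non-consecutive i j
      }
      where
      e∩g : Empty (edge H e ∩ edge H g)
      e∩g = opposite-disjoint e≢f f≢g (e≢g ∘ sym) ue uf vf vg u≢v
      f∩h : Empty (edge H f ∩ edge H h)
      f∩h = opposite-disjoint f≢g g≢h (f≢h ∘ sym) vf vg wg wh v≢w
      u≢w : u ≢ w
      u≢w refl = e∩g (u , x∈p∩q⁺ (ue , wg))
      v≢t : v ≢ t
      v≢t refl = e∩g (v , x∈p∩q⁺ (te , vg))
      u≢t : u ≢ t
      u≢t refl = f∩h (u , x∈p∩q⁺ (uf , th))
      w≢t : w ≢ t
      w≢t refl = e∩g (w , x∈p∩q⁺ (te , wg))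
      vs : Vec (Vertex H) 4
      vs = t ∷ u ∷ v ∷ w ∷ []
      es : Vec (Edge H) 4
      es = e ∷ f ∷ g ∷ h ∷ []
      vs-unique : Unique vs
      vs-unique = ((u≢t ∘ sym) ∷ (v≢t ∘ sym) ∷ (w≢t ∘ sym) ∷ []) ∷ (u≢v ∷ u≢w ∷ []) ∷ (v≢w ∷ []) ∷ [] ∷
          []
      es-unique : Unique es
      es-unique = (e≢f ∷ e≢g ∷ (h≢e ∘ sym) ∷ []) ∷ (f≢g ∷ f≢h ∷ []) ∷ (g≢h ∷ []) ∷ [] ∷ []
      es-consecutive : ∀ i j → CyclicSuc i j → edge H (lookup es i) ∩ edge H (lookup es j) ≡ ⁅ lookup vs
          j ⁆
      es-consecutive zero                   j p with refl ← cyclicSuc-unique {k = suc zero} p (inj₁ refl)             = meet e≢f ue uf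
      es-consecutive (suc zero)             j p with refl ← cyclicSuc-unique {k = suc (suc zero)} p (inj₁ refl)       = meet f≢g vf vg
      es-consecutive (suc (suc zero))       j p with refl ← cyclicSuc-unique {k = suc (suc (suc zero))} p (inj₁ refl) = meet g≢h wg wh
      es-consecutive (suc (suc (suc zero))) j p with refl ← cyclicSuc-unique {k = zero} p (inj₂ (refl , refl))        = meet h≢e th te
      es-non-consecutive : ∀ i j → i ≢ j → ¬ CyclicSuc i j → ¬ CyclicSuc j i → Empty
          (edge H (lookup es i) ∩ edge H (lookup es j))
      es-non-consecutive zero                   (suc (suc zero))       _   _ _ = e∩g
      es-non-consecutive (suc zero)             (suc (suc (suc zero))) _   _ _ = f∩h
      es-non-consecutive (suc (suc zero))       zero                   _   _ _ = swap-empty e∩g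
      es-non-consecutive (suc (suc (suc zero))) (suc zero)             _   _ _ = swap-empty f∩h
      es-non-consecutive zero                   zero                   i≢j _ _ = contradiction refl i≢j
      es-non-consecutive (suc zero)             (suc zero)             i≢j _ _ = contradiction refl i≢j
      es-non-consecutive (suc (suc zero))       (suc (suc zero))       i≢j _ _ = contradiction refl i≢j
      es-non-consecutive (suc (suc (suc zero))) (suc (suc (suc zero))) i≢j _ _ = contradiction refl i≢j
      es-non-consecutive zero                   (suc zero)             _   p _ = contradiction
          (inj₁ refl) p
      es-non-consecutive (suc zero)             (suc (suc zero))       _   p _ = contradiction
          (inj₁ refl) p
      es-non-consecutive (suc (suc zero))       (suc (suc (suc zero))) _   p _ = contradiction
          (inj₁ refl) p
      es-non-consecutive (suc (suc (suc zero))) zero                   _   p _ = contradiction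
          (inj₂ (refl , refl)) p
      es-non-consecutive (suc zero)             zero                   _   _ q = contradiction
          (inj₁ refl) q
      es-non-consecutive (suc (suc zero))       (suc zero)             _   _ q = contradiction
          (inj₁ refl) q
      es-non-consecutive (suc (suc (suc zero))) (suc (suc zero))       _   _ q = contradiction
          (inj₁ refl) q
      es-non-consecutive zero                   (suc (suc (suc zero))) _   _ q = contradiction
          (inj₂ (refl , refl)) q

    Meets : Edge H → Edge H → Vertex H → Set
    Meets e g v = v ∈ᵉ e × v ∈ᵉ g × g ≢ e

    -- The conditions `v ≢ z` and `g ≢ f` exclude routes that turn back, so that each edge two steps
    -- away has a single route.
    Meets² : Edge H → Edge H → Vertex H → Edge H → Vertex H → Set
    Meets² e g v f z = Meets e f v × z ∈ᵉ f × v ≢ z × z ∈ᵉ g × g ≢ f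

    meets²⇒≢ : ∀ {e g v f z} → Meets² e g v f z → g ≢ e
    meets²⇒≢ ((ve , vf , f≢e) , zf , v≢z , zg , _) refl = f≢e (same-edge v≢z vf zf ve zg)

    meets-unique : ∀ {e g v w} → Meets e g v → Meets e g w → v ≡ w
    meets-unique (ve , vg , g≢e) (we , wg , _) = same-vertex (g≢e ∘ sym) ve we vg wg

    meets-meets² : ∀ {e g w v f z} → Meets e g w → Meets² e g v f z → ⊥
    meets-meets² {w = w} {v} (we , wg , g≢e) ((ve , vf , f≢e) , zf , v≢z , zg , g≢f) =
      no-triangle (f≢e ∘ sym) (g≢f ∘ sym) g≢e ve vf zf zg wg we v≢z

    -- Routes through different middle edges would close a loose cycle: a triangle if they share one
    -- of their joints, a square if they share none. Sharing both contradicts linearity.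
    meets²-unique : ∀ {e g v f z v′ f′ z′} → Meets² e g v f z → Meets² e g v′ f′ z′ → v ≡ v′ × f ≡ f′ ×
        z ≡ z′
    meets²-unique {e} {g} {v} {f} {z} {v′} {f′} {z′}
      M@((ve , vf , f≢e) , zf , v≢z , zg , g≢f) M′@((v′e , v′f′ , f′≢e) , z′f′ , v′≢z′ , z′g , g≢f′)
      with f Fin.≟ f′
    ... | yes refl = same-vertex (f≢e ∘ sym) ve v′e vf v′f′ , refl , same-vertex (g≢f ∘ sym) zf z′f′ zg
        z′g
    ... | no f≢f′ with v Fin.≟ v′ | z Fin.≟ z′
    ...   | yes refl | yes refl = contradiction (same-edge v≢z vf zf v′f′ z′f′) f≢f′
    ...   | no v≢v′  | yes refl = contradiction (no-triangle (f≢e ∘ sym) f≢f′ f′≢e ve vf zf z′f′ v′f′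
        v′e v≢z) λ ()
    ...   | yes refl | no z≢z′  = contradiction (no-triangle (g≢f ∘ sym) g≢f′ (f≢f′ ∘ sym) zf zg z′g
        z′f′ v′f′ vf z≢z′) λ ()
    ...   | no v≢v′  | no z≢z′  = contradiction (no-square (f≢e ∘ sym) (g≢f ∘ sym) g≢f′ f′≢e
        (meets²⇒≢ M ∘ sym) f≢f′
                                    ve vf zf zg z′g z′f′ v′f′ v′e v≢z z≢z′) λ ()

-- Counting edges near a vertex or an edge by means of a geodesic

module LocalCounts where

  open import Data.Rational.Base using (ℚ; 0ℚ; 1ℚ; _+_; _*_; _-_; -_; _≤_; _<_)
  open import Data.Rational.Properties hiding (_≟_)
  open +-*-Solver using (solve; con; _:=_; _:+_; _:*_; _:-_; :-_)

  open import Defs hiding (sum)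
  open Rationals
  open FiniteSums
  open Adjacencies
  open Walks
  open LinearAcyclic

  record Unit (p : ℚ) : Set where
    constructor _,_
    field
      0≤ : 0ℚ ≤ p
      ≤1 : p ≤ 1ℚ
  open Unit

  unit-* : ∀ {p q} → Unit p → Unit q → Unit (p * q)
  unit-* (0≤p , p≤1) (0≤q , q≤1) = 0≤-* 0≤p 0≤q , *-mono 0≤p 0≤1 p≤1 q≤1

  unit-I : ∀ b → Unit (I b)
  unit-I b = 0≤I b , I≤1 b

  unit-complement : ∀ {p} → Unit p → Unit (1ℚ - p)
  unit-complement {p} (0≤p , p≤1) = ≤⇒0≤- p≤1 , ≤-by (cancel p) 0≤p
    where
    cancel = solve 1 (λ a → (con 1ℚ) :- (con 1ℚ :- a) := a) refl

  0<*⇒ : ∀ {p q} → 0ℚ ≤ p → 0ℚ ≤ q → 0ℚ < p * q → 0ℚ < p × 0ℚ < q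
  0<*⇒ {p} {q} 0≤p 0≤q h = 0<-cancelˡ q 0≤q (subst (0ℚ <_) (*-comm p q) h) , 0<-cancelˡ p 0≤p h

  module _ {n} {f : Fin n → ℚ} (unit : ∀ i → Unit (f i)) (unique : ∀ i j → 0ℚ < f i → 0ℚ < f j → i ≡ j) where

    unit-sum : Unit (sum f)
    unit-sum = 0≤sum (0≤ ∘ unit) , sum≤1 (exclusive (0≤ ∘ unit) (≤1 ∘ unit) unique)

  sum-below : ∀ {d} (f : Fin d → ℚ) n → (∀ i → Unit (f i)) → (∀ i → 0ℚ < f i → toℕ i ℕ.< n) → sum f ≤ ι
      n
  sum-below {zero}  f n       unit below = 0≤ι n
  sum-below {suc d} f zero    unit below = ≤-reflexive
      (sum-zero (λ i → ≤-antisym (≮⇒≥ (λ h → ℕ.n≮0 (below i h))) (0≤ (unit i))))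
  sum-below {suc d} f (suc n) unit below = +-mono-≤ (≤1 (unit zero))
      (sum-below (f ∘ suc) n (unit ∘ suc) (λ i h → ℕ.s≤s⁻¹ (below (suc i) h)))

  -- Entries before the first positive one vanish, and that one confines all positive entries to the
  -- `n` positions beginning with it.
  sum-window : ∀ {d} (f : Fin d → ℚ) n → (∀ i → Unit (f i)) →
               (∀ i j → 0ℚ < f i → 0ℚ < f j → toℕ j ℕ.< toℕ i ℕ.+ n) → sum f ≤ ι n
  sum-window {zero}  f n unit window = 0≤ι n
  sum-window {suc d} f n unit window with 0ℚ <? f zero
  ... | yes 0<f₀ = sum-below f n unit (λ i h → window zero i 0<f₀ h)
  ... | no 0≮f₀  = subst (_≤ ι n) (sym (trans (cong (_+ sum (f ∘ suc))
      (≤-antisym (≮⇒≥ 0≮f₀) (0≤ (unit zero)))) (+-identityˡ _)))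
                     (sum-window (f ∘ suc) n (unit ∘ suc) (λ i j p q → ℕ.s≤s⁻¹
                         (window (suc i) (suc j) p q)))

  module PathCount (H : Hypergraph) {d} (link : Fin d → Edge H) (link-injective : ∀ {i j} → link i ≡ link j → i ≡ j) where

    -- Edges outside the listed family contribute at most 1 each. The count goes through 1 - f, so
    -- that the complement of the family need not be enumerated.
    sum-off-path : ∀ (f : Edge H → ℚ) → (∀ e → Unit (f e)) → sum f ≤ (ι (size H) - ι d) + sum (f ∘ link)
    sum-off-path f unit = ≤-by (regroup (ι (size H)) (ι d) (sum (f ∘ link)) (sum f)) (≤⇒0≤- (begin
      ι d - sum (f ∘ link)                       ≡⟨ cong (_- sum (f ∘ link))
          (trans (sum-const d 1ℚ) (*-identityʳ (ι d))) ⟨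
      sum {d} (λ _ → 1ℚ) - sum (f ∘ link)        ≡⟨ ∑-distrib-- (λ _ → 1ℚ) (f ∘ link) ⟨
      sum (λ a → 1ℚ - f (link a))                ≤⟨ sum-injective {f = λ e → 1ℚ - f e} link
          link-injective (λ e → ≤⇒0≤- (≤1 (unit e))) ⟩
      sum (λ e → 1ℚ - f e)                       ≡⟨ ∑-distrib-- (λ _ → 1ℚ) f ⟩
      sum {size H} (λ _ → 1ℚ) - sum f            ≡⟨ cong (_- sum f)
          (trans (sum-const (size H) 1ℚ) (*-identityʳ (ι (size H)))) ⟩
      ι (size H) - sum f                         ∎))
      where
      open ≤-Reasoning
      regroup = solve 4 (λ k d p s → ((k :- d) :+ p) :- s := (k :- s) :- (d :- p)) refl

  module Ball (H : Hypergraph) (linear : Linear H) (acyclic : ∀ l → ¬ LooseCycle H l) where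

    open Incidence H
    open ShortCycles H linear acyclic

    apart : ∀ {n} → Fin n → Fin n → ℚ
    apart i j = 1ℚ - ⟦ i Fin.≟ j ⟧

    unit-apart : ∀ {n} (i j : Fin n) → Unit (apart i j)
    unit-apart i j = unit-complement (unit-I (does (i Fin.≟ j)))

    0<apart : ∀ {n} {i j : Fin n} → 0ℚ < apart i j → i ≢ j
    0<apart {i = i} {j} h i≡j = <-irrefl refl (subst (λ p → 0ℚ < 1ℚ - p) (⟦⟧-yes (i Fin.≟ j) i≡j) h)

    unit-χ : ∀ e v → Unit (χ e v)
    unit-χ e v = 0≤χ e v , χ≤1 e v

    private
      spread = solve 2 (λ a p → a :* (con 1ℚ :- p) := a :- p :* a) refl

    sum-apart : ∀ {n} (i : Fin n) (f : Fin n → ℚ) → sum (λ j → f j * apart j i) ≡ sum f - f i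
    sum-apart i f = trans (sum-cong-≗ (λ j → spread (f j) ⟦ j Fin.≟ i ⟧))
      (trans (∑-distrib-- f (λ j → ⟦ j Fin.≟ i ⟧ * f j)) (cong (λ h → sum f - h)
        (trans (sum-single i (λ j j≢i → ≡0⇒*≡0 (⟦⟧-no (j Fin.≟ i) j≢i) (f j)))
            (≡1⇒*≡ (⟦⟧-yes (i Fin.≟ i) refl) (f i)))))

    sum-χ-apart : ∀ {v e} → v ∈ᵉ e → sum (λ g → χ g v * apart g e) ≡ deg v - 1ℚ
    sum-χ-apart {v} {e} v∈e = trans (sum-apart e (λ g → χ g v))
        (cong₂ _-_ (sym (deg≡sum v)) (∈⇒χ≡1 v∈e))

    -- Counts the pairs of a vertex of `f` other than `v` and a further edge through that vertex.
    excess : Vertex H → Edge H → ℚ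
    excess v f = sum (λ z → (χ f z * apart z v) * (deg z - 1ℚ))

    -- Counts the routes from `e` through `v` to an edge two steps away; for `v` on `e`, such edges
    -- have only one route by `meets²-unique`.
    beyond : Edge H → Vertex H → ℚ
    beyond e v = sum (λ f → (χ f v * apart f e) * excess v f)

    module Near (e : Edge H) where

      meets : Edge H → Vertex H → ℚ
      meets g v = χ e v * (χ g v * apart g e)

      meets² : Edge H → Vertex H → Edge H → Vertex H → ℚ
      meets² g v f z = meets f v * ((χ f z * apart z v) * (χ g z * apart g f))

      unit-meets : ∀ g v → Unit (meets g v)
      unit-meets g v = unit-* (unit-χ e v) (unit-* (unit-χ g v) (unit-apart g e))

      unit-meets² : ∀ g v f z → Unit (meets² g v f z)
      unit-meets² g v f z = unit-* (unit-meets f v)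
          (unit-* (unit-* (unit-χ f z) (unit-apart z v)) (unit-* (unit-χ g z) (unit-apart g f)))

      0<meets : ∀ {g v} → 0ℚ < meets g v → Meets e g v
      0<meets {g} {v} h =
        let p , q = 0<*⇒ (0≤χ e v) (0≤ (unit-* (unit-χ g v) (unit-apart g e))) h
            q₁ , q₂ = 0<*⇒ (0≤χ g v) (0≤ (unit-apart g e)) q
        in 0<χ⇒∈ p , 0<χ⇒∈ q₁ , 0<apart q₂

      0<meets² : ∀ {g v f z} → 0ℚ < meets² g v f z → Meets² e g v f z
      0<meets² {g} {v} {f} {z} h =
        let u₁ = unit-* (unit-χ f z) (unit-apart z v)
            u₂ = unit-* (unit-χ g z) (unit-apart g f)
            p , q = 0<*⇒ (0≤ (unit-meets f v)) (0≤ (unit-* u₁ u₂)) h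
            q₁ , q₂ = 0<*⇒ (0≤ u₁) (0≤ u₂) q
            a , b = 0<*⇒ (0≤χ f z) (0≤ (unit-apart z v)) q₁
            c , d = 0<*⇒ (0≤χ g z) (0≤ (unit-apart g f)) q₂
        in 0<meets p , 0<χ⇒∈ a , (λ v≡z → 0<apart b (sym v≡z)) , 0<χ⇒∈ c , 0<apart d

      -- Indicators for `g` being 0, 1 or 2 steps from `e`, written as sums over all witnesses. They
      -- stay below 1 because the witnesses are unique, and they exclude each other because there
      -- are no triangles.
      level : Edge H → Fin 3 → ℚ
      level g zero             = ⟦ g Fin.≟ e ⟧
      level g (suc zero)       = sum (λ v → meets g v)
      level g (suc (suc zero)) = sum (λ v → sum (λ f → sum (λ z → meets² g v f z)))

      near : Edge H → ℚ
      near g = sum (level g)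

      private
        0<level₁ : ∀ g → 0ℚ < level g (suc zero) → ∃ λ v → Meets e g v
        0<level₁ g h = let v , h₁ = 0<sum⇒∃ {f = λ v → meets g v} h in v , 0<meets h₁

        0<sum-z : ∀ g v f → 0ℚ < sum (λ z → meets² g v f z) → ∃ λ z → Meets² e g v f z
        0<sum-z g v f h = let z , h₁ = 0<sum⇒∃ {f = λ z → meets² g v f z} h in z , 0<meets² h₁

        0<sum-fz : ∀ g v → 0ℚ < sum (λ f → sum (λ z → meets² g v f z)) → ∃ λ f → ∃ λ z → Meets² e g v f
            z
        0<sum-fz g v h = let f , h₁ = 0<sum⇒∃ {f = λ f → sum (λ z → meets² g v f z)} h in f , 0<sum-z g v f h₁

        0<level₂ : ∀ g → 0ℚ < level g (suc (suc zero)) → ∃ λ v → ∃ λ f → ∃ λ z → Meets² e g v f z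
        0<level₂ g h = let v , h₁ = 0<sum⇒∃ {f = λ v → sum (λ f → sum (λ z → meets² g v f z))} h in v , 0<sum-fz g v h₁

        unit-level : ∀ g i → Unit (level g i)
        unit-level g zero       = unit-I (does (g Fin.≟ e))
        unit-level g (suc zero) = unit-sum (unit-meets g)
            (λ v w p q → meets-unique (0<meets p) (0<meets q))
        unit-level g (suc (suc zero)) = unit-sum
          (λ v → unit-sum
            (λ f → unit-sum (unit-meets² g v f)
              (λ z z′ p q → proj₂ (proj₂ (meets²-unique (0<meets² p) (0<meets² q)))))
            (λ f f′ p q → proj₁ (proj₂ (meets²-unique (proj₂ (0<sum-z g v f p))
                (proj₂ (0<sum-z g v f′ q))))))
          (λ v v′ p q → proj₁ (meets²-unique (proj₂ (proj₂ (0<sum-fz g v p)))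
              (proj₂ (proj₂ (0<sum-fz g v′ q)))))

        level-unique : ∀ g i j → 0ℚ < level g i → 0ℚ < level g j → i ≡ j
        level-unique g zero             zero             _ _ = refl
        level-unique g (suc zero)       (suc zero)       _ _ = refl
        level-unique g (suc (suc zero)) (suc (suc zero)) _ _ = refl
        level-unique g zero             (suc zero)       p q = contradiction (0<⟦⟧ (g Fin.≟ e) p)
            (proj₂ (proj₂ (proj₂ (0<level₁ g q))))
        level-unique g (suc zero)       zero             q p = contradiction (0<⟦⟧ (g Fin.≟ e) p)
            (proj₂ (proj₂ (proj₂ (0<level₁ g q))))
        level-unique g zero             (suc (suc zero)) p q = let _ , _ , _ , M = 0<level₂ g q in contradiction (0<⟦⟧ (g Fin.≟ e) p) (meets²⇒≢ M)
        level-unique g (suc (suc zero)) zero             q p = let _ , _ , _ , M = 0<level₂ g q in contradiction (0<⟦⟧ (g Fin.≟ e) p) (meets²⇒≢ M)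
        level-unique g (suc zero)       (suc (suc zero)) p q = let _ , M = 0<level₁ g p ; _ , _ , _ , M′ = 0<level₂ g q in contradiction (meets-meets² M M′) λ ()
        level-unique g (suc (suc zero)) (suc zero)       q p = let _ , M = 0<level₁ g p ; _ , _ , _ , M′ = 0<level₂ g q in contradiction (meets-meets² M M′) λ ()

      unit-near : ∀ g → Unit (near g)
      unit-near g = unit-sum (unit-level g) (level-unique g)

      near⇒chain : ∀ g → 0ℚ < near g → ∃ λ n → n ℕ.≤ 2 × Chain {H} (suc n) g e × Chain {H} (suc n) e g
      near⇒chain g h with 0<sum⇒∃ {f = level g} h
      ... | zero , p with 0<⟦⟧ (g Fin.≟ e) p
      ...   | refl = 0 , ℕ.z≤n , [ g ] , [ g ]
      near⇒chain g h | suc zero , p = let v , ve , vg , _ = 0<level₁ g p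
        in 1 , ℕ.s≤s ℕ.z≤n , (vg , ve ∷ [ e ]) , (ve , vg ∷ [ g ])
      near⇒chain g h | suc (suc zero) , p = let v , f , z , (ve , vf , _) , zf , _ , zg , _ = 0<level₂ g p
        in 2 , ℕ.≤-refl , (zg , zf ∷ (vf , ve ∷ [ e ])) , (ve , vf ∷ (zf , zg ∷ [ g ]))

      -- Exchange of sums: with all other witnesses fixed, the last edge of a route ranges over the
      -- other edges at one vertex, of which there are deg - 1.
      sum-near : sum near ≡ (1ℚ + sum (λ v → χ e v * (deg v - 1ℚ))) + sum (λ v → χ e v * beyond e v)
      sum-near = begin
        sum near
          ≡⟨ sum-cong-≗ (λ g → regroup (level g zero) (level g (suc zero)) (level g (suc (suc zero)))) ⟩
        sum (λ g → (level g zero + level g (suc zero)) + level g (suc (suc zero)))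
          ≡⟨ trans (∑-distrib-+ (λ g → level g zero + level g (suc zero))
              (λ g → level g (suc (suc zero))))
               (cong (_+ sum (λ g → level g (suc (suc zero))))
                   (∑-distrib-+ (λ g → level g zero) (λ g → level g (suc zero)))) ⟩
        (sum (λ g → level g zero) + sum (λ g → level g (suc zero))) + sum
            (λ g → level g (suc (suc zero)))
          ≡⟨ cong₂ _+_ (cong₂ _+_ level₀ level₁) level₂ ⟩
        (1ℚ + sum (λ v → χ e v * (deg v - 1ℚ))) + sum (λ v → χ e v * beyond e v) ∎
        where
        open ≡-Reasoning
        regroup = solve 3 (λ a b c → a :+ (b :+ (c :+ con 0ℚ)) := (a :+ b) :+ c) refl
        level₀ : sum (λ g → level g zero) ≡ 1ℚ
        level₀ = trans (sum-single e (λ g g≢e → ⟦⟧-no (g Fin.≟ e) g≢e)) (⟦⟧-yes (e Fin.≟ e) refl)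
        level₁ : sum (λ g → level g (suc zero)) ≡ sum (λ v → χ e v * (deg v - 1ℚ))
        level₁ = trans (∑-comm meets) (sum-cong-≗ (λ v → trans
            (sym (*-distribˡ-sum (χ e v) (λ g → χ g v * apart g e))) (χ-cong sum-χ-apart)))
        last-step : ∀ v f z → sum (λ g → meets² g v f z) ≡ meets f v *
            ((χ f z * apart z v) * (deg z - 1ℚ))
        last-step v f z = trans (sym (*-distribˡ-sum (meets f v)
            (λ g → (χ f z * apart z v) * (χ g z * apart g f)))) (cong (meets f v *_)
          (trans (sym (*-distribˡ-sum (χ f z * apart z v) (λ g → χ g z * apart g f)))
            (trans (swap (χ f z) (apart z v) _) (trans
                (χ-cong (λ z∈f → cong (apart z v *_) (sum-χ-apart z∈f)))
                (sym (swap (χ f z) (apart z v) _))))))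
          where
          swap = solve 3 (λ a b c → (a :* b) :* c := a :* (b :* c)) refl
        level₂ : sum (λ g → level g (suc (suc zero))) ≡ sum (λ v → χ e v * beyond e v)
        level₂ = begin
          sum (λ g → sum (λ v → sum (λ f → sum (λ z → meets² g v f z))))
            ≡⟨ ∑-comm (λ g v → sum (λ f → sum (λ z → meets² g v f z))) ⟩
          sum (λ v → sum (λ g → sum (λ f → sum (λ z → meets² g v f z))))
            ≡⟨ sum-cong-≗ (λ v → ∑-comm (λ g f → sum (λ z → meets² g v f z))) ⟩
          sum (λ v → sum (λ f → sum (λ g → sum (λ z → meets² g v f z))))
            ≡⟨ sum-cong-≗ (λ v → sum-cong-≗ (λ f → trans (∑-comm (λ g z → meets² g v f z))
                (sum-cong-≗ (last-step v f)))) ⟩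
          sum (λ v → sum (λ f → sum (λ z → meets f v * ((χ f z * apart z v) * (deg z - 1ℚ)))))
            ≡⟨ sum-cong-≗ (λ v → sum-cong-≗ (λ f → sym
                (*-distribˡ-sum (meets f v) (λ z → (χ f z * apart z v) * (deg z - 1ℚ))))) ⟩
          sum (λ v → sum (λ f → (χ e v * (χ f v * apart f e)) * excess v f))
            ≡⟨ sum-cong-≗ (λ v → trans (sum-cong-≗ (λ f → *-assoc (χ e v) (χ f v * apart f e)
                (excess v f)))
                 (sym (*-distribˡ-sum (χ e v) (λ f → (χ f v * apart f e) * excess v f)))) ⟩
          sum (λ v → χ e v * beyond e v) ∎

  module Bounds (H : Hypergraph) (linear : Linear H) (acyclic : ∀ l → ¬ LooseCycle H l)
    {x y d} (P : Path H x y d) (minimal : ∀ l → Path H x y l → d ℕ.≤ l) where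

    open Incidence H
    open Ball H linear acyclic
    open Path P
    open Geodesic P minimal
    open PathCount H link edges-distinct

    degree-bound : ∀ v → deg v ≤ (ι (size H) - ι d) + ι 2
    degree-bound v = ≤-trans (≤-reflexive (deg≡sum v))
        (≤-trans (sum-off-path (λ e → χ e v) (λ e → unit-χ e v))
      -- Two path edges at `v` form a chain of two edges, so their positions differ by at most 1.
      (+-monoʳ-≤ (ι (size H) - ι d) (sum-window (λ a → χ (link a) v) 2 (λ a → unit-χ (link a) v)
        (λ a b p q → chain-length a b (0<χ⇒∈ p , 0<χ⇒∈ q ∷ [ link b ])))))

    ball-bound : ∀ e → (1ℚ + sum (λ v → χ e v * (deg v - 1ℚ))) + sum (λ v → χ e v * beyond e v) ≤
        (ι (size H) - ι d) + ι 5
    ball-bound e = subst (_≤ (ι (size H) - ι d) + ι 5) sum-near (≤-trans (sum-off-path near unit-near)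
      (+-monoʳ-≤ (ι (size H) - ι d) (sum-window (near ∘ link) 5 (unit-near ∘ link) window)))
      where
      open Near e
      window : ∀ a b → 0ℚ < near (link a) → 0ℚ < near (link b) → toℕ b ℕ.< toℕ a ℕ.+ 5
      window a b p q with near⇒chain (link a) p | near⇒chain (link b) q
      -- Each path edge near `e` is joined to `e` by a chain of at most three edges; merging two
      -- such chains at `e` leaves at most five.
      ... | m , m≤2 , C , _ | n , n≤2 , _ , C′ = ℕ.≤-trans (chain-length a b (C ++ᶜ C′))
            (ℕ.+-monoʳ-≤ (toℕ a) (ℕ.≤-trans (ℕ.+-monoʳ-≤ m (ℕ.s≤s n≤2)) (ℕ.+-monoˡ-≤ 3 m≤2)))

-- The polynomial inequality for the edge weights

module EdgeInequality where

  open import Data.Rational.Base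
  open import Data.Rational.Properties
  open +-*-Solver using (solve; con; _:=_; _:+_; _:*_; _:-_; :-_)

  open Rationals

  infixr 6 _⊕_
  infixr 7 _⊗_

  _⊕_ : ∀ {p q} → 0ℚ ≤ p → 0ℚ ≤ q → 0ℚ ≤ p + q
  _⊕_ = 0≤-+

  _⊗_ : ∀ {p q} → 0ℚ ≤ p → 0ℚ ≤ q → 0ℚ ≤ p * q
  _⊗_ = 0≤-*

  0≤lit : ∀ q → {{NonNegative q}} → 0ℚ ≤ q
  0≤lit q = nonNegative⁻¹ q

  0<lit : ∀ q → {{Positive q}} → 0ℚ < q
  0<lit q = positive⁻¹ q

  -- r = m − 1, D = k − d + 2 and a = r λ, where a (a − r + 1) is slightly below
  -- its value D r for a star with D edges.
  module Local (r D a : ℚ) (1≤r : 1ℚ ≤ r) (9≤D : + 9 / 1 ≤ D) (42≤ : + 42 / 1 ≤ r * (D - + 8 / 1))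
    (Q≥ : (D - + 1 / 4) * r ≤ a * (a - r + 1ℚ)) (Q≤ : a * (a - r + 1ℚ) ≤ D * r) (0≤t : 0ℚ ≤ a - r + 1ℚ) where

    private
      0≤ρ : 0ℚ ≤ r - 1ℚ
      0≤ρ = ≤⇒0≤- 1≤r
      0≤E : 0ℚ ≤ D - + 9 / 1
      0≤E = ≤⇒0≤- 9≤D
      0≤W : 0ℚ ≤ r * (D - + 8 / 1) - + 42 / 1
      0≤W = ≤⇒0≤- 42≤
      0≤r : 0ℚ ≤ r
      0≤r = ≤-trans 0≤1 1≤r
      0<r : 0ℚ < r
      0<r = <-≤-trans 0<1 1≤r

    -- If t < 13/2, then a t < 13/2 (r + 11/2), whereas a t ≥ (D - 1/4) r ≥ 42 + 31/4 r. Refutations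
    -- of this kind write a positive number plus non-negative terms as a sum that vanishes
    -- identically; `zero-sum` is the certificate.
    13/2≤t : + 13 / 2 ≤ a - r + 1ℚ
    13/2≤t = ≮⇒≥ λ t<13/2 → <-irrefl refl (begin-strict
      0ℚ <⟨ 0<-+ (0<lit (+ 25 / 4)) (0≤lit (+ 5 / 4) ⊗ 0≤r ⊕ 0≤W ⊕ ≤⇒0≤- Q≥ ⊕
             (<⇒≤ (<⇒0<- t<13/2) ⊗ (0≤lit (+ 13 / 2) ⊕ 0≤t ⊕ 0≤ρ))) ⟩
      _  ≡⟨ zero-sum r D a ⟩
      0ℚ ∎)
      where
      open ≤-Reasoning
      zero-sum = solve 3 (λ r D a → (con (+ 25 / 4)) :+ (con (+ 5 / 4) :* r :+ ((r :* (D :- (con (+ 8 /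
          1))) :- con (+ 42 / 1)) :+ ((a :* (a :- r :+ con 1ℚ) :- (D :- con (+ 1 / 4)) :* r)
          :+ (con (+ 13 / 2) :- (a :- r :+ con 1ℚ)) :* (con (+ 13 / 2) :+ ((a :- r :+ (con
          1ℚ)) :+ (r :- con 1ℚ)))))) := con 0ℚ) refl

    0≤a′ : 0ℚ ≤ a - r - + 11 / 2
    0≤a′ = subst (0ℚ ≤_) (shift r a) (≤⇒0≤- 13/2≤t)
      where
      shift = solve 2 (λ r a → (a :- r :+ con 1ℚ) :- con (+ 13 / 2) := a :- r :- con (+ 11 / 2))
          refl

    0≤a : 0ℚ ≤ a
    0≤a = subst (0ℚ ≤_) (shift r a) (0≤a′ ⊕ 0≤r ⊕ 0≤lit (+ 11 / 2))
      where
      shift = solve 2 (λ r a → (a :- r :- con (+ 11 / 2)) :+ (r :+ con (+ 11 / 2)) := a) refl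

    -- A quarter of this is the worst case of `pendant-case`, where x = D - 1, N = 4 and a (a - r +
    -- 1) = (D - 1/4) r. It holds because `Q≤` bounds a from above.
    13a+16≤ : 0ℚ ≤ + 3 / 1 * r * (D - 1ℚ) - + 16 / 1 - + 13 / 1 * a
    13a+16≤ = ≮⇒≥ λ neg → <-irrefl refl (begin-strict
      0ℚ <⟨ 0<-+ (0<lit (+ 8711 / 1)) (0≤lit (+ 617 / 1) ⊗ 0≤W ⊕ 0≤lit (+ 2447 / 1) ⊗ 0≤ρ ⊕
              (0≤lit (+ 3 / 1) ⊗ 0≤W ⊕ 0≤lit (+ 21 / 1) ⊗ 0≤ρ) ⊗
                  (0≤lit (+ 3 / 1) ⊗ 0≤W ⊕ 0≤lit (+ 8 / 1) ⊗ 0≤ρ) ⊕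
              0≤lit (+ 169 / 1) ⊗ ≤⇒0≤- Q≤ ⊕
              subst (0ℚ ≤_) (minus z) (neg-antimono-≤ (<⇒≤ neg)) ⊗
                  (0≤lit (+ 13 / 1) ⊗ 0≤t ⊕ (0≤lit (+ 3 / 1) ⊗ 0≤W ⊕ 0≤lit (+ 21 / 1) ⊗ 0≤ρ ⊕ 0≤lit
                  (+ 131 / 1)))) ⟩
      _  ≡⟨ zero-sum r D a ⟩
      0ℚ ∎)
      where
      open ≤-Reasoning
      z : ℚ
      z = + 3 / 1 * r * (D - 1ℚ) - + 16 / 1 - + 13 / 1 * a
      minus = solve 1 (λ z → :- z := con 0ℚ :- z) refl
      zero-sum = solve 3 (λ r D a → (con (+ 8711 / 1)) :+ (con (+ 617 / 1) :* (r :* (D :- (con (+ 8 /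
          1))) :- con (+ 42 / 1)) :+ (con (+ 2447 / 1) :* (r :- con 1ℚ) :+ ((con (+ 3 / 1)
          :* (r :* (D :- con (+ 8 / 1)) :- con (+ 42 / 1)) :+ con (+ 21 / 1) :* (r :- (con
          1ℚ))) :* (con (+ 3 / 1) :* (r :* (D :- con (+ 8 / 1)) :- con (+ 42 / 1)) :+ (con (+
          8 / 1)) :* (r :- con 1ℚ)) :+ (con (+ 169 / 1) :* (D :* r :- a :* (a :- r :+ con 1ℚ))
          :+ (con 0ℚ :- (con (+ 3 / 1) :* r :* (D :- con 1ℚ) :- con (+ 16 / 1) :- (con (+ 13
          / 1)) :* a)) :* (con (+ 13 / 1) :* (a :- r :+ con 1ℚ) :+ (con (+ 3 / 1) :* (r :* (D
          :- con (+ 8 / 1)) :- con (+ 42 / 1)) :+ (con (+ 21 / 1) :* (r :- con 1ℚ) :+ (con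
          (+ 131 / 1))))))))) := con 0ℚ) refl

    -- Concerns an edge with one non-pendant vertex, of degree x. With a (a - r + 1) least and N
    -- greatest, the difference from the value at x = D - 1 has the factor D - 1 - x, and the other
    -- factor is non-negative for x ≥ 2.
    pendant-case : ∀ x N S → + 2 / 1 ≤ x → x ≤ D - 1ℚ → N ≤ D + + 3 / 1 - x → r * S ≡ a + r * x →
                   0ℚ ≤ S * (a * (a - r + 1ℚ) - r * x) - N * (a + 1ℚ)
    pendant-case x N S 2≤x x≤ N≤ rS≡ = 0≤-cancelˡ r 0<r
        (subst (0ℚ ≤_) (sym (trans (scale r S (a * (a - r + 1ℚ) - r * x) (N * (a + 1ℚ)))
        (trans (cong (λ h → h * (a * (a - r + 1ℚ) - r * x) - r * (N * (a + 1ℚ))) rS≡)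
            (identity r D a x N))))
      ((0≤a ⊕ 0≤r ⊗ 0≤x) ⊗ ≤⇒0≤- Q≥ ⊕ 0≤r ⊗ (≤⇒0≤- N≤ ⊗ (0≤a ⊕ 0≤1)) ⊕ 0≤r ⊗
        (≤⇒0≤- x≤ ⊗ (0≤ρ ⊗ (≤⇒0≤- 2≤x ⊕ 0≤lit (+ 5 / 4)) ⊕ ≤⇒0≤- 2≤x ⊕ 0≤lit (+ 1 / 4)) ⊕ 0≤lit
            (+ 1 / 4) ⊗ 13a+16≤)))
      where
      0≤x : 0ℚ ≤ x
      0≤x = ≤-trans (0≤lit (+ 2 / 1)) 2≤x
      scale = solve 4 (λ r S u v → r :* (S :* u :- v) := (r :* S) :* u :- r :* v) refl
      identity = solve 5 (λ r D a x N → (a :+ r :* x) :* (a :* (a :- r :+ con 1ℚ) :- r :* x) :- r :* (N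
          :* (a :+ con 1ℚ)) := (a :+ r :* x) :* (a :* (a :- r :+ con 1ℚ) :- (D :- (con (+ 1 /
          4))) :* r) :+ (r :* ((D :+ con (+ 3 / 1) :- x :- N) :* (a :+ con 1ℚ)) :+ r :* ((D :-
          (con 1ℚ) :- x) :* ((r :- con 1ℚ) :* ((x :- con (+ 2 / 1)) :+ con (+ 5 / 4)) :+ ((x
          :- con (+ 2 / 1)) :+ con (+ 1 / 4))) :+ con (+ 1 / 4) :* (con (+ 3 / 1) :* r :* (D
          :- con 1ℚ) :- con (+ 16 / 1) :- con (+ 13 / 1) :* a)))) refl

    private
      -- Here s = x + y and P = (x - 1)(y - 1). For the least a (a - r + 1), the difference a (a - r
      -- + 1) - r x y is r ((D + 4 - s) - 13/4 - P), whence the 13/4. The weight a + 2/3 (r - 1) is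
      -- the part of the coefficient of P that is kept in `L`.
      L : ℚ → ℚ → ℚ
      L s P = (D + + 4 / 1 - s) * ((r - 1ℚ) * (s - 1ℚ) + 1ℚ) + P * (a + + 2 / 3 * (r - 1ℚ)) - + 13 / 4 *
          (a + r * (s - 1ℚ))

      L-end₁ = solve 3 (λ r D a → (con (+ 52 / 1)) :* ((D :+ con (+ 4 / 1) :- con (+ 4 / 1)) :* ((r
          :- con 1ℚ) :* (con (+ 4 / 1) :- con 1ℚ) :+ con 1ℚ) :+ con 1ℚ :* (a :+ (con (+ 2
          / 3)) :* (r :- con 1ℚ)) :- con (+ 13 / 4) :* (a :+ r :* (con (+ 4 / 1) :- (con
          1ℚ)))) := con (+ 9 / 1) :* (con (+ 3 / 1) :* r :* (D :- con 1ℚ) :- con (+ 16 / 1)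
          :- con (+ 13 / 1) :* a) :+ (con (+ 25 / 1) :* (r :* (D :- con (+ 8 / 1)) :- (con (+
          42 / 1))) :+ (con (+ 656 / 1) :* r :+ (con (+ 104 / 1) :* ((r :- con 1ℚ) :* (D :-
          (con (+ 9 / 1)))) :+ (con (+ 258 / 1) :+ con (+ 104 / 3) :* (r :- con 1ℚ)))))) refl

      L-end₂ = solve 3 (λ r D a → (D :+ con (+ 4 / 1) :- (D :+ con 1ℚ)) :* ((r :- con 1ℚ) :* ((D :+
          (con 1ℚ)) :- con 1ℚ) :+ con 1ℚ) :+ (D :- con (+ 2 / 1)) :* (a :+ con (+ 2 / 3) :*
          (r :- con 1ℚ)) :- con (+ 13 / 4) :* (a :+ r :* ((D :+ con 1ℚ) :- con 1ℚ)) := ((D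
          :- con (+ 9 / 1)) :+ con (+ 15 / 4)) :* (a :- r :- con (+ 11 / 2)) :+ ((con (+ 17 /
          12)) :* (r :* (D :- con (+ 8 / 1)) :- con (+ 42 / 1)) :+ (con (+ 57 / 12) :* r :+
          (con (+ 11 / 6) :* (D :- con (+ 9 / 1)) :+ con (+ 1235 / 24))))) refl

      L-end₃ = solve 3 (λ r D a → (D :+ con (+ 4 / 1) :- (D :+ con (+ 4 / 1))) :* ((r :- con 1ℚ) :*
          ((D :+ con (+ 4 / 1)) :- con 1ℚ) :+ con 1ℚ) :+ (D :- con (+ 2 / 1)) :* (con (+ 4 /
          1)) :* (a :+ con (+ 2 / 3) :* (r :- con 1ℚ)) :- con (+ 13 / 4) :* (a :+ r :* ((D :+
          (con (+ 4 / 1))) :- con 1ℚ)) := (con (+ 4 / 1) :* (D :- con (+ 9 / 1)) :+ (con (+ 99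
          / 4))) :* (a :- r :- con (+ 11 / 2)) :+ (r :* (con (+ 41 / 12) :* (D :- (con (+ 9 /
          1))) :+ con (+ 53 / 12)) :+ (con (+ 58 / 3) :* (D :- con (+ 9 / 1)) :+ (con (+ 2819
          / 24))))) refl

      -- The three end points are s = 4, where x = y = 2; s = D + 1, where both lower bounds for P
      -- agree; and s = D + 4, the largest s that the ball count allows.
      0≤L₁ : 0ℚ ≤ L (+ 4 / 1) 1ℚ
      0≤L₁ = 0≤-cancelˡ (+ 52 / 1) (0<lit (+ 52 / 1)) (subst (0ℚ ≤_) (sym (L-end₁ r D a))
        (0≤lit (+ 9 / 1) ⊗ 13a+16≤ ⊕ 0≤lit (+ 25 / 1) ⊗ 0≤W ⊕ 0≤lit (+ 656 / 1) ⊗ 0≤r ⊕ 0≤lit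
            (+ 104 / 1) ⊗ (0≤ρ ⊗ 0≤E) ⊕
         0≤lit (+ 258 / 1) ⊕ 0≤lit (+ 104 / 3) ⊗ 0≤ρ))

      0≤L₂ : 0ℚ ≤ L (D + 1ℚ) (D - + 2 / 1)
      0≤L₂ = subst (0ℚ ≤_) (sym (L-end₂ r D a))
        ((0≤E ⊕ 0≤lit (+ 15 / 4)) ⊗ 0≤a′ ⊕ 0≤lit (+ 17 / 12) ⊗ 0≤W ⊕ 0≤lit (+ 57 / 12) ⊗ 0≤r ⊕ 0≤lit
            (+ 11 / 6) ⊗ 0≤E ⊕ 0≤lit (+ 1235 / 24))

      0≤L₃ : 0ℚ ≤ L (D + + 4 / 1) ((D - + 2 / 1) * (+ 4 / 1))
      0≤L₃ = subst (0ℚ ≤_) (sym (L-end₃ r D a))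
        ((0≤lit (+ 4 / 1) ⊗ 0≤E ⊕ 0≤lit (+ 99 / 4)) ⊗ 0≤a′ ⊕ 0≤r ⊗
            (0≤lit (+ 41 / 12) ⊗ 0≤E ⊕ 0≤lit (+ 53 / 12)) ⊕ 0≤lit (+ 58 / 3) ⊗ 0≤E ⊕ 0≤lit
            (+ 2819 / 24))

      0≤D-3 : 0ℚ ≤ D - + 3 / 1
      0≤D-3 = subst (0ℚ ≤_) (shift D) (0≤E ⊕ 0≤lit (+ 6 / 1))
        where
        shift = solve 1 (λ D → (D :- con (+ 9 / 1)) :+ con (+ 6 / 1) := D :- con (+ 3 / 1)) refl

      0<D-3 : 0ℚ < D - + 3 / 1
      0<D-3 = subst (0ℚ <_) (shift D) (0<-+ (0<lit (+ 6 / 1)) 0≤E)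
        where
        shift = solve 1 (λ D → (con (+ 6 / 1)) :+ (D :- con (+ 9 / 1)) := D :- con (+ 3 / 1)) refl

      -- L is concave along both pieces of the lower bound for P, so it suffices
      -- to look at their end points.
      0≤L-small : ∀ s → + 4 / 1 ≤ s → s ≤ D + 1ℚ → 0ℚ ≤ L s (s - + 3 / 1)
      0≤L-small s 4≤s s≤D+1 = 0≤-cancelˡ (D - + 3 / 1) 0<D-3 (subst (0ℚ ≤_) (sym (interpolate r D a s))
        (≤⇒0≤- s≤D+1 ⊗ 0≤L₁ ⊕ ≤⇒0≤- 4≤s ⊗ 0≤L₂ ⊕ 0≤ρ ⊗ (≤⇒0≤- 4≤s ⊗ (≤⇒0≤- s≤D+1 ⊗ 0≤D-3))))
        where
        interpolate = solve 4 (λ r D a s → (D :- con (+ 3 / 1)) :* ((D :+ con (+ 4 / 1) :- s) :* ((r :-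
            (con 1ℚ)) :* (s :- con 1ℚ) :+ con 1ℚ) :+ (s :- con (+ 3 / 1)) :* (a :+ (con (+ 2 /
            3)) :* (r :- con 1ℚ)) :- con (+ 13 / 4) :* (a :+ r :* (s :- con 1ℚ))) := (D :+
            (con 1ℚ) :- s) :* ((D :+ con (+ 4 / 1) :- con (+ 4 / 1)) :* ((r :- con 1ℚ) :*
            (con (+ 4 / 1) :- con 1ℚ) :+ con 1ℚ) :+ con 1ℚ :* (a :+ con (+ 2 / 3) :* (r :-
            (con 1ℚ))) :- con (+ 13 / 4) :* (a :+ r :* (con (+ 4 / 1) :- con 1ℚ))) :+ ((s :-
            (con (+ 4 / 1))) :* ((D :+ con (+ 4 / 1) :- (D :+ con 1ℚ)) :* ((r :- con 1ℚ) :*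
            ((D :+ con 1ℚ) :- con 1ℚ) :+ con 1ℚ) :+ (D :- con (+ 2 / 1)) :* (a :+ (con (+ 2
            / 3)) :* (r :- con 1ℚ)) :- con (+ 13 / 4) :* (a :+ r :* ((D :+ con 1ℚ) :- (con
            1ℚ)))) :+ (r :- con 1ℚ) :* ((s :- con (+ 4 / 1)) :* ((D :+ con 1ℚ :- s) :* (D :-
            (con (+ 3 / 1))))))) refl

      0≤L-large : ∀ s → D + 1ℚ ≤ s → s ≤ D + + 4 / 1 → 0ℚ ≤ L s ((D - + 2 / 1) * (s - D))
      0≤L-large s D+1≤s s≤D+4 = 0≤-cancelˡ (+ 3 / 1) (0<lit (+ 3 / 1))
          (subst (0ℚ ≤_) (sym (interpolate r D a s))
        (≤⇒0≤- s≤D+4 ⊗ 0≤L₂ ⊕ ≤⇒0≤- D+1≤s ⊗ 0≤L₃ ⊕ 0≤lit (+ 3 / 1) ⊗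
            (≤⇒0≤- s≤D+4 ⊗ (≤⇒0≤- D+1≤s ⊗ 0≤ρ))))
        where
        interpolate = solve 4 (λ r D a s → (con (+ 3 / 1)) :*
            ((D :+ con (+ 4 / 1) :- s) :* ((r :- con 1ℚ)
            :* (s :- con 1ℚ) :+ con 1ℚ) :+ ((D :- con (+ 2 / 1)) :* (s :- D)) :* (a :+ (con (+
            2 / 3)) :* (r :- con 1ℚ)) :- con (+ 13 / 4) :* (a :+ r :* (s :- con 1ℚ))) := (D :+
            (con (+ 4 / 1)) :- s) :* ((D :+ con (+ 4 / 1) :- (D :+ con 1ℚ)) :* ((r :- con 1ℚ)
            :* ((D :+ con 1ℚ) :- con 1ℚ) :+ con 1ℚ) :+ (D :- con (+ 2 / 1)) :* (a :+ (con (+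
            2 / 3)) :* (r :- con 1ℚ)) :- con (+ 13 / 4) :* (a :+ r :* ((D :+ con 1ℚ) :- (con
            1ℚ)))) :+ ((s :- (D :+ con 1ℚ)) :* ((D :+ con (+ 4 / 1) :- (D :+ con (+ 4 / 1)))
            :* ((r :- con 1ℚ) :* ((D :+ con (+ 4 / 1)) :- con 1ℚ) :+ con 1ℚ) :+ (D :- (con
            (+ 2 / 1))) :* con (+ 4 / 1) :* (a :+ con (+ 2 / 3) :* (r :- con 1ℚ)) :- (con (+
            13 / 4)) :* (a :+ r :* ((D :+ con (+ 4 / 1)) :- con 1ℚ))) :+ con (+ 3 / 1) :* ((D
            :+ con (+ 4 / 1) :- s) :* ((s :- (D :+ con 1ℚ)) :* (r :- con 1ℚ))))) refl

      0≤a+ρ : 0ℚ ≤ a + + 2 / 3 * (r - 1ℚ)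
      0≤a+ρ = 0≤a ⊕ 0≤lit (+ 2 / 3) ⊗ 0≤ρ

      L-mono : ∀ s P P′ → P ≤ P′ → 0ℚ ≤ L s P → 0ℚ ≤ L s P′
      L-mono s P P′ P≤P′ h = subst (0ℚ ≤_) (step ((D + + 4 / 1 - s) * ((r - 1ℚ) * (s - 1ℚ) + 1ℚ)) P P′
          (a + + 2 / 3 * (r - 1ℚ)) (+ 13 / 4 * (a + r * (s - 1ℚ))))
        (h ⊕ ≤⇒0≤- P≤P′ ⊗ 0≤a+ρ)
        where
        step = solve 5 (λ u P P′ c v → (u :+ P :* c :- v) :+ (P′ :- P) :* c := u :+ P′ :* c :- v) refl

    module Inner (x y Nu Nw S : ℚ) (2≤x : + 2 / 1 ≤ x) (2≤y : + 2 / 1 ≤ y) (x≤ : x ≤ D - 1ℚ)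
        (y≤ : y ≤ D - 1ℚ)
      (0≤Nu : 0ℚ ≤ Nu) (0≤Nw : 0ℚ ≤ Nw) (N≤ : Nu + Nw ≤ D + + 4 / 1 - (x + y)) (rS≡ : r * S ≡ a + r * (x + y - 1ℚ)) where

      private
        s P : ℚ
        s = x + y
        P = (x - 1ℚ) * (y - 1ℚ)
        0≤x-2 = ≤⇒0≤- 2≤x
        0≤y-2 = ≤⇒0≤- 2≤y
        4≤s : + 4 / 1 ≤ s
        4≤s = +-mono-≤ 2≤x 2≤y
        s≤D+4 : s ≤ D + + 4 / 1
        s≤D+4 = ≤-by (shift D s Nu Nw) (≤⇒0≤- N≤ ⊕ 0≤Nu ⊕ 0≤Nw)
          where
          shift = solve 4 (λ D s Nu Nw → D :+ con (+ 4 / 1) :- s := (D :+ con (+ 4 / 1) :- s :- (Nu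
              :+ Nw)) :+ (Nu :+ Nw)) refl
        0≤L : 0ℚ ≤ L s P
        -- For fixed s the product P is least on the boundary: a degree equal to 2 gives s - 3, a
        -- degree equal to D - 1 gives (D - 2)(s - D).
        0≤L with ≤-total s (D + 1ℚ)
        ... | inj₁ s≤ = L-mono s (s - + 3 / 1) P (≤-by (gap′ x y) (0≤x-2 ⊗ 0≤y-2)) (0≤L-small s 4≤s s≤)
          where
          gap′ = solve 2 (λ x y → (x :- con 1ℚ) :* (y :- con 1ℚ) :- (x :+ y :- con (+ 3 / 1)) :=
              (x :- con (+ 2 / 1)) :* (y :- con (+ 2 / 1))) refl
        ... | inj₂ s≥ = L-mono s ((D - + 2 / 1) * (s - D)) P (≤-by (gap′ D x y) (≤⇒0≤- x≤ ⊗ ≤⇒0≤- y≤))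
            (0≤L-large s s≥ s≤D+4)
          where
          gap′ = solve 3 (λ D x y → (x :- con 1ℚ) :* (y :- con 1ℚ) :- (D :- con (+ 2 / 1)) :* (x
              :+ y :- D) := (D :- con 1ℚ :- x) :* (D :- con 1ℚ :- y)) refl
        0≤P : 0ℚ ≤ P
        0≤P = subst (0ℚ ≤_) (shift x y) ((0≤x-2 ⊕ 0≤1) ⊗ (0≤y-2 ⊕ 0≤1))
          where
          shift = solve 2 (λ x y → ((x :- con (+ 2 / 1)) :+ con 1ℚ) :* ((y :- con (+ 2 / 1)) :+
              (con 1ℚ)) := (x :- con 1ℚ) :* (y :- con 1ℚ)) refl
        0≤Σ : 0ℚ ≤ a + r * (s - 1ℚ)
        0≤Σ = 0≤a ⊕ 0≤r ⊗ subst (0ℚ ≤_) (shift s) (≤⇒0≤- 4≤s ⊕ 0≤lit (+ 3 / 1))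
          where
          shift = solve 1 (λ s → (s :- con (+ 4 / 1)) :+ con (+ 3 / 1) := s :- con 1ℚ) refl

        -- What the coefficient of P keeps beyond r (a + 1) (a + 2/3 (r − 1)) when
        -- a (a − r + 1) and D + 4 − s take their least values.
        coefficient : ℚ
        coefficient = + 1 / 3 * (r - 1ℚ + + 5 / 4) * ((r - 1ℚ - + 11 / 4) * (r - 1ℚ - + 11 / 4)) + + 1 /
            48 * (r - 1ℚ) + + 835 / 192
          + (a - r - + 11 / 2) * (+ 1 / 3 * (r * (r - 1ℚ)) + 1ℚ)

        0≤coefficient : 0ℚ ≤ coefficient
        0≤coefficient = 0≤-+ (0≤-+ (0≤-+ ((0≤lit (+ 1 / 3) ⊗ (0≤ρ ⊕ 0≤lit (+ 5 / 4))) ⊗ 0≤²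
            (r - 1ℚ - + 11 / 4))
          (0≤lit (+ 1 / 48) ⊗ 0≤ρ)) (0≤lit (+ 835 / 192)))
              (0≤a′ ⊗ (0≤lit (+ 1 / 3) ⊗ (0≤r ⊗ 0≤ρ) ⊕ 0≤1))

        -- The left side is the full coefficient of P in r times the quantity of `inner-case`, after
        -- r S = a + r (s - 1) has been substituted.
        C-bound = solve 4 (λ r D a s → r :* (a :+ con 1ℚ) :* (con (+ 2 / 1) :* a :+ s) :- (a :+ r :*
            (s :- con 1ℚ)) :* (a :+ r) := r :* (a :+ con 1ℚ) :* (a :+ con (+ 2 / 3) :* (r :-
            (con 1ℚ))) :+ ((con (+ 1 / 3) :* (r :- con 1ℚ :+ con (+ 5 / 4)) :* ((r :- con 1ℚ
            :- con (+ 11 / 4)) :* (r :- con 1ℚ :- con (+ 11 / 4))) :+ con (+ 1 / 48) :* (r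
            :- con 1ℚ) :+ con (+ 835 / 192) :+ (a :- r :- con (+ 11 / 2)) :* (con (+ 1 / 3)
            :* (r :* (r :- con 1ℚ)) :+ con 1ℚ)) :+ ((r :- con 1ℚ) :* (a :* (a :- r :+ (con
            1ℚ)) :- (D :- con (+ 1 / 4)) :* r) :+ r :* ((r :- con 1ℚ) :* (D :+ con (+ 4 / 1)
            :- s))))) refl

      inner-case : 0ℚ ≤ (a + 1ℚ) * (P * (+ 2 / 1 * a + s) - Nu * (a + y) - Nw * (a + x) - S *
          (r * (x * y) - a * (a - r + 1ℚ))) + S * a * (r - 1ℚ) * P
      inner-case = 0≤-cancelˡ r 0<r (subst (0ℚ ≤_) (sym
          (trans (scale r a (P * (+ 2 / 1 * a + s) - Nu * (a + y) - Nw * (a + x)) S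
          (r * (x * y) - a * (a - r + 1ℚ)) P)
          (trans (cong (λ h → (a + 1ℚ) * (r * (P * (+ 2 / 1 * a + s) - Nu * (a + y) - Nw * (a + x)) - h
              * (r * (x * y) - a * (a - r + 1ℚ))) + h * a * (r - 1ℚ) * P) rS≡)
            (identity r D a x y Nu Nw))))
        ((0≤r ⊗ (0≤a ⊕ 0≤1)) ⊗ 0≤L ⊕ 0≤P ⊗ (subst (0ℚ ≤_)
            (sym (trans (cong (_- r * (a + 1ℚ) * (a + + 2 / 3 * (r - 1ℚ))) (C-bound r D a s))
            (cancel (r * (a + 1ℚ) * (a + + 2 / 3 * (r - 1ℚ))) _)))
            (0≤coefficient ⊕ 0≤ρ ⊗ ≤⇒0≤- Q≥ ⊕ 0≤r ⊗ (0≤ρ ⊗ ≤⇒0≤- s≤D+4))) ⊕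
          (0≤a ⊕ 0≤1) ⊗ (0≤r ⊗ (≤⇒0≤- N≤ ⊗ (0≤a ⊕ (0≤x-2 ⊕ 0≤y)) ⊕ 0≤Nu ⊗ 0≤x-2 ⊕ 0≤Nw ⊗ 0≤y-2) ⊕ 0≤Σ ⊗
              ≤⇒0≤- Q≥)))
        where
        0≤y : 0ℚ ≤ y
        0≤y = ≤-trans (0≤lit (+ 2 / 1)) 2≤y
        cancel = solve 2 (λ u v → (u :+ v) :- u := v) refl
        scale = solve 6 (λ r a u S v P → r :* ((a :+ con 1ℚ) :* (u :- S :* v) :+ S :* a :* (r :- (con
            1ℚ)) :* P) := (a :+ con 1ℚ) :* (r :* u :- (r :* S) :* v) :+ (r :* S) :* a :* (r :-
            (con 1ℚ)) :* P) refl
        identity = solve 7 (λ r D a x y Nu Nw → (a :+ con 1ℚ) :* (r :* ((x :- con 1ℚ) :* (y :- (con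
            1ℚ)) :* (con (+ 2 / 1) :* a :+ (x :+ y)) :- Nu :* (a :+ y) :- Nw :* (a :+ x)) :- (a :+
            r :* (x :+ y :- con 1ℚ)) :* (r :* (x :* y) :- a :* (a :- r :+ con 1ℚ))) :+ (a :+ r
            :* (x :+ y :- con 1ℚ)) :* a :* (r :- con 1ℚ) :* ((x :- con 1ℚ) :* (y :- con 1ℚ))
            := (r :* (a :+ con 1ℚ)) :* ((D :+ con (+ 4 / 1) :- (x :+ y)) :* ((r :- con 1ℚ) :*
            ((x :+ y) :- con 1ℚ) :+ con 1ℚ) :+ (x :- con 1ℚ) :* (y :- con 1ℚ) :* (a :+ (con
            (+ 2 / 3)) :* (r :- con 1ℚ)) :- con (+ 13 / 4) :* (a :+ r :* ((x :+ y) :- (con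
            1ℚ)))) :+ ((x :- con 1ℚ) :* (y :- con 1ℚ) :* (r :* (a :+ con 1ℚ) :* ((con (+ 2 /
            1)) :* a :+ (x :+ y)) :- (a :+ r :* ((x :+ y) :- con 1ℚ)) :* (a :+ r) :- r :* (a :+
            (con 1ℚ)) :* (a :+ con (+ 2 / 3) :* (r :- con 1ℚ))) :+ (a :+ con 1ℚ) :* (r :* ((D
            :+ con (+ 4 / 1) :- (x :+ y) :- (Nu :+ Nw)) :* (a :+ ((x :- con (+ 2 / 1)) :+ y)) :+
            (Nu :* (x :- con (+ 2 / 1)) :+ Nw :* (y :- con (+ 2 / 1)))) :+ (a :+ r :* ((x :+ y)
            :- con 1ℚ)) :* (a :* (a :- r :+ con 1ℚ) :- (D :- con (+ 1 / 4)) :* r)))) refl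

    -- This is (a + 1)(a + x)(a + y) times the slack of `edge-inequality`, with all inverses
    -- cleared.
    gap : ℚ → ℚ → ℚ → ℚ → ℚ → ℚ
    gap x y Nu Nw S = (a + 1ℚ) * ((x - 1ℚ) * (y - 1ℚ) * (+ 2 / 1 * a + (x + y)) - Nu * (a + y) - Nw *
        (a + x) - S * (r * (x * y) - a * (a - r + 1ℚ)))
      + S * a * (r - 1ℚ) * ((x - 1ℚ) * (y - 1ℚ))

    -- Integrality of the degrees enters as the alternative between 1 and at least 2; the products
    -- (x - 1)(y - 1) vanish unless both ends are non-pendant.
    0≤gap : ∀ x y Nu Nw S → x ≤ D - 1ℚ → y ≤ D - 1ℚ → 0ℚ ≤ Nu → 0ℚ ≤ Nw → Nu + Nw ≤ D + + 4 / 1 -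
        (x + y) →
            0ℚ ≤ S → r * S ≡ a + r * (x + y - 1ℚ) →
            (x ≡ 1ℚ × Nu ≡ 0ℚ) ⊎ + 2 / 1 ≤ x → (y ≡ 1ℚ × Nw ≡ 0ℚ) ⊎ + 2 / 1 ≤ y → 0ℚ ≤ gap x y Nu Nw S
    0≤gap x y Nu Nw S x≤ y≤ 0≤Nu 0≤Nw N≤ 0≤S rS≡ (inj₂ 2≤x) (inj₂ 2≤y) = Inner.inner-case x y Nu Nw S
        2≤x 2≤y x≤ y≤ 0≤Nu 0≤Nw N≤ rS≡
    0≤gap x y Nu Nw S x≤ y≤ 0≤Nu 0≤Nw N≤ 0≤S rS≡ (inj₁ (refl , refl)) (inj₁ (refl , refl)) = subst
        (0ℚ ≤_) (sym (identity r D a S))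
        ((0≤a ⊕ 0≤1) ⊗ (0≤S ⊗ (≤⇒0≤- Q≥ ⊕ 0≤r ⊗ (0≤E ⊕ 0≤lit (+ 31 / 4)))))
      where
      identity = solve 4 (λ r D a S → (a :+ con 1ℚ) :* ((con 1ℚ :- con 1ℚ) :* (con 1ℚ :- con 1ℚ)
          :* (con (+ 2 / 1) :* a :+ (con 1ℚ :+ con 1ℚ)) :- con 0ℚ :* (a :+ con 1ℚ) :- (con
          0ℚ) :* (a :+ con 1ℚ) :- S :* (r :* (con 1ℚ :* con 1ℚ) :- a :* (a :- r :+ con 1ℚ)))
          :+ S :* a :* (r :- con 1ℚ) :* ((con 1ℚ :- con 1ℚ) :* (con 1ℚ :- con 1ℚ)) := (a
          :+ con 1ℚ) :* (S :* ((a :* (a :- r :+ con 1ℚ) :- (D :- con (+ 1 / 4)) :* r) :+ r :*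
          ((D :- con (+ 9 / 1)) :+ con (+ 31 / 4))))) refl
    0≤gap x y Nu Nw S x≤ y≤ 0≤Nu 0≤Nw N≤ 0≤S rS≡ (inj₂ 2≤x) (inj₁ (refl , refl)) = subst (0ℚ ≤_)
        (sym (identity r D a x Nu S))
        ((0≤a ⊕ 0≤1) ⊗ pendant-case x Nu S 2≤x x≤ (≤-by (bound D x Nu) (≤⇒0≤- N≤))
            (trans rS≡ (reduce r a x)))
      where
      bound = solve 3 (λ D x Nu → D :+ con (+ 3 / 1) :- x :- Nu := D :+ con (+ 4 / 1) :- (x :+ (con
          1ℚ)) :- (Nu :+ con 0ℚ)) refl
      reduce = solve 3 (λ r a x → a :+ r :* (x :+ con 1ℚ :- con 1ℚ) := a :+ r :* x) refl
      identity = solve 6 (λ r D a x Nu S → (a :+ con 1ℚ) :* ((x :- con 1ℚ) :* (con 1ℚ :- con 1ℚ) :*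
          (con (+ 2 / 1) :* a :+ (x :+ con 1ℚ)) :- Nu :* (a :+ con 1ℚ) :- con 0ℚ :* (a :+ x)
          :- S :* (r :* (x :* con 1ℚ) :- a :* (a :- r :+ con 1ℚ))) :+ S :* a :* (r :- con 1ℚ)
          :* ((x :- con 1ℚ) :* (con 1ℚ :- con 1ℚ)) := (a :+ con 1ℚ) :* (S :* (a :* (a :- r
          :+ con 1ℚ) :- r :* x) :- Nu :* (a :+ con 1ℚ))) refl
    0≤gap x y Nu Nw S x≤ y≤ 0≤Nu 0≤Nw N≤ 0≤S rS≡ (inj₁ (refl , refl)) (inj₂ 2≤y) = subst (0ℚ ≤_)
        (sym (identity r D a y Nw S))
        ((0≤a ⊕ 0≤1) ⊗ pendant-case y Nw S 2≤y y≤ (≤-by (bound D y Nw) (≤⇒0≤- N≤))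
            (trans rS≡ (reduce r a y)))
      where
      bound = solve 3 (λ D y Nw → D :+ con (+ 3 / 1) :- y :- Nw := D :+ con (+ 4 / 1) :- (con 1ℚ
          :+ y) :- (con 0ℚ :+ Nw)) refl
      reduce = solve 3 (λ r a y → a :+ r :* (con 1ℚ :+ y :- con 1ℚ) := a :+ r :* y) refl
      identity = solve 6 (λ r D a y Nw S → (a :+ con 1ℚ) :* ((con 1ℚ :- con 1ℚ) :* (y :- con 1ℚ) :*
          (con (+ 2 / 1) :* a :+ (con 1ℚ :+ y)) :- con 0ℚ :* (a :+ y) :- Nw :* (a :+ con 1ℚ)
          :- S :* (r :* (con 1ℚ :* y) :- a :* (a :- r :+ con 1ℚ))) :+ S :* a :* (r :- con 1ℚ)
          :* ((con 1ℚ :- con 1ℚ) :* (y :- con 1ℚ)) := (a :+ con 1ℚ) :* (S :* (a :* (a :- r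
          :+ con 1ℚ) :- r :* y) :- Nw :* (a :+ con 1ℚ))) refl

    -- The inequality between the edge weight S = β + (x − 1) + (y − 1) and the
    -- values that it induces on the vertices of the edge.
    module _ (x y Nu Nw S : ℚ) (1≤x : 1ℚ ≤ x) (1≤y : 1ℚ ≤ y) (0≤gap : 0ℚ ≤ gap x y Nu Nw S) where

      private
        0<a+1 : 0ℚ < a + 1ℚ
        0<a+1 = +-mono-≤-< 0≤a 0<1
        0<a+x : 0ℚ < a + x
        0<a+x = +-mono-≤-< 0≤a (<-≤-trans 0<1 1≤x)
        0<a+y : 0ℚ < a + y
        0<a+y = +-mono-≤-< 0≤a (<-≤-trans 0<1 1≤y)
        U V : ℚ
        U = S + (x - 1ℚ) * (S - (y - 1ℚ)) + Nu
        V = S + (y - 1ℚ) * (S - (x - 1ℚ)) + Nw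

      edge-inequality : inv (a + x) * U + inv (a + y) * V + (r - 1ℚ) * (inv (a + 1ℚ) * S) ≤ S
      edge-inequality = 0≤-⇒≤ (0≤-cancelˡ ((a + 1ℚ) * ((a + x) * (a + y)))
          (0<-* 0<a+1 (0<-* 0<a+x 0<a+y)) (subst (0ℚ ≤_) (sym eq) 0≤gap))
        where
        distribute = solve 10 (λ p q s i j k r S U V → (p :* (q :* s)) :*
            (S :- (i :* U :+ j :* V :+ (r :-
            (con 1ℚ)) :* (k :* S))) := (p :* (q :* s)) :* S :- ((q :* i) :* (p :* s :* U) :+ (s :*
            j) :* (p :* q :* V) :+ (r :- con 1ℚ) :* ((p :* k) :* (q :* s :* S)))) refl
        identity = solve 7 (λ r a x y Nu Nw S → ((a :+ con 1ℚ) :* ((a :+ x) :* (a :+ y))) :* S :- ((con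
            1ℚ) :* ((a :+ con 1ℚ) :* (a :+ y) :* (S :+ (x :- con 1ℚ) :* (S :- (y :- con 1ℚ))
            :+ Nu)) :+ con 1ℚ :* ((a :+ con 1ℚ) :* (a :+ x) :* (S :+ (y :- con 1ℚ) :* (S :- (x
            :- con 1ℚ)) :+ Nw)) :+ (r :- con 1ℚ) :* (con 1ℚ :* ((a :+ x) :* (a :+ y) :* S)))
            := (a :+ con 1ℚ) :* ((x :- con 1ℚ) :* (y :- con 1ℚ) :* (con (+ 2 / 1) :* a :+ (x
            :+ y)) :- Nu :* (a :+ y) :- Nw :* (a :+ x) :- S :* (r :* (x :* y) :- a :* (a :- r :+
            (con 1ℚ)))) :+ S :* a :* (r :- con 1ℚ) :* ((x :- con 1ℚ) :* (y :- con 1ℚ))) refl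
        eq : ((a + 1ℚ) * ((a + x) * (a + y))) * (S -
            (inv (a + x) * U + inv (a + y) * V + (r - 1ℚ) * (inv (a + 1ℚ) * S))) ≡ gap x y Nu Nw S
        eq = trans (distribute (a + 1ℚ) (a + x) (a + y) (inv (a + x)) (inv (a + y)) (inv (a + 1ℚ)) r S U
            V)
          (trans (cong₂ (λ h h′ → (a + 1ℚ) * ((a + x) * (a + y)) * S -
              (h * ((a + 1ℚ) * (a + y) * U) + h′ * ((a + 1ℚ) * (a + x) * V) + (r - 1ℚ) *
              (((a + 1ℚ) * inv (a + 1ℚ)) * ((a + x) * (a + y) * S))))
             (*-inv 0<a+x) (*-inv 0<a+y))
          (trans (cong (λ h → (a + 1ℚ) * ((a + x) * (a + y)) * S -
              (1ℚ * ((a + 1ℚ) * (a + y) * U) + 1ℚ * ((a + 1ℚ) * (a + x) * V) + (r - 1ℚ) *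
              (h * ((a + x) * (a + y) * S)))) (*-inv 0<a+1))
            (identity r a x y Nu Nw S)))

-- The bound for hypertrees without a vertex of maximal degree

module LowDegrees where

  open import Data.Fin.Subset as Subset using (_∈_; _∩_; ∣_∣)
  open import Data.Fin.Subset.Properties using (_∈?_; x∈p∩q⁺; x∈p∧x≢y⇒x∈p-y; x∈p⇒∣p-x∣<∣p∣)
  open import Data.Rational.Base using (ℚ; 0ℚ; 1ℚ; _+_; _*_; _-_; -_; _≤_; _<_; _/_)
  open import Data.Rational.Properties hiding (_≟_)
  open import Data.Vec.Properties using (lookup⇒[]=; lookup∘tabulate)
  open import Relation.Nullary.Decidable using (dec-true)
  open +-*-Solver using (solve; con; _:=_; _:+_; _:*_; _:-_; :-_)

  open import Defs hiding (sum)
  open Rationals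
  open FiniteSums
  open Adjacencies
  open LocalCounts
  open EdgeInequality

  sum-pair : ∀ {n} {f : Fin n → ℚ} {i j} → i ≢ j → (∀ l → l ≢ i → l ≢ j → f l ≡ 0ℚ) → sum f ≡ f i + f j
  sum-pair {f = f} {i} {j} i≢j h = begin
    sum f
      ≡⟨ sum-cong-≗ (λ l → split (f l) ⟦ l Fin.≟ i ⟧) ⟩
    sum (λ l → ⟦ l Fin.≟ i ⟧ * f l + (1ℚ - ⟦ l Fin.≟ i ⟧) * f l)
      ≡⟨ ∑-distrib-+ (λ l → ⟦ l Fin.≟ i ⟧ * f l) (λ l → (1ℚ - ⟦ l Fin.≟ i ⟧) * f l) ⟩
    sum (λ l → ⟦ l Fin.≟ i ⟧ * f l) + sum (λ l → (1ℚ - ⟦ l Fin.≟ i ⟧) * f l)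
      ≡⟨ cong₂ _+_ (trans (sum-single i (λ l l≢i → ≡0⇒*≡0 (⟦⟧-no (l Fin.≟ i) l≢i) (f l)))
          (≡1⇒*≡ (⟦⟧-yes (i Fin.≟ i) refl) (f i)))
           (trans (sum-single j rest) (≡1⇒*≡ (cong (λ p → 1ℚ - p) (⟦⟧-no (j Fin.≟ i) (i≢j ∘ sym)))
               (f j))) ⟩
    f i + f j ∎
    where
    open ≡-Reasoning
    split = solve 2 (λ a p → a := p :* a :+ (con 1ℚ :- p) :* a) refl
    annihilate = solve 1 (λ p → (con 1ℚ :- p) :* con 0ℚ := con 0ℚ) refl
    rest : ∀ l → l ≢ j → (1ℚ - ⟦ l Fin.≟ i ⟧) * f l ≡ 0ℚ
    rest l l≢j with l Fin.≟ i
    ... | yes refl = *-zeroˡ (f l)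
    ... | no l≢i   = trans (cong ((1ℚ - 0ℚ) *_) (h l l≢i l≢j)) (annihilate 0ℚ)

  three-members : ∀ {n} {p : Subset.Subset n} {u v w} → u ∈ p → v ∈ p → w ∈ p → u ≢ v → u ≢ w → v ≢ w →
      3 ℕ.≤ ∣ p ∣
  three-members {p = p} {u} {v} {w} u∈ v∈ w∈ u≢v u≢w v≢w =
    ℕ.≤-trans (ℕ.s≤s (ℕ.≤-trans (ℕ.s≤s (ℕ.≤-trans (ℕ.s≤s ℕ.z≤n) (x∈p⇒∣p-x∣<∣p∣ w∈″)))
        (x∈p⇒∣p-x∣<∣p∣ v∈′))) (x∈p⇒∣p-x∣<∣p∣ u∈)
    where
    v∈′ : v ∈ p Subset.- u
    v∈′ = x∈p∧x≢y⇒x∈p-y v∈ (u≢v ∘ sym)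
    w∈″ : w ∈ (p Subset.- u) Subset.- v
    w∈″ = x∈p∧x≢y⇒x∈p-y (x∈p∧x≢y⇒x∈p-y w∈ (u≢w ∘ sym)) (v≢w ∘ sym)

  module Pendant (H : Hypergraph) where

    open Incidence H

    1≤deg : ∀ {v e} → v ∈ᵉ e → 1ℚ ≤ deg v
    1≤deg {v} {e} v∈e = subst₂ _≤_ (∈⇒χ≡1 v∈e) (sym (deg≡sum v)) (single≤sum (λ f → 0≤χ f v) e)

    another : ∀ {e} → 2 ℕ.≤ ∣ edge H e ∣ → ∀ u → ∃ λ w → u ≢ w × w ∈ᵉ e
    another {e} 2≤ u with Fin.any? (λ w → ¬? (u Fin.≟ w) ×-dec (w ∈? edge H e))
    ... | yes found = found
    ... | no none   = contradiction (begin-strict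
      1ℚ              <⟨ ι-mono-< {1} {2} ℕ.≤-refl ⟩
      ι 2             ≤⟨ ι-mono 2≤ ⟩
      ι ∣ edge H e ∣  ≡⟨ size≡sum e ⟩
      sum (χ e)       ≡⟨ sum-single u (λ w w≢u → ∉⇒χ≡0 (λ w∈e → none (w , w≢u ∘ sym , w∈e))) ⟩
      χ e u           ≤⟨ χ≤1 e u ⟩
      1ℚ              ∎) (<-irrefl refl)
      where open ≤-Reasoning

    ∈nonPendant : ∀ {v} → 1 ℕ.< degree H v → v ∈ nonPendant H
    ∈nonPendant {v} h = lookup⇒[]= v (nonPendant H)
        (trans (lookup∘tabulate (λ v → does (1 ℕ.<? degree H v)) v) (dec-true (1 ℕ.<? degree H v) h))

    record Ends (e : Edge H) : Set where
      field
        u w  : Vertex H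
        u≢w  : u ≢ w
        u∈e  : u ∈ᵉ e
        w∈e  : w ∈ᵉ e
        rest : ∀ v → v ∈ᵉ e → v ≢ u → v ≢ w → ¬ 1 ℕ.< degree H v

    -- An edge may have fewer than two non-pendant vertices. Pendant ones, available since the edge
    -- has at least two vertices, then fill the places, so that every edge is treated as having two
    -- ends.
    ends : ∀ e → 2 ℕ.≤ ∣ edge H e ∣ → ∣ edge H e ∩ nonPendant H ∣ ℕ.≤ 2 → Ends e
    ends e 2≤ ≤2 with Fin.any? (λ u → (u ∈? edge H e) ×-dec (1 ℕ.<? degree H u))
    ... | no none with another 2≤ (proj₁ (edge-nonempty H e))
    ...   | w , u≢w , w∈e = record { u≢w = u≢w ; u∈e = proj₂ (edge-nonempty H e) ; w∈e = w∈e ; rest = λ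
        v v∈e _ _ h → none (v , v∈e , h) }
    ends e 2≤ ≤2 | yes (u , u∈e , hu) with Fin.any? (λ w → ¬? (u Fin.≟ w) ×-dec ((w ∈? edge H e) ×-dec (1 ℕ.<? degree H w)))
    ...   | yes (w , u≢w , w∈e , hw) = record { u≢w = u≢w ; u∈e = u∈e ; w∈e = w∈e ; rest = λ v v∈e v≢u
        v≢w hv →
            ℕ.<-irrefl refl (ℕ.≤-trans (three-members (x∈p∩q⁺ (u∈e , ∈nonPendant hu))
                (x∈p∩q⁺ (w∈e , ∈nonPendant hw)) (x∈p∩q⁺ (v∈e , ∈nonPendant hv))
              u≢w (v≢u ∘ sym) (v≢w ∘ sym)) ≤2) }
    ...   | no none with another 2≤ u
    ...     | w , u≢w , w∈e = record { u≢w = u≢w ; u∈e = u∈e ; w∈e = w∈e ; rest = λ v v∈e v≢u _ hv →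
        none (v , v≢u ∘ sym , v∈e , hv) }

    degree-cases : ∀ {v e} → v ∈ᵉ e → deg v ≡ 1ℚ ⊎ + 2 / 1 ≤ deg v
    degree-cases {v} v∈e with 1 ℕ.<? degree H v
    ... | yes h = inj₂ (ι-mono {2} h)
    ... | no h  = inj₁ (≤-antisym (ι-mono {n = 1} (ℕ.≮⇒≥ h)) (1≤deg v∈e))

  -- The edge weights of the bound are S e = a / (m − 1) + 1 + Σ_{v ∈ e} (deg v − 1).
  module LowDegree (n : ℕ) (H : Hypergraph) (uniform : Uniform (2+ n) H) (tree : Hypertree H)
    {x₀ y₀ d} (P : Path H x₀ y₀ d) (minimal : ∀ l → Path H x₀ y₀ l → d ℕ.≤ l)
    (covered : ∀ v → ∃ λ e → v ∈ edge H e)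
    (a : ℚ)
    (9≤D : + 9 / 1 ≤ ι (size H) - ι d + + 2 / 1)
    (42≤ : + 42 / 1 ≤ ι (suc n) * (ι (size H) - ι d + + 2 / 1 - + 8 / 1))
    (Q≥ : (ι (size H) - ι d + + 2 / 1 - + 1 / 4) * ι (suc n) ≤ a * (a - ι (suc n) + 1ℚ))
    (Q≤ : a * (a - ι (suc n) + 1ℚ) ≤ (ι (size H) - ι d + + 2 / 1) * ι (suc n))
    (0≤t : 0ℚ ≤ a - ι (suc n) + 1ℚ)
    (degrees : ∀ v → Incidence.deg H v ≤ ι (size H) - ι d + + 2 / 1 - 1ℚ) where

    open Hypertree tree
    open Incidence H
    open Pendant H
    open Adjacency n H linear
    open Ball H linear acyclic
    open Bounds H linear acyclic P minimal

    private
      r D β : ℚ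
      r = ι (suc n)
      D = ι (size H) - ι d + + 2 / 1
      1≤r : 1ℚ ≤ r
      1≤r = ι-mono {1} {suc n} (ℕ.s≤s ℕ.z≤n)
      0<r : 0ℚ < r
      0<r = <-≤-trans 0<1 1≤r
      β = a * inv r + 1ℚ

    open Local r D a 1≤r 9≤D 42≤ Q≥ Q≤ 0≤t

    private
      0<a : 0ℚ < a
      0<a = <-≤-trans (0<lit (+ 11 / 2)) (≤-by (shift r a) (0≤a′ ⊕ ≤-trans 0≤1 1≤r))
        where
        shift = solve 2 (λ r a → a :- con (+ 11 / 2) := (a :- r :- con (+ 11 / 2)) :+ r) refl

      S : Edge H → ℚ
      S e = β + sum (λ v → χ e v * (deg v - 1ℚ))

      0≤excess : ∀ e v → 0ℚ ≤ χ e v * (deg v - 1ℚ)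
      0≤excess e v = subst (_≤ χ e v * (deg v - 1ℚ)) (*-zeroʳ (χ e v))
          (χ-mono (λ v∈e → ≤⇒0≤- (1≤deg v∈e)))

      0<S : ∀ e → 0ℚ < S e
      0<S e = 0<-+ (+-mono-≤-< (0≤-* 0≤a (<⇒≤ (0<inv 0<r))) 0<1) (0≤sum (0≤excess e))

      s : Vertex H → ℚ
      s v = sum (λ f → χ f v * S f)

      -- Another edge f at v has the weight β + (deg v - 1) + `excess v f`. There are deg v - 1 such
      -- edges, and their excesses add up to `beyond e v`.
      s≡ : ∀ {v e} → v ∈ᵉ e → s v ≡ S e + (deg v - 1ℚ) * (β + (deg v - 1ℚ)) + beyond e v
      s≡ {v} {e} v∈e = begin
        s v
          ≡⟨ sub-add (s v) (χ e v * S e) ⟩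
        (s v - χ e v * S e) + χ e v * S e
          ≡⟨ cong₂ _+_ (sym (sum-apart e (λ f → χ f v * S f))) (≡1⇒*≡ (∈⇒χ≡1 v∈e) (S e)) ⟩
        sum (λ f → (χ f v * S f) * apart f e) + S e
          ≡⟨ cong (_+ S e) (sum-cong-≗ (λ f → trans (*-assoc (χ f v) (S f) (apart f e))
              (trans (χ-cong (λ v∈f → cong (_* apart f e) (S-split v∈f)))
               (expand (χ f v) (apart f e) (β + (deg v - 1ℚ)) (excess v f))))) ⟩
        sum (λ f → (χ f v * apart f e) * (β + (deg v - 1ℚ)) + (χ f v * apart f e) * excess v f) + S e
          ≡⟨ cong (_+ S e) (trans (∑-distrib-+ (λ f → (χ f v * apart f e) * (β + (deg v - 1ℚ)))
              (λ f → (χ f v * apart f e) * excess v f))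
               (cong (_+ beyond e v) (trans (sym (*-distribʳ-sum (β + (deg v - 1ℚ))
                   (λ f → χ f v * apart f e))) (cong (_* (β + (deg v - 1ℚ))) (sum-χ-apart v∈e))))) ⟩
        ((deg v - 1ℚ) * (β + (deg v - 1ℚ)) + beyond e v) + S e
          ≡⟨ rotate ((deg v - 1ℚ) * (β + (deg v - 1ℚ))) (beyond e v) (S e) ⟩
        S e + (deg v - 1ℚ) * (β + (deg v - 1ℚ)) + beyond e v ∎
        where
        open ≡-Reasoning
        expand = solve 4 (λ c p u w → c :* ((u :+ w) :* p) := (c :* p) :* u :+ (c :* p) :* w) refl
        rotate = solve 3 (λ u v w → (u :+ v) :+ w := w :+ u :+ v) refl
        assemble = solve 3 (λ b u w → b :+ (w :+ u) := (b :+ u) :+ w) refl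
        swap = solve 3 (λ a b c → (a :* b) :* c := (a :* c) :* b) refl
        S-split : ∀ {f} → v ∈ᵉ f → S f ≡ (β + (deg v - 1ℚ)) + excess v f
        S-split {f} v∈f = trans (cong (λ h → β + h) (begin
          sum (λ z → χ f z * (deg z - 1ℚ))
            ≡⟨ sub-add _ (χ f v * (deg v - 1ℚ)) ⟩
          (sum (λ z → χ f z * (deg z - 1ℚ)) - χ f v * (deg v - 1ℚ)) + χ f v * (deg v - 1ℚ)
            ≡⟨ cong₂ _+_ (trans (sym (sum-apart v (λ z → χ f z * (deg z - 1ℚ))))
                (sum-cong-≗ (λ z → swap (χ f z) (deg z - 1ℚ) (apart z v))))
                 (≡1⇒*≡ (∈⇒χ≡1 v∈f) (deg v - 1ℚ)) ⟩
          excess v f + (deg v - 1ℚ) ∎)) (assemble β (deg v - 1ℚ) (excess v f))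

      0≤excess-at : ∀ v f → 0ℚ ≤ excess v f
      0≤excess-at v f = 0≤sum (λ z → subst (0ℚ ≤_) (swap (χ f z) (deg z - 1ℚ) (apart z v))
          (0≤-* (0≤excess f z) (Unit.0≤ (unit-apart z v))))
        where
        swap = solve 3 (λ a b c → (a :* b) :* c := (a :* c) :* b) refl

      0≤beyond : ∀ e v → 0ℚ ≤ beyond e v
      0≤beyond e v = 0≤sum (λ f → 0≤-* (0≤-* (0≤χ f v) (Unit.0≤ (unit-apart f e))) (0≤excess-at v f))

      beyond-pendant : ∀ {e v} → v ∈ᵉ e → deg v ≡ 1ℚ → beyond e v ≡ 0ℚ
      beyond-pendant {e} {v} v∈e d≡1 = sum-zero (λ f → ≡0⇒*≡0 (≤-antisym
        (subst (χ f v * apart f e ≤_) (trans (sum-χ-apart v∈e) (cong (_- 1ℚ) d≡1))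
            (single≤sum (λ f → 0≤-* (0≤χ f v) (Unit.0≤ (unit-apart f e))) f))
        (0≤-* (0≤χ f v) (Unit.0≤ (unit-apart f e)))) (excess v f))

      super : ∀ e → edgeSum (λ v → inv (a + deg v) * s v) e ≤ S e
      super e = subst (_≤ S e) (sym total) (edge-inequality x y (beyond e u) (beyond e w) (S e)
          (1≤deg u∈e) (1≤deg w∈e)
          (0≤gap x y (beyond e u) (beyond e w) (S e) (degrees u) (degrees w) (0≤beyond e u)
              (0≤beyond e w) N≤ (<⇒≤ (0<S e)) rS≡
            (cases u∈e) (cases w∈e)))
        where
        e-ends : Ends e
        e-ends = ends e (subst (2 ℕ.≤_) (sym (uniform e)) (ℕ.s≤s (ℕ.s≤s ℕ.z≤n))) (two-non-pendant e)
        open Ends e-ends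
        x y c : ℚ
        x = deg u
        y = deg w
        c = inv (a + 1ℚ) * S e
        rest-pendant : ∀ {v} → v ∈ᵉ e → v ≢ u → v ≢ w → deg v ≡ 1ℚ
        rest-pendant {v} v∈e v≢u v≢w with degree-cases v∈e
        ... | inj₁ d≡1 = d≡1
        ... | inj₂ 2≤d = contradiction (ι-cancel-≤ {2} 2≤d) (rest v v∈e v≢u v≢w)
        cases : ∀ {v} → v ∈ᵉ e → (deg v ≡ 1ℚ × beyond e v ≡ 0ℚ) ⊎ + 2 / 1 ≤ deg v
        cases v∈e with degree-cases v∈e
        ... | inj₁ d≡1 = inj₁ (d≡1 , beyond-pendant v∈e d≡1)
        ... | inj₂ 2≤d = inj₂ 2≤d
        χ*0 : ∀ {v p} → (v ∈ᵉ e → p ≡ 0ℚ) → χ e v * p ≡ 0ℚ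
        χ*0 {v} h = trans (χ-cong h) (*-zeroʳ (χ e v))
        pair : ∀ (g : Vertex H → ℚ) → (∀ v → v ∈ᵉ e → v ≢ u → v ≢ w → g v ≡ 0ℚ) → sum
            (λ v → χ e v * g v) ≡ g u + g w
        pair g h = trans (sum-pair u≢w (λ v v≢u v≢w → χ*0 (λ v∈e → h v v∈e v≢u v≢w)))
          (cong₂ _+_ (≡1⇒*≡ (∈⇒χ≡1 u∈e) (g u)) (≡1⇒*≡ (∈⇒χ≡1 w∈e) (g w)))
        excess≡ : sum (λ v → χ e v * (deg v - 1ℚ)) ≡ (x - 1ℚ) + (y - 1ℚ)
        excess≡ = pair (λ v → deg v - 1ℚ) (λ v v∈e v≢u v≢w → cong (_- 1ℚ) (rest-pendant v∈e v≢u v≢w))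
        beyond≡ : sum (λ v → χ e v * beyond e v) ≡ beyond e u + beyond e w
        beyond≡ = pair (beyond e) (λ v v∈e v≢u v≢w → beyond-pendant v∈e (rest-pendant v∈e v≢u v≢w))
        -- The ball count gives 1 + (x - 1) + (y - 1) + N ≤ D + 3, where N is the left side.
        N≤ : beyond e u + beyond e w ≤ D + + 4 / 1 - (x + y)
        N≤ = ≤-by (regroup (ι (size H)) (ι d) x y (beyond e u) (beyond e w))
          (≤⇒0≤- (subst (_≤ (ι (size H) - ι d) + ι 5) (cong₂ _+_ (cong (λ h → 1ℚ + h) excess≡) beyond≡)
              (ball-bound e)))
          where
          regroup = solve 6 (λ k d x y p q → (k :- d :+ con (+ 2 / 1)) :+ con (+ 4 / 1) :- (x :+ y) :-
              (p :+ q) := ((k :- d) :+ con (+ 5 / 1)) :- ((con 1ℚ :+ ((x :- con 1ℚ) :+ (y :-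
              (con 1ℚ)))) :+ (p :+ q))) refl
        weigh = solve 4 (λ r a i u → r :* ((a :* i :+ con 1ℚ) :+ u) := a :* (r :* i) :+ r :* (u :+
            (con 1ℚ))) refl
        tidy = solve 4 (λ r a x y → a :* con 1ℚ :+ r :* (((x :- con 1ℚ) :+ (y :- con 1ℚ)) :+ (con
            1ℚ)) := a :+ r :* (x :+ y :- con 1ℚ)) refl
        rS≡ : r * S e ≡ a + r * (x + y - 1ℚ)
        rS≡ = trans (weigh r a (inv r) _) (trans (cong₂ (λ p q → a * p + r * (q + 1ℚ)) (*-inv 0<r)
            excess≡) (tidy r a x y))
        -- `z` is what the other end contributes to the weight, so β + (deg v - 1) is S e - z and β
        -- disappears from the formula.
        s-end : ∀ {v} → v ∈ᵉ e → (z : ℚ) → S e ≡ β + ((deg v - 1ℚ) + z) → s v ≡ S e + (deg v - 1ℚ) *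
            (S e - z) + beyond e v
        s-end {v} v∈e z eq = trans (s≡ v∈e) (cong (λ h → S e + (deg v - 1ℚ) * h + beyond e v)
            (trans (cancel β (deg v - 1ℚ) z) (cong (_- z) (sym eq))))
          where
          cancel = solve 3 (λ b u z → b :+ u := b :+ (u :+ z) :- z) refl
        g : Vertex H → ℚ
        g v = inv (a + deg v) * s v
        g-rest : ∀ v → v ∈ᵉ e → v ≢ u → v ≢ w → g v - c ≡ 0ℚ
        g-rest v v∈e v≢u v≢w = trans (cong (_- c) (cong₂ (λ p q → inv (a + p) * q) d≡1 (trans (s≡ v∈e)
          (trans (cong₂ (λ p q → S e + (p - 1ℚ) * (β + (p - 1ℚ)) + q) d≡1 (beyond-pendant v∈e d≡1))
              (drop (S e) β))))) (+-inverseʳ c)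
          where
          d≡1 : deg v ≡ 1ℚ
          d≡1 = rest-pendant v∈e v≢u v≢w
          drop = solve 2 (λ S b → S :+ (con 1ℚ :- con 1ℚ) :* (b :+ (con 1ℚ :- con 1ℚ)) :+ (con
              0ℚ) := S) refl
        recentre = solve 3 (λ p g c → p :* g := p :* (g :- c) :+ p :* c) refl
        collect = solve 4 (λ g h c r → ((g :- c) :+ (h :- c)) :+ (con 1ℚ :+ r) :* c := g :+ h :+ (r :-
            (con 1ℚ)) :* c) refl
        total : edgeSum g e ≡ inv (a + x) * (S e + (x - 1ℚ) * (S e - (y - 1ℚ)) + beyond e u)
                              + inv (a + y) * (S e + (y - 1ℚ) * (S e - (x - 1ℚ)) + beyond e w) +
                                  (r - 1ℚ) * c
        -- All vertices but the two ends carry the value c. Subtracting c at all 1 + r vertices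
        -- leaves only the ends, and (1 + r) c is added back.
        total = begin
          sum (λ v → χ e v * g v)
            ≡⟨ trans (sum-cong-≗ (λ v → recentre (χ e v) (g v) c))
                (∑-distrib-+ (λ v → χ e v * (g v - c)) (λ v → χ e v * c)) ⟩
          sum (λ v → χ e v * (g v - c)) + sum (λ v → χ e v * c)
            ≡⟨ cong₂ _+_ (pair (λ v → g v - c) g-rest)
                (trans (sym (*-distribʳ-sum c (χ e))) (cong (_* c)
                (trans (sym (size≡sum e)) (cong ι (uniform e))))) ⟩
          ((g u - c) + (g w - c)) + (1ℚ + r) * c
            ≡⟨ collect (g u) (g w) c r ⟩
          g u + g w + (r - 1ℚ) * c
            ≡⟨ cong (_+ (r - 1ℚ) * c) (cong₂ (λ p q → inv (a + x) * p + inv (a + y) * q)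
                 (s-end u∈e (y - 1ℚ) (cong (λ h → β + h) excess≡))
                     (s-end w∈e (x - 1ℚ) (cong (λ h → β + h)
                     (trans excess≡ (+-comm (x - 1ℚ) (y - 1ℚ)))))) ⟩
          inv (a + x) * (S e + (x - 1ℚ) * (S e - (y - 1ℚ)) + beyond e u)
            + inv (a + y) * (S e + (y - 1ℚ) * (S e - (x - 1ℚ)) + beyond e w) + (r - 1ℚ) * c ∎
          where open ≡-Reasoning

    low-degree-bound : ∀ ρ → λ₁ (2+ n) H ρ → ρ ≤ᴿ fromℚ (ϱ * a)
    low-degree-bound = edge-bound a S 0<a 0<S covered super

-- Lipschitz functions and bisection over the rationals

module RootFinding where

  open import Data.Rational.Base
  open import Data.Rational.Properties
  open +-*-Solver using (solve; con; _:=_; _:+_; _:*_; _:-_; :-_)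

  open import Defs using (IsCauchy)
  open Rationals

  module Lipschitz (A B : ℚ) where

    -- The bound `M` accompanies the Lipschitz constant because the constant of a product depends on
    -- it.
    record Lip (f : ℚ → ℚ) : Set where
      field
        K M    : ℚ
        0≤K    : 0ℚ ≤ K
        0≤M    : 0ℚ ≤ M
        bound  : ∀ s → A ≤ s → s ≤ B → ∣ f s ∣ ≤ M
        change : ∀ s t → A ≤ s → s ≤ B → A ≤ t → t ≤ B → ∣ f s - f t ∣ ≤ K * ∣ s - t ∣

    open Lip

    lip-const : ∀ c → Lip (λ _ → c)
    lip-const c = record
      { K = 0ℚ ; M = ∣ c ∣ ; 0≤K = ≤-refl ; 0≤M = 0≤∣p∣ c ; bound = λ _ _ _ → ≤-refl
      ; change = λ s t _ _ _ _ → ≤-reflexive (trans (cong ∣_∣ (+-inverseʳ c)) (sym (*-zeroˡ ∣ s - t ∣)))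
          }

    lip-id : Lip (λ t → t)
    lip-id = record
      { K = 1ℚ ; M = ∣ A ∣ + ∣ B ∣ ; 0≤K = 0≤1 ; 0≤M = 0≤-+ (0≤∣p∣ A) (0≤∣p∣ B) ; bound = λ s A≤s s≤B →
          ∣-∣-≤
          (≤-trans s≤B (≤-trans (p≤∣p∣ B) (≤-by (cancelʳ ∣ A ∣ ∣ B ∣) (0≤∣p∣ A))))
          (≤-trans (neg-antimono-≤ A≤s) (≤-trans (subst (- A ≤_) (∣-p∣≡∣p∣ A) (p≤∣p∣ (- A)))
              (≤-by (cancelˡ ∣ A ∣ ∣ B ∣) (0≤∣p∣ B))))
      ; change = λ s t _ _ _ _ → ≤-reflexive (sym (*-identityˡ ∣ s - t ∣)) }
      where
      cancelʳ = solve 2 (λ a b → (a :+ b) :- b := a) refl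
      cancelˡ = solve 2 (λ a b → (a :+ b) :- a := b) refl

    lip-+ : ∀ {f g} → Lip f → Lip g → Lip (λ t → f t + g t)
    lip-+ {f} {g} F G = record
      { K = K F + K G ; M = M F + M G ; 0≤K = 0≤-+ (0≤K F) (0≤K G) ; 0≤M = 0≤-+ (0≤M F) (0≤M G)
      ; bound = λ s p q → ≤-trans (∣p+q∣≤∣p∣+∣q∣ (f s) (g s)) (+-mono-≤ (bound F s p q) (bound G s p q))
      ; change = λ s t p q p′ q′ → begin
          ∣ (f s + g s) - (f t + g t) ∣        ≡⟨ cong ∣_∣ (regroup (f s) (g s) (f t) (g t)) ⟩
          ∣ (f s - f t) + (g s - g t) ∣        ≤⟨ ∣p+q∣≤∣p∣+∣q∣ (f s - f t) (g s - g t) ⟩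
          ∣ f s - f t ∣ + ∣ g s - g t ∣        ≤⟨ +-mono-≤ (change F s t p q p′ q′)
              (change G s t p q p′ q′) ⟩
          K F * ∣ s - t ∣ + K G * ∣ s - t ∣    ≡⟨ *-distribʳ-+ ∣ s - t ∣ (K F) (K G) ⟨
          (K F + K G) * ∣ s - t ∣              ∎ }
      where
      open ≤-Reasoning
      regroup = solve 4 (λ a b c d → (a :+ b) :- (c :+ d) := (a :- c) :+ (b :- d)) refl

    lip-* : ∀ {f g} → Lip f → Lip g → Lip (λ t → f t * g t)
    lip-* {f} {g} F G = record
      { K = M F * K G + M G * K F ; M = M F * M G
      ; 0≤K = 0≤-+ (0≤-* (0≤M F) (0≤K G)) (0≤-* (0≤M G) (0≤K F)) ; 0≤M = 0≤-* (0≤M F) (0≤M G)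
      ; bound = λ s p q → subst (_≤ M F * M G) (sym (∣p*q∣≡∣p∣*∣q∣ (f s) (g s)))
          (*-mono (0≤∣p∣ (f s)) (0≤M G) (bound F s p q) (bound G s p q))
      ; change = λ s t p q p′ q′ → begin
          ∣ f s * g s - f t * g t ∣
            ≡⟨ cong ∣_∣ (regroup (f s) (g s) (f t) (g t)) ⟩
          ∣ f s * (g s - g t) + g t * (f s - f t) ∣
            ≤⟨ ∣p+q∣≤∣p∣+∣q∣ (f s * (g s - g t)) (g t * (f s - f t)) ⟩
          ∣ f s * (g s - g t) ∣ + ∣ g t * (f s - f t) ∣
            ≡⟨ cong₂ _+_ (∣p*q∣≡∣p∣*∣q∣ (f s) (g s - g t)) (∣p*q∣≡∣p∣*∣q∣ (g t) (f s - f t)) ⟩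
          ∣ f s ∣ * ∣ g s - g t ∣ + ∣ g t ∣ * ∣ f s - f t ∣
            ≤⟨ +-mono-≤ (*-mono (0≤∣p∣ (f s)) (0≤-* (0≤K G) (0≤∣p∣ (s - t))) (bound F s p q)
                (change G s t p q p′ q′))
                        (*-mono (0≤∣p∣ (g t)) (0≤-* (0≤K F) (0≤∣p∣ (s - t))) (bound G t p′ q′)
                            (change F s t p q p′ q′)) ⟩
          M F * (K G * ∣ s - t ∣) + M G * (K F * ∣ s - t ∣)
            ≡⟨ collect (M F) (K G) (M G) (K F) ∣ s - t ∣ ⟩
          (M F * K G + M G * K F) * ∣ s - t ∣ ∎ }
      where
      open ≤-Reasoning
      regroup = solve 4 (λ a b c d → a :* b :- c :* d := a :* (b :- d) :+ d :* (a :- c)) refl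
      collect = solve 5 (λ a b c d h → a :* (b :* h) :+ c :* (d :* h) := (a :* b :+ c :* d) :* h) refl

    lip-- : ∀ {f g} → Lip f → Lip g → Lip (λ t → f t - g t)
    lip-- {f} {g} F G = record
      { K = K F + K G ; M = M F + M G ; 0≤K = 0≤-+ (0≤K F) (0≤K G) ; 0≤M = 0≤-+ (0≤M F) (0≤M G)
      ; bound = λ s p q → ≤-trans (∣p-q∣≤∣p∣+∣q∣ (f s) (g s)) (+-mono-≤ (bound F s p q) (bound G s p q))
      ; change = λ s t p q p′ q′ → begin
          ∣ (f s - g s) - (f t - g t) ∣        ≡⟨ cong ∣_∣ (regroup (f s) (g s) (f t) (g t)) ⟩
          ∣ (f s - f t) - (g s - g t) ∣        ≤⟨ ∣p-q∣≤∣p∣+∣q∣ (f s - f t) (g s - g t) ⟩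
          ∣ f s - f t ∣ + ∣ g s - g t ∣        ≤⟨ +-mono-≤ (change F s t p q p′ q′)
              (change G s t p q p′ q′) ⟩
          K F * ∣ s - t ∣ + K G * ∣ s - t ∣    ≡⟨ *-distribʳ-+ ∣ s - t ∣ (K F) (K G) ⟨
          (K F + K G) * ∣ s - t ∣              ∎ }
      where
      open ≤-Reasoning
      regroup = solve 4 (λ a b c d → (a :- b) :- (c :- d) := (a :- c) :- (b :- d)) refl

    -- For A ≥ 1 the arguments t + c are at least 1, so the inverses are at most 1 and 1 serves as a
    -- Lipschitz constant.
    lip-inv : ∀ c → 1ℚ ≤ A → 0ℚ ≤ c → Lip (λ t → inv (t + c))
    lip-inv c 1≤A 0≤c = record
      { K = 1ℚ ; M = 1ℚ ; 0≤K = 0≤1 ; 0≤M = 0≤1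
      ; bound = λ s p _ → subst (_≤ 1ℚ) (sym (0≤p⇒∣p∣≡p (<⇒≤ (0<inv (0<+ s p))))) (inv≤1 s p)
      ; change = λ s t p _ p′ _ → begin
          ∣ inv (s + c) - inv (t + c) ∣
            ≡⟨ cong ∣_∣ (difference s t p p′) ⟩
          ∣ (inv (s + c) * inv (t + c)) * (t - s) ∣
            ≡⟨ ∣p*q∣≡∣p∣*∣q∣ (inv (s + c) * inv (t + c)) (t - s) ⟩
          ∣ inv (s + c) * inv (t + c) ∣ * ∣ t - s ∣
            ≡⟨ cong₂ _*_ (0≤p⇒∣p∣≡p (0≤-* (<⇒≤ (0<inv (0<+ s p))) (<⇒≤ (0<inv (0<+ t p′)))))
                (∣p-q∣≡∣q-p∣ t s) ⟩
          (inv (s + c) * inv (t + c)) * ∣ s - t ∣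
            ≤⟨ *-monoʳ ∣ s - t ∣ (0≤∣p∣ (s - t)) (*-mono (<⇒≤ (0<inv (0<+ s p))) 0≤1 (inv≤1 s p)
                (inv≤1 t p′)) ⟩
          1ℚ * ∣ s - t ∣ ∎ }
      where
      open ≤-Reasoning
      1≤+ : ∀ s → A ≤ s → 1ℚ ≤ s + c
      1≤+ s A≤s = +-mono-≤ (≤-trans 1≤A A≤s) 0≤c
      0<+ : ∀ s → A ≤ s → 0ℚ < s + c
      0<+ s A≤s = <-≤-trans 0<1 (1≤+ s A≤s)
      inv≤1 : ∀ s → A ≤ s → inv (s + c) ≤ 1ℚ
      inv≤1 s A≤s = *-cancelˡ (s + c) (0<+ s A≤s) (subst₂ _≤_ (sym (*-inv (0<+ s A≤s)))
          (sym (*-identityʳ (s + c))) (1≤+ s A≤s))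
      expand = solve 5 (λ s t c i j → (i :* j) :* (t :- s) := i :* ((t :+ c) :* j) :- ((s :+ c) :* i) :*
          j) refl
      unit = solve 2 (λ i j → i :* con 1ℚ :- con 1ℚ :* j := i :- j) refl
      difference : ∀ s t → A ≤ s → A ≤ t → inv (s + c) - inv (t + c) ≡ (inv (s + c) * inv (t + c)) *
          (t - s)
      difference s t p p′ = sym (trans (expand s t c (inv (s + c)) (inv (t + c)))
        (trans (cong₂ (λ u v → inv (s + c) * u - v * inv (t + c)) (*-inv (0<+ t p′)) (*-inv (0<+ s p)))
            (unit (inv (s + c)) (inv (t + c)))))

  module Bisection (f : ℚ → ℚ) (A B : ℚ) (A≤B : A ≤ B) (fA<0 : f A < 0ℚ) (0≤fB : 0ℚ ≤ f B) where

    -- Strictness is kept at the lower end: it later separates a lower end from the root by a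
    -- positive distance.
    record Bracket : Set where
      field
        lo hi : ℚ
        A≤lo  : A ≤ lo
        lo≤hi : lo ≤ hi
        hi≤B  : hi ≤ B
        flo<0 : f lo < 0ℚ
        0≤fhi : 0ℚ ≤ f hi

    open Bracket public

    private
      mid : ℚ → ℚ → ℚ
      mid l h = (l + h) * ½

      mid-lo = solve 2 (λ l h → (l :+ h) :* (con ½) :- l := (h :- l) :* (con ½)) refl
      hi-mid = solve 2 (λ l h → h :- (l :+ h) :* (con ½) := (h :- l) :* (con ½)) refl

      lo≤mid : ∀ {l h} → l ≤ h → l ≤ mid l h
      lo≤mid {l} {h} l≤h = ≤-by (mid-lo l h) (0≤-* (≤⇒0≤- l≤h) (nonNegative⁻¹ ½))

      mid≤hi : ∀ {l h} → l ≤ h → mid l h ≤ h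
      mid≤hi {l} {h} l≤h = ≤-by (hi-mid l h) (0≤-* (≤⇒0≤- l≤h) (nonNegative⁻¹ ½))

    -- The decision is an argument, so facts about one halving follow by cases on it.
    halve : ∀ (b : Bracket) → Dec (f (mid (lo b) (hi b)) < 0ℚ) → Bracket
    halve b (yes f<0) = record { A≤lo = ≤-trans (A≤lo b) (lo≤mid (lo≤hi b)) ; lo≤hi = mid≤hi (lo≤hi b) ;
        hi≤B = hi≤B b ; flo<0 = f<0 ; 0≤fhi = 0≤fhi b }
    halve b (no f≮0)  = record { A≤lo = A≤lo b ; lo≤hi = lo≤mid (lo≤hi b) ; hi≤B = ≤-trans
        (mid≤hi (lo≤hi b)) (hi≤B b) ; flo<0 = flo<0 b ; 0≤fhi = ≮⇒≥ f≮0 }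

    private
      halve-lo : ∀ b dec → lo b ≤ lo (halve b dec)
      halve-lo b (yes _) = lo≤mid (lo≤hi b)
      halve-lo b (no _)  = ≤-refl

      halve-hi : ∀ b dec → hi (halve b dec) ≤ hi b
      halve-hi b (yes _) = ≤-refl
      halve-hi b (no _)  = mid≤hi (lo≤hi b)

      halve-width : ∀ b dec → hi (halve b dec) - lo (halve b dec) ≡ (hi b - lo b) * ½
      halve-width b (yes _) = hi-mid (lo b) (hi b)
      halve-width b (no _)  = mid-lo (lo b) (hi b)

    abstract

      bracket : ℕ → Bracket
      bracket zero    = record { A≤lo = ≤-refl ; lo≤hi = A≤B ; hi≤B = ≤-refl ; flo<0 = fA<0 ; 0≤fhi =
          0≤fB }
      bracket (suc n) = halve (bracket n) (f (mid (lo (bracket n)) (hi (bracket n))) <? 0ℚ)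

      lo-mono : ∀ {m n} → m ℕ.≤′ n → lo (bracket m) ≤ lo (bracket n)
      lo-mono ℕ.≤′-refl = ≤-refl
      lo-mono {n = suc n} (ℕ.≤′-step m≤n) = ≤-trans (lo-mono m≤n)
          (halve-lo (bracket n) (f (mid (lo (bracket n)) (hi (bracket n))) <? 0ℚ))

      hi-mono : ∀ {m n} → m ℕ.≤′ n → hi (bracket n) ≤ hi (bracket m)
      hi-mono ℕ.≤′-refl = ≤-refl
      hi-mono {n = suc n} (ℕ.≤′-step m≤n) = ≤-trans
          (halve-hi (bracket n) (f (mid (lo (bracket n)) (hi (bracket n))) <? 0ℚ)) (hi-mono m≤n)

      bracket-zero : hi (bracket 0) - lo (bracket 0) ≡ B - A
      bracket-zero = refl

      bracket-suc : ∀ n → hi (bracket (suc n)) - lo (bracket (suc n)) ≡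
          (hi (bracket n) - lo (bracket n)) * ½
      bracket-suc n = halve-width (bracket n) (f (mid (lo (bracket n)) (hi (bracket n))) <? 0ℚ)

    private
      width : ℕ → ℚ
      width n = hi (bracket n) - lo (bracket n)

      0≤width : ∀ n → 0ℚ ≤ width n
      0≤width n = ≤⇒0≤- (lo≤hi (bracket n))

      -- 2ⁿ ≥ n + 1
      width-bound : ∀ n → (1ℚ + ι n) * width n ≤ B - A
      width-bound zero    = ≤-reflexive (trans (one (width 0)) bracket-zero)
        where
        one = solve 1 (λ p → (con 1ℚ :+ con 0ℚ) :* p := p) refl
      width-bound (suc n) = ≤-trans (≤-by
        (trans (cong (λ h → (1ℚ + ι n) * width n - (1ℚ + (1ℚ + ι n)) * h) (bracket-suc n))
          (gap (ι n) (width n))) (0≤-* (0≤-* (0≤ι n) (0≤width n)) (nonNegative⁻¹ ½))) (width-bound n)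
        where
        gap = solve 2 (λ n w → (con 1ℚ :+ n) :* w :- (con 1ℚ :+ (con 1ℚ :+ n)) :* (w :* (con ½))
            := n :* w :* (con ½)) refl

    width→0 : ∀ ε → 0ℚ < ε → ∃ λ N → ∀ n → N ℕ.≤ n → hi (bracket n) - lo (bracket n) ≤ ε
    width→0 ε 0<ε with archimedean ((B - A) * inv ε)
    ... | N , h = N , λ n N≤n → *-cancelˡ (1ℚ + ι n) (0<-+ 0<1 (0≤ι n)) (begin
      (1ℚ + ι n) * width n         ≤⟨ width-bound n ⟩
      B - A                        ≡⟨ trans (cong ((B - A) *_) (*-inv 0<ε)) (*-identityʳ (B - A)) ⟨
      (B - A) * (ε * inv ε)        ≡⟨ rotate (B - A) ε (inv ε) ⟩
      ((B - A) * inv ε) * ε        ≤⟨ *-monoʳ ε (<⇒≤ 0<ε)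
          (≤-trans h (≤-trans (ι-mono N≤n) (ι-mono (ℕ.n≤1+n n)))) ⟩
      (1ℚ + ι n) * ε               ∎)
      where
      open ≤-Reasoning
      rotate = solve 3 (λ a b c → a :* (b :* c) := (a :* c) :* b) refl

    lo-cauchy : IsCauchy (λ n → lo (bracket n))
    lo-cauchy ε 0<ε = N , λ i j N≤i N≤j → ∣-∣-≤ (close i j N≤i N≤j)
        (subst (_≤ ε) (flip (lo (bracket i)) (lo (bracket j))) (close j i N≤j N≤i))
      where
      N : ℕ
      N = proj₁ (width→0 ε 0<ε)
      flip = solve 2 (λ a b → b :- a := :- (a :- b)) refl
      close : ∀ i j → N ℕ.≤ i → N ℕ.≤ j → lo (bracket i) - lo (bracket j) ≤ ε
      close i j N≤i N≤j = ≤-trans (+-mono-≤ (≤-trans (lo≤hi (bracket i)) (hi-mono (ℕ.≤⇒≤′ N≤i)))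
          (neg-antimono-≤ (lo-mono (ℕ.≤⇒≤′ N≤j)))) (proj₂ (width→0 ε 0<ε) N ℕ.≤-refl)

    lo≤hi′ : ∀ m n → lo (bracket m) ≤ hi (bracket n)
    lo≤hi′ m n with ℕ.≤-total m n
    ... | inj₁ m≤n = ≤-trans (lo-mono (ℕ.≤⇒≤′ m≤n)) (lo≤hi (bracket n))
    ... | inj₂ n≤m = ≤-trans (lo≤hi (bracket m)) (hi-mono (ℕ.≤⇒≤′ n≤m))

    module _ (lip : Lipschitz.Lip A B f) where

      open Lipschitz.Lip lip

      -- The two ends may come from different stages. Thus a negative value at one lower end keeps
      -- all upper ends at a distance, and for m = n the value tends to 0 with the width.
      value-bound : ∀ m n → - f (lo (bracket m)) ≤ K * (hi (bracket n) - lo (bracket m))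
      value-bound m n = begin
        - f l                 ≤⟨ subst (- f l ≤_) (+-comm (- f l) (f h))
            (subst (_≤ - f l + f h) (+-identityʳ (- f l)) (+-monoʳ-≤ (- f l) (0≤fhi (bracket n)))) ⟩
        f h - f l             ≤⟨ p≤∣p∣ (f h - f l) ⟩
        ∣ f h - f l ∣         ≤⟨ change h l (≤-trans (A≤lo (bracket n)) (lo≤hi (bracket n)))
            (hi≤B (bracket n)) (A≤lo (bracket m)) (≤-trans (lo≤hi (bracket m)) (hi≤B (bracket m))) ⟩
        K * ∣ h - l ∣         ≡⟨ cong (K *_) (0≤p⇒∣p∣≡p (≤⇒0≤- (lo≤hi′ m n))) ⟩
        K * (h - l)           ∎
        where
        open ≤-Reasoning
        l h : ℚ
        l = lo (bracket m)
        h = hi (bracket n)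

      value→0 : ∀ ε → 0ℚ < ε → ∃ λ N → ∀ n → N ℕ.≤ n → - f (lo (bracket n)) ≤ ε
      value→0 ε 0<ε = N , λ n N≤n → begin
        - f (lo (bracket n))                         ≤⟨ value-bound n n ⟩
        K * width n                                  ≤⟨ ≤-by (gap K (width n)) (0≤width n) ⟩
        (1ℚ + K) * width n
            ≤⟨ *-monoˡ (1ℚ + K) (0≤-+ 0≤1 0≤K) (proj₂ small n N≤n) ⟩
        (1ℚ + K) * (ε * inv (1ℚ + K))                ≡⟨ rotate (1ℚ + K) ε (inv (1ℚ + K)) ⟩
        ε * ((1ℚ + K) * inv (1ℚ + K))
            ≡⟨ trans (cong (ε *_) (*-inv (0<-+ 0<1 0≤K))) (*-identityʳ ε) ⟩
        ε                                            ∎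
        where
        open ≤-Reasoning
        small : ∃ λ N → ∀ n → N ℕ.≤ n → hi (bracket n) - lo (bracket n) ≤ ε * inv (1ℚ + K)
        small = width→0 (ε * inv (1ℚ + K)) (0<-* 0<ε (0<inv (0<-+ 0<1 0≤K)))
        N : ℕ
        N = proj₁ small
        gap = solve 2 (λ k w → (con 1ℚ :+ k) :* w :- k :* w := w) refl
        rotate = solve 3 (λ a b c → a :* (b :* c) := b :* (a :* c)) refl

-- The recurrence along the arms and the defect at the centre

module PathArms where

  open import Data.Rational.Base using (ℚ; 0ℚ; 1ℚ; _+_; _*_; _-_; -_; _≤_; _<_; _/_)
  open import Data.Rational.Properties
  open +-*-Solver using (solve; con; _:=_; _:+_; _:*_; _:-_; :-_)

  open Rationals
  open EdgeInequality using (_⊕_; _⊗_; 0≤lit; 0<lit)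
  open RootFinding

  -- With t = (m − 1) λ − m + 2, the entries X 0, X 1, … are those of a
  -- λ-eigenvector at the joints of a path, counted from one end of the path.
  module _ (r : ℚ) where

    -- An inner vertex of a path edge with joint values x and y has the value (x + y) / (t + 1), so
    -- the sum over the edge is E (x + y). The equation at a joint y between x and z then becomes x
    -- + z = φ y, where E (φ + 2) = t + r + 1.
    κ φ E : ℚ → ℚ
    κ t = (r - 1ℚ) * inv (t + r)
    φ t = t - κ t
    E t = (t + r) * inv (t + 1ℚ)

    X : ℚ → ℕ → ℚ
    X t zero          = 1ℚ
    X t (suc zero)    = t
    X t (suc (suc j)) = φ t * X t (suc j) - X t j

    -- The defect of the λ-eigenvalue equation at a joint with q pendant edges
    -- which has arms of lengths suc i and suc l.
    F : ℚ → ℕ → ℕ → ℚ → ℚ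
    -- A pendant edge at the centre has 1 / t of the centre's value at each of its r other vertices.
    -- The form `t + 0ℚ` is the one that `lip-inv` covers.
    F q i l t = (t + r + 1ℚ - q * r * inv (t + 0ℚ)) * (X t (suc i) * X t (suc l))
      - E t * (X t i * X t (suc l) + (X t (suc i) * X t (suc l) + X t (suc i) * X t (suc l)) + X t
          (suc i) * X t l)

    module LipArms (B : ℚ) (1≤r : 1ℚ ≤ r) where

      open Lipschitz (+ 3 / 1) B

      private
        1≤3 : 1ℚ ≤ + 3 / 1
        1≤3 = ι-mono {1} {3} (ℕ.s≤s ℕ.z≤n)

        lip-φ : Lip φ
        lip-φ = lip-- lip-id (lip-* (lip-const (r - 1ℚ)) (lip-inv r 1≤3 (≤-trans 0≤1 1≤r)))

      lip-E : Lip E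
      lip-E = lip-* (lip-+ lip-id (lip-const r)) (lip-inv 1ℚ 1≤3 0≤1)

      lip-X : ∀ j → Lip (λ t → X t j)
      lip-X zero          = lip-const 1ℚ
      lip-X (suc zero)    = lip-id
      lip-X (suc (suc j)) = lip-- (lip-* lip-φ (lip-X (suc j))) (lip-X j)

      lip-F : ∀ q i l → Lip (F q i l)
      lip-F q i l = lip--
        (lip-* (lip-- (lip-+ (lip-+ lip-id (lip-const r)) (lip-const 1ℚ))
            (lip-* (lip-const (q * r)) (lip-inv 0ℚ 1≤3 ≤-refl)))
            (lip-* (lip-X (suc i)) (lip-X (suc l))))
        (lip-* lip-E (lip-+ (lip-+ (lip-* (lip-X i) (lip-X (suc l)))
            (lip-+ (lip-* (lip-X (suc i)) (lip-X (suc l))) (lip-* (lip-X (suc i)) (lip-X (suc l)))))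
            (lip-* (lip-X (suc i)) (lip-X l))))

    module At (t : ℚ) (3≤t : + 3 / 1 ≤ t) (1≤r : 1ℚ ≤ r) where

      0≤t : 0ℚ ≤ t
      0≤t = ≤-trans (0≤lit (+ 3 / 1)) 3≤t

      0<t : 0ℚ < t
      0<t = <-≤-trans (0<lit (+ 3 / 1)) 3≤t

      0≤r : 0ℚ ≤ r
      0≤r = ≤-trans 0≤1 1≤r

      0<t+r : 0ℚ < t + r
      0<t+r = 0<-+ 0<t 0≤r

      0<t+1 : 0ℚ < t + 1ℚ
      0<t+1 = 0<-+ 0<t 0≤1

      t*inv : t * inv (t + 0ℚ) ≡ 1ℚ
      t*inv = trans (cong (_* inv (t + 0ℚ)) (sym (+-identityʳ t)))
          (*-inv (subst (0ℚ <_) (sym (+-identityʳ t)) 0<t))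

      0≤κ : 0ℚ ≤ κ t
      0≤κ = ≤⇒0≤- 1≤r ⊗ <⇒≤ (0<inv 0<t+r)

      κ≤1 : κ t ≤ 1ℚ
      κ≤1 = subst (κ t ≤_) (*-inv 0<t+r) (*-monoʳ {r - 1ℚ} {t + r} (inv (t + r)) (<⇒≤ (0<inv 0<t+r))
          (≤-by (gap t r) (0≤t ⊕ 0≤1)))
        where
        gap = solve 2 (λ t r → (t :+ r) :- (r :- con 1ℚ) := t :+ con 1ℚ) refl

      2≤φ : + 2 / 1 ≤ φ t
      2≤φ = ≤-by (gap t (κ t)) (≤⇒0≤- 3≤t ⊕ ≤⇒0≤- κ≤1)
        where
        gap = solve 2 (λ t k → (t :- k) :- con (+ 2 / 1) := (t :- con (+ 3 / 1)) :+ (con 1ℚ :-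
            k)) refl

      φ*E : (t + r + 1ℚ) ≡ E t * (φ t + (1ℚ + 1ℚ))
      φ*E = sym (trans (expand t r (inv (t + 1ℚ)) (inv (t + r)))
          (trans (cong (λ v → inv (t + 1ℚ) * ((t + r) * (1ℚ + 1ℚ) - (r - 1ℚ) * v + t * (t + r)))
          (*-inv 0<t+r))
        (trans (factor t r (inv (t + 1ℚ))) (trans (cong ((t + r + 1ℚ) *_) (*-inv 0<t+1))
            (*-identityʳ (t + r + 1ℚ))))))
        where
        expand = solve 4 (λ t r i j → ((t :+ r) :* i) :* ((t :- (r :- con 1ℚ) :* j) :+ (con 1ℚ :+
            (con 1ℚ))) := i :* ((t :+ r) :* (con 1ℚ :+ con 1ℚ) :- (r :- con 1ℚ) :* ((t :+ r)
            :* j) :+ t :* (t :+ r))) refl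
        factor = solve 3 (λ t r i → i :* ((t :+ r) :* (con 1ℚ :+ con 1ℚ) :- (r :- con 1ℚ) :* (con
            1ℚ) :+ t :* (t :+ r)) := (t :+ r :+ con 1ℚ) :* ((t :+ con 1ℚ) :* i)) refl

      E*[t+1] : E t * (t + 1ℚ) ≡ t + r
      E*[t+1] = trans (*-assoc (t + r) (inv (t + 1ℚ)) (t + 1ℚ))
          (trans (cong ((t + r) *_) (trans (*-comm (inv (t + 1ℚ)) (t + 1ℚ)) (*-inv 0<t+1)))
          (*-identityʳ (t + r)))

      1≤E : 1ℚ ≤ E t
      1≤E = *-cancelˡ (t + 1ℚ) 0<t+1 (subst₂ _≤_ (sym (*-identityʳ (t + 1ℚ)))
          (trans (sym E*[t+1]) (*-comm (E t) (t + 1ℚ))) (+-monoʳ-≤ t 1≤r))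

      0≤E : 0ℚ ≤ E t
      0≤E = ≤-trans 0≤1 1≤E

      -- Since φ ≥ 2, the sequence is convex, and its first step is t - 1.
      X-growth : ∀ j → 1ℚ ≤ X t j × 1ℚ ≤ X t (suc j) - X t j
      X-growth zero = ≤-refl , ≤-by (gap t) (≤⇒0≤- 3≤t ⊕ 0≤1)
        where
        gap = solve 1 (λ t → (t :- con 1ℚ) :- con 1ℚ := (t :- con (+ 3 / 1)) :+ con 1ℚ) refl
      X-growth (suc j) with X-growth j
      ... | 1≤X , 1≤ΔX = 1≤X′ , ≤-by (gap (φ t) (X t (suc j)) (X t j))
          (≤⇒0≤- 2≤φ ⊗ ≤-trans 0≤1 1≤X′ ⊕ ≤⇒0≤- 1≤ΔX)
        where
        gap = solve 3 (λ f x y → (f :* x :- y) :- x :- con 1ℚ := (f :- con (+ 2 / 1)) :* x :+ ((x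
            :- y) :- con 1ℚ)) refl
        gap′ = solve 2 (λ x y → x :- con 1ℚ := (y :- con 1ℚ) :+ (((x :- y) :- con 1ℚ) :+ (con
            1ℚ))) refl
        1≤X′ : 1ℚ ≤ X t (suc j)
        1≤X′ = ≤-by (gap′ (X t (suc j)) (X t j)) (≤⇒0≤- 1≤X ⊕ ≤⇒0≤- 1≤ΔX ⊕ 0≤1)

      1≤X : ∀ j → 1ℚ ≤ X t j
      1≤X j = proj₁ (X-growth j)

      0<X : ∀ j → 0ℚ < X t j
      0<X j = <-≤-trans 0<1 (1≤X j)

      0≤X : ∀ j → 0ℚ ≤ X t j
      0≤X j = <⇒≤ (0<X j)

      X-step : ∀ j → 1ℚ ≤ X t (suc j) - X t j
      X-step j = proj₂ (X-growth j)

      X-mono : ∀ {i j} → i ℕ.≤′ j → X t i ≤ X t j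
      X-mono ℕ.≤′-refl = ≤-refl
      X-mono {j = suc j} (ℕ.≤′-step i≤j) = ≤-trans (X-mono i≤j) (0≤-⇒≤ (≤-trans 0≤1 (X-step j)))

      X-ratio : ∀ j → X t (suc j) ≤ t * X t j
      X-ratio zero    = ≤-reflexive (sym (*-identityʳ t))
      X-ratio (suc j) = ≤-by (gap t (κ t) (X t (suc j)) (X t j)) (0≤κ ⊗ 0≤X (suc j) ⊕ 0≤X j)
        where
        gap = solve 4 (λ t k x y → t :* x :- ((t :- k) :* x :- y) := k :* x :+ y) refl

      K : ℚ
      K = 1ℚ + t * κ t

      1≤K : 1ℚ ≤ K
      1≤K = ≤-by (gap (t * κ t)) (0≤t ⊗ 0≤κ)
        where
        gap = solve 1 (λ k → (con 1ℚ :+ k) :- con 1ℚ := k) refl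

      -- A conserved quantity of the recurrence, as in Cassini's identity; its value K = 1 + t κ is
      -- read off at j = 0.
      X-determinant : ∀ j → X t (suc j) * X t (suc j) - X t j * X t (suc (suc j)) ≡ K
      X-determinant zero    = base t (κ t)
        where
        base = solve 2 (λ t k → t :* t :- con 1ℚ :* ((t :- k) :* t :- con 1ℚ) := con 1ℚ :+ t :*
            k) refl
      X-determinant (suc j) = trans (step (φ t) (X t (suc j)) (X t j)) (X-determinant j)
        where
        step = solve 3 (λ f x y → (f :* x :- y) :* (f :* x :- y) :- x :* (f :* (f :* x :- y) :- x) := x
            :* x :- y :* (f :* x :- y)) refl

      -- Both defects belong to the same path, with the centre one joint apart. After the cross
      -- multiplication the terms with q and the terms 2 E cancel, and the remaining products
      -- combine to two determinants, both equal to K.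
      F-step : ∀ q i l → F q i (suc l) t * (X t (suc (suc i)) * X t (suc l)) ≡
               F q (suc i) l t * (X t (suc i) * X t (suc (suc l))) + E t * K *
                   (X t (suc l) * X t (suc (suc l)) - X t (suc i) * X t (suc (suc i)))
      F-step q i l = trans (identity (t + r + 1ℚ - q * r * inv (t + 0ℚ)) (E t) (X t i) (X t (suc i))
          (X t (suc (suc i))) (X t l) (X t (suc l)) (X t (suc (suc l))))
        (trans (cong₂ (λ k k′ → F q (suc i) l t * (X t (suc i) * X t (suc (suc l))) + E t *
            (k * (X t (suc l) * X t (suc (suc l))) - k′ * (X t (suc i) * X t (suc (suc i)))))
           (X-determinant i) (X-determinant l))
          (factor (F q (suc i) l t * (X t (suc i) * X t (suc (suc l)))) (E t) K
              (X t (suc l) * X t (suc (suc l))) (X t (suc i) * X t (suc (suc i)))))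
        where
        factor = solve 5 (λ f e k u v → f :+ e :* (k :* u :- k :* v) := f :+ e :* k :* (u :- v)) refl
        identity = solve 8 (λ c e u₀ u₁ u₂ v₀ v₁ v₂ →
            (c :* (u₁ :* v₂) :- e :* (u₀ :* v₂ :+ (u₁ :* v₂ :+ u₁
            :* v₂) :+ u₁ :* v₁)) :* (u₂ :* v₁) := (c :* (u₂ :* v₁) :- e :* (u₁ :* v₁ :+ (u₂ :* v₁ :+
            u₂ :* v₁) :+ u₂ :* v₀)) :* (u₁ :* v₂) :+ e :* ((u₁ :* u₁ :- u₀ :* u₂) :* (v₁ :* v₂) :-
            (v₁ :* v₁ :- v₀ :* v₂) :* (u₁ :* u₂))) refl

      -- The bound 1, rather than mere positivity, lets the gain outweigh the small negative value
      -- of F at a suitable lower end.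
      F-gain : ∀ i l → i ℕ.≤ l → 1ℚ ≤ E t * K * (X t (suc l) * X t (suc (suc l)) - X t i * X t (suc i))
      F-gain i l i≤l = *-mono 0≤1 (≤-trans 0≤1 1≤gain) (*-mono 0≤1 (≤-trans 0≤1 1≤K) 1≤E 1≤K) 1≤gain
        where
        x y z w : ℚ
        x = X t i
        y = X t (suc i)
        z = X t (suc l)
        w = X t (suc (suc l))
        gap = solve 4 (λ x y z w → (z :* w :- x :* y) :- con 1ℚ := (z :- con 1ℚ) :* ((w :- z) :+
            (z :- x)) :+ (((w :- z) :- con 1ℚ) :+ ((z :- x) :+ x :* (z :- y)))) refl
        1≤gain : 1ℚ ≤ z * w - x * y
        1≤gain = ≤-by (gap x y z w) (≤⇒0≤- (1≤X (suc l)) ⊗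
            (≤-trans 0≤1 (X-step (suc l)) ⊕ ≤⇒0≤- (X-mono (ℕ.≤⇒≤′ (ℕ.m≤n⇒m≤1+n i≤l)))) ⊕
          ≤⇒0≤- (X-step (suc l)) ⊕ ≤⇒0≤- (X-mono (ℕ.≤⇒≤′ (ℕ.m≤n⇒m≤1+n i≤l))) ⊕ 0≤X i ⊗ ≤⇒0≤-
              (X-mono (ℕ.≤⇒≤′ (ℕ.s≤s i≤l))))

      -- Each arm contributes at least as much as a pendant edge, since X (suc i) ≤ t X i.
      star-bound : ∀ q i l → 0ℚ ≤ F q i l t → (q + + 2 / 1) * r ≤ t * (t + r - 1ℚ)
      star-bound q i l 0≤F = 0≤-⇒≤ (0≤-cancelˡ (X t (suc i) * X t (suc l))
          (0<-* (0<X (suc i)) (0<X (suc l)))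
        (subst (0ℚ ≤_) (identity t r q (E t) (inv (t + 0ℚ)) (X t i) (X t (suc i)) (X t l) (X t (suc l)))
          ((0≤t ⊗ 0≤F ⊕ 0≤E ⊗ (≤⇒0≤- (X-ratio i) ⊗ 0≤X (suc l) ⊕ ≤⇒0≤- (X-ratio l) ⊗ 0≤X (suc i))) ⊕
            ≤-reflexive (sym (trans (cong₂ (λ u v → (q * r * X t (suc i) * X t (suc l)) * (u - 1ℚ) +
                (X t (suc i) * X t (suc l) + X t (suc i) * X t (suc l)) * (v - (t + r))) t*inv E*[t+1])
              (vanish (q * r * X t (suc i) * X t (suc l))
                  (X t (suc i) * X t (suc l) + X t (suc i) * X t (suc l)) (t + r)))))))
        where
        vanish = solve 3 (λ a b s → a :* (con 1ℚ :- con 1ℚ) :+ b :* (s :- s) := con 0ℚ) refl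
        identity = solve 9 (λ t r q e i u₀ u₁ v₀ v₁ → (t :* ((t :+ r :+ con 1ℚ :- q :* r :* i) :* (u₁ :*
            v₁) :- e :* (u₀ :* v₁ :+ (u₁ :* v₁ :+ u₁ :* v₁) :+ u₁ :* v₀)) :+ e :* ((t :* u₀ :- u₁)
            :* v₁ :+ (t :* v₀ :- v₁) :* u₁)) :+ ((q :* r :* u₁ :* v₁) :* (t :* i :- con 1ℚ) :+ (u₁
            :* v₁ :+ u₁ :* v₁) :* (e :* (t :+ con 1ℚ) :- (t :+ r))) := (u₁ :* v₁) :* (t :* (t :+ r
            :- con 1ℚ) :- (q :+ con (+ 2 / 1)) :* r)) refl

      -- Read at t = q + 4, this supplies the right end of the bisection.
      F-large : ∀ i l → 0ℚ ≤ F (t - + 4 / 1) i l t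
      F-large i l = 0≤-cancelˡ (t * (t + 1ℚ)) (0<-* 0<t 0<t+1)
          (subst (0ℚ ≤_) (identity t r (E t) (inv (t + 0ℚ)) (X t i) (X t (suc i)) (X t l) (X t (suc l)))
        ((((0≤X (suc i) ⊗ 0≤X (suc l)) ⊗ (0≤t ⊗ (≤⇒0≤- 3≤t ⊗ 0≤t ⊕ 0≤t ⊕ 0≤1) ⊕ 0≤lit (+ 4 / 1) ⊗ 0≤r))
            ⊕
          ((0≤t ⊗ <⇒≤ 0<t+1) ⊗ 0≤E) ⊗ (≤-trans 0≤1 (X-step i) ⊗ 0≤X (suc l) ⊕ ≤-trans 0≤1 (X-step l) ⊗
              0≤X (suc i))) ⊕
         ≤-reflexive (sym (trans (cong₂ (λ u v → ((t + 1ℚ) * (t - + 4 / 1) * r * X t (suc i) * X t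
             (suc l)) * (1ℚ - u) + (+ 4 / 1 * t * X t (suc i) * X t (suc l)) * ((t + r) - v)) t*inv
             E*[t+1])
           (vanish ((t + 1ℚ) * (t - + 4 / 1) * r * X t (suc i) * X t (suc l))
               (+ 4 / 1 * t * X t (suc i) * X t (suc l)) (t + r))))))
        where
        vanish = solve 3 (λ a b s → a :* (con 1ℚ :- con 1ℚ) :+ b :* (s :- s) := con 0ℚ) refl
        identity = solve 8 (λ t r e i u₀ u₁ v₀ v₁ → (((u₁ :* v₁) :* (t :* ((t :- con (+ 3 / 1)) :* t :+
            (t :+ con 1ℚ)) :+ con (+ 4 / 1) :* r)) :+ (t :* (t :+ con 1ℚ) :* e) :* ((u₁ :- u₀)
            :* v₁ :+ (v₁ :- v₀) :* u₁)) :+ (((t :+ con 1ℚ) :* (t :- con (+ 4 / 1)) :* r :* u₁ :*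
            v₁) :* (con 1ℚ :- t :* i) :+ (con (+ 4 / 1) :* t :* u₁ :* v₁) :* ((t :+ r) :- e :*
            (t :+ con 1ℚ))) := (t :* (t :+ con 1ℚ)) :* ((t :+ r :+ con 1ℚ :- (t :- (con (+ 4 /
            1))) :* r :* i) :* (u₁ :* v₁) :- e :* (u₀ :* v₁ :+ (u₁ :* v₁ :+ u₁ :* v₁) :+ u₁ :* v₀)))
            refl

-- Brooms and their explicit eigenvectors

module Brooms where

  open import Data.Fin.Subset using (Subset; _∈_; _∩_; ∣_∣)
  open import Data.Fin.Subset.Properties using (x∈p∩q⁻)
  open import Data.Maybe.Properties using (just-injective)
  open import Data.Rational.Base using (ℚ; 0ℚ; 1ℚ; _+_; _*_; _-_; -_; _≤_; _<_; _/_)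
  open import Data.Rational.Properties hiding (_≟_)
  open import Data.Sum.Properties using (inj₁-injective)
  open import Data.Vec.Base using (lookup)
  open import Data.Vec.Properties using (lookup⇒[]=)
  open +-*-Solver using (solve; con; _:=_; _:+_; _:*_; _:-_; :-_)

  open import Defs hiding (sum; inner; T; joint)
  open Rationals
  open FiniteSums
  open Adjacencies
  open EdgeInequality using (_⊕_)
  open LowDegrees using (sum-pair)
  open PathArms

  module _ {d : ℕ} (c : Fin (suc d)) where

    On : Fin (suc d) → Maybe (Fin d) → Set
    On j (just a) = j ≡ inject₁ a ⊎ j ≡ suc a
    On j nothing  = j ≡ c

    -- Incidence is determined by labels alone: an edge is a numbered path edge or, as `nothing`,
    -- pendant at the centre; a vertex is a numbered joint or is labelled by its only edge.
    Inc : ∀ {k} → (Fin k → Maybe (Fin d)) → Fin (suc d) ⊎ Fin k → Fin k → Set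
    Inc lab (inj₁ j) e = On j (lab e)
    Inc lab (inj₂ f) e = f ≡ e

  -- A loose path with d edges whose other edges are pendant at the joint w c.
  -- All v₁, …, v_{d+1} count as joints; the remaining vertices lie in one edge.
  record Broom (m : ℕ) (H : Hypergraph) (d : ℕ) (c : Fin (suc d)) : Set where
    field
      uniform  : Uniform m H
      w        : Fin (suc d) → Vertex H
      link     : Fin d → Edge H
      ℓ        : Vertex H → Fin (suc d) ⊎ Edge H
      lab      : Edge H → Maybe (Fin d)
      ℓ-w      : ∀ j → ℓ (w j) ≡ inj₁ j
      w-ℓ      : ∀ {v j} → ℓ v ≡ inj₁ j → v ≡ w j
      lab-link : ∀ a → lab (link a) ≡ just a
      link-lab : ∀ {e a} → lab e ≡ just a → e ≡ link a
      incident : ∀ v e → v ∈ edge H e ⇔ Inc c lab (ℓ v) e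

    link-injective : ∀ {a b} → link a ≡ link b → a ≡ b
    link-injective {a} {b} eq = just-injective (trans (sym (lab-link a))
        (trans (cong lab eq) (lab-link b)))

    w-injective : ∀ {i j} → w i ≡ w j → i ≡ j
    w-injective {i} {j} eq = inj₁-injective (trans (sym (ℓ-w i)) (trans (cong ℓ eq) (ℓ-w j)))

    ∈⇒Inc : ∀ {v e} → v ∈ edge H e → Inc c lab (ℓ v) e
    ∈⇒Inc {v} {e} = Equivalence.to (incident v e)

    Inc⇒∈ : ∀ {v e} → Inc c lab (ℓ v) e → v ∈ edge H e
    Inc⇒∈ {v} {e} = Equivalence.from (incident v e)

    w∈link : ∀ {j a} → j ≡ inject₁ a ⊎ j ≡ suc a → w j ∈ edge H (link a)
    w∈link {j} {a} h = Inc⇒∈ (subst (λ x → Inc c lab x (link a)) (sym (ℓ-w j))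
        (subst (On c j) (sym (lab-link a)) h))

    w∈link⁻ : ∀ {j a} → w j ∈ edge H (link a) → j ≡ inject₁ a ⊎ j ≡ suc a
    w∈link⁻ {j} {a} h = subst (On c j) (lab-link a)
        (subst (λ x → Inc c lab x (link a)) (ℓ-w j) (∈⇒Inc h))

  ∣p∣≤1 : ∀ {n} (p : Subset n) → (∀ {x y} → x ∈ p → y ∈ p → x ≡ y) → ∣ p ∣ ℕ.≤ 1
  ∣p∣≤1 p unique = ι-cancel-≤ {n = 1} (subst (_≤ 1ℚ) (sym (ι∣∣≡sum p))
      (sum≤1 (exclusive (λ v → 0≤I (lookup p v)) (λ v → I≤1 (lookup p v))
    (λ x y hx hy → unique (lookup⇒[]= x p (0<I⇒true hx)) (lookup⇒[]= y p (0<I⇒true hy))))))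

  private
    -- The explicit value, the larger of the two positions, is what makes the joint shared by two
    -- path edges unique.
    common-end : ∀ {x a b} → x ≡ a ⊎ x ≡ suc a → x ≡ b ⊎ x ≡ suc b → a ≢ b → x ≡ a ℕ.⊔ b
    common-end (inj₁ refl) (inj₁ refl) a≢b = contradiction refl a≢b
    common-end (inj₁ refl) (inj₂ refl) a≢b = sym (ℕ.m≥n⇒m⊔n≡m (ℕ.n≤1+n _))
    common-end (inj₂ refl) (inj₁ refl) a≢b = sym (ℕ.m≤n⇒m⊔n≡n (ℕ.n≤1+n _))
    common-end (inj₂ refl) (inj₂ eq)   a≢b = contradiction (ℕ.suc-injective eq) a≢b

    toℕ-on : ∀ {d} {j : Fin (suc d)} {a : Fin d} → j ≡ inject₁ a ⊎ j ≡ suc a → toℕ j ≡ toℕ a ⊎ toℕ j ≡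
        suc (toℕ a)
    toℕ-on {a = a} (inj₁ eq) = inj₁ (trans (cong toℕ eq) (Fin.toℕ-inject₁ a))
    toℕ-on         (inj₂ eq) = inj₂ (cong toℕ eq)

    fromℕ-on : ∀ {d} {j : Fin (suc d)} {a : Fin d} → toℕ j ≡ toℕ a ⊎ toℕ j ≡ suc (toℕ a) → j ≡ inject₁ a
        ⊎ j ≡ suc a
    fromℕ-on {a = a} (inj₁ eq) = inj₁ (Fin.toℕ-injective (trans eq (sym (Fin.toℕ-inject₁ a))))
    fromℕ-on         (inj₂ eq) = inj₂ (Fin.toℕ-injective eq)

  module BroomLinear {m H d c} (B : Broom m H d c) where

    open Broom B

    private
      joints-unique : ∀ {i j x y} → x ≢ y ⊎ (x ≡ nothing ⊎ y ≡ nothing) → On c i x → On c i y → On c j x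
          → On c j y → i ≡ j
      joints-unique {x = nothing} {y}      _ ix iy jx jy = trans ix (sym jx)
      joints-unique {x = just a} {nothing} _ ix iy jx jy = trans iy (sym jy)
      joints-unique {x = just a} {just b} (inj₂ (inj₁ ())) ix iy jx jy
      joints-unique {x = just a} {just b} (inj₂ (inj₂ ())) ix iy jx jy
      joints-unique {x = just a} {just b} (inj₁ x≢y) ix iy jx jy = Fin.toℕ-injective (trans
        (common-end (toℕ-on ix) (toℕ-on iy) a≢b) (sym (common-end (toℕ-on jx) (toℕ-on jy) a≢b)))
        where
        a≢b : toℕ a ≢ toℕ b
        a≢b eq = x≢y (cong just (Fin.toℕ-injective eq))

      lab-distinct : ∀ {e f} → e ≢ f → lab e ≢ lab f ⊎ (lab e ≡ nothing ⊎ lab f ≡ nothing)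
      lab-distinct {e} {f} e≢f with lab e in eqe | lab f in eqf
      ... | nothing | _       = inj₂ (inj₁ refl)
      ... | just a  | nothing = inj₂ (inj₂ refl)
      ... | just a  | just b  = inj₁ λ eq → e≢f (trans (link-lab eqe)
          (trans (cong link (just-injective eq)) (sym (link-lab eqf))))

      same : ∀ {e f u v} → e ≢ f → u ∈ edge H e → u ∈ edge H f → v ∈ edge H e → v ∈ edge H f → u ≡ v
      same {e} {f} {u} {v} e≢f ue uf ve vf with ℓ u in equ | ℓ v in eqv | ∈⇒Inc ue | ∈⇒Inc uf | ∈⇒Inc ve | ∈⇒Inc vf
      ... | inj₂ g | _      | p | q | _ | _ = contradiction (trans (sym p) q) e≢f
      ... | inj₁ i | inj₂ g | _ | _ | p | q = contradiction (trans (sym p) q) e≢f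
      ... | inj₁ i | inj₁ j | p | q | p′ | q′ = trans (w-ℓ equ)
          (trans (cong w (joints-unique (lab-distinct e≢f) p q p′ q′)) (sym (w-ℓ eqv)))

    linear : Linear H
    linear e f e≢f = ∣p∣≤1 (edge H e ∩ edge H f) λ u∈ v∈ →
      let ue , uf = x∈p∩q⁻ (edge H e) (edge H f) u∈ ; ve , vf = x∈p∩q⁻ (edge H e) (edge H f) v∈ in same e≢f ue uf ve vf

  module BroomSpectrum {n H d c} (B : Broom (2+ n) H d c) (i l : ℕ) (c≡ : toℕ c ≡ suc i) (d≡ : d ≡ suc i ℕ.+ suc l) where

    open Broom B
    open BroomLinear B
    open Incidence H
    open Adjacency n H linear hiding (A)

    private
      r q : ℚ
      r = ι (suc n)
      q = ι (size H) - ι d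
      1≤r : 1ℚ ≤ r
      1≤r = ι-mono {1} {suc n} (ℕ.s≤s ℕ.z≤n)

    yj : ℚ → ℕ → ℚ
    yj t j with j ℕ.≤? suc i
    ... | yes _ = X r t j * X r t (suc l)
    ... | no _  = X r t (suc i) * X r t (d ℕ.∸ j)

    yₑ : ℚ → Maybe (Fin d) → ℚ
    yₑ t (just a) = (yj t (toℕ a) + yj t (suc (toℕ a))) * inv (t + 1ℚ)
    yₑ t nothing  = yj t (suc i) * inv (t + 0ℚ)

    yℓ : ℚ → Fin (suc d) ⊎ Edge H → ℚ
    yℓ t (inj₁ j) = yj t (toℕ j)
    yℓ t (inj₂ e) = yₑ t (lab e)

    y : ℚ → Vertex H → ℚ
    y t v = yℓ t (ℓ v)

    module Eigen (t : ℚ) (3≤t : + 3 / 1 ≤ t) where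

      open At r t 3≤t 1≤r

      private
        Y = yj t
        A = t + r - 1ℚ

        d∸c : d ℕ.∸ suc i ≡ suc l
        d∸c = trans (cong (ℕ._∸ suc i) d≡) (ℕ.m+n∸m≡n (suc i) (suc l))

        left : ∀ {j} → j ℕ.≤ suc i → Y j ≡ X r t j * X r t (suc l)
        left {j} j≤ with j ℕ.≤? suc i
        ... | yes _ = refl
        ... | no j≰ = contradiction j≤ j≰

        right : ∀ {j} → suc i ℕ.≤ j → Y j ≡ X r t (suc i) * X r t (d ℕ.∸ j)
        right {j} ≤j with j ℕ.≤? suc i
        ... | no _   = refl
        ... | yes j≤ with ℕ.≤-antisym j≤ ≤j
        ...   | refl = cong (λ h → X r t (suc i) * X r t h) (sym d∸c)

        0<Y : ∀ j → 0ℚ < Y j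
        0<Y j with j ℕ.≤? suc i
        ... | yes _ = 0<-* (0<X j) (0<X (suc l))
        ... | no _  = 0<-* (0<X (suc i)) (0<X (d ℕ.∸ j))

        1≤c : 1 ℕ.≤ suc i
        1≤c = ℕ.s≤s ℕ.z≤n

        c≤pred : ∀ {d′} → d ≡ suc d′ → suc i ℕ.≤ d′
        c≤pred eq = ℕ.≤-trans (ℕ.m≤m+n (suc i) l) (ℕ.≤-reflexive
            (ℕ.suc-injective (trans (cong suc (sym (ℕ.+-suc i l))) (trans (sym d≡) eq))))

      Y-start : Y 1 ≡ t * Y 0
      Y-start = trans (left 1≤c) (trans (scale t (X r t (suc l))) (cong (t *_) (sym (left ℕ.z≤n))))
        where
        scale = solve 2 (λ t x → t :* x := t :* (con 1ℚ :* x)) refl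

      Y-end : ∀ {d′} → d ≡ suc d′ → Y d′ ≡ t * Y (suc d′)
      Y-end {d′} eq = trans (right (c≤pred eq)) (trans
          (cong (λ h → X r t (suc i) * X r t h) (trans (cong (ℕ._∸ d′) eq) (ℕ.m+n∸n≡m 1 d′)))
        (trans (scale t (X r t (suc i))) (cong (t *_) (sym (trans (right (ℕ.m≤n⇒m≤1+n (c≤pred eq)))
          (cong (λ h → X r t (suc i) * X r t h) (trans (cong (ℕ._∸ suc d′) eq) (ℕ.n∸n≡0 (suc d′)))))))))
        where
        scale = solve 2 (λ t x → x :* t := t :* (x :* con 1ℚ)) refl

      Y-mid : ∀ j → suc (suc j) ℕ.≤ d → suc j ≢ suc i → Y j + Y (suc (suc j)) ≡ φ r t * Y (suc j)
      Y-mid j j< j≢ with ℕ.<-cmp (suc j) (suc i)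
      ... | tri< lt _ _ = trans (cong₂ _+_ (left (ℕ.≤-trans (ℕ.n≤1+n j) (ℕ.<⇒≤ lt))) (left lt))
              (trans (collect (φ r t) (X r t j) (X r t (suc j)) (X r t (suc l)))
                  (cong (φ r t *_) (sym (left (ℕ.<⇒≤ lt)))))
        where
        collect = solve 4 (λ f x y z → x :* z :+ (f :* y :- x) :* z := f :* (y :* z)) refl
      ... | tri≈ _ eq _ = contradiction eq j≢
      ... | tri> _ _ gt = trans (cong₂ _+_ (trans (right (ℕ.s≤s⁻¹ gt))
          (cong (λ h → X r t (suc i) * X r t h) d∸j)) (right (ℕ.m≤n⇒m≤1+n (ℕ.<⇒≤ gt))))
              (trans (collect (φ r t) (X r t (d ℕ.∸ suc (suc j))) (X r t (suc (d ℕ.∸ suc (suc j))))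
                  (X r t (suc i)))
                (cong (φ r t *_) (sym (trans (right (ℕ.<⇒≤ gt))
                    (cong (λ h → X r t (suc i) * X r t h) d∸suc-j)))))
        where
        collect = solve 4 (λ f x y z → z :* (f :* y :- x) :+ z :* x := f :* (z :* y)) refl
        d∸suc-j : d ℕ.∸ suc j ≡ suc (d ℕ.∸ suc (suc j))
        d∸suc-j = ℕ.+-∸-assoc 1 j<
        d∸j : d ℕ.∸ j ≡ suc (suc (d ℕ.∸ suc (suc j)))
        d∸j = trans (ℕ.+-∸-assoc 1 (ℕ.<⇒≤ j<)) (cong suc d∸suc-j)

      private
        member : Maybe (Fin d) → ℚ
        member (just a) = E r t * (Y (toℕ a) + Y (suc (toℕ a)))
        member nothing  = Y (suc i) + r * (Y (suc i) * inv (t + 0ℚ))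

      edgeSum-y : ∀ e → edgeSum (y t) e ≡ member (lab e)
      -- Subtracting the common value p of the inner vertices at all 1 + r vertices leaves only the
      -- joints of the edge.
      edgeSum-y e = begin
        sum (λ v → χ e v * y t v)
          ≡⟨ trans (sum-cong-≗ (λ v → recentre (χ e v) (y t v) p))
              (∑-distrib-+ (λ v → χ e v * (y t v - p)) (λ v → χ e v * p)) ⟩
        sum (λ v → χ e v * (y t v - p)) + sum (λ v → χ e v * p)
          ≡⟨ cong (λ h → sum (λ v → χ e v * (y t v - p)) + h)
              (trans (sym (*-distribʳ-sum p (χ e))) (cong (_* p)
              (trans (sym (size≡sum e)) (cong ι (uniform e))))) ⟩
        sum (λ v → χ e v * (y t v - p)) + (1ℚ + r) * p
          ≡⟨ by-label (lab e) refl ⟩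
        member (lab e) ∎
        where
        open ≡-Reasoning
        p : ℚ
        p = yₑ t (lab e)
        recentre = solve 3 (λ c g p → c :* g := c :* (g :- p) :+ c :* p) refl
        inner : ∀ {v f} → ℓ v ≡ inj₂ f → χ e v * (y t v - p) ≡ 0ℚ
        inner {v} {f} eq = trans (χ-cong (λ v∈e → trans (cong (λ x → yℓ t x - p) eq)
          (trans (cong (λ g → yₑ t (lab g) - p) (subst (λ x → Inc c lab x e) eq (∈⇒Inc v∈e)))
              (+-inverseʳ p)))) (*-zeroʳ (χ e v))
        outside : ∀ {v} → ¬ v ∈ᵉ e → χ e v * (y t v - p) ≡ 0ℚ
        outside {v} v∉e = ≡0⇒*≡0 (∉⇒χ≡0 v∉e) (y t v - p)
        at-joint : ∀ {j} → On c j (lab e) → χ e (w j) * (y t (w j) - p) ≡ Y (toℕ j) - p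
        at-joint {j} on = trans (≡1⇒*≡ (∈⇒χ≡1 (Inc⇒∈ (subst (λ x → Inc c lab x e) (sym (ℓ-w j)) on)))
            (y t (w j) - p)) (cong (λ x → yℓ t x - p) (ℓ-w j))
        off-joint : ∀ v → (∀ j → On c j (lab e) → v ≢ w j) → χ e v * (y t v - p) ≡ 0ℚ
        off-joint v v≢ with ℓ v in eq
        ... | inj₂ f = subst (λ x → χ e v * (yℓ t x - p) ≡ 0ℚ) eq (inner eq)
        ... | inj₁ j = subst (λ x → χ e v * (yℓ t x - p) ≡ 0ℚ) eq
            (outside λ v∈e → v≢ j (subst (λ x → Inc c lab x e) eq (∈⇒Inc v∈e)) (w-ℓ eq))
        by-label : ∀ x → lab e ≡ x → sum (λ v → χ e v * (y t v - p)) + (1ℚ + r) * p ≡ member x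
        by-label (just a) eq = trans (cong₂ _+_
            (trans (sum-pair {i = w (inject₁ a)} {j = w (suc a)} w≢w
                (λ v v≢₁ v≢₂ → off-joint v λ j on v≡ → [ (λ j≡ → v≢₁ (trans v≡ (cong w j≡))) ,
                (λ j≡ → v≢₂ (trans v≡ (cong w j≡))) ]′ (subst (On c j) eq on)))
              (cong₂ _+_ (trans (at-joint (subst (On c (inject₁ a)) (sym eq) (inj₁ refl)))
                  (cong₂ (λ h p → Y h - p) (Fin.toℕ-inject₁ a) p≡))
                         (trans (at-joint (subst (On c (suc a)) (sym eq) (inj₂ refl)))
                             (cong (λ p → Y (suc (toℕ a)) - p) p≡))))
            (cong ((1ℚ + r) *_) p≡))
          (trans (collect (Y (toℕ a)) (Y (suc (toℕ a))) r t (inv (t + 1ℚ)))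
              (trans (cong (λ h → (Y (toℕ a) + Y (suc (toℕ a))) * ((t + r) * inv (t + 1ℚ) + (1ℚ - h)))
              (*-inv 0<t+1))
            (finish (E r t) (Y (toℕ a) + Y (suc (toℕ a))))))
          where
          p≡ : p ≡ (Y (toℕ a) + Y (suc (toℕ a))) * inv (t + 1ℚ)
          p≡ = cong (yₑ t) eq
          w≢w : w (inject₁ a) ≢ w (suc a)
          w≢w h = ℕ.1+n≢n (sym (trans (sym (Fin.toℕ-inject₁ a)) (cong toℕ (w-injective h))))
          collect = solve 5 (λ y z r t i → ((y :- (y :+ z) :* i) :+ (z :- (y :+ z) :* i)) :+ (con 1ℚ :+
              r) :* ((y :+ z) :* i) := (y :+ z) :* ((t :+ r) :* i :+ (con 1ℚ :- (t :+ con 1ℚ) :*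
              i))) refl
          finish = solve 2 (λ e s → s :* (e :+ (con 1ℚ :- con 1ℚ)) := e :* s) refl
        by-label nothing eq = trans (cong₂ _+_
            (trans (sum-single (w c) (λ v v≢ → off-joint v λ j on v≡ → v≢
                (trans v≡ (cong w (subst (On c j) eq on)))))
              (trans (at-joint (subst (On c c) (sym eq) refl)) (cong₂ (λ h p → Y h - p) c≡ p≡)))
            (cong ((1ℚ + r) *_) p≡))
          (collect (Y (suc i)) r (inv (t + 0ℚ)))
          where
          p≡ : p ≡ Y (suc i) * inv (t + 0ℚ)
          p≡ = cong (yₑ t) eq
          collect = solve 3 (λ y r i → (y :- y :* i) :+ (con 1ℚ :+ r) :* (y :* i) := y :+ r :* (y :* i))
              refl

      private
        N : Vertex H → ℚ
        N = neighbourSum (y t)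

        rate : ∀ {v e} → ℓ v ≡ inj₂ e → y t v ≡ yₑ t (lab e)
        rate eq = cong (yℓ t) eq

      inner-equation : ∀ v e → ℓ v ≡ inj₂ e → N v ≡ A * y t v
      inner-equation v e eq = trans (sum-single e (λ f f≢e → ≡0⇒*≡0
          (∉⇒χ≡0 (λ v∈f → f≢e (sym (subst (λ x → Inc c lab x f) eq (∈⇒Inc v∈f)))))
          (edgeSum (y t) f - y t v)))
        (trans (≡1⇒*≡ (∈⇒χ≡1 (Inc⇒∈ (subst (λ x → Inc c lab x e) (sym eq) refl)))
            (edgeSum (y t) e - y t v))
          (trans (cong₂ _-_ (edgeSum-y e) (rate eq)) (trans (by-label (lab e))
              (cong (A *_) (sym (rate eq))))))
        where
        by-label : ∀ x → member x - yₑ t x ≡ A * yₑ t x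
        by-label (just a) = factor t r (Y (toℕ a) + Y (suc (toℕ a))) (inv (t + 1ℚ))
          where
          factor = solve 4 (λ t r s i → ((t :+ r) :* i) :* s :- s :* i := (t :+ r :- con 1ℚ) :* (s :*
              i)) refl
        by-label nothing  = trans (cong (λ h → h + r * (Y (suc i) * inv (t + 0ℚ)) - Y (suc i) * inv
            (t + 0ℚ)) restore)
          (factor t r (Y (suc i)) (inv (t + 0ℚ)))
          where
          restore : Y (suc i) ≡ Y (suc i) * (t * inv (t + 0ℚ))
          restore = trans (sym (*-identityʳ (Y (suc i)))) (cong (Y (suc i) *_) (sym t*inv))
          factor = solve 4 (λ t r s i → s :* (t :* i) :+ r :* (s :* i) :- s :* i := (t :+ r :- con 1ℚ)
              :* (s :* i)) refl

      private
        sum-image : ∀ (f : Edge H → ℚ) → (∀ e → lab e ≡ nothing → f e ≡ 0ℚ) → sum f ≡ sum (f ∘ link)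
        sum-image f off = begin
          sum f
            ≡⟨ sum-cong-≗ expand ⟩
          sum (λ e → sum (λ a → ⟦ link a Fin.≟ e ⟧ * f e))
            ≡⟨ ∑-comm (λ e a → ⟦ link a Fin.≟ e ⟧ * f e) ⟩
          sum (λ a → sum (λ e → ⟦ link a Fin.≟ e ⟧ * f e))
            ≡⟨ sum-cong-≗ (λ a → trans (sum-single (link a)
                (λ e e≢ → ≡0⇒*≡0 (⟦⟧-no (link a Fin.≟ e) (e≢ ∘ sym)) (f e)))
                 (≡1⇒*≡ (⟦⟧-yes (link a Fin.≟ link a) refl) (f (link a)))) ⟩
          sum (f ∘ link) ∎
          where
          open ≡-Reasoning
          expand : ∀ e → f e ≡ sum (λ a → ⟦ link a Fin.≟ e ⟧ * f e)
          expand e with lab e in eq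
          ... | nothing = trans (off e eq) (sym (sum-zero
              (λ a → trans (cong (⟦ link a Fin.≟ e ⟧ *_) (off e eq)) (*-zeroʳ ⟦ link a Fin.≟ e ⟧))))
          ... | just a  = sym (trans (sum-single a (λ b b≢a → ≡0⇒*≡0
              (⟦⟧-no (link b Fin.≟ e) (λ b≡ → b≢a (link-injective (trans b≡ (link-lab eq))))) (f e)))
                            (≡1⇒*≡ (⟦⟧-yes (link a Fin.≟ e) (sym (link-lab eq))) (f e)))

        term : Fin (suc d) → Edge H → ℚ
        term j e = χ e (w j) * (edgeSum (y t) e - y t (w j))

        y-w : ∀ j → y t (w j) ≡ Y (toℕ j)
        y-w j = cong (yℓ t) (ℓ-w j)

        edgeSum-link : ∀ a → edgeSum (y t) (link a) ≡ E r t * (Y (toℕ a) + Y (suc (toℕ a)))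
        edgeSum-link a = trans (edgeSum-y (link a)) (cong member (lab-link a))

        link-term : ∀ j a → toℕ j ≡ toℕ a ⊎ toℕ j ≡ suc (toℕ a) → term j (link a) ≡ E r t *
            (Y (toℕ a) + Y (suc (toℕ a))) - Y (toℕ j)
        link-term j a h = trans (≡1⇒*≡ (∈⇒χ≡1 (w∈link (fromℕ-on h)))
            (edgeSum (y t) (link a) - y t (w j))) (cong₂ _-_ (edgeSum-link a) (y-w j))

        other-term : ∀ j a → toℕ j ≢ toℕ a → toℕ j ≢ suc (toℕ a) → term j (link a) ≡ 0ℚ
        other-term j a h h′ = ≡0⇒*≡0 (∉⇒χ≡0 (λ w∈ → [ h , h′ ]′ (toℕ-on (w∈link⁻ w∈))))
            (edgeSum (y t) (link a) - y t (w j))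

        path-sum-start : ∀ {d′} → d ≡ suc d′ → ∀ j → toℕ j ≡ 0 → sum (term j ∘ link) ≡ E r t *
            (Y 0 + Y 1) - Y 0
        path-sum-start refl j j≡0 = trans (sum-single zero
            (λ a a≢0 → other-term j a (λ eq → a≢0 (Fin.toℕ-injective (trans (sym eq) j≡0)))
            (λ eq → ℕ.0≢1+n (trans (sym j≡0) eq))))
          (trans (link-term j zero (inj₁ j≡0)) (cong (λ h → E r t * (Y 0 + Y 1) - Y h) j≡0))

        path-sum-end : ∀ {d′} → d ≡ suc d′ → ∀ j → toℕ j ≡ suc d′ → sum (term j ∘ link) ≡ E r t *
            (Y d′ + Y (suc d′)) - Y (suc d′)
        path-sum-end {d′} d≡ j j≡ = trans (sum-single a₀
            (λ a a≢ → other-term j a (λ eq → ℕ.<-irrefl (trans (sym eq) (trans j≡ (sym d≡)))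
            (Fin.toℕ<n a))
            (λ eq → a≢ (Fin.toℕ-injective (trans (ℕ.suc-injective (trans (sym eq) j≡)) (sym a₀≡))))))
          (trans (link-term j a₀ (inj₂ (trans j≡ (cong suc (sym a₀≡)))))
              (cong₂ (λ h h′ → E r t * (Y h + Y (suc h)) - Y h′) a₀≡ j≡))
          where
          a₀ : Fin d
          a₀ = fromℕ< {d′} (ℕ.≤-reflexive (sym d≡))
          a₀≡ : toℕ a₀ ≡ d′
          a₀≡ = Fin.toℕ-fromℕ< _

        path-sum-mid : ∀ j′ → suc (suc j′) ℕ.≤ d → ∀ j → toℕ j ≡ suc j′ →
          sum (term j ∘ link) ≡ (E r t * (Y j′ + Y (suc j′)) - Y (suc j′)) +
              (E r t * (Y (suc j′) + Y (suc (suc j′))) - Y (suc j′))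
        path-sum-mid j′ j< j j≡ = trans (sum-pair {i = a} {j = b}
            (λ a≡b → ℕ.1+n≢n (trans (sym b≡) (trans (cong toℕ (sym a≡b)) a≡)))
            (λ x x≢a x≢b → other-term j x (λ eq → x≢b (Fin.toℕ-injective
                (trans (sym eq) (trans j≡ (sym b≡)))))
              (λ eq → x≢a (Fin.toℕ-injective (trans (ℕ.suc-injective (trans (sym eq) j≡)) (sym a≡))))))
          (cong₂ _+_ (trans (link-term j a (inj₂ (trans j≡ (cong suc (sym a≡)))))
              (cong₂ (λ h h′ → E r t * (Y h + Y (suc h)) - Y h′) a≡ j≡))
                     (trans (link-term j b (inj₁ (trans j≡ (sym b≡))))
                         (cong₂ (λ h h′ → E r t * (Y h + Y (suc h)) - Y h′) b≡ j≡)))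
          where
          a b : Fin d
          a = fromℕ< (ℕ.<⇒≤ j<)
          b = fromℕ< j<
          a≡ : toℕ a ≡ j′
          a≡ = Fin.toℕ-fromℕ< _
          b≡ : toℕ b ≡ suc j′
          b≡ = Fin.toℕ-fromℕ< _

        N-path : ∀ j → j ≢ c → N (w j) ≡ sum (term j ∘ link)
        N-path j j≢c = sum-image (term j) (λ e eq → ≡0⇒*≡0
            (∉⇒χ≡0 (λ w∈ → j≢c (subst (On c j) eq (subst (λ x → Inc c lab x e) (ℓ-w j) (∈⇒Inc w∈)))))
            (edgeSum (y t) e - y t (w j)))

      path-equation : ∀ j → j ≢ c → N (w j) ≡ A * y t (w j)
      path-equation j j≢c = trans (N-path j j≢c) (trans (position (toℕ j) refl)
          (cong (A *_) (sym (y-w j))))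
        where
        pred-d : ∃ λ d′ → d ≡ suc d′
        pred-d = i ℕ.+ suc l , d≡
        position : ∀ p → toℕ j ≡ p → sum (term j ∘ link) ≡ A * Y (toℕ j)
        position zero j≡ = trans (path-sum-start (proj₂ pred-d) j j≡)
            (trans (cong (λ h → E r t * (Y 0 + h) - Y 0) Y-start)
          (trans (factor (E r t) t (Y 0)) (trans (cong (λ h → (h - 1ℚ) * Y 0) E*[t+1])
              (cong (λ h → A * Y h) (sym j≡)))))
          where
          factor = solve 3 (λ e t y → e :* (y :+ t :* y) :- y := (e :* (t :+ con 1ℚ) :- con 1ℚ) :* y)
              refl
        position (suc p) j≡ with suc (suc p) ℕ.≤? d
        ... | yes p< = trans (path-sum-mid p p< j j≡)
            (trans (collect (E r t) (Y p) (Y (suc p)) (Y (suc (suc p))))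
            (trans (cong (λ h → E r t * (h + (Y (suc p) + Y (suc p))) - (Y (suc p) + Y (suc p)))
                (Y-mid p p< (λ eq → j≢c (Fin.toℕ-injective (trans j≡ (trans eq (sym c≡)))))))
            (trans (factor (E r t) (φ r t) (Y (suc p)))
                (trans (cong (λ h → (h - (1ℚ + 1ℚ)) * Y (suc p)) (sym φ*E))
                (trans (tidy t r (Y (suc p))) (cong (λ h → A * Y h) (sym j≡)))))))
          where
          collect = solve 4 (λ e x y z → (e :* (x :+ y) :- y) :+ (e :* (y :+ z) :- y) := e :*
              ((x :+ z) :+
              (y :+ y)) :- (y :+ y)) refl
          factor = solve 3 (λ e f y → e :* (f :* y :+ (y :+ y)) :- (y :+ y) := (e :* (f :+ (con 1ℚ :+
              (con 1ℚ))) :- (con 1ℚ :+ con 1ℚ)) :* y) refl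
          tidy = solve 3 (λ t r y → ((t :+ r :+ con 1ℚ) :- (con 1ℚ :+ con 1ℚ)) :* y := (t :+ r :-
              (con 1ℚ)) :* y) refl
        ... | no p≮ = trans (path-sum-end d≡p j j≡) (trans
            (cong (λ h → E r t * (h + Y (suc p)) - Y (suc p)) (Y-end d≡p))
            (trans (factor (E r t) t (Y (suc p))) (trans (cong (λ h → (h - 1ℚ) * Y (suc p)) E*[t+1])
                (cong (λ h → A * Y h) (sym j≡)))))
          where
          factor = solve 3 (λ e t y → e :* (t :* y :+ y) :- y := (e :* (t :+ con 1ℚ) :- con 1ℚ) :* y)
              refl
          d≡p : d ≡ suc p
          d≡p = ℕ.≤-antisym (ℕ.s≤s⁻¹ (ℕ.≰⇒> p≮)) (ℕ.≤-trans (ℕ.≤-reflexive (sym j≡))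
              (ℕ.s≤s⁻¹ (Fin.toℕ<n j)))

      -- The pendant edges at the centre all contribute `g₀`. Subtracting `g₀` for every edge of H
      -- reduces the sum to the path edges, without counting the pendant ones separately.
      centre-equation : N (w c) ≡ A * y t (w c) - F r q i l t
      centre-equation = begin
        sum (term c)
          ≡⟨ sum-cong-≗ (λ e → sub-add (term c e) g₀) ⟩
        sum (λ e → (term c e - g₀) + g₀)
          ≡⟨ ∑-distrib-+ (λ e → term c e - g₀) (λ _ → g₀) ⟩
        sum (λ e → term c e - g₀) + sum {size H} (λ _ → g₀)
          ≡⟨ cong₂ _+_ (trans (sum-image (λ e → term c e - g₀)
              (λ e eq → trans (cong (_- g₀) (off-term e eq)) (+-inverseʳ g₀)))
              (∑-distrib-- (term c ∘ link) (λ _ → g₀))) (sum-const (size H) g₀) ⟩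
        (sum (term c ∘ link) - sum {d} (λ _ → g₀)) + ι (size H) * g₀
          ≡⟨ cong (_+ ι (size H) * g₀) (cong₂ _-_ (path-sum-mid i c<d c c≡) (sum-const d g₀)) ⟩
        (((E r t * (Y i + Y (suc i)) - Y (suc i)) + (E r t * (Y (suc i) + Y (suc (suc i))) - Y (suc i)))
            - ι d * g₀) + ι (size H) * g₀
          ≡⟨ cong₂ (λ u v → ((E r t * (u + Y (suc i)) - Y (suc i) +
              (E r t * (Y (suc i) + v) - Y (suc i))) - ι d * g₀) + ι (size H) * g₀)
               (left (ℕ.n≤1+n i)) (trans (right (ℕ.n≤1+n (suc i)))
                   (cong (λ h → X r t (suc i) * X r t h) d∸2+i)) ⟩
        (((E r t * (X r t i * X r t (suc l) + Y (suc i)) - Y (suc i)) +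
            (E r t * (Y (suc i) + X r t (suc i) * X r t l) - Y (suc i))) - ι d * g₀) + ι (size H) * g₀
          ≡⟨ cong (λ h → (((E r t * (X r t i * X r t (suc l) + h) - h) +
              (E r t * (h + X r t (suc i) * X r t l) - h)) - ι d * (r * (h * inv (t + 0ℚ)))) + ι
              (size H) * (r * (h * inv (t + 0ℚ)))) (left ℕ.≤-refl) ⟩
        _ ≡⟨ identity t r (E r t) (inv (t + 0ℚ)) (ι (size H)) (ι d) (X r t i) (X r t (suc i)) (X r t l)
            (X r t (suc l)) ⟩
        A * (X r t (suc i) * X r t (suc l)) - F r q i l t
          ≡⟨ cong (λ h → A * h - F r q i l t) (sym (trans (y-w c) (trans (cong Y c≡) (left ℕ.≤-refl))))
              ⟩
        A * y t (w c) - F r q i l t ∎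
        where
        open ≡-Reasoning
        g₀ : ℚ
        g₀ = r * (Y (suc i) * inv (t + 0ℚ))
        c<d : suc (suc i) ℕ.≤ d
        c<d = ℕ.≤-trans (ℕ.s≤s (ℕ.≤-trans (ℕ.m≤m+n (suc i) l) (ℕ.≤-reflexive (sym (ℕ.+-suc i l)))))
            (ℕ.≤-reflexive (sym d≡))
        d∸2+i : d ℕ.∸ suc (suc i) ≡ l
        d∸2+i = ℕ.suc-injective (trans (sym (ℕ.+-∸-assoc 1 c<d)) d∸c)
        off-term : ∀ e → lab e ≡ nothing → term c e ≡ g₀
        off-term e eq = trans (≡1⇒*≡ (∈⇒χ≡1 (Inc⇒∈ (subst (λ x → Inc c lab x e) (sym (ℓ-w c))
            (subst (On c c) (sym eq) refl)))) (edgeSum (y t) e - y t (w c)))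
          (trans (cong₂ _-_ (trans (edgeSum-y e) (cong member eq)) (trans (y-w c) (cong Y c≡)))
              (cancel (Y (suc i)) g₀))
          where
          cancel = solve 2 (λ y g → (y :+ g) :- y := g) refl
        identity = solve 10 (λ t r e j k d u₀ u₁ v₀ v₁ →
            (((e :* (u₀ :* v₁ :+ u₁ :* v₁) :- u₁ :* v₁) :+ (e
            :* (u₁ :* v₁ :+ u₁ :* v₀) :- u₁ :* v₁)) :- d :* (r :* ((u₁ :* v₁) :* j))) :+ k :* (r :*
            ((u₁ :* v₁) :* j)) := (t :+ r :- con 1ℚ) :* (u₁ :* v₁) :- ((t :+ r :+ con 1ℚ :- (k
            :- d) :* r :* j) :* (u₁ :* v₁) :- e :* (u₀ :* v₁ :+ (u₁ :* v₁ :+ u₁ :* v₁) :+ u₁ :*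
            v₀))) refl

      0<y : ∀ v → 0ℚ < y t v
      0<y v with ℓ v
      ... | inj₁ j = 0<Y (toℕ j)
      ... | inj₂ e with lab e
      ...   | just a  = 0<-* (0<-+ (0<Y (toℕ a)) (<⇒≤ (0<Y (suc (toℕ a))))) (0<inv 0<t+1)
      ...   | nothing = 0<-* (0<Y (suc i)) (0<inv (subst (0ℚ <_) (sym (+-identityʳ t)) 0<t))

      -- The centre is the only vertex where the eigenvalue equation can fail, and there it fails by
      -- F in the favourable direction.
      super : 0ℚ ≤ F r q i l t → ∀ v → N v ≤ A * y t v
      super 0≤F v = by-label (ℓ v) refl
        where
        gap = solve 2 (λ u f → u :- (u :- f) := f) refl
        by-label : ∀ x → ℓ v ≡ x → N v ≤ A * y t v
        by-label (inj₂ e) eq = ≤-reflexive (inner-equation v e eq)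
        by-label (inj₁ j) eq with j Fin.≟ c
        ... | no j≢c   = subst (λ v → N v ≤ A * y t v) (sym (w-ℓ eq))
            (≤-reflexive (path-equation j j≢c))
        ... | yes refl = subst (λ v → N v ≤ A * y t v) (sym (w-ℓ eq))
                (subst (_≤ A * y t (w c)) (sym centre-equation)
                    (≤-by (gap (A * y t (w c)) (F r q i l t)) 0≤F))

      0≤a : 0ℚ ≤ A
      0≤a = subst (0ℚ ≤_) (shift t r) (0≤t ⊕ ≤⇒0≤- 1≤r)
        where
        shift = solve 2 (λ t r → t :+ (r :- con 1ℚ) := t :+ r :- con 1ℚ) refl

      broom-bound : 0ℚ ≤ F r q i l t → ∀ ρ → λ₁ (2+ n) H ρ → ρ ≤ᴿ fromℚ (ϱ * A)
      broom-bound 0≤F = neighbour-bound A (y t) 0≤a 0<y (super 0≤F)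

-- The spectral radius of a broom as a limit of rationals

module BroomRadii where

  open import Data.Rational.Base using (ℚ; 0ℚ; 1ℚ; ½; _+_; _*_; _-_; -_; _≤_; _<_; _/_; ∣_∣)
  open import Data.Rational.Properties hiding (_≟_)
  open +-*-Solver using (solve; con; _:=_; _:+_; _:*_; _:-_; :-_)

  open import Defs hiding (sum; inner; T; joint; ∣_∣²)
  open Rationals
  open SpectralBounds
  open Adjacencies
  open EdgeInequality using (_⊕_; _⊗_; 0≤lit; 0<lit)
  open RootFinding
  open PathArms
  open Brooms

  module BroomRadius {n H d c} (B : Broom (2+ n) H d c) (i l : ℕ) (c≡ : toℕ c ≡ suc i)
      (d≡ : d ≡ suc i ℕ.+ suc l)
    (9≤D : + 9 / 1 ≤ ι (size H) - ι d + + 2 / 1)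
    (42≤ : + 42 / 1 ≤ ι (suc n) * (ι (size H) - ι d + + 2 / 1 - + 8 / 1)) where

    open Broom B
    open BroomLinear B
    open BroomSpectrum B i l c≡ d≡
    open Adjacency n H linear

    r q top : ℚ
    r = ι (suc n)
    q = ι (size H) - ι d
    top = q + + 4 / 1

    private
      1≤r : 1ℚ ≤ r
      1≤r = ι-mono {1} {suc n} (ℕ.s≤s ℕ.z≤n)

      3≤top : + 3 / 1 ≤ top
      3≤top = ≤-by (gap q) (≤⇒0≤- 9≤D ⊕ 0≤lit (+ 8 / 1))
        where
        gap = solve 1 (λ q → q :+ con (+ 4 / 1) :- con (+ 3 / 1) := (q :+ con (+ 2 / 1) :- (con
            (+ 9 / 1))) :+ con (+ 8 / 1)) refl

      -- By `star-bound`, F ≥ 0 at t = 3 would give (q + 2) r ≤ 3 (r + 2), against r (q - 6) ≥ 42.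
      F₃<0 : F r q i l (+ 3 / 1) < 0ℚ
      F₃<0 = ≰⇒> λ 0≤F → <-irrefl refl (begin-strict
        0ℚ <⟨ 0<-+ (0<lit (+ 36 / 1)) (≤⇒0≤- 42≤ ⊕ 0≤lit (+ 5 / 1) ⊗ ≤-trans 0≤1 1≤r ⊕ ≤⇒0≤-
            (At.star-bound r (+ 3 / 1) ≤-refl 1≤r q i l 0≤F)) ⟩
        _  ≡⟨ zero-sum r q ⟩
        0ℚ ∎)
        where
        open ≤-Reasoning
        zero-sum = solve 2 (λ r q → (con (+ 36 / 1)) :+ ((r :* (q :+ con (+ 2 / 1) :- con (+ 8 / 1)) :-
            (con (+ 42 / 1))) :+ (con (+ 5 / 1) :* r :+ (con (+ 3 / 1) :* (con (+ 3 / 1) :+ r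
            :- con 1ℚ) :- (q :+ con (+ 2 / 1)) :* r))) := con 0ℚ) refl

      0≤F-top : 0ℚ ≤ F r q i l top
      0≤F-top = subst (λ h → 0ℚ ≤ F r h i l top) (cancel q) (At.F-large r top 3≤top 1≤r i l)
        where
        cancel = solve 1 (λ q → q :+ con (+ 4 / 1) :- con (+ 4 / 1) := q) refl

    open Bisection (F r q i l) (+ 3 / 1) top 3≤top F₃<0 0≤F-top public
    open Lipschitz (+ 3 / 1) top
    open LipArms r top 1≤r

    lo-at hi-at : ℕ → ℚ
    lo-at k = lo (bracket k)
    hi-at k = hi (bracket k)

    3≤hi : ∀ k → + 3 / 1 ≤ hi-at k
    3≤hi k = ≤-trans (A≤lo (bracket k)) (lo≤hi (bracket k))

    private
      lip-Y : ∀ j → Lip (λ t → yj t j)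
      lip-Y j with j ℕ.≤? suc i
      ... | yes _ = lip-* (lip-X j) (lip-X (suc l))
      ... | no _  = lip-* (lip-X (suc i)) (lip-X (d ℕ.∸ j))

      1≤3 : 1ℚ ≤ + 3 / 1
      1≤3 = ι-mono {1} {3} (ℕ.s≤s ℕ.z≤n)

      lip-yₑ : ∀ x → Lip (λ t → yₑ t x)
      lip-yₑ (just a) = lip-* (lip-+ (lip-Y (toℕ a)) (lip-Y (suc (toℕ a)))) (lip-inv 1ℚ 1≤3 0≤1)
      lip-yₑ nothing  = lip-* (lip-Y (suc i)) (lip-inv 0ℚ 1≤3 ≤-refl)

      lip-yℓ : ∀ x → Lip (λ t → yℓ t x)
      lip-yℓ (inj₁ j) = lip-Y (toℕ j)
      lip-yℓ (inj₂ e) = lip-yₑ (lab e)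

      cauchy-lip : ∀ {f} → Lip f → IsCauchy (λ k → f (lo-at k))
      cauchy-lip {f} L ε 0<ε = proj₁ close , λ a b p q → begin
        ∣ f (lo-at a) - f (lo-at b) ∣          ≤⟨ change (lo-at a) (lo-at b) (A≤lo (bracket a))
            (≤-trans (lo≤hi (bracket a)) (hi≤B (bracket a))) (A≤lo (bracket b))
            (≤-trans (lo≤hi (bracket b)) (hi≤B (bracket b))) ⟩
        K * ∣ lo-at a - lo-at b ∣              ≤⟨ ≤-by (gap K ∣ lo-at a - lo-at b ∣)
            (0≤∣p∣ (lo-at a - lo-at b)) ⟩
        (1ℚ + K) * ∣ lo-at a - lo-at b ∣       ≤⟨ *-monoˡ (1ℚ + K) (0≤-+ 0≤1 0≤K) (proj₂ close a b p q)
            ⟩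
        (1ℚ + K) * (ε * inv (1ℚ + K))          ≡⟨ rotate (1ℚ + K) ε (inv (1ℚ + K)) ⟩
        ε * ((1ℚ + K) * inv (1ℚ + K))          ≡⟨ trans (cong (ε *_) (*-inv (0<-+ 0<1 0≤K)))
            (*-identityʳ ε) ⟩
        ε                                      ∎
        where
        open ≤-Reasoning
        open Lip L
        gap = solve 2 (λ k w → (con 1ℚ :+ k) :* w :- k :* w := w) refl
        rotate = solve 3 (λ a b c → a :* (b :* c) := b :* (a :* c)) refl
        close = lo-cauchy (ε * inv (1ℚ + K)) (0<-* 0<ε (0<inv (0<-+ 0<1 0≤K)))

      lip-radius : Lip (λ t → ϱ * (t + r - 1ℚ))
      lip-radius = lip-* (lip-const ϱ) (lip-- (lip-+ lip-id (lip-const r)) (lip-const 1ℚ))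

    -- The eigenvalue ϱ (t + r - 1) at the root t of F, represented by the lower ends of the
    -- bisection.
    τ : ℝ
    τ = mkℝ (λ k → ϱ * (lo-at k + r - 1ℚ)) (cauchy-lip lip-radius)

    private
      ŷ : Vertex H → ℝ
      ŷ v = mkℝ (λ k → y (lo-at k) v) (cauchy-lip (lip-yℓ (ℓ v)))

      null-F : Null (λ k → F r q i l (lo-at k))
      null-F ε 0<ε = proj₁ small , λ k N≤k → subst (_≤ ε)
          (trans (sym (0≤p⇒∣p∣≡p (neg-antimono-≤ (<⇒≤ (flo<0 (bracket k))))))
          (∣-p∣≡∣p∣ (F r q i l (lo-at k)))) (proj₂ small k N≤k)
        where
        small = value→0 (lip-F q i l) ε 0<ε

      -- At the lower ends all vertex equations hold exactly except the one at the centre, which is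
      -- off by a value of F that tends to 0.
      residual : ∀ v → Null (λ k → neighbourSum (y (lo-at k)) v - (lo-at k + r - 1ℚ) * y (lo-at k) v)
      residual v = by-label (ℓ v) refl
        where
        exact : (∀ k → neighbourSum (y (lo-at k)) v ≡ (lo-at k + r - 1ℚ) * y (lo-at k) v) → Null
            (λ k → neighbourSum (y (lo-at k)) v - (lo-at k + r - 1ℚ) * y (lo-at k) v)
        exact eq = null-cong (λ k → sym (trans (cong (_- (lo-at k + r - 1ℚ) * y (lo-at k) v) (eq k))
            (+-inverseʳ ((lo-at k + r - 1ℚ) * y (lo-at k) v)))) (λ ε 0<ε → 0 , λ _ _ → <⇒≤ 0<ε)
        cancel = solve 2 (λ u f → f :* (con 0ℚ :- con 1ℚ) := (u :- f) :- u) refl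
        by-label : ∀ x → ℓ v ≡ x → Null (λ k → neighbourSum (y (lo-at k)) v - (lo-at k + r - 1ℚ) * y
            (lo-at k) v)
        by-label (inj₂ e) eq = exact (λ k → Eigen.inner-equation (lo-at k) (A≤lo (bracket k)) v e eq)
        by-label (inj₁ j) eq = by-centre (j Fin.≟ c) eq
          where
          by-centre : ∀ {j} → Dec (j ≡ c) → ℓ v ≡ inj₁ j → Null
              (λ k → neighbourSum (y (lo-at k)) v - (lo-at k + r - 1ℚ) * y (lo-at k) v)
          by-centre {j} (no j≢c) eq = exact (λ k → subst
              (λ v → neighbourSum (y (lo-at k)) v ≡ (lo-at k + r - 1ℚ) * y (lo-at k) v) (sym (w-ℓ eq))
              (Eigen.path-equation (lo-at k) (A≤lo (bracket k)) j j≢c))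
          by-centre (yes refl) eq = subst (λ v → Null
              (λ k → neighbourSum (y (lo-at k)) v - (lo-at k + r - 1ℚ) * y (lo-at k) v)) (sym (w-ℓ eq))
                (null-cong (λ k → trans (cancel ((lo-at k + r - 1ℚ) * y (lo-at k) (w c))
                    (F r q i l (lo-at k)))
                    (cong (_- (lo-at k + r - 1ℚ) * y (lo-at k) (w c))
                        (sym (Eigen.centre-equation (lo-at k) (A≤lo (bracket k))))))
                  (null-* null-F (bounded-const (0ℚ - 1ℚ))))

      0≤radius : ∀ k → 0ℚ ≤ seq τ k
      0≤radius k = 0≤-* (<⇒≤ 0<ϱ) (Eigen.0≤a (lo-at k) (A≤lo (bracket k)))

    τ≤σ : ∀ σ → λ₁ (2+ n) H σ → τ ≤ᴿ σ
    τ≤σ σ = eigenvalue≤spectralRadius A τ ŷ 0≤radius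
      (w c , λ k → subst (1ℚ ≤_) (sym (trans (cong (yℓ (lo-at k)) (ℓ-w c))
          (trans (cong (yj (lo-at k)) c≡) (y-centre (lo-at k)))))
        (*-mono 0≤1 (At.0≤X r (lo-at k) (A≤lo (bracket k)) 1≤r (suc l))
            (At.1≤X r (lo-at k) (A≤lo (bracket k)) 1≤r (suc i))
            (At.1≤X r (lo-at k) (A≤lo (bracket k)) 1≤r (suc l))))
      (λ v → null-cong (λ k → trans (factor ϱ (neighbourSum (y (lo-at k)) v) (lo-at k + r - 1ℚ)
          (y (lo-at k) v))
          (cong (_- ϱ * (lo-at k + r - 1ℚ) * y (lo-at k) v) (sym (row-sum (y (lo-at k)) v))))
        (null-* (residual v) (bounded-const ϱ))) σ
      where
      factor = solve 4 (λ p n a y → (n :- a :* y) :* p := p :* n :- p :* a :* y) refl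
      y-centre : ∀ t → yj t (suc i) ≡ X r t (suc i) * X r t (suc l)
      y-centre t with suc i ℕ.≤? suc i
      ... | yes _ = refl
      ... | no ≰  = contradiction ℕ.≤-refl ≰

    radius : ℚ → ℚ
    radius t = ϱ * (t + r - 1ℚ)

    -- The upper ends converge to the same root as the lower ends representing τ, so the bounds pass
    -- to τ; and τ ≤ σ, since τ is an eigenvalue.
    below-all⇒≤ : ∀ {ρ σ} → (∀ k → ρ ≤ᴿ fromℚ (radius (hi-at k))) → λ₁ (2+ n) H σ → ρ ≤ᴿ σ
    below-all⇒≤ {ρ} {σ} h sr = ≤ᴿ-trans {ρ} {τ} {σ} ρ≤τ (τ≤σ σ sr)
      where
      ρ≤τ : ρ ≤ᴿ τ
      ρ≤τ ε 0<ε = eventually₂ conclude (h N (ε * ½) (half-positive 0<ε)) (N , λ k N≤k → N≤k)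
        where
        ε′ : ℚ
        -- The factor r undoes the factor ϱ = 1 / r of `radius`.
        ε′ = ε * ½ * r
        small = width→0 ε′ (0<-* (half-positive 0<ε) (<-≤-trans 0<1 1≤r))
        N : ℕ
        N = proj₁ small
        conclude : ∀ k → seq ρ k ≤ radius (hi-at N) + ε * ½ → N ℕ.≤ k → seq ρ k ≤ seq τ k + ε
        conclude k h₁ N≤k = ≤-trans h₁ (subst (radius (hi-at N) + ε * ½ ≤_)
            (trans (+-assoc (seq τ k) (ε * ½) (ε * ½)) (cong (λ h → seq τ k + h) (halves ε)))
            (+-monoˡ-≤ (ε * ½) (begin
          radius (hi-at N)                              ≡⟨ split ϱ (hi-at N) (lo-at k) r ⟩
          seq τ k + ϱ * (hi-at N - lo-at k)
              ≤⟨ +-monoʳ-≤ (seq τ k) (*-monoˡ ϱ (<⇒≤ 0<ϱ)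
              (≤-trans (+-monoʳ-≤ (hi-at N) (neg-antimono-≤ (lo-mono (ℕ.≤⇒≤′ N≤k))))
              (proj₂ small N ℕ.≤-refl))) ⟩
          seq τ k + ϱ * ε′
              ≡⟨ cong (λ h → seq τ k + h) (trans (rotate ϱ (ε * ½) r)
              (trans (cong ((ε * ½) *_) ϱ*r≡1) (*-identityʳ (ε * ½)))) ⟩
          seq τ k + ε * ½                               ∎)))
          where
          open ≤-Reasoning
          split = solve 4 (λ p h s r → p :* (h :+ r :- con 1ℚ) := p :* (s :+ r :- con 1ℚ) :+ p :* (h
              :- s)) refl
          rotate = solve 3 (λ p e r → p :* (e :* r) := e :* (p :* r)) refl

    -- The distance δ puts a rational gap of ϱ δ / 2 between the bound for ρ and τ, hence between ρ
    -- and σ; a quarter of it is the tolerance that refutes equality.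
    strictly-below : ∀ {ρ σ} t δ → 0ℚ < δ → (∀ k → t + δ ≤ hi-at k) → ρ ≤ᴿ fromℚ (radius t) → λ₁ (2+ n)
        H σ → ρ ≤ᴿ σ × ¬ ρ ≈ᴿ σ
    strictly-below {ρ} {σ} t δ 0<δ h ρ≤t sr = ≤ᴿ-trans {ρ} {fromℚ (radius t)} {σ} ρ≤t
        (≤ᴿ-trans {fromℚ (radius t)} {τ} {σ} t≤τ (τ≤σ σ sr)) , apart
      where
      small = width→0 (δ * ½) (half-positive 0<δ)
      ε : ℚ
      ε = ϱ * (δ * ½)
      0<ε : 0ℚ < ε
      0<ε = 0<-* 0<ϱ (half-positive 0<δ)
      gap : ∀ k → proj₁ small ℕ.≤ k → radius t + ε ≤ seq τ k
      gap k N≤k = ≤-by (identity ϱ t (lo-at k) (hi-at k) r δ)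
        (<⇒≤ 0<ϱ ⊗ (≤⇒0≤- (h k) ⊕ ≤⇒0≤- (proj₂ small k N≤k)))
        where
        identity = solve 6 (λ p t l h r d → p :* (l :+ r :- con 1ℚ) :- (p :* (t :+ r :- con 1ℚ) :+ p :*
            (d :* (con ½))) := p :* ((h :- (t :+ d)) :+ (d :* (con ½) :- (h :- l)))) refl
      t≤τ : fromℚ (radius t) ≤ᴿ τ
      t≤τ ε′ 0<ε′ = proj₁ small , λ k N≤k → ≤-trans (≤-by (cancel (radius t) ε) (<⇒≤ 0<ε))
          (≤-trans (gap k N≤k) (≤-by (cancel (seq τ k) ε′) (<⇒≤ 0<ε′)))
        where
        cancel = solve 2 (λ a b → (a :+ b) :- a := b) refl
      quarter : ℚ
      quarter = ε * ½ * ½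
      apart : ¬ ρ ≈ᴿ σ
      apart ρ≈σ = <-irrefl refl (begin-strict
        0ℚ <⟨ 0<-+ 0<quarter (≤⇒0≤- (proj₂ e₁ k k≥₁) ⊕ ≤⇒0≤- (gap k k≥₂) ⊕ ≤⇒0≤- (proj₂ e₃ k k≥₃) ⊕
            ≤⇒0≤- close) ⟩
        quarter + ((radius t + quarter - seq ρ k) + ((seq τ k - (radius t + ε)) +
            ((seq σ k + quarter - seq τ k) + (quarter - (seq σ k - seq ρ k)))))
           ≡⟨ zero-sum ε (radius t) (seq ρ k) (seq τ k) (seq σ k) ⟩
        0ℚ ∎)
        where
        open ≤-Reasoning
        0<quarter : 0ℚ < quarter
        0<quarter = half-positive (half-positive 0<ε)
        e₁ = ρ≤t quarter 0<quarter
        e₃ = τ≤σ σ sr quarter 0<quarter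
        e₄ = ρ≈σ quarter 0<quarter
        k : ℕ
        k = (proj₁ e₁ ℕ.⊔ proj₁ small) ℕ.⊔ (proj₁ e₃ ℕ.⊔ proj₁ e₄)
        k≥₁ = ℕ.≤-trans (ℕ.m≤m⊔n (proj₁ e₁) (proj₁ small)) (ℕ.m≤m⊔n _ (proj₁ e₃ ℕ.⊔ proj₁ e₄))
        k≥₂ = ℕ.≤-trans (ℕ.m≤n⊔m (proj₁ e₁) (proj₁ small)) (ℕ.m≤m⊔n _ (proj₁ e₃ ℕ.⊔ proj₁ e₄))
        k≥₃ = ℕ.≤-trans (ℕ.m≤m⊔n (proj₁ e₃) (proj₁ e₄)) (ℕ.m≤n⊔m (proj₁ e₁ ℕ.⊔ proj₁ small) _)
        k≥₄ = ℕ.≤-trans (ℕ.m≤n⊔m (proj₁ e₃) (proj₁ e₄)) (ℕ.m≤n⊔m (proj₁ e₁ ℕ.⊔ proj₁ small) _)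
        close : seq σ k - seq ρ k ≤ quarter
        close = ≤-trans (p≤∣p∣ (seq σ k - seq ρ k)) (subst (_≤ quarter)
            (∣p-q∣≡∣q-p∣ (seq ρ k) (seq σ k)) (proj₂ e₄ k k≥₄))
        zero-sum = solve 5 (λ e t ρ τ σ → e :* (con ½) :* (con ½) :+
            ((t :+ e :* (con ½) :* (con ½) :- ρ)
            :+ ((τ :- (t :+ e)) :+ ((σ :+ e :* (con ½) :* (con ½) :- τ) :+ (e :* (con ½) :* (con ½)
            :- (σ :- ρ))))) := con 0ℚ) refl

    star≤hi : ∀ k → (q + + 2 / 1) * r ≤ hi-at k * (hi-at k + r - 1ℚ)
    star≤hi k = At.star-bound r (hi-at k) (3≤hi k) 1≤r q i l (0≤fhi (bracket k))

    -- F is strictly negative at a lower end and Lipschitz, so every upper end, where F ≥ 0, stays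
    -- at least - F / (1 + K) away.
    lo-gap : ∀ m → ∃ λ δ → 0ℚ < δ × (∀ k → lo-at m + δ ≤ hi-at k)
    lo-gap m = δ , 0<δ , λ k → *-cancelˡ (1ℚ + K) 0<1+K (begin
      (1ℚ + K) * (lo-at m + δ)                                  ≡⟨ *-distribˡ-+ (1ℚ + K) (lo-at m) δ ⟩
      (1ℚ + K) * lo-at m + (1ℚ + K) * (- Fₘ * inv (1ℚ + K))
          ≡⟨ cong (λ h → (1ℚ + K) * lo-at m + h) (trans (rotate (1ℚ + K) (- Fₘ) (inv (1ℚ + K)))
          (trans (cong (- Fₘ *_) (*-inv 0<1+K)) (*-identityʳ (- Fₘ)))) ⟩
      (1ℚ + K) * lo-at m + - Fₘ
          ≤⟨ +-monoʳ-≤ ((1ℚ + K) * lo-at m) (value-bound (lip-F q i l) m k) ⟩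
      (1ℚ + K) * lo-at m + K * (hi-at k - lo-at m)
          ≤⟨ ≤-by (gap K (lo-at m) (hi-at k)) (≤⇒0≤- (lo≤hi′ m k)) ⟩
      (1ℚ + K) * hi-at k                                        ∎)
      where
      open ≤-Reasoning
      open Lip (lip-F q i l)
      Fₘ δ : ℚ
      Fₘ = F r q i l (lo-at m)
      δ = - Fₘ * inv (1ℚ + K)
      0<1+K : 0ℚ < 1ℚ + K
      0<1+K = 0<-+ 0<1 0≤K
      0<δ : 0ℚ < δ
      0<δ = 0<-* (neg-antimono-< (flo<0 (bracket m))) (0<inv 0<1+K)
      rotate = solve 3 (λ a b c → a :* (b :* c) := b :* (a :* c)) refl
      gap = solve 3 (λ k l h → (con 1ℚ :+ k) :* h :- ((con 1ℚ :+ k) :* l :+ k :* (h :- l)) := h :-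
          l) refl

    -- Moving the pendant edges one joint away from the centre of the path lowers
    -- the radius: the defect of the new hypergraph is already positive at a
    -- rational t slightly below τ.
    further-out : ∀ i′ → i ≡ suc i′ → i ℕ.≤ l → ∃ λ m → 0ℚ < F r q i′ (suc l) (lo-at m)
    further-out i′ refl i≤l = m , 0<-cancelˡ (X r t (suc i) * X r t (suc l))
        (<⇒≤ (0<-* (0<X (suc i)) (0<X (suc l))))
      (subst (0ℚ <_) (trans (sym (F-step q i′ l)) (*-comm (F r q i′ (suc l) t)
          (X r t (suc i) * X r t (suc l)))) (begin-strict
        0ℚ                                                       <⟨ positive⁻¹ ½ ⟩
        ½
            ≤⟨ ≤-by (gap (F r q i l t * U) gain) (≤⇒0≤- FU≥ ⊕ ≤⇒0≤- (F-gain i l i≤l)) ⟩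
        F r q i l t * U + gain                                  ∎))
      where
      open ≤-Reasoning
      module L = Lip (lip-* (lip-X i) (lip-X (suc (suc l))))
      -- F tends to 0 along the lower ends and `M` does not depend on m, so m can be chosen with - F
      -- U ≤ 1/2; half of the gain of at least 1 is then left.
      ε : ℚ
      ε = ½ * inv (1ℚ + L.M)
      0<1+M : 0ℚ < 1ℚ + L.M
      0<1+M = 0<-+ 0<1 L.0≤M
      small = value→0 (lip-F q i l) ε (0<-* (positive⁻¹ ½) (0<inv 0<1+M))
      m : ℕ
      m = proj₁ small
      t : ℚ
      t = lo-at m
      open At r t (A≤lo (bracket m)) 1≤r
      U gain : ℚ
      U = X r t i * X r t (suc (suc l))
      gain = E r t * K * (X r t (suc l) * X r t (suc (suc l)) - X r t i * X r t (suc i))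
      gap = solve 2 (λ u g → (u :+ g) :- (con ½) := (u :- (con 0ℚ :- (con ½))) :+ (g :- con 1ℚ))
          refl
      U≤M : U ≤ 1ℚ + L.M
      U≤M = ≤-trans (p≤∣p∣ U) (≤-trans (L.bound t (A≤lo (bracket m))
          (≤-trans (lo≤hi (bracket m)) (hi≤B (bracket m)))) (≤-by (cancel L.M) 0≤1))
        where
        cancel = solve 1 (λ M → (con 1ℚ :+ M) :- M := con 1ℚ) refl
      FU≥ : 0ℚ - ½ ≤ F r q i l t * U
      FU≥ = subst₂ _≤_ (sym (+-identityˡ (- ½))) (flip (F r q i l t) U) (neg-antimono-≤ (begin
        - F r q i l t * U                  ≤⟨ *-mono (neg-antimono-≤ (<⇒≤ (flo<0 (bracket m))))
            (<⇒≤ 0<1+M) (proj₂ small m ℕ.≤-refl) U≤M ⟩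
        (½ * inv (1ℚ + L.M)) * (1ℚ + L.M)  ≡⟨ trans (rotate (inv (1ℚ + L.M)) (1ℚ + L.M))
            (trans (cong (½ *_) (*-inv 0<1+M)) (*-identityʳ ½)) ⟩
        ½                                  ∎))
        where
        flip = solve 2 (λ f u → :- (:- f :* u) := f :* u) refl
        rotate = solve 2 (λ a b → ((con ½) :* a) :* b := (con ½) :* (b :* a)) refl

-- A rational slightly below the root of the star

module StarRoot where

  open import Data.Rational.Base using (ℚ; 0ℚ; 1ℚ; _+_; _*_; _-_; -_; _≤_; _<_; _/_)
  open import Data.Rational.Properties
  open +-*-Solver using (solve; con; _:=_; _:+_; _:*_; _:-_; :-_)

  open Rationals
  open EdgeInequality using (_⊕_; _⊗_; 0≤lit; 0<lit)
  open RootFinding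

  module _ (r D : ℚ) (1≤r : 1ℚ ≤ r) (9≤D : + 9 / 1 ≤ D) (42≤ : + 42 / 1 ≤ r * (D - + 8 / 1)) where

    private
      -- The target is D - 1/8 instead of D: stopping the bisection with an error of at most r / 8
      -- gives a value between (D - 1/4) r and (D - 1/8) r, which is still separated from D r.
      f : ℚ → ℚ
      f t = t * (t + r - 1ℚ) - (D - + 1 / 8) * r

      0≤r : 0ℚ ≤ r
      0≤r = ≤-trans 0≤1 1≤r

      f₃<0 : f (+ 3 / 1) < 0ℚ
      f₃<0 = <-by (identity r D) (0<-+ (0<lit (+ 36 / 1)) (≤⇒0≤- 42≤ ⊕ 0≤lit (+ 39 / 8) ⊗ 0≤r))
        where
        identity = solve 2 (λ r D → (con 0ℚ) :- (con (+ 3 / 1) :* (con (+ 3 / 1) :+ r :- con 1ℚ) :-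
            (D :- con (+ 1 / 8)) :* r) := con (+ 36 / 1) :+ ((r :* (D :- con (+ 8 / 1)) :-
            (con (+ 42 / 1))) :+ con (+ 39 / 8) :* r)) refl

      0≤fD : 0ℚ ≤ f D
      0≤fD = subst (0ℚ ≤_) (identity r D) ((≤⇒0≤- 9≤D ⊕ 0≤lit (+ 9 / 1)) ⊗ (≤⇒0≤- 9≤D ⊕ 0≤lit (+ 8 / 1))
          ⊕ 0≤lit (+ 1 / 8) ⊗ 0≤r)
        where
        identity = solve 2 (λ r D → ((D :- con (+ 9 / 1)) :+ con (+ 9 / 1)) :* ((D :- con (+ 9 / 1))
            :+ con (+ 8 / 1)) :+ con (+ 1 / 8) :* r := D :* (D :+ r :- con 1ℚ) :- (D :- (con
            (+ 1 / 8))) :* r) refl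

      3≤D : + 3 / 1 ≤ D
      3≤D = ≤-by (gap D) (≤⇒0≤- 9≤D ⊕ 0≤lit (+ 6 / 1))
        where
        gap = solve 1 (λ D → D :- con (+ 3 / 1) := (D :- con (+ 9 / 1)) :+ con (+ 6 / 1)) refl

      open Bisection f (+ 3 / 1) D 3≤D f₃<0 0≤fD
      open Lipschitz (+ 3 / 1) D

      lip-f : Lip f
      lip-f = lip-- (lip-* lip-id (lip-- (lip-+ lip-id (lip-const r)) (lip-const 1ℚ)))
          (lip-const ((D - + 1 / 8) * r))

      small : ∃ λ N → ∀ n → N ℕ.≤ n → - f (lo (bracket n)) ≤ + 1 / 8 * r
      small = value→0 lip-f (+ 1 / 8 * r) (0<-* (0<lit (+ 1 / 8)) (<-≤-trans 0<1 1≤r))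

    t₀ : ℚ
    t₀ = lo (bracket (proj₁ small))

    3≤t₀ : + 3 / 1 ≤ t₀
    3≤t₀ = A≤lo (bracket (proj₁ small))

    star-lower : (D - + 1 / 4) * r ≤ t₀ * (t₀ + r - 1ℚ)
    star-lower = ≤-by (identity r D t₀) (≤⇒0≤- (proj₂ small (proj₁ small) ℕ.≤-refl))
      where
      identity = solve 3 (λ r D t → t :* (t :+ r :- con 1ℚ) :- (D :- con (+ 1 / 4)) :* r := (con (+ 1 /
          8)) :* r :- (:- (t :* (t :+ r :- con 1ℚ) :- (D :- con (+ 1 / 8)) :* r))) refl

    star-upper : t₀ * (t₀ + r - 1ℚ) ≤ (D - + 1 / 8) * r
    star-upper = ≤-by (identity (t₀ * (t₀ + r - 1ℚ)) ((D - + 1 / 8) * r))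
        (neg-antimono-≤ (<⇒≤ (flo<0 (bracket (proj₁ small)))))
      where
      identity = solve 2 (λ u v → v :- u := :- (u :- v)) refl

    -- δ solves (2 t₀ + r + 1) δ = r / 8: a step of δ ≤ 2 from t₀ increases t (t + r - 1) by at most
    -- this amount, hence not beyond D r.
    star-gap : ∃ λ δ → 0ℚ < δ × (∀ h → 0ℚ ≤ h → D * r ≤ h * (h + r - 1ℚ) → t₀ + δ ≤ h)
    star-gap = δ , 0<δ , λ h 0≤h Dr≤ → ≮⇒≥ λ h<t₀+δ → <-irrefl refl (begin-strict
      0ℚ <⟨ 0<-+ (0<-* (<⇒0<- h<t₀+δ) (0<t₀+δ+h+ρ h 0≤h))
          (≤⇒0≤- Dr≤ ⊕ ≤⇒0≤- star-upper ⊕ <⇒≤ 0<δ ⊗ ≤⇒0≤- δ≤2) ⟩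
      (t₀ + δ - h) * (t₀ + δ + h + (r - 1ℚ)) + ((h * (h + r - 1ℚ) - D * r) +
          (((D - + 1 / 8) * r - t₀ * (t₀ + r - 1ℚ)) + δ * (+ 2 / 1 - δ)))
         ≡⟨ identity r D t₀ δ h ⟩
      c * δ - + 1 / 8 * r
         ≡⟨ cong (_- + 1 / 8 * r) cδ≡ ⟩
      + 1 / 8 * r - + 1 / 8 * r
         ≡⟨ +-inverseʳ (+ 1 / 8 * r) ⟩
      0ℚ ∎)
      where
      open ≤-Reasoning
      c δ : ℚ
      c = + 2 / 1 * t₀ + r + 1ℚ
      δ = + 1 / 8 * r * inv c
      0≤t₀ : 0ℚ ≤ t₀
      0≤t₀ = ≤-trans (0≤lit (+ 3 / 1)) 3≤t₀
      0<c : 0ℚ < c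
      0<c = +-mono-≤-< (0≤lit (+ 2 / 1) ⊗ 0≤t₀ ⊕ 0≤r) 0<1
      0<δ : 0ℚ < δ
      0<δ = 0<-* (0<-* (0<lit (+ 1 / 8)) (<-≤-trans 0<1 1≤r)) (0<inv 0<c)
      cδ≡ : c * δ ≡ + 1 / 8 * r
      cδ≡ = trans (rotate c (+ 1 / 8 * r) (inv c)) (trans (cong (+ 1 / 8 * r *_) (*-inv 0<c))
          (*-identityʳ (+ 1 / 8 * r)))
        where
        rotate = solve 3 (λ a b i → a :* (b :* i) := b :* (a :* i)) refl
      δ≤2 : δ ≤ + 2 / 1
      δ≤2 = *-cancelˡ c 0<c (subst (_≤ c * (+ 2 / 1)) (sym cδ≡)
          (≤-by (gap t₀ r) (0≤lit (+ 4 / 1) ⊗ 0≤t₀ ⊕ 0≤lit (+ 15 / 8) ⊗ 0≤r ⊕ 0≤lit (+ 2 / 1))))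
        where
        gap = solve 2 (λ t r → (con (+ 2 / 1) :* t :+ r :+ con 1ℚ) :* con (+ 2 / 1) :- (con (+ 1
            / 8)) :* r := con (+ 4 / 1) :* t :+ (con (+ 15 / 8) :* r :+ con (+ 2 / 1))) refl
      0<t₀+δ+h+ρ : ∀ h → 0ℚ ≤ h → 0ℚ < t₀ + δ + h + (r - 1ℚ)
      0<t₀+δ+h+ρ h 0≤h = 0<-+ (0<-+ (+-mono-≤-< 0≤t₀ 0<δ) 0≤h) (≤⇒0≤- 1≤r)
      identity = solve 5 (λ r D t d h → (t :+ d :- h) :* (t :+ d :+ h :+ (r :- con 1ℚ)) :+
          ((h :* (h :+ r
          :- con 1ℚ) :- D :* r) :+ (((D :- con (+ 1 / 8)) :* r :- t :* (t :+ r :- con 1ℚ)) :+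
          d :* (con (+ 2 / 1) :- d))) := (con (+ 2 / 1) :* t :+ r :+ con 1ℚ) :* d :- (con (+ 1
          / 8)) :* r) refl

-- A vertex of maximal degree forces a broom

module MaximalDegree where

  open import Data.Fin.Subset using (_∈_)
  open import Data.Fin.Subset.Properties using (_∈?_)
  open import Data.Rational.Base using (ℚ; 0ℚ; 1ℚ; _+_; _-_; -_; _≤_; _<_)
  open import Data.Rational.Properties hiding (_≟_)
  open +-*-Solver using (solve; con; _:=_; _:+_; _:-_; :-_)

  open import Defs hiding (sum; inner; T; joint)
  open Rationals
  open FiniteSums
  open Adjacencies
  open Walks
  open LinearAcyclic
  open LocalCounts
  open Brooms

  module _ {m} (H : Hypergraph) (uniform : Uniform m H) (linear : Linear H)
      (acyclic : ∀ l → ¬ LooseCycle H l)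
    {x y d} (P : Path H x y d) (minimal : ∀ l → Path H x y l → d ℕ.≤ l)
    (covered : ∀ v → ∃ λ e → v ∈ edge H e) where

    open Incidence H
    open ShortCycles H linear acyclic
    open Ball H linear acyclic using (unit-χ)
    open Path P
    open Geodesic P minimal

    private
      -- Otherwise the common edge would shorten the geodesic.
      span : ∀ {e} i j → vertex i ∈ᵉ e → vertex j ∈ᵉ e → toℕ j ℕ.≤ suc (toℕ i)
      span i j i∈ j∈ = ℕ.+-cancelʳ-≤ (d ℕ.∸ toℕ j) (toℕ j) (suc (toℕ i)) (begin
        toℕ j ℕ.+ (d ℕ.∸ toℕ j)            ≡⟨ ℕ.m+[n∸m]≡n (ℕ.s≤s⁻¹ (Fin.toℕ<n j)) ⟩
        d                                  ≤⟨ walk-length (prefix P i ++ʷ step i∈ j∈ (suffix P j)) ⟩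
        toℕ i ℕ.+ suc (d ℕ.∸ toℕ j)        ≡⟨ ℕ.+-suc (toℕ i) (d ℕ.∸ toℕ j) ⟩
        suc (toℕ i) ℕ.+ (d ℕ.∸ toℕ j)      ∎)
        where open ℕ.≤-Reasoning

      start∈ : ∀ a → vertex (inject₁ a) ∈ᵉ link a
      start∈ a = proj₁ (incident a)

      end∈ : ∀ a → vertex (suc a) ∈ᵉ link a
      end∈ a = proj₂ (incident a)

      vertex∈link : ∀ {j a} → vertex j ∈ᵉ link a → j ≡ inject₁ a ⊎ j ≡ suc a
      vertex∈link {j} {a} j∈ with ℕ.m≤n⇒m<n∨m≡n (span j (suc a) j∈ (end∈ a))
      ... | inj₂ eq = inj₁ (Fin.toℕ-injective (trans (sym (ℕ.suc-injective eq))
          (sym (Fin.toℕ-inject₁ a))))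
      ... | inj₁ lt = inj₂ (Fin.toℕ-injective (ℕ.≤-antisym
          (subst (toℕ j ℕ.≤_) (cong suc (Fin.toℕ-inject₁ a)) (span (inject₁ a) j (start∈ a) j∈))
          (ℕ.s≤s⁻¹ lt)))

      consecutive-vertex : ∀ {a b} → toℕ b ≡ suc (toℕ a) → vertex (suc a) ∈ᵉ link b
      consecutive-vertex {a} {b} eq = subst (λ j → vertex j ∈ᵉ link b)
          (Fin.toℕ-injective (trans (Fin.toℕ-inject₁ b) eq)) (start∈ b)

      consecutive : ∀ {a b v} → toℕ b ≡ suc (toℕ a) → v ∈ᵉ link a → v ∈ᵉ link b → v ≡ vertex (suc a)
      consecutive {a} {b} eq va vb = same-vertex (λ h → ℕ.1+n≢n
          (trans (sym eq) (cong toℕ (sym (edges-distinct h))))) va (end∈ a) vb (consecutive-vertex eq)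

      adjacent : ∀ {a b : Fin d} → a ≢ b → toℕ b ℕ.< toℕ a ℕ.+ 2 → toℕ a ℕ.< toℕ b ℕ.+ 2 → toℕ b ≡ suc
          (toℕ a) ⊎ toℕ a ≡ suc (toℕ b)
      adjacent {a} {b} a≢b b< a< with ℕ.<-cmp (toℕ a) (toℕ b)
      ... | tri< lt _ _ = inj₁ (ℕ.≤-antisym (ℕ.s≤s⁻¹ (subst (toℕ b ℕ.<_) (ℕ.+-comm (toℕ a) 2) b<)) lt)
      ... | tri≈ _ eq _ = contradiction (Fin.toℕ-injective eq) a≢b
      ... | tri> _ _ gt = inj₂ (ℕ.≤-antisym (ℕ.s≤s⁻¹ (subst (toℕ a ℕ.<_) (ℕ.+-comm (toℕ b) 2) a<)) gt)

      meeting-links : ∀ {a b v} → a ≢ b → v ∈ᵉ link a → v ∈ᵉ link b → toℕ b ≡ suc (toℕ a) ⊎ toℕ a ≡ suc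
          (toℕ b)
      meeting-links {a} {b} a≢b va vb = adjacent a≢b (chain-length a b (va , vb ∷ [ link b ]))
          (chain-length b a (vb , va ∷ [ link a ]))

    -- The path and the edges at v, if v has the largest degree that is possible
    -- for the given number of edges and diameter.
    module _ (v : Vertex H) (deg≡ : deg v ≡ (ι (size H) - ι d) + ι 2) where

      private
        OffPath : Edge H → Set
        OffPath e = ∀ a → e ≢ link a

        path-degree : ℚ
        path-degree = sum (λ a → χ (link a) v)

        path-degree≤2 : path-degree ≤ ι 2
        path-degree≤2 = sum-window (λ a → χ (link a) v) 2 (λ a → unit-χ (link a) v)
          (λ a b p q → chain-length a b (0<χ⇒∈ p , 0<χ⇒∈ q ∷ [ link b ]))

        -- The edges off the path contribute at most k - d to the degree.
        2≤path-degree : ι 2 ≤ path-degree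
        2≤path-degree = ≤-by (identity (ι (size H) - ι d) path-degree (ι 2))
            (≤⇒0≤- (subst (_≤ (ι (size H) - ι d) + path-degree) (trans (sym (deg≡sum v)) deg≡)
          (PathCount.sum-off-path H link edges-distinct (λ e → χ e v) (λ e → unit-χ e v))))
          where
          identity = solve 3 (λ k p t → p :- t := (k :+ p) :- (k :+ t)) refl

        -- `sum-off-path` holds for any injective list of edges, so `e` can be put in front of the
        -- path: an `e` that misses `v` would lower the bound on the degree by 1.
        off-path∋v : ∀ e → OffPath e → v ∈ᵉ e
        off-path∋v e off with v ∈? edge H e
        ... | yes v∈e = v∈e
        ... | no v∉e  = contradiction (≤-<-trans (subst₂ _≤_ (trans (sym (deg≡sum v)) deg≡) refl
                (PathCount.sum-off-path H extended extended-injective (λ e → χ e v) (λ e → unit-χ e v)))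
              (subst (λ h → (ι (size H) - ι (suc d)) + (h + path-degree) < (ι (size H) - ι d) + ι 2)
                  (sym (∉⇒χ≡0 v∉e))
                (<-by (identity (ι (size H)) (ι d) path-degree (ι 2))
                    (0<-+ 0<1 (≤⇒0≤- path-degree≤2))))) (<-irrefl refl)
          where
          identity = solve 4 (λ k d p t → ((k :- d) :+ t) :- ((k :- (con 1ℚ :+ d)) :+ (con 0ℚ :+ p)) :=
              (con 1ℚ) :+ (t :- p)) refl
          extended : Fin (suc d) → Edge H
          extended zero    = e
          extended (suc a) = link a
          extended-injective : ∀ {a b} → extended a ≡ extended b → a ≡ b
          extended-injective {zero}  {zero}  _  = refl
          extended-injective {zero}  {suc b} eq = contradiction eq (off b)
          extended-injective {suc a} {zero}  eq = contradiction (sym eq) (off a)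
          extended-injective {suc a} {suc b} eq = cong suc (edges-distinct eq)

        two-links : ∃ λ a → ∃ λ b → toℕ b ≡ suc (toℕ a) × v ∈ᵉ link a × v ∈ᵉ link b
        two-links with Fin.any? (λ a → Fin.any? (λ b → ¬? (a Fin.≟ b) ×-dec ((v ∈? edge H (link a)) ×-dec (v ∈? edge H (link b)))))
        ... | yes (a , b , a≢b , va , vb) = [ (λ eq → a , b , eq , va , vb) ,
            (λ eq → b , a , eq , vb , va) ]′ (meeting-links a≢b va vb)
        ... | no none = contradiction (≤-trans 2≤path-degree
            (sum≤1 (exclusive (λ a → 0≤χ (link a) v) (λ a → χ≤1 (link a) v) unique)))
            (<⇒≱ (ι-mono-< {1} {2} ℕ.≤-refl))
          where
          <⇒≱ : ∀ {p q} → p < q → ¬ q ≤ p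
          <⇒≱ p<q q≤p = <-irrefl refl (<-≤-trans p<q q≤p)
          unique : ∀ a b → 0ℚ < χ (link a) v → 0ℚ < χ (link b) v → a ≡ b
          unique a b ha hb with a Fin.≟ b
          ... | yes a≡b = a≡b
          ... | no a≢b  = contradiction (a , b , a≢b , 0<χ⇒∈ ha , 0<χ⇒∈ hb) none

        a₀ b₀ : Fin d
        a₀ = proj₁ two-links
        b₀ = proj₁ (proj₂ two-links)
        b₀≡ : toℕ b₀ ≡ suc (toℕ a₀)
        b₀≡ = proj₁ (proj₂ (proj₂ two-links))
        v∈a₀ : v ∈ᵉ link a₀
        v∈a₀ = proj₁ (proj₂ (proj₂ (proj₂ two-links)))
        v∈b₀ : v ∈ᵉ link b₀
        v∈b₀ = proj₂ (proj₂ (proj₂ (proj₂ two-links)))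

        c : Fin (suc d)
        c = suc a₀

        v≡ : v ≡ vertex c
        v≡ = consecutive b₀≡ v∈a₀ v∈b₀

        label : ∀ e → (∃ λ a → e ≡ link a) ⊎ OffPath e
        label e with Fin.any? (λ a → e Fin.≟ link a)
        ... | yes found = inj₁ found
        ... | no none   = inj₂ λ a eq → none (a , eq)

        lab : Edge H → Maybe (Fin d)
        lab e = [ just ∘ proj₁ , (λ _ → nothing) ]′ (label e)

        lab-link : ∀ a → lab (link a) ≡ just a
        lab-link a with label (link a)
        ... | inj₁ (b , eq) = cong just (sym (edges-distinct eq))
        ... | inj₂ off      = contradiction refl (off a)

        link-lab : ∀ {e a} → lab e ≡ just a → e ≡ link a
        link-lab {e} h with label e
        link-lab refl | inj₁ (_ , eq) = eq
        link-lab ()   | inj₂ _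

        -- By `span`, another joint on `e` would be next to `c`, and `e` would share two vertices
        -- with a path edge, against linearity.
        vertex∈off-path : ∀ {e j} → OffPath e → vertex j ∈ᵉ e → j ≡ c
        vertex∈off-path {e} {j} off j∈ with ℕ.<-cmp (toℕ j) (toℕ c)
        ... | tri≈ _ eq _ = Fin.toℕ-injective eq
        ... | tri< lt _ _ = contradiction (same-edge
            (λ h → ℕ.<-irrefl (cong toℕ (vertices-distinct h)) lt) j∈ c∈
                (subst (λ j → vertex j ∈ᵉ link a₀) (sym j≡) (start∈ a₀)) (end∈ a₀)) (off a₀)
          where
          c∈ = subst (_∈ᵉ e) v≡ (off-path∋v e off)
          j≡ : j ≡ inject₁ a₀
          j≡ = Fin.toℕ-injective (trans (ℕ.≤-antisym (ℕ.s≤s⁻¹ lt) (ℕ.s≤s⁻¹ (span j c j∈ c∈)))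
              (sym (Fin.toℕ-inject₁ a₀)))
        ... | tri> _ _ gt = contradiction (same-edge
            (λ h → ℕ.<-irrefl (cong toℕ (vertices-distinct h)) gt) c∈ j∈
                (consecutive-vertex b₀≡) (subst (λ j → vertex j ∈ᵉ link b₀) (sym j≡) (end∈ b₀)))
                    (off b₀)
          where
          c∈ = subst (_∈ᵉ e) v≡ (off-path∋v e off)
          j≡ : j ≡ suc b₀
          j≡ = Fin.toℕ-injective (trans (ℕ.≤-antisym (span c j c∈ j∈) gt) (cong suc (sym b₀≡)))

        -- An edge off the path meets the path in v only: otherwise it would yield
        -- a shorter walk or close a triangle at v.
        off-path-meets : ∀ {e b z} → OffPath e → z ∈ᵉ e → z ∈ᵉ link b → z ≡ v
        off-path-meets {e} {b} {z} off ze zb with v ∈? edge H (link b)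
        ... | yes vb = same-vertex (off b) ze (off-path∋v e off) zb vb
        ... | no v∉b = contradiction position λ { (inj₁ eq) → above eq ; (inj₂ eq) → below eq }
          where
          ve = off-path∋v e off
          a₀≢b : a₀ ≢ b
          a₀≢b refl = v∉b v∈a₀
          b₀≢b : b₀ ≢ b
          b₀≢b refl = v∉b v∈b₀
          a₀≢b₀ : a₀ ≢ b₀
          a₀≢b₀ h = ℕ.1+n≢n (trans (sym b₀≡) (cong toℕ (sym h)))
          above : toℕ b ≡ suc (toℕ b₀) → ⊥
          above eq = no-triangle (off b₀) (λ h → b₀≢b (edges-distinct h)) (off b ∘ sym) ve v∈b₀
              (end∈ b₀) (consecutive-vertex eq) zb ze
            (λ h → a₀≢b₀ (Fin.suc-injective (vertices-distinct (trans (sym v≡) h))))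
          below : toℕ a₀ ≡ suc (toℕ b) → ⊥
          below eq = no-triangle (off a₀) (λ h → a₀≢b (edges-distinct h)) (off b ∘ sym) ve v∈a₀
              (consecutive-vertex eq) (end∈ b) zb ze
            (λ h → a₀≢b (Fin.suc-injective (vertices-distinct (trans (sym v≡) h))))
          -- Chains of three edges through `e` leave for `b` only the positions next to `a₀` and
          -- `b₀`, where a joint of the path completes a triangle.
          position : toℕ b ≡ suc (toℕ b₀) ⊎ toℕ a₀ ≡ suc (toℕ b)
          position with ℕ.<-cmp (toℕ b) (toℕ b₀)
          ... | tri≈ _ eq _ = contradiction (Fin.toℕ-injective (sym eq)) b₀≢b
          ... | tri> _ _ gt = inj₁ (ℕ.≤-antisym (ℕ.s≤s⁻¹
              (subst (toℕ b ℕ.<_) (trans (ℕ.+-comm (toℕ a₀) 3) (cong (2+) (sym b₀≡)))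
                                (chain-length a₀ b (v∈a₀ , ve ∷ (ze , zb ∷ [ link b ]))))) gt)
          ... | tri< lt _ _ = inj₂ (ℕ.≤-antisym (ℕ.s≤s⁻¹ (ℕ.s≤s⁻¹ (subst₂ ℕ._<_ b₀≡ (ℕ.+-comm (toℕ b) 3)
                                (chain-length b b₀ (zb , ze ∷ (ve , v∈b₀ ∷ [ link b₀ ]))))))
                                (ℕ.≤∧≢⇒< (ℕ.s≤s⁻¹ (subst (toℕ b ℕ.<_) b₀≡ lt))
                                    (λ eq → a₀≢b (Fin.toℕ-injective (sym eq)))))

        -- Consequently a vertex that is no joint lies in a single edge, which can serve as its
        -- label.
        two-edges⇒joint : ∀ {e f z} → e ≢ f → z ∈ᵉ e → z ∈ᵉ f → ∃ λ j → z ≡ vertex j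
        two-edges⇒joint {e} {f} e≢f ze zf with label e | label f
        ... | inj₂ off | inj₂ off′ = c , trans (same-vertex e≢f ze (off-path∋v e off) zf
            (off-path∋v f off′)) v≡
        ... | inj₂ off | inj₁ (b , refl) = c , trans (off-path-meets off ze zf) v≡
        ... | inj₁ (a , refl) | inj₂ off = c , trans (off-path-meets off zf ze) v≡
        ... | inj₁ (a , refl) | inj₁ (b , refl) = [ (λ eq → suc a , consecutive eq ze zf) ,
            (λ eq → suc b , consecutive eq zf ze) ]′
                (meeting-links (λ a≡b → e≢f (cong link a≡b)) ze zf)

        vlabel : ∀ z → (∃ λ j → z ≡ vertex j) ⊎ (∀ j → z ≢ vertex j)
        vlabel z with Fin.any? (λ j → z Fin.≟ vertex j)
        ... | yes found = inj₁ found
        ... | no none   = inj₂ λ j eq → none (j , eq)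

        ℓ : Vertex H → Fin (suc d) ⊎ Edge H
        ℓ z = [ inj₁ ∘ proj₁ , (λ _ → inj₂ (proj₁ (covered z))) ]′ (vlabel z)

        ℓ-vertex : ∀ j → ℓ (vertex j) ≡ inj₁ j
        ℓ-vertex j with vlabel (vertex j)
        ... | inj₁ (i , eq) = cong inj₁ (sym (vertices-distinct eq))
        ... | inj₂ none     = contradiction refl (none j)

        vertex-ℓ : ∀ {z j} → ℓ z ≡ inj₁ j → z ≡ vertex j
        vertex-ℓ {z} h with vlabel z
        vertex-ℓ refl | inj₁ (_ , eq) = eq
        vertex-ℓ ()   | inj₂ _

        joint⇒ : ∀ {j e} → vertex j ∈ᵉ e → On c j (lab e)
        joint⇒ {j} {e} j∈ with label e
        ... | inj₁ (a , refl) = vertex∈link j∈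
        ... | inj₂ off        = vertex∈off-path off j∈

        joint⇐ : ∀ {j e} → On c j (lab e) → vertex j ∈ᵉ e
        joint⇐ {j} {e} on with label e
        joint⇐ (inj₁ refl) | inj₁ (a , refl) = start∈ a
        joint⇐ (inj₂ refl) | inj₁ (a , refl) = end∈ a
        joint⇐ {e = e} refl | inj₂ off       = subst (_∈ᵉ e) v≡ (off-path∋v e off)

        to : ∀ z e → z ∈ᵉ e → Inc c lab (ℓ z) e
        to z e z∈e with vlabel z
        ... | inj₁ (j , refl) = joint⇒ z∈e
        ... | inj₂ none with proj₁ (covered z) Fin.≟ e
        ...   | yes eq = eq
        ...   | no neq = contradiction (two-edges⇒joint neq (proj₂ (covered z)) z∈e)
            (λ { (j , eq) → none j eq })

        from : ∀ z e → Inc c lab (ℓ z) e → z ∈ᵉ e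
        from z e inc with vlabel z
        ... | inj₁ (j , refl) = joint⇐ inc
        ... | inj₂ none       = subst (z ∈ᵉ_) inc (proj₂ (covered z))

      extract-broom : ∃ λ c → 1 ℕ.≤ toℕ c × toℕ c ℕ.< d × Broom m H d c
      extract-broom = c , ℕ.s≤s ℕ.z≤n , subst (ℕ._< d) b₀≡ (Fin.toℕ<n b₀) , record
        { uniform = uniform
        ; w = vertex
        ; link = link
        ; ℓ = ℓ
        ; lab = lab
        ; ℓ-w = ℓ-vertex
        ; w-ℓ = vertex-ℓ
        ; lab-link = lab-link
        ; link-lab = link-lab
        ; incident = λ z e → mk⇔ (to z e) (from z e)
        }

-- Isomorphism of brooms by counting labels

module BroomIsomorphisms where

  open import Data.Fin.Permutation using (Permutation; _⟨$⟩ʳ_; _⟨$⟩ˡ_; inverseˡ; inverseʳ; insert;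
      insert-punchIn; permutation)
  open import Data.Fin.Subset using (∣_∣)
  import Data.Maybe.Properties as Maybe
  open import Data.Rational.Base using (ℚ; 0ℚ; 1ℚ; _+_; _*_; _-_; -_; _≤_; _<_)
  open import Data.Rational.Properties hiding (_≟_)
  import Data.Sum.Properties as Sum
  open +-*-Solver using (solve; _:=_; _:+_; _:-_; :-_)

  open import Defs hiding (sum; inner; T; joint)
  open Rationals
  open FiniteSums
  open Adjacencies using (module Incidence)
  open Brooms

  module _ {A : Set} (_≟_ : DecidableEquality A) where

    count : ∀ {n} → (Fin n → A) → A → ℚ
    count f a = sum (λ i → ⟦ f i ≟ a ⟧)

    private
      1≤count : ∀ {n} (f : Fin (suc n) → A) → 1ℚ ≤ count f (f zero)
      1≤count f = subst (_≤ count f (f zero)) (⟦⟧-yes (f zero ≟ f zero) refl)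
          (single≤sum {f = λ i → ⟦ f i ≟ f zero ⟧} (λ i → 0≤I (does (f i ≟ f zero))) zero)

    -- Greedy matching: the label of the first index has a positive count on the other side, which
    -- yields a partner; removing both leaves the counts equal.
    counts⇒permutation : ∀ {m n} (f : Fin m → A) (g : Fin n → A) → (∀ a → count f a ≡ count g a) →
                         Σ (Permutation m n) λ π → ∀ i → g (π ⟨$⟩ʳ i) ≡ f i
    counts⇒permutation {zero} {zero} f g h = permutation id id (λ _ → refl) (λ _ → refl) , λ ()
    counts⇒permutation {zero} {suc n} f g h = contradiction
        (<-≤-trans 0<1 (subst (1ℚ ≤_) (sym (h (g zero))) (1≤count g))) (<-irrefl refl)
    counts⇒permutation {suc m} {zero} f g h = contradiction
        (<-≤-trans 0<1 (subst (1ℚ ≤_) (h (f zero)) (1≤count f))) (<-irrefl refl)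
    counts⇒permutation {suc m} {suc n} f g h = insert zero j π , value
      where
      found : ∃ λ j → 0ℚ < ⟦ g j ≟ f zero ⟧
      found = 0<sum⇒∃ {f = λ j → ⟦ g j ≟ f zero ⟧} (<-≤-trans 0<1
          (subst (1ℚ ≤_) (h (f zero)) (1≤count f)))
      j : Fin (suc n)
      j = proj₁ found
      gj≡ : g j ≡ f zero
      gj≡ = 0<⟦⟧ (g j ≟ f zero) (proj₂ found)
      rest : ∀ a → count (f ∘ suc) a ≡ count (g ∘ punchIn j) a
      rest a = +-cancel ⟦ f zero ≟ a ⟧ (count (f ∘ suc) a) (count (g ∘ punchIn j) a) (trans (h a)
        (trans (sum-remove {i = j} (λ i → ⟦ g i ≟ a ⟧))
            (cong (λ x → ⟦ x ≟ a ⟧ + count (g ∘ punchIn j) a) gj≡)))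
        where
        shift = solve 2 (λ a b → (a :+ b) :- a := b) refl
        +-cancel : ∀ a b c → a + b ≡ a + c → b ≡ c
        +-cancel a b c eq = trans (sym (shift a b)) (trans (cong (_- a) eq) (shift a c))
      recursive : Σ (Permutation m n) λ π → ∀ i → g (punchIn j (π ⟨$⟩ʳ i)) ≡ f (suc i)
      recursive = counts⇒permutation (f ∘ suc) (g ∘ punchIn j) rest
      π : Permutation m n
      π = proj₁ recursive
      value : ∀ i → g (insert zero j π ⟨$⟩ʳ i) ≡ f i
      value zero    = gj≡
      value (suc i) = trans (cong g (insert-punchIn zero j π i)) (proj₂ recursive i)

  private
    sub-self = solve 2 (λ a b → (a :+ b) :- b := a) refl

    cancelʳ : ∀ {a b} c → a + c ≡ b + c → a ≡ b
    cancelʳ {a} {b} c eq = trans (sym (sub-self a c)) (trans (cong (_- c) eq) (sub-self b c))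

  module Labels {m H d c} (B : Broom m H d c) where

    open Broom B
    open Incidence H

    _≟ᵉ_ : DecidableEquality (Maybe (Fin d))
    _≟ᵉ_ = Maybe.≡-dec Fin._≟_

    _≟ᵛ_ : DecidableEquality (Fin (suc d) ⊎ Edge H)
    _≟ᵛ_ = Sum.≡-dec Fin._≟_ Fin._≟_

    On? : ∀ j x → Dec (On c j x)
    On? j (just a) = (j Fin.≟ inject₁ a) ⊎-dec (j Fin.≟ suc a)
    On? j nothing  = j Fin.≟ c

    count-just : ∀ a → count _≟ᵉ_ lab (just a) ≡ 1ℚ
    count-just a = trans (sum-single (link a) (λ e e≢ → ⟦⟧-no (lab e ≟ᵉ just a) (e≢ ∘ link-lab)))
        (⟦⟧-yes (lab (link a) ≟ᵉ just a) (lab-link a))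

    count-nothing : count _≟ᵉ_ lab nothing + ι d ≡ ι (size H)
    count-nothing = begin
      count _≟ᵉ_ lab nothing + ι d
        ≡⟨ cong (λ h → count _≟ᵉ_ lab nothing + h) (trans
            (sym (trans (sum-const d 1ℚ) (*-identityʳ (ι d)))) (sum-cong-≗ (λ a → sym (count-just a))))
            ⟩
      count _≟ᵉ_ lab nothing + sum (λ a → sum (λ e → ⟦ lab e ≟ᵉ just a ⟧))
        ≡⟨ cong (λ h → count _≟ᵉ_ lab nothing + h) (∑-comm (λ a e → ⟦ lab e ≟ᵉ just a ⟧)) ⟩
      sum (λ e → ⟦ lab e ≟ᵉ nothing ⟧) + sum (λ e → sum (λ a → ⟦ lab e ≟ᵉ just a ⟧))
        ≡⟨ ∑-distrib-+ (λ e → ⟦ lab e ≟ᵉ nothing ⟧) (λ e → sum (λ a → ⟦ lab e ≟ᵉ just a ⟧)) ⟨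
      sum (λ e → ⟦ lab e ≟ᵉ nothing ⟧ + sum (λ a → ⟦ lab e ≟ᵉ just a ⟧))
        ≡⟨ sum-cong-≗ (λ e → total (lab e)) ⟩
      sum {size H} (λ _ → 1ℚ)
        ≡⟨ trans (sum-const (size H) 1ℚ) (*-identityʳ (ι (size H))) ⟩
      ι (size H) ∎
      where
      open ≡-Reasoning
      total : ∀ x → ⟦ x ≟ᵉ nothing ⟧ + sum (λ a → ⟦ x ≟ᵉ just a ⟧) ≡ 1ℚ
      total nothing  = trans (cong (λ h → 1ℚ + h) (sum-zero (λ a → ⟦⟧-no (nothing ≟ᵉ just a) λ ())))
          (+-identityʳ 1ℚ)
      total (just b) = cong₂ _+_ (⟦⟧-no (just b ≟ᵉ nothing) λ ())
        (trans (sum-single b (λ a a≢b → ⟦⟧-no (just b ≟ᵉ just a)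
            (λ eq → a≢b (sym (Maybe.just-injective eq))))) (⟦⟧-yes (just b ≟ᵉ just b) refl))

    count-joint : ∀ j → count _≟ᵛ_ ℓ (inj₁ j) ≡ 1ℚ
    count-joint j = trans (sum-single (w j) (λ v v≢ → ⟦⟧-no (ℓ v ≟ᵛ inj₁ j) (v≢ ∘ w-ℓ)))
        (⟦⟧-yes (ℓ (w j) ≟ᵛ inj₁ j) (ℓ-w j))

    -- Inner vertices and joints together exhaust the m vertices of the edge, so the number of inner
    -- ones depends only on the label of the edge.
    count-inner : ∀ e → count _≟ᵛ_ ℓ (inj₂ e) + sum (λ j → ⟦ On? j (lab e) ⟧) ≡ ι m
    count-inner e = begin
      count _≟ᵛ_ ℓ (inj₂ e) + sum (λ j → ⟦ On? j (lab e) ⟧)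
        ≡⟨ cong (λ h → count _≟ᵛ_ ℓ (inj₂ e) + h) (sum-cong-≗
            (λ j → trans (sym (*-identityˡ ⟦ On? j (lab e) ⟧))
            (trans (cong (_* ⟦ On? j (lab e) ⟧) (sym (count-joint j)))
             (*-distribʳ-sum ⟦ On? j (lab e) ⟧ (λ v → ⟦ ℓ v ≟ᵛ inj₁ j ⟧))))) ⟩
      count _≟ᵛ_ ℓ (inj₂ e) + sum (λ j → sum (λ v → ⟦ ℓ v ≟ᵛ inj₁ j ⟧ * ⟦ On? j (lab e) ⟧))
        ≡⟨ cong (λ h → count _≟ᵛ_ ℓ (inj₂ e) + h) (∑-comm
            (λ j v → ⟦ ℓ v ≟ᵛ inj₁ j ⟧ * ⟦ On? j (lab e) ⟧)) ⟩
      sum (λ v → ⟦ ℓ v ≟ᵛ inj₂ e ⟧) + sum (λ v → sum (λ j → ⟦ ℓ v ≟ᵛ inj₁ j ⟧ * ⟦ On? j (lab e) ⟧))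
        ≡⟨ ∑-distrib-+ (λ v → ⟦ ℓ v ≟ᵛ inj₂ e ⟧) (λ v → sum
            (λ j → ⟦ ℓ v ≟ᵛ inj₁ j ⟧ * ⟦ On? j (lab e) ⟧)) ⟨
      sum (λ v → ⟦ ℓ v ≟ᵛ inj₂ e ⟧ + sum (λ j → ⟦ ℓ v ≟ᵛ inj₁ j ⟧ * ⟦ On? j (lab e) ⟧))
        ≡⟨ sum-cong-≗ (λ v → by-label v (ℓ v) refl) ⟩
      sum (χ e)
        ≡⟨ size≡sum e ⟨
      ι ∣ edge H e ∣
        ≡⟨ cong ι (uniform e) ⟩
      ι m ∎
      where
      open ≡-Reasoning
      indicator : ∀ {v A} (A? : Dec A) → (A → v ∈ᵉ e) → (v ∈ᵉ e → A) → ⟦ A? ⟧ ≡ χ e v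
      indicator (yes a) f g = sym (∈⇒χ≡1 (f a))
      indicator (no ¬a) f g = sym (∉⇒χ≡0 (¬a ∘ g))
      by-label : ∀ v x → ℓ v ≡ x → ⟦ x ≟ᵛ inj₂ e ⟧ + sum (λ j → ⟦ x ≟ᵛ inj₁ j ⟧ * ⟦ On? j (lab e) ⟧) ≡ χ
          e v
      by-label v (inj₁ i) eq = trans (cong₂ _+_ (⟦⟧-no (inj₁ i ≟ᵛ inj₂ e) λ ())
          (trans (sum-single i (λ j j≢i → ≡0⇒*≡0 (⟦⟧-no (inj₁ i ≟ᵛ inj₁ j)
              (λ h → j≢i (sym (Sum.inj₁-injective h)))) ⟦ On? j (lab e) ⟧))
            (≡1⇒*≡ (⟦⟧-yes (inj₁ i ≟ᵛ inj₁ i) refl) ⟦ On? i (lab e) ⟧)))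
        (trans (+-identityˡ ⟦ On? i (lab e) ⟧) (indicator (On? i (lab e))
            (λ on → Inc⇒∈ (subst (λ x → Inc c lab x e) (sym eq) on))
            (λ v∈ → subst (λ x → Inc c lab x e) eq (∈⇒Inc v∈))))
      by-label v (inj₂ f) eq = trans (cong (λ h → ⟦ inj₂ f ≟ᵛ inj₂ e ⟧ + h)
          (sum-zero (λ j → ≡0⇒*≡0 (⟦⟧-no (inj₂ f ≟ᵛ inj₁ j) λ ()) ⟦ On? j (lab e) ⟧)))
        (trans (+-identityʳ ⟦ inj₂ f ≟ᵛ inj₂ e ⟧) (indicator (inj₂ f ≟ᵛ inj₂ e)
            (λ h → Inc⇒∈ (subst (λ x → Inc c lab x e) (sym eq) (Sum.inj₂-injective h)))
          (λ v∈ → cong inj₂ (subst (λ x → Inc c lab x e) eq (∈⇒Inc v∈)))))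

  -- Edges are matched first, by their labels. Vertex labels mention edges, so they are transported
  -- along that matching before the vertices are matched in turn.
  broom-≅ : ∀ {m G H d c} → Broom m G d c → Broom m H d c → size G ≡ size H → G ≅ H
  broom-≅ {m} {G} {H} {d} {c} BG BH size≡ = record
    { vertices  = ν
    ; edges     = π
    ; incidence = λ v e → mk⇔ (λ v∈e → HB.Inc⇒∈ (subst (λ x → Inc c HB.lab x (π ⟨$⟩ʳ e))
        (sym (ν-label v)) (transport (GB.ℓ v) (GB.∈⇒Inc v∈e))))
                              (λ v∈e → GB.Inc⇒∈ (transport⁻ (GB.ℓ v)
                                  (subst (λ x → Inc c HB.lab x (π ⟨$⟩ʳ e)) (ν-label v) (HB.∈⇒Inc v∈e))))
    }
    where
    module GB = Broom BG
    module HB = Broom BH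
    module GL = Labels BG
    module HL = Labels BH
    edge-counts : ∀ x → count GL._≟ᵉ_ GB.lab x ≡ count GL._≟ᵉ_ HB.lab x
    edge-counts (just a) = trans (GL.count-just a) (sym (HL.count-just a))
    edge-counts nothing  = cancelʳ (ι d) (trans GL.count-nothing
        (trans (cong ι size≡) (sym HL.count-nothing)))
    edge-matching = counts⇒permutation GL._≟ᵉ_ GB.lab HB.lab edge-counts
    π : Permutation (size G) (size H)
    π = proj₁ edge-matching
    π-label : ∀ e → HB.lab (π ⟨$⟩ʳ e) ≡ GB.lab e
    π-label = proj₂ edge-matching
    π-injective : ∀ {e f} → π ⟨$⟩ʳ e ≡ π ⟨$⟩ʳ f → e ≡ f
    π-injective eq = trans (sym (inverseˡ π)) (trans (cong (π ⟨$⟩ˡ_) eq) (inverseˡ π))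
    relabel : Fin (suc d) ⊎ Edge G → Fin (suc d) ⊎ Edge H
    relabel = Sum.map₂ (π ⟨$⟩ʳ_)
    relabel-≡ : ∀ x e → (relabel x ≡ inj₂ (π ⟨$⟩ʳ e)) ⇔ (x ≡ inj₂ e)
    relabel-≡ x e = mk⇔ (to x) (λ { refl → refl })
      where
      to : ∀ x → relabel x ≡ inj₂ (π ⟨$⟩ʳ e) → x ≡ inj₂ e
      to (inj₂ f) eq = cong inj₂ (π-injective (Sum.inj₂-injective eq))
    relabel-joint : ∀ x j → (relabel x ≡ inj₁ j) ⇔ (x ≡ inj₁ j)
    relabel-joint x j = mk⇔ (to x) (λ { refl → refl })
      where
      to : ∀ x → relabel x ≡ inj₁ j → x ≡ inj₁ j
      to (inj₁ i) refl = refl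
    same-indicator : ∀ {A B : Set} (A? : Dec A) (B? : Dec B) → A ⇔ B → ⟦ A? ⟧ ≡ ⟦ B? ⟧
    same-indicator (yes a) B? eqv = sym (⟦⟧-yes B? (Equivalence.to eqv a))
    same-indicator (no ¬a) B? eqv = sym (⟦⟧-no B? (¬a ∘ Equivalence.from eqv))
    inner-counts : ∀ e → count HL._≟ᵛ_ (relabel ∘ GB.ℓ) (inj₂ (π ⟨$⟩ʳ e)) ≡ count HL._≟ᵛ_ HB.ℓ
        (inj₂ (π ⟨$⟩ʳ e))
    inner-counts e = trans (sum-cong-≗ (λ v → same-indicator (relabel (GB.ℓ v) HL.≟ᵛ inj₂ (π ⟨$⟩ʳ e))
        (GB.ℓ v GL.≟ᵛ inj₂ e) (relabel-≡ (GB.ℓ v) e)))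
      (cancelʳ (sum (λ j → ⟦ GL.On? j (GB.lab e) ⟧))
          (trans (GL.count-inner e) (trans (sym (HL.count-inner (π ⟨$⟩ʳ e)))
        (cong (λ h → count HL._≟ᵛ_ HB.ℓ (inj₂ (π ⟨$⟩ʳ e)) + h)
            (sum-cong-≗ (λ j → same-indicator (HL.On? j (HB.lab (π ⟨$⟩ʳ e))) (GL.On? j (GB.lab e))
          (mk⇔ (subst (On c j) (π-label e)) (subst (On c j) (sym (π-label e))))))))))
    vertex-counts : ∀ x → count HL._≟ᵛ_ (relabel ∘ GB.ℓ) x ≡ count HL._≟ᵛ_ HB.ℓ x
    vertex-counts (inj₁ j) = trans (sum-cong-≗ (λ v → same-indicator (relabel (GB.ℓ v) HL.≟ᵛ inj₁ j)
        (GB.ℓ v GL.≟ᵛ inj₁ j) (relabel-joint (GB.ℓ v) j)))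
      (trans (GL.count-joint j) (sym (HL.count-joint j)))
    vertex-counts (inj₂ e) = subst (λ e → count HL._≟ᵛ_ (relabel ∘ GB.ℓ) (inj₂ e) ≡ count HL._≟ᵛ_ HB.ℓ
        (inj₂ e)) (inverseʳ π) (inner-counts (π ⟨$⟩ˡ e))
    vertex-matching = counts⇒permutation HL._≟ᵛ_ (relabel ∘ GB.ℓ) HB.ℓ vertex-counts
    ν : Permutation (order G) (order H)
    ν = proj₁ vertex-matching
    ν-label : ∀ v → HB.ℓ (ν ⟨$⟩ʳ v) ≡ relabel (GB.ℓ v)
    ν-label = proj₂ vertex-matching
    transport : ∀ x {e} → Inc c GB.lab x e → Inc c HB.lab (relabel x) (π ⟨$⟩ʳ e)
    transport (inj₁ j) {e} on = subst (On c j) (sym (π-label e)) on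
    transport (inj₂ f) refl   = refl
    transport⁻ : ∀ x {e} → Inc c HB.lab (relabel x) (π ⟨$⟩ʳ e) → Inc c GB.lab x e
    transport⁻ (inj₁ j) {e} on = subst (On c j) (π-label e) on
    transport⁻ (inj₂ f) eq     = π-injective eq

  module _ {d : ℕ} where

    private
      toℕ-opposite-inject₁ : ∀ (a : Fin d) → toℕ (opposite (inject₁ a)) ≡ suc (toℕ (opposite a))
      toℕ-opposite-inject₁ a = trans (Fin.opposite-prop (inject₁ a))
          (trans (cong (λ h → d ℕ.∸ h) (Fin.toℕ-inject₁ a))
        (trans (ℕ.+-∸-assoc 1 (Fin.toℕ<n a)) (cong suc (sym (Fin.opposite-prop a)))))

      opposite-inject₁ : ∀ (a : Fin d) → opposite (inject₁ a) ≡ suc (opposite a)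
      opposite-inject₁ a = Fin.toℕ-injective (toℕ-opposite-inject₁ a)

      opposite-suc : ∀ (a : Fin d) → opposite (suc a) ≡ inject₁ (opposite a)
      opposite-suc a = Fin.toℕ-injective (trans (Fin.opposite-suc a)
          (sym (Fin.toℕ-inject₁ (opposite a))))

      On-opposite : ∀ c j x → On c j x → On (opposite c) (opposite j) (Maybe.map opposite x)
      On-opposite c j nothing  on         = cong opposite on
      On-opposite c j (just a) (inj₁ refl) = inj₂ (opposite-inject₁ a)
      On-opposite c j (just a) (inj₂ refl) = inj₁ (opposite-suc a)

      map-opposite² : ∀ (x : Maybe (Fin d)) → Maybe.map opposite (Maybe.map opposite x) ≡ x
      map-opposite² nothing  = refl
      map-opposite² (just a) = cong just (Fin.opposite-involutive a)

      On-opposite⁻ : ∀ c j x → On (opposite c) (opposite j) (Maybe.map opposite x) → On c j x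
      On-opposite⁻ c j x on = subst₂ (λ c j → On c j x) (Fin.opposite-involutive c)
          (Fin.opposite-involutive j)
        (subst (On (opposite (opposite c)) (opposite (opposite j))) (map-opposite² x)
            (On-opposite (opposite c) (opposite j) (Maybe.map opposite x) on))

    -- The same hypergraph read from the other end of the path, so that the centre may be assumed in
    -- the nearer half.
    reverse-broom : ∀ {m H} {c : Fin (suc d)} → Broom m H d c → Broom m H d (opposite c)
    reverse-broom {m} {H} {c} B = record
      { uniform  = uniform
      ; w        = w ∘ opposite
      ; link     = link ∘ opposite
      ; ℓ        = Sum.map₁ opposite ∘ ℓ
      ; lab      = Maybe.map opposite ∘ lab
      ; ℓ-w      = λ j → trans (cong (Sum.map₁ opposite) (ℓ-w (opposite j)))
          (cong inj₁ (Fin.opposite-involutive j))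
      ; w-ℓ      = λ {v} h → w-ℓ (unlabel (ℓ v) h)
      ; lab-link = λ a → trans (cong (Maybe.map opposite) (lab-link (opposite a)))
          (cong just (Fin.opposite-involutive a))
      ; link-lab = λ {e} h → link-lab (trans (sym (map-opposite² (lab e)))
          (cong (Maybe.map opposite) h))
      ; incident = λ v e → mk⇔ (λ v∈e → forth (ℓ v) (∈⇒Inc v∈e)) (λ inc → Inc⇒∈ (back (ℓ v) inc))
      }
      where
      open Broom B
      unlabel : ∀ x {j} → Sum.map₁ opposite x ≡ inj₁ j → x ≡ inj₁ (opposite j)
      unlabel (inj₁ i) refl = cong inj₁ (sym (Fin.opposite-involutive i))
      forth : ∀ x {e} → Inc c lab x e → Inc (opposite c) (Maybe.map opposite ∘ lab)
          (Sum.map₁ opposite x) e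
      forth (inj₁ j) {e} on = On-opposite c j (lab e) on
      forth (inj₂ f) eq     = eq
      back : ∀ x {e} → Inc (opposite c) (Maybe.map opposite ∘ lab) (Sum.map₁ opposite x) e → Inc c lab x
          e
      back (inj₁ j) {e} on = On-opposite⁻ c j (lab e) on
      back (inj₂ f) eq     = eq

-- The hypertrees T_d(c_i = q) are brooms

module BroomModels where

  open import Data.Bool.Base using (Bool; true; false; _∧_; T)
  open import Data.Bool.Properties using (T-≡; T-∧)
  open import Data.Fin.Subset as Subset using (Subset; _∈_; ∣_∣; ⁅_⁆; ⊤)
  open import Data.Fin.Subset.Properties using (x∈⁅x⁆; x∈⁅y⁆⇒x≡y; ∣⁅x⁆∣≡1; ∣⊤∣≡n; ∣⊥∣≡0; ∈⊤; ∉⊥)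
  open import Data.List.Base using (List; []; _∷_; _++_; length; concatMap; replicate; tabulate)
  import Data.List.Properties as List
  open import Data.List.Relation.Unary.All using (All; []; _∷_)
  import Data.List.Relation.Unary.All.Properties as All
  open import Data.Maybe.Properties using (just-injective)
  open import Data.Nat.Base using (_≤ᵇ_)
  import Data.Rational.Base as ℚ
  import Data.Vec.Base as Vec
  open import Data.Vec.Properties using (lookup∘tabulate; []=⇒lookup; lookup⇒[]=; lookup-splitAt;
      tabulate-cong)

  open import Defs hiding (T; sum)
  import Defs
  open Rationals
  open FiniteSums
  open Brooms

  private
    suc-≤ᵇ-suc : ∀ a b → (suc a ≤ᵇ suc b) ≡ (a ≤ᵇ b)
    suc-≤ᵇ-suc zero    b = refl
    suc-≤ᵇ-suc (suc a) b = refl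

    card-none : ∀ N (f : Fin N → Bool) → (∀ x → f x ≡ false) → ∣ Vec.tabulate f ∣ ≡ 0
    card-none zero    f h = refl
    card-none (suc N) f h with f zero | h zero
    ... | false | refl = card-none N (f ∘ suc) (h ∘ suc)

    card-range : ∀ N a k → a ℕ.+ k ℕ.< N → ∣ Vec.tabulate {n = N}
        (λ x → (a ≤ᵇ toℕ x) ∧ (toℕ x ≤ᵇ a ℕ.+ k)) ∣ ≡ suc k
    card-range (suc N) zero zero h = cong suc (card-none N _ (λ _ → refl))
    card-range (suc N) zero (suc k) h = cong suc (trans
      (cong ∣_∣ (tabulate-cong {n = N} (λ x → suc-≤ᵇ-suc (toℕ x) k))) (card-range N zero k (ℕ.s≤s⁻¹ h)))
    card-range (suc N) (suc a) k h = trans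
      (cong ∣_∣ (tabulate-cong {n = N} (λ x → cong₂ _∧_ (suc-≤ᵇ-suc a (toℕ x))
          (suc-≤ᵇ-suc (toℕ x) (a ℕ.+ k))))) (card-range N a k (ℕ.s≤s⁻¹ h))

    card-++ : ∀ {m n} (p : Subset m) (q : Subset n) → ∣ p Vec.++ q ∣ ≡ ∣ p ∣ ℕ.+ ∣ q ∣
    card-++ Vec.[]            q = refl
    card-++ (true Vec.∷ p)  q = cong suc (card-++ p q)
    card-++ (false Vec.∷ p) q = card-++ p q

  module _ (n : ℕ) where

    private
      m r : ℕ
      m = 2+ n
      r = suc n

    module LoosePath (d : ℕ) (1≤d : 1 ℕ.≤ d) (c : Fin (suc d)) where

      private
        G : Hypergraph
        G = loosePath m d

        w : Fin (suc d) → Vertex G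
        w = joint m d

        toℕ-w : ∀ j → toℕ (w j) ≡ toℕ j ℕ.* r
        toℕ-w j = Fin.toℕ-fromℕ< _

        Between : Vertex G → Fin d → Set
        Between x a = toℕ a ℕ.* r ℕ.≤ toℕ x × toℕ x ℕ.≤ suc (toℕ a) ℕ.* r

        ∈⇒between : ∀ {x a} → x ∈ edge G a → Between x a
        ∈⇒between {x} {a} x∈ = let p , q = Equivalence.to (T-∧ {toℕ a ℕ.* r ≤ᵇ toℕ x}) (Equivalence.from T-≡ (trans (sym (lookup∘tabulate (within m d a) x)) ([]=⇒lookup x∈)))
          in ℕ.≤ᵇ⇒≤ _ _ p , ℕ.≤ᵇ⇒≤ _ _ q

        between⇒∈ : ∀ {x a} → Between x a → x ∈ edge G a
        between⇒∈ {x} {a} (p , q) = lookup⇒[]= _ _ (trans (lookup∘tabulate (within m d a) x)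
            (Equivalence.to T-≡ (Equivalence.from T-∧ (ℕ.≤⇒≤ᵇ p , ℕ.≤⇒≤ᵇ q))))

        between-joint : ∀ {j a} → j ≡ inject₁ a ⊎ j ≡ suc a → Between (w j) a
        between-joint {a = a} (inj₁ refl) = subst (λ h → toℕ a ℕ.* r ℕ.≤ h × h ℕ.≤ suc (toℕ a) ℕ.* r)
            (sym (trans (toℕ-w (inject₁ a)) (cong (ℕ._* r) (Fin.toℕ-inject₁ a))))
          (ℕ.≤-refl , ℕ.m≤n+m (toℕ a ℕ.* r) r)
        between-joint {a = a} (inj₂ refl) = subst (λ h → toℕ a ℕ.* r ℕ.≤ h × h ℕ.≤ suc (toℕ a) ℕ.* r)
            (sym (toℕ-w (suc a)))
          (ℕ.m≤n+m (toℕ a ℕ.* r) r , ℕ.≤-refl)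

        joint-between : ∀ {j a} → Between (w j) a → j ≡ inject₁ a ⊎ j ≡ suc a
        joint-between {j} {a} (p , q) with ℕ.m≤n⇒m<n∨m≡n (ℕ.*-cancelʳ-≤ (toℕ a) (toℕ j) r (subst (toℕ a ℕ.* r ℕ.≤_) (toℕ-w j) p))
        ... | inj₂ eq = inj₁ (Fin.toℕ-injective (trans (sym eq) (sym (Fin.toℕ-inject₁ a))))
        ... | inj₁ lt = inj₂ (Fin.toℕ-injective (ℕ.≤-antisym
            (ℕ.*-cancelʳ-≤ (toℕ j) (suc (toℕ a)) r (subst (ℕ._≤ suc (toℕ a) ℕ.* r) (toℕ-w j) q)) lt))

        w-injective : ∀ {i j} → w i ≡ w j → i ≡ j
        w-injective {i} {j} eq = Fin.toℕ-injective (ℕ.*-cancelʳ-≡ (toℕ i) (toℕ j) r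
            (trans (sym (toℕ-w i)) (trans (cong toℕ eq) (toℕ-w j))))

        ordered : ∀ {x a b} → toℕ a ℕ.< toℕ b → Between x a → Between x b → x ≡ w (suc a)
        ordered {x} {a} {b} a<b (_ , x≤) (≤x , _) = Fin.toℕ-injective
            (trans (ℕ.≤-antisym x≤ (ℕ.≤-trans (ℕ.*-monoˡ-≤ r a<b) ≤x)) (sym (toℕ-w (suc a))))

        shared-joint : ∀ {x a b} → a ≢ b → Between x a → Between x b → ∃ λ j → x ≡ w j
        shared-joint {x} {a} {b} a≢b ha hb with ℕ.<-cmp (toℕ a) (toℕ b)
        ... | tri< lt _ _ = suc a , ordered lt ha hb
        ... | tri≈ _ eq _ = contradiction (Fin.toℕ-injective eq) a≢b
        ... | tri> _ _ gt = suc b , ordered gt hb ha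

        -- A search for an edge containing position x. At a common end point either answer will do,
        -- since joints are labelled separately.
        slot : ∀ d x → x ℕ.≤ suc d ℕ.* r → ∃ λ a → a ℕ.< suc d × a ℕ.* r ℕ.≤ x × x ℕ.≤ suc a ℕ.* r
        slot zero    x x≤ = 0 , ℕ.≤-refl , ℕ.z≤n , x≤
        slot (suc d) x x≤ with ℕ.≤-total x (suc d ℕ.* r)
        ... | inj₂ ≥ = suc d , ℕ.≤-refl , ≥ , x≤
        ... | inj₁ ≤ = let a , a< , p , q = slot d x ≤ in a , ℕ.m≤n⇒m≤1+n a< , p , q

        covered : ∀ x → ∃ λ a → Between x a
        covered x = let a , a< , p , q = slot (ℕ.pred d) (toℕ x) (subst (λ d → toℕ x ℕ.≤ d ℕ.* r) (sym (ℕ.suc-pred d {{ℕ.>-nonZero 1≤d}})) (ℕ.s≤s⁻¹ (Fin.toℕ<n x)))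
                        a<d = subst (a ℕ.<_) (ℕ.suc-pred d {{ℕ.>-nonZero 1≤d}}) a<
          in fromℕ< a<d , subst (λ a → a ℕ.* r ℕ.≤ toℕ x × toℕ x ℕ.≤ suc a ℕ.* r) (sym (Fin.toℕ-fromℕ< a<d)) (p , q)

        vlabel : ∀ z → (∃ λ j → z ≡ w j) ⊎ (∀ j → z ≢ w j)
        vlabel z with Fin.any? (λ j → z Fin.≟ w j)
        ... | yes found = inj₁ found
        ... | no none   = inj₂ λ j eq → none (j , eq)

        ℓ : Vertex G → Fin (suc d) ⊎ Edge G
        ℓ z = [ inj₁ ∘ proj₁ , (λ _ → inj₂ (proj₁ (covered z))) ]′ (vlabel z)

        ℓ-w : ∀ j → ℓ (w j) ≡ inj₁ j
        ℓ-w j with vlabel (w j)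
        ... | inj₁ (i , eq) = cong inj₁ (sym (w-injective eq))
        ... | inj₂ none     = contradiction refl (none j)

        w-ℓ : ∀ {z j} → ℓ z ≡ inj₁ j → z ≡ w j
        w-ℓ {z} h with vlabel z
        w-ℓ refl | inj₁ (_ , eq) = eq
        w-ℓ ()   | inj₂ _

        to : ∀ z e → z ∈ edge G e → Inc c just (ℓ z) e
        to z e z∈e with vlabel z
        ... | inj₁ (j , refl) = joint-between {a = e} (∈⇒between {a = e} z∈e)
        ... | inj₂ none with proj₁ (covered z) Fin.≟ e
        ...   | yes eq = eq
        ...   | no neq = contradiction (shared-joint neq (proj₂ (covered z)) (∈⇒between {a = e} z∈e))
            (λ { (j , eq) → none j eq })

        from : ∀ z e → Inc c just (ℓ z) e → z ∈ edge G e
        from z e inc with vlabel z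
        ... | inj₁ (j , refl) = between⇒∈ {a = e} (between-joint {a = e} inc)
        ... | inj₂ none       = between⇒∈ {a = e} (subst (Between z) inc (proj₂ (covered z)))

        uniform : Uniform m G
        uniform e = trans (cong ∣_∣ (tabulate-cong {n = suc (d ℕ.* r)}
            (λ x → cong (λ h → (toℕ e ℕ.* r ≤ᵇ toℕ x) ∧ (toℕ x ≤ᵇ h)) (ℕ.+-comm r (toℕ e ℕ.* r)))))
          (card-range (suc (d ℕ.* r)) (toℕ e ℕ.* r) r
              (ℕ.s≤s (ℕ.≤-trans (ℕ.≤-reflexive (ℕ.+-comm (toℕ e ℕ.* r) r))
              (ℕ.*-monoˡ-≤ r (Fin.toℕ<n e)))))

      loosePath-broom : Broom m G d c
      loosePath-broom = record
        { uniform = uniform ; w = w ; link = id ; ℓ = ℓ ; lab = just ; ℓ-w = ℓ-w ; w-ℓ = w-ℓ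
        ; lab-link = λ _ → refl ; link-lab = just-injective ; incident = λ z e → mk⇔ (to z e) (from z e)
            }

    -- The new edge gets index 0 and the label `nothing`; old vertices and edges keep their labels
    -- up to the shift of edge indices by `suc`.
    attach-broom : ∀ {G d c} (B : Broom m G d c) → Broom m (attach m G (Broom.w B c)) d c
    attach-broom {G} {d} {c} B = record
      { uniform  = uniform′
      ; w        = λ j → w j ↑ˡ r
      ; link     = suc ∘ link
      ; ℓ        = ℓ′
      ; lab      = lab′
      ; ℓ-w      = λ j → trans (cong from-split (Fin.splitAt-↑ˡ (order G) (w j) r))
          (cong (Sum.map₂ suc) (ℓ-w j))
      ; w-ℓ      = λ {x} h → w-ℓ′ x (splitAt (order G) x) refl h
      ; lab-link = lab-link
      ; link-lab = λ {e} → link-lab′ e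
      ; incident = λ x e → mk⇔ (λ x∈ → to (splitAt (order G) x) e
          (trans (sym (lookup-edge x e)) ([]=⇒lookup x∈)))
                               (λ inc → lookup⇒[]= x _ (trans (lookup-edge x e)
                                   (from (splitAt (order G) x) e inc)))
      }
      where
      open Broom B
      G′ : Hypergraph
      G′ = attach m G (w c)
      from-split : Vertex G ⊎ Fin r → Fin (suc d) ⊎ Edge G′
      from-split = [ Sum.map₂ suc ∘ ℓ , (λ _ → inj₂ zero) ]′
      ℓ′ : Vertex G′ → Fin (suc d) ⊎ Edge G′
      ℓ′ x = from-split (splitAt (order G) x)
      lab′ : Edge G′ → Maybe (Fin d)
      lab′ zero    = nothing
      lab′ (suc e) = lab e
      link-lab′ : ∀ e {a} → lab′ e ≡ just a → e ≡ suc (link a)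
      link-lab′ (suc e) h = cong suc (link-lab h)
      w-ℓ′ : ∀ x s → splitAt (order G) x ≡ s → ∀ {j} → from-split (splitAt (order G) x) ≡ inj₁ j → x ≡ w
          j ↑ˡ r
      w-ℓ′ x (inj₁ v) eq {j} h = trans (sym (Fin.splitAt⁻¹-↑ˡ eq))
          (cong (_↑ˡ r) (w-ℓ (unlabel (ℓ v) (trans (cong from-split (sym eq)) h))))
        where
        unlabel : ∀ x → Sum.map₂ {B = Edge G} {D = Edge G′} suc x ≡ inj₁ j → x ≡ inj₁ j
        unlabel (inj₁ i) refl = refl
      w-ℓ′ x (inj₂ u) eq h = contradiction (trans (cong from-split (sym eq)) h) λ ()
      left right : Edge G′ → Subset _
      left zero     = ⁅ w c ⁆
      left (suc e)  = edge G e
      right zero    = ⊤ {n = r}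
      right (suc e) = Subset.⊥ {n = r}
      edge≡ : ∀ e → edge G′ e ≡ left e Vec.++ right e
      edge≡ zero    = refl
      edge≡ (suc e) = refl
      uniform′ : Uniform m G′
      uniform′ zero    = trans (card-++ ⁅ w c ⁆ (⊤ {n = r})) (cong₂ ℕ._+_ (∣⁅x⁆∣≡1 (w c)) (∣⊤∣≡n r))
      uniform′ (suc e) = trans (card-++ (edge G e) (Subset.⊥ {n = r}))
          (trans (cong₂ ℕ._+_ (uniform e) (∣⊥∣≡0 r)) (ℕ.+-identityʳ m))
      lookup-edge : ∀ x e → Vec.lookup (edge G′ e) x ≡ [ Vec.lookup (left e) , Vec.lookup (right e) ]′
          (splitAt (order G) x)
      lookup-edge x e = trans (cong (λ p → Vec.lookup p x) (edge≡ e))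
          (lookup-splitAt (order G) (left e) (right e) x)
      to : ∀ s e → [ Vec.lookup (left e) , Vec.lookup (right e) ]′ s ≡ true → Inc c lab′ (from-split s)
          e
      to (inj₁ v) zero h = subst (λ x → Inc c lab′ (Sum.map₂ suc x) zero)
          (sym (trans (cong ℓ (x∈⁅y⁆⇒x≡y (w c) (lookup⇒[]= v ⁅ w c ⁆ h))) (ℓ-w c))) refl
      to (inj₁ v) (suc e) h = lift (ℓ v) (∈⇒Inc (lookup⇒[]= v (edge G e) h))
        where
        lift : ∀ x → Inc c lab x e → Inc c lab′ (Sum.map₂ suc x) (suc e)
        lift (inj₁ j) on = on
        lift (inj₂ f) eq = cong suc eq
      to (inj₂ u) zero h = refl
      to (inj₂ u) (suc e) h = contradiction (lookup⇒[]= u Subset.⊥ h) ∉⊥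
      from : ∀ s e → Inc c lab′ (from-split s) e → [ Vec.lookup (left e) , Vec.lookup (right e) ]′ s ≡
          true
      from (inj₁ v) zero inc = []=⇒lookup (subst (_∈ ⁅ w c ⁆) (sym (at-centre (ℓ v) refl inc))
          (x∈⁅x⁆ (w c)))
        where
        at-centre : ∀ x → ℓ v ≡ x → Inc c lab′ (Sum.map₂ suc x) zero → v ≡ w c
        at-centre (inj₁ j) eq on = w-ℓ (trans eq (cong inj₁ on))
      from (inj₁ v) (suc e) inc = []=⇒lookup (Inc⇒∈ (lower (ℓ v) inc))
        where
        lower : ∀ x → Inc c lab′ (Sum.map₂ suc x) (suc e) → Inc c lab x e
        lower (inj₁ j) on = on
        lower (inj₂ f) eq = Fin.suc-injective eq
      from (inj₂ u) zero inc = []=⇒lookup (∈⊤ {x = u})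

    attachAll-broom : ∀ {G d c} (B : Broom m G d c) vs → All (_≡ Broom.w B c) vs →
      Σ (Broom m (proj₁ (attachAll m G vs)) d c) λ B′ → proj₂ (attachAll m G vs) (Broom.w B c) ≡ Broom.w
          B′ c × size (proj₁ (attachAll m G vs)) ≡ length vs ℕ.+ size G
    attachAll-broom B []       []             = B , refl , refl
    attachAll-broom {G} {d} {c} B (v ∷ vs) (refl ∷ eqs) with attachAll-broom B vs eqs
    -- The attachment takes place at the embedded copy of `v`, which `eq` identifies with the centre
    -- of `B′`.
    ... | B′ , eq , s = subst (λ u → Σ (Broom m (attach m (proj₁ (attachAll m G vs)) u) d c) λ B″ → u ↑ˡ
        r ≡ Broom.w B″ c × suc (size (proj₁ (attachAll m G vs))) ≡ suc (length vs ℕ.+ size G))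
            (sym eq) (attach-broom B′ , refl , cong suc s)

    private
      copies : ∀ {A B : Set} {N} (h : A → B) (cnt : A → ℕ) (f : Fin N → A) → List B
      copies h cnt f = concatMap (λ a → replicate (cnt a) (h a)) (tabulate f)

      length-copies : ∀ {A B : Set} {N} (h : A → B) (cnt : A → ℕ) (f : Fin N → A) → ι
          (length (copies h cnt f)) ≡ sum (λ i → ι (cnt (f i)))
      length-copies {N = zero}  h cnt f = refl
      length-copies {N = suc N} h cnt f = trans (cong ι
          (trans (List.length-++ (replicate (cnt (f zero)) (h (f zero))))
          (cong (ℕ._+ length (copies h cnt (f ∘ suc))) (List.length-replicate (cnt (f zero))))))
        (trans (ι-homo-+ (cnt (f zero)) (length (copies h cnt (f ∘ suc))))
            (cong (λ s → ι (cnt (f zero)) ℚ.+ s) (length-copies h cnt (f ∘ suc))))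

      all-copies : ∀ {A B : Set} {N} {x : B} (h : A → B) (cnt : A → ℕ) (f : Fin N → A) →
          (∀ i → cnt (f i) ≡ 0 ⊎ h (f i) ≡ x) → All (_≡ x) (copies h cnt f)
      all-copies {N = zero}  h cnt f cases = []
      all-copies {N = suc N} {x} h cnt f cases = All.++⁺ (first (cases zero))
          (all-copies h cnt (f ∘ suc) (cases ∘ suc))
        where
        first : cnt (f zero) ≡ 0 ⊎ h (f zero) ≡ x → All (_≡ x) (replicate (cnt (f zero)) (h (f zero)))
        first (inj₁ eq) = subst (λ k → All (_≡ x) (replicate k (h (f zero)))) (sym eq) []
        first (inj₂ eq) = All.replicate⁺ (cnt (f zero)) eq

    -- Joints are numbered from 0, so v_{i+2} is joint i + 1, while the entry c_{i+2} is stored at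
    -- argument i.
    T-broom : ∀ d i q (c : Fin (suc d)) → toℕ c ≡ suc i → suc (suc i) ℕ.≤ d →
              Broom m (Defs.T m d (c[ suc (suc i) ]= q)) d c × size (Defs.T m d (c[ suc (suc i) ]= q)) ≡
                  q ℕ.+ d
    T-broom (suc d) i q c c≡ i< =
      let B , _ , s = attachAll-broom (LoosePath.loosePath-broom (suc d) (ℕ.s≤s ℕ.z≤n) c) (copies (inner m (suc d)) cnt id) (all-copies (inner m (suc d)) cnt id cases)
      in B , trans s (cong (ℕ._+ suc d) (ι-injective (trans (length-copies (inner m (suc d)) cnt id) (trans (sum-single j₀ (λ j j≢ → cong ι (other j j≢))) (cong ι here)))))
      where
      cnt : Fin d → ℕ
      cnt = c[ suc (suc i) ]= q
      j₀ : Fin d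
      j₀ = fromℕ< (ℕ.s≤s⁻¹ i<)
      j₀≡ : toℕ j₀ ≡ i
      j₀≡ = Fin.toℕ-fromℕ< (ℕ.s≤s⁻¹ i<)
      here : cnt j₀ ≡ q
      here with 2 ℕ.+ toℕ j₀ ℕ.≡ᵇ suc (suc i) in eq
      ... | true  = refl
      ... | false = contradiction (subst T eq (ℕ.≡⇒≡ᵇ (2 ℕ.+ toℕ j₀) (suc (suc i)) (cong (2 ℕ.+_) j₀≡)))
          id
      other : ∀ j → j ≢ j₀ → cnt j ≡ 0
      other j j≢ with 2 ℕ.+ toℕ j ℕ.≡ᵇ suc (suc i) in eq
      ... | false = refl
      ... | true  = contradiction (Fin.toℕ-injective
          (trans (ℕ.suc-injective (ℕ.suc-injective (ℕ.≡ᵇ⇒≡ (2 ℕ.+ toℕ j) (suc (suc i))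
          (subst T (sym eq) _)))) (sym j₀≡))) j≢
      cases : ∀ j → cnt j ≡ 0 ⊎ inner m (suc d) j ≡ joint m (suc d) c
      cases j with j Fin.≟ j₀
      ... | no j≢    = inj₁ (other j j≢)
      ... | yes refl = inj₂ (cong (joint m (suc d))
          (Fin.toℕ-injective (trans (cong suc (trans (Fin.toℕ-inject₁ j₀) j₀≡)) (sym c≡))))

-- Comparison with T_d(c_p = k - d)

module Comparison where

  open import Data.Integer.Base as ℤ using (ℤ; +_; -[1+_])
  import Data.Integer.Properties as ℤ
  import Data.Integer.Solver as ℤSolver
  open import Data.Rational.Base using (ℚ; 0ℚ; 1ℚ; _+_; _*_; _-_; -_; _≤_; _<_; _/_)
  open import Data.Rational.Properties hiding (_≟_)
  open +-*-Solver using (solve; con; _:=_; _:+_; _:*_; _:-_; :-_)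

  open import Defs hiding (sum)
  open Rationals
  open Adjacencies
  open EdgeInequality using (_⊕_; _⊗_; 0≤lit)
  open LocalCounts
  open LowDegrees
  open PathArms
  open Brooms
  open BroomRadii
  open StarRoot
  open MaximalDegree
  open BroomIsomorphisms
  open BroomModels

  -- Iterates `F-step`: while the arm being shortened is not the longer one, the gain is positive
  -- and F stays non-negative.
  shift-out : ∀ r t → + 3 / 1 ≤ t → 1ℚ ≤ r → ∀ q j i l → j ℕ.+ i ℕ.≤ l → 0ℚ ≤ F r q (j ℕ.+ i) l t → 0ℚ ≤
      F r q i (j ℕ.+ l) t
  shift-out r t 3≤t 1≤r q zero    i l _ h = h
  shift-out r t 3≤t 1≤r q (suc j) i l j+i≤l h = subst (λ x → 0ℚ ≤ F r q i x t) (ℕ.+-suc j l)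
    (shift-out r t 3≤t 1≤r q j i (suc l) (ℕ.≤-trans (ℕ.n≤1+n (j ℕ.+ i)) (ℕ.m≤n⇒m≤1+n j+i≤l)) step)
    where
    open At r t 3≤t 1≤r
    step : 0ℚ ≤ F r q (j ℕ.+ i) (suc l) t
    step = 0≤-cancelˡ (X r t (suc (suc (j ℕ.+ i))) * X r t (suc l))
        (0<-* (0<X (suc (suc (j ℕ.+ i)))) (0<X (suc l)))
      (subst (0ℚ ≤_) (trans (sym (F-step q (j ℕ.+ i) l))
          (*-comm (F r q (j ℕ.+ i) (suc l) t) (X r t (suc (suc (j ℕ.+ i))) * X r t (suc l))))
        (h ⊗ (0≤X (suc (j ℕ.+ i)) ⊗ 0≤X (suc (suc l))) ⊕ ≤-trans 0≤1 (F-gain (suc (j ℕ.+ i)) l j+i≤l)))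

  -- To be read with i = p - 2 and l = d - p: the arms at v_p have lengths i + 1 and l + 1, and l is
  -- i + 2 or i + 3 by the parity of d. The joint ruled out by `off-centre` is v_{p+1}.
  module Compare (n : ℕ) (H : Hypergraph) (uniform : Uniform (2+ n) H) (tree : Hypertree H)
    {x₀ y₀ d} (P : Path H x₀ y₀ d) (minimal : ∀ l → Path H x₀ y₀ l → d ℕ.≤ l)
    (s : ℕ) (size≡ : size H ≡ 6 ℕ.+ s ℕ.+ d) (42≤ : 42 ℕ.≤ s ℕ.* suc n)
    (G : Hypergraph) (size-G : size G ≡ size H) (i l : ℕ) (d≡ : d ≡ suc i ℕ.+ suc l)
        (i≤l : suc (suc i) ℕ.≤ l) (l≤i : l ℕ.≤ suc (suc (suc i)))
    (c : Fin (suc d)) (c≡ : toℕ c ≡ suc i) (B : Broom (2+ n) G d c)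
    (off-centre : ∀ c → toℕ c ≡ suc (suc i) → ¬ Broom (2+ n) H d c) where

    open Hypertree tree
    open Incidence H hiding (δ)

    private
      r : ℚ
      r = ι (suc n)
      1≤r : 1ℚ ≤ r
      1≤r = ι-mono {1} {suc n} (ℕ.s≤s ℕ.z≤n)

      q≡ : ι (size H) - ι d ≡ + 6 / 1 + ι s
      q≡ = trans (cong (λ k → ι k - ι d) size≡) (trans
          (cong (_- ι d) (trans (ι-homo-+ (6 ℕ.+ s) d) (cong (_+ ι d) (ι-homo-+ 6 s))))
          (cancel (+ 6 / 1 + ι s) (ι d)))
        where
        cancel = solve 2 (λ a b → (a :+ b) :- b := a) refl

      qG≡ : ι (size G) - ι d ≡ ι (size H) - ι d
      qG≡ = cong (λ k → ι k - ι d) size-G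

      1≤s : 1 ℕ.≤ s
      1≤s = positive s 42≤
        where
        positive : ∀ s → 42 ℕ.≤ s ℕ.* suc n → 1 ℕ.≤ s
        positive (suc s) _ = ℕ.s≤s ℕ.z≤n

      9≤D : + 9 / 1 ≤ ι (size H) - ι d + + 2 / 1
      9≤D = subst (λ q → + 9 / 1 ≤ q + + 2 / 1) (sym q≡) (≤-by (gap (ι s)) (≤⇒0≤- (ι-mono {1} 1≤s)))
        where
        gap = solve 1 (λ s → (con (+ 6 / 1)) :+ s :+ con (+ 2 / 1) :- con (+ 9 / 1) := s :- (con
            1ℚ)) refl

      42≤r : + 42 / 1 ≤ r * (ι (size H) - ι d + + 2 / 1 - + 8 / 1)
      42≤r = subst (λ q → + 42 / 1 ≤ r * (q + + 2 / 1 - + 8 / 1)) (sym q≡) (≤-trans (ι-mono {42} 42≤)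
        (≤-reflexive (trans (ι-homo-* s (suc n)) (reorder r (ι s)))))
        where
        reorder = solve 2 (λ r s → s :* r := r :* (con (+ 6 / 1) :+ s :+ con (+ 2 / 1) :- (con (+ 8 /
            1)))) refl

      D≡ : ι (size H) - ι d + + 2 / 1 ≡ ι (8 ℕ.+ s)
      D≡ = trans (cong (_+ + 2 / 1) q≡) (trans (tidy (ι s)) (sym (ι-homo-+ 8 s)))
        where
        tidy = solve 1 (λ s → (con (+ 6 / 1)) :+ s :+ con (+ 2 / 1) := con (+ 8 / 1) :+ s) refl

      module R = BroomRadius B i l c≡ d≡ (subst (λ q → + 9 / 1 ≤ q + + 2 / 1) (sym qG≡) 9≤D)
                   (subst (λ q → + 42 / 1 ≤ r * (q + + 2 / 1 - + 8 / 1)) (sym qG≡) 42≤r)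

      1≤d : 1 ℕ.≤ d
      1≤d = subst (1 ℕ.≤_) (sym d≡) (ℕ.s≤s ℕ.z≤n)

      -- The geodesic has positive length, hence two distinct vertices, so each vertex has another
      -- one to be connected to.
      covered : ∀ v → ∃ λ e → v ∈ᵉ e
      covered v = nonempty-path v (proj₂ (connected v (proj₁ other)))  (proj₂ other)
        where
        open Path P
        0≢d : zero ≢ fromℕ d
        0≢d eq = ℕ.<⇒≢ 1≤d (trans (cong toℕ eq) (Fin.toℕ-fromℕ d))
        other : ∃ λ u → v ≢ u
        other with v Fin.≟ vertex zero
        ... | no v≢    = vertex zero , v≢
        ... | yes refl = vertex (fromℕ d) , λ eq → 0≢d (vertices-distinct eq)
        nonempty-path : ∀ v {u l} → Path H v u l → v ≢ u → ∃ λ e → v ∈ᵉ e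
        nonempty-path v {l = zero}  Q v≢u = contradiction (trans (sym (Path.start Q)) (Path.end Q)) v≢u
        nonempty-path v {l = suc l} Q v≢u = Path.link Q zero , subst (_∈ᵉ Path.link Q zero)
            (Path.start Q) (proj₁ (Path.incident Q zero))

    module _ (ρ σ : ℝ) (λH : λ₁ (2+ n) H ρ) (λG : λ₁ (2+ n) G σ) where

      Goal : Set
      Goal = ρ ≤ᴿ σ × (ρ ≈ᴿ σ → H ≅ G)

      private
        strict : ρ ≤ᴿ σ × ¬ ρ ≈ᴿ σ → Goal
        strict (ρ≤σ , ρ≉σ) = ρ≤σ , λ ρ≈σ → ⊥-elim (ρ≉σ ρ≈σ)

      -- The rational t₀ lies below the root of the star with D edges, whereas `star≤hi` keeps all
      -- upper ends of the broom from falling below that root; the gap between them gives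
      -- strictness.
      low-degree : (∀ v → degree H v ≢ 8 ℕ.+ s) → Goal
      low-degree degrees≢ = strict (R.strictly-below {ρ} {σ} t δ (proj₁ (proj₂ gap))
          (λ k → proj₂ (proj₂ gap) (R.hi-at k) (≤-trans (0≤lit (+ 3 / 1)) (R.3≤hi k))
            (subst (λ q → (q + + 2 / 1) * r ≤ R.hi-at k * (R.hi-at k + r - 1ℚ)) qG≡ (R.star≤hi k)))
          (LowDegree.low-degree-bound n H uniform tree P minimal covered a 9≤D 42≤r Q≥ Q≤ 0≤t degrees ρ
              λH) λG)
        where
        D = ι (size H) - ι d + + 2 / 1
        t = t₀ r D 1≤r 9≤D 42≤r
        a = t + r - 1ℚ
        gap = star-gap r D 1≤r 9≤D 42≤r
        δ = proj₁ gap
        commute = solve 2 (λ t r → t :* (t :+ r :- con 1ℚ) := (t :+ r :- con 1ℚ) :* ((t :+ r :- (con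
            1ℚ)) :- r :+ con 1ℚ)) refl
        undo = solve 2 (λ t r → t := (t :+ r :- con 1ℚ) :- r :+ con 1ℚ) refl
        slack = solve 2 (λ D r → D :* r :- (D :- con (+ 1 / 8)) :* r := con (+ 1 / 8) :* r) refl
        Q≥ : (D - + 1 / 4) * r ≤ a * (a - r + 1ℚ)
        Q≥ = subst ((D - + 1 / 4) * r ≤_) (commute t r) (star-lower r D 1≤r 9≤D 42≤r)
        Q≤ : a * (a - r + 1ℚ) ≤ D * r
        Q≤ = subst (_≤ D * r) (commute t r) (≤-trans (star-upper r D 1≤r 9≤D 42≤r)
            (≤-by (slack D r) (0≤lit (+ 1 / 8) ⊗ ≤-trans 0≤1 1≤r)))
        0≤t : 0ℚ ≤ a - r + 1ℚ
        0≤t = subst (0ℚ ≤_) (undo t r) (≤-trans (0≤lit (+ 3 / 1)) (3≤t₀ r D 1≤r 9≤D 42≤r))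
        degrees : ∀ v → deg v ≤ D - 1ℚ
        degrees v = ≤-trans (ι-mono (ℕ.s≤s⁻¹ (ℕ.≤∧≢⇒<
            (ι-cancel-≤ (subst (deg v ≤_) D≡ (Bounds.degree-bound H linear acyclic P minimal v)))
            (degrees≢ v))))
          (≤-reflexive (trans (pred (ι (7 ℕ.+ s))) (cong (_- 1ℚ) (sym D≡))))
          where
          pred = solve 1 (λ x → x := (con 1ℚ :+ x) :- con 1ℚ) refl

      -- The same F governs both hypergraphs, so no gap is available: the bounds at all upper ends
      -- are combined, and the equality case is settled by `broom-≅`.
      same-place : ∀ c → toℕ c ≡ suc i → Broom (2+ n) H d c → Goal
      same-place c′ c′≡ BH = R.below-all⇒≤ {ρ} {σ} below λG , λ _ → broom-≅ BH
          (subst (Broom (2+ n) G d) (Fin.toℕ-injective (trans c≡ (sym c′≡))) B) (sym size-G)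
        where
        below : ∀ k → ρ ≤ᴿ fromℚ (R.radius (R.hi-at k))
        below k = BroomSpectrum.Eigen.broom-bound BH i l c′≡ d≡ (R.hi-at k) (R.3≤hi k)
          (subst (λ q → 0ℚ ≤ F r q i l (R.hi-at k)) qG≡ (R.0≤fhi (R.bracket k))) ρ λH

      -- The first step outwards makes F positive at a lower end of the bisection for G, and the
      -- remaining j steps keep it non-negative; `lo-gap` then separates that lower end from the
      -- radius of G.
      further : ∀ i′ j → suc j ℕ.+ i′ ≡ i → ∀ c → toℕ c ≡ suc i′ → Broom (2+ n) H d c → Goal
      further i′ j i≡ c′ c′≡ BH = strict (R.strictly-below {ρ} {σ} (R.lo-at m) δ
          (proj₁ (proj₂ (R.lo-gap m))) (proj₂ (proj₂ (R.lo-gap m)))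
          (BroomSpectrum.Eigen.broom-bound BH i′ (j ℕ.+ suc l) c′≡ d≡′ (R.lo-at m) 3≤lo 0≤F ρ λH) λG)
        where
        found = R.further-out (j ℕ.+ i′) (sym i≡) (ℕ.≤-trans (ℕ.n≤1+n i)
            (ℕ.≤-trans (ℕ.n≤1+n (suc i)) i≤l))
        m = proj₁ found
        δ = proj₁ (R.lo-gap m)
        3≤lo = R.A≤lo (R.bracket m)
        0≤F : 0ℚ ≤ F r (ι (size H) - ι d) i′ (j ℕ.+ suc l) (R.lo-at m)
        0≤F = shift-out r (R.lo-at m) 3≤lo 1≤r (ι (size H) - ι d) j i′ (suc l)
          (ℕ.≤-trans (ℕ.n≤1+n (j ℕ.+ i′)) (ℕ.≤-trans (ℕ.≤-reflexive i≡)
              (ℕ.≤-trans (ℕ.n≤1+n i) (ℕ.≤-trans (ℕ.n≤1+n (suc i)) (ℕ.m≤n⇒m≤1+n i≤l)))))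
          (subst (λ q → 0ℚ ≤ F r q (j ℕ.+ i′) (suc l) (R.lo-at m)) qG≡ (<⇒≤ (proj₂ found)))
        d≡′ : d ≡ suc i′ ℕ.+ suc (j ℕ.+ suc l)
        d≡′ = trans d≡ (cong suc (begin
          i ℕ.+ suc l                        ≡⟨ cong (ℕ._+ suc l) (sym i≡) ⟩
          suc j ℕ.+ i′ ℕ.+ suc l             ≡⟨ cong (ℕ._+ suc l) (ℕ.+-comm (suc j) i′) ⟩
          i′ ℕ.+ suc j ℕ.+ suc l             ≡⟨ ℕ.+-assoc i′ (suc j) (suc l) ⟩
          i′ ℕ.+ suc (j ℕ.+ suc l)           ∎))
          where open ≡-Reasoning

      private
        near-side : ∀ c → 1 ℕ.≤ toℕ c → toℕ c ℕ.≤ suc (suc i) → Broom (2+ n) H d c → Goal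
        near-side c′ 1≤c c≤ BH with ℕ.<-cmp (toℕ c′) (suc i)
        ... | tri≈ _ eq _ = same-place c′ eq BH
        ... | tri> _ _ gt = contradiction BH (off-centre c′ (ℕ.≤-antisym c≤ gt))
        ... | tri< lt _ _ = further (ℕ.pred (toℕ c′)) (i ∸ toℕ c′)
            (trans (sym (ℕ.+-suc (i ∸ toℕ c′) (ℕ.pred (toℕ c′))))
            (trans (cong (i ∸ toℕ c′ ℕ.+_) c′≡) (ℕ.m∸n+n≡m (ℕ.s≤s⁻¹ lt)))) c′ (sym c′≡) BH
          where
          c′≡ : suc (ℕ.pred (toℕ c′)) ≡ toℕ c′
          c′≡ = ℕ.suc-pred (toℕ c′) {{ℕ.>-nonZero 1≤c}}

        -- A centre beyond v_{p+1} is brought to the near side by reversal: since d ≤ 2 p + 1, its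
        -- number counted from 0 then is at most p.
        broom-case : ∀ c → 1 ℕ.≤ toℕ c → toℕ c ℕ.< d → Broom (2+ n) H d c → Goal
        broom-case c′ 1≤c c<d BH with toℕ c′ ℕ.≤? suc (suc i)
        ... | yes c≤ = near-side c′ 1≤c c≤ BH
        ... | no c≰  = near-side (opposite c′) (subst (1 ℕ.≤_) (sym (Fin.opposite-prop c′))
            (ℕ.m<n⇒0<n∸m c<d))
                (subst (ℕ._≤ suc (suc i)) (sym (Fin.opposite-prop c′)) (ℕ.m≤n+o⇒m∸n≤o d (toℕ c′) (begin
                  d                                         ≡⟨ d≡ ⟩
                  suc i ℕ.+ suc l                           ≤⟨ ℕ.+-monoʳ-≤ (suc i) (ℕ.s≤s l≤i) ⟩
                  suc i ℕ.+ suc (suc (suc (suc i)))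
                      ≡⟨ ℕ.+-comm (suc i) (suc (suc (suc (suc i)))) ⟩
                  suc (suc (suc (suc i))) ℕ.+ suc i         ≡⟨ ℕ.+-suc (suc (suc (suc i))) (suc i) ⟨
                  suc (suc (suc i)) ℕ.+ suc (suc i)         ≤⟨ ℕ.+-monoˡ-≤ (suc (suc i)) (ℕ.≰⇒> c≰) ⟩
                  toℕ c′ ℕ.+ suc (suc i)                    ∎)))
                (reverse-broom BH)
          where open ℕ.≤-Reasoning

      compare : Goal
      compare = by-degree (Fin.any? (λ v → degree H v ℕ.≟ 8 ℕ.+ s))
        where
        by-degree : Dec (∃ λ v → degree H v ≡ 8 ℕ.+ s) → Goal
        by-degree (no none)        = low-degree (λ v eq → none (v , eq))
        by-degree (yes (v , deg≡)) =
          let c′ , 1≤c , c<d , BH = extract-broom H uniform linear acyclic P minimal covered v (trans (cong ι deg≡) (sym D≡))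
          in broom-case c′ 1≤c c<d BH

  -- The factor m - 1 is positive, so k - d - 6 cannot be negative; with s = k - d - 6 the later
  -- arithmetic stays in ℕ and truncated subtraction is harmless.
  size-condition : ∀ k d n → (+ k ℤ.- + d ℤ.- + 6) ℤ.* (+ 2+ n ℤ.- + 1) ℤ.≥ + 42 → ∃ λ s → k ≡ 6 ℕ.+ s
      ℕ.+ d × 42 ℕ.≤ s ℕ.* suc n
  size-condition k d n h with + k ℤ.- + d ℤ.- + 6 in eq
  ... | + s = s , ℤ.+-injective (begin
          + k                                      ≡⟨ regroup (+ k) (+ d) ⟩
          (+ k ℤ.- + d ℤ.- + 6) ℤ.+ + 6 ℤ.+ + d     ≡⟨ cong (λ z → z ℤ.+ + 6 ℤ.+ + d) eq ⟩
          + s ℤ.+ + 6 ℤ.+ + d                      ≡⟨ cong (λ z → + (z ℕ.+ d)) (ℕ.+-comm s 6) ⟩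
          + (6 ℕ.+ s ℕ.+ d)                        ∎) , ℤ.drop‿+≤+
              (subst (+ 42 ℤ.≤_) (sym (ℤ.pos-* s (suc n))) h)
    where
    open ≡-Reasoning
    open ℤSolver.+-*-Solver using () renaming (solve to solveℤ; con to conℤ; _:=_ to _:=ℤ_; _:+_ to
        _:+ℤ_; _:-_ to _:-ℤ_)
    regroup : ∀ a b → a ≡ (a ℤ.- b ℤ.- + 6) ℤ.+ + 6 ℤ.+ b
    regroup = solveℤ 2 (λ a b → a :=ℤ (a :-ℤ b :-ℤ conℤ (+ 6)) :+ℤ conℤ (+ 6) :+ℤ b) refl
  ... | -[1+ s ] = contradiction h λ ()

  halves : ∀ d → ∃ λ b → b ℕ.≤ 1 × d ≡ b ℕ.+ (⌊ d /2⌋ ℕ.+ ⌊ d /2⌋)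
  halves zero       = 0 , ℕ.z≤n , refl
  halves (suc zero) = 1 , ℕ.≤-refl , refl
  halves (2+ d) with halves d
  ... | b , b≤1 , eq = b , b≤1 , trans (cong 2+ eq) (sym (trans (ℕ.+-suc b (⌊ d /2⌋ ℕ.+ suc ⌊ d /2⌋))
          (cong suc (trans (cong (b ℕ.+_) (ℕ.+-suc ⌊ d /2⌋ ⌊ d /2⌋))
              (ℕ.+-suc b (⌊ d /2⌋ ℕ.+ ⌊ d /2⌋))))))

  second-largest : ∀ n (H : Hypergraph) (k d p b : ℕ) → b ℕ.≤ 1 → d ≡ b ℕ.+ (p ℕ.+ p) → 2 ℕ.≤ p →
    Uniform (2+ n) H → Hypertree H → size H ≡ k → Diameter H d →
    (+ k ℤ.- + d ℤ.- + 6) ℤ.* (+ 2+ n ℤ.- + 1) ℤ.≥ + 42 →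
    ¬ (H ≅ T (2+ n) d (c[ suc p ]= (k ∸ d))) →
    ∀ (ρ σ : ℝ) → λ₁ (2+ n) H ρ → λ₁ (2+ n) (T (2+ n) d (c[ p ]= (k ∸ d))) σ →
    ρ ≤ᴿ σ × (ρ ≈ᴿ σ → H ≅ T (2+ n) d (c[ p ]= (k ∸ d)))
  second-largest n H k d (2+ i) b b≤1 d≡ (ℕ.s≤s (ℕ.s≤s ℕ.z≤n)) uniform tree size≡
      ((x , y , P , minimal) , _) large not-centre ρ σ λH λT =
    Compare.compare n H uniform tree P minimal s (trans size≡ k≡) 42≤ (T (2+ n) d (c[ 2+ i ]= (k ∸ d)))
        (trans (proj₂ near) size-T) i l
      d≡′ (ℕ.m≤n+m (2+ i) b) (ℕ.+-monoˡ-≤ (2+ i) b≤1) c c≡ (proj₁ near)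
      -- A broom centred at v_{p+1} would be isomorphic to the excluded hypertree.
      (λ c′ c′≡ BH → let far = T-broom n d (suc i) (k ∸ d) c′ c′≡ 3+i≤d in not-centre (broom-≅ BH (proj₁ far) (sym (trans (proj₂ far) size-T))))
      ρ σ λH λT
    where
    s,k≡,42≤ = size-condition k d n large
    s = proj₁ s,k≡,42≤
    k≡ : k ≡ 6 ℕ.+ s ℕ.+ d
    k≡ = proj₁ (proj₂ s,k≡,42≤)
    42≤ = proj₂ (proj₂ s,k≡,42≤)
    l : ℕ
    l = b ℕ.+ 2+ i
    d≡′ : d ≡ suc i ℕ.+ suc l
    d≡′ = trans d≡ (trans (trans (sym (ℕ.+-assoc b (2+ i) (2+ i))) (ℕ.+-comm l (2+ i)))
        (sym (ℕ.+-suc (suc i) l)))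
    3+i≤d : 3 ℕ.+ i ℕ.≤ d
    3+i≤d = subst (3 ℕ.+ i ℕ.≤_) (sym (trans d≡′ (ℕ.+-comm (suc i) (suc l))))
        (ℕ.≤-trans (ℕ.s≤s (ℕ.m≤n+m (2+ i) b)) (ℕ.m≤m+n (suc l) (suc i)))
    c< : suc i ℕ.< suc d
    c< = ℕ.≤-trans (ℕ.n≤1+n (2+ i)) (ℕ.m≤n⇒m≤1+n 3+i≤d)
    c : Fin (suc d)
    c = fromℕ< c<
    c≡ : toℕ c ≡ suc i
    c≡ = Fin.toℕ-fromℕ< c<
    near = T-broom n d i (k ∸ d) c c≡ (ℕ.≤-trans (ℕ.n≤1+n (2+ i)) 3+i≤d)
    size-T : k ∸ d ℕ.+ d ≡ size H
    size-T = trans (ℕ.m∸n+n≡m (subst (d ℕ.≤_) (sym k≡) (ℕ.m≤n+m d (6 ℕ.+ s)))) (sym size≡)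

open import Defs
open import Data.Integer.Base using (+_; _-_; _*_; _≥_)
open import Data.Nat.Base using (ℕ; suc; _∸_; _≤_; ⌊_/2⌋; NonTrivial)
open import Data.Product.Base using (_×_)
open import Relation.Binary.PropositionalEquality using (_≡_)
open import Relation.Nullary using (¬_)

theorem2p2p1 : ∀ (m : ℕ) .{{_ : NonTrivial m}} (H : Hypergraph) (k d : ℕ) →
    Uniform m H → Hypertree H → size H ≡ k → Diameter H d →
    (+ k - + d - + 6) * (+ m - + 1) ≥ + 42 →
    2 ≤ ⌊ d /2⌋ →
    ¬ (H ≅ T m d (c[ suc ⌊ d /2⌋ ]= (k ∸ d))) →
    ∀ (ρ σ : ℝ) → λ₁ m H ρ → λ₁ m (T m d (c[ ⌊ d /2⌋ ]= (k ∸ d))) σ →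
    ρ ≤ᴿ σ × (ρ ≈ᴿ σ → H ≅ T m d (c[ ⌊ d /2⌋ ]= (k ∸ d)))
-- Splitting off m = 0 and m = 1 lets m - 1 reduce to `suc n` in everything that follows.
theorem2p2p1 0 {{2≤m}} = contradiction (ℕ.nonTrivial⇒n>1 0 {{2≤m}}) λ ()
theorem2p2p1 1 {{2≤m}} = contradiction (ℕ.nonTrivial⇒n>1 1 {{2≤m}}) λ { (ℕ.s≤s ()) }
theorem2p2p1 (suc (suc n)) H k d uniform tree size≡ diameter large 2≤p not-centre ρ σ =
  let b , b≤1 , d≡ = Comparison.halves d
  in Comparison.second-largest n H k d ⌊ d /2⌋ b b≤1 d≡ 2≤p uniform tree size≡ diameter large not-centre ρ σ
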